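{- The reduction relation $\rightsquigarrow_{\mathrm{sua}'}$ is confluent: writing $\rightsquigarrow^*$ for its reflexive transitive closure, for all terms $s,t,u$ with $s\rightsquigarrow^*t$ and $s\rightsquigarrow^*u$ there is a term $v$ with $t\rightsquigarrow^*v$ and $u\rightsquigarrow^*v$.
   Context: Syntax. Syntax is taken up to renaming of variables; $\equiv$ is syntactic equality, and syntax over $\Gamma$ is silently regarded as syntax over $\Gamma,(x:A)$ (weakening). By mutual induction: a context is a finite list $(x_1:A_1),\dots,(x_m:A_m)$ with $A_i$ a type over the preceding entries; a type over $\Gamma$ is $\star$ or $s\to_A t$ with $A$ a type and $s,t$ terms over $\Gamma$; a term over $\Gamma$ is a variable of $\Gamma$ or $\mathrm{Coh}_{(\Delta;A)}[\sigma]$ with $\Delta$ a context, $A$ a type over $\Delta$ and $\sigma:\Delta\to\Gamma$; a substitution $\sigma:\Delta\to\Gamma$ is a list of terms over $\Gamma$, one for each variable of $\Delta$. $x[\![\sigma]\!]$ is the entry of $\sigma$ at the variable $x$; $\mathrm{Coh}_{(\Theta;A)}[\tau][\![\sigma]\!]=\mathrm{Coh}_{(\Theta;A)}[\tau\bullet\sigma]$, where $\tau\bullet\sigma$ applies $[\![\sigma]\!]$ to each entry of $\tau$; $\star[\![\sigma]\!]=\star$; $(s\to_At)[\![\sigma]\!]=s[\![\sigma]\!]\to_{A[\![\sigma]\!]}t[\![\sigma]\!]$. $\mathrm{id}_\Gamma$ sends each variable to itself. $\dim\star=0$, $\dim(s\to_At)=\dim A+1$; the dimension of a context is the maximal dimension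 of its types. Suspension: $\Sigma\Gamma$ is $(N:\star),(S:\star)$ followed by $(x:\Sigma A)$ for $(x:A)\in\Gamma$; $\Sigma\star=N\to_\star S$, $\Sigma(s\to_At)=\Sigma s\to_{\Sigma A}\Sigma t$, $\Sigma x=x$, $\Sigma\mathrm{Coh}_{(\Delta;A)}[\sigma]=\mathrm{Coh}_{(\Sigma\Delta;\Sigma A)}[\Sigma\sigma]$, and $\Sigma\sigma$ sends $N\mapsto N$, $S\mapsto S$, $x\mapsto\Sigma(x[\![\sigma]\!])$. Ps-contexts. $(x:\star)\vdash_{ps}x:\star$; if $\Gamma\vdash_{ps}x:A$ then $\Gamma,(y:A),(f:x\to_Ay)\vdash_{ps}f:x\to_Ay$; if $\Gamma\vdash_{ps}x:s\to_At$ then $\Gamma\vdash_{ps}t:A$; if $\Gamma\vdash_{ps}x:\star$ then $\Gamma\vdash_{ps}$ ($\Gamma$ is a ps-context). For $i\in\mathbb N$, $\epsilon\in\{ -,+\}$: $\partial_i^\epsilon((x:\star))=\{x\}$, and for $\Delta=\Gamma,(y:A),(f:x\to_Ay)$, $\partial^\epsilon_i(\Delta)$ is $\partial_i^\epsilon(\Gamma)$ if $i<\dim A$; $\partial_i^-(\Gamma)$ if $i=\dim A$, $\epsilon=-$; $(\partial_i^+(\Gamma)\cup\{y\})\setminus\{x\}$ if $i=\dim A$, $\epsilon=+$; $\partial_i^\epsilon(\Gamma)\cup\{y,f\}$ if $i>\dim A$. Support. $\mathrm{FV}(x)=\{x\}$, $\mathrm{FV}(\mathrm{Coh}_{(\Delta;A)}[\sigma])=\mathrm{FV}(\sigma)$,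 $\mathrm{FV}(\star)=\emptyset$, and $\mathrm{FV}$ of arrow types and substitutions is the union over components. $\mathrm{Supp}$ of syntax over $\Gamma$ is the smallest set $U\supseteq\mathrm{FV}$ such that $x\in U$ and $(x:A)\in\Gamma$ imply $\mathrm{FV}(A)\subseteq U$. Typing and equality. Let $\mathcal O$ be the regular operation set: all triples $(\Delta,\partial_n^-(\Delta),\partial_n^+(\Delta))$ with $\Delta$ a ps-context, $n\in\mathbb N$, $n\ge\dim\Delta-1$. An equality rule set $\mathcal R$ is a set of triples $(\Gamma,s,t)$, $s,t$ terms over $\Gamma$. The theory $\mathrm{Catt}_{\mathcal R}$ is generated mutually by: $\emptyset\vdash$; $\Gamma\vdash$, $\Gamma\vdash A$ give $\Gamma,(x:A)\vdash$; $\Gamma\vdash\star$; $\Gamma\vdash A$, $\Gamma\vdash s:A$, $\Gamma\vdash t:A$ give $\Gamma\vdash s\to_At$; $\Gamma\vdash\langle\rangle:\emptyset$; $\Gamma\vdash\sigma:\Delta$, $\Gamma\vdash t:A[\![\sigma]\!]$ give $\Gamma\vdash\langle\sigma,t\rangle:\Delta,(x:A)$; $(x:A)\in\Gamma$ gives $\Gamma\vdash x:A$; $\Gamma\vdash t:A$, $\Gamma\vdash A=B$ give $\Gamma\vdash t:B$; $\Delta\vdash_{ps}$, $\Delta\vdash s\to_At$, $\Gamma\vdash\sigma:\Delta$, $(\Delta,\mathrm{Supp}(s),\mathrm{Supp}(t))\in\mathcal O$ give $\Gamma\vdash\mathrm{Coh}_{(\Delta;s\to_At)}[\sigma]:(s\to_At)[\![\sigma]\!]$;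 equality is a congruence for all constructors (for coherences: $\Delta\vdash A=B$, $\Gamma\vdash\sigma=\tau$ give $\Gamma\vdash\mathrm{Coh}_{(\Delta;A)}[\sigma]=\mathrm{Coh}_{(\Delta;B)}[\tau]$), reflexive on variables, symmetric and transitive on terms, and $\Gamma\vdash s=t$ whenever $(\Gamma,s,t)\in\mathcal R$ and $\Gamma\vdash s:A$ for some $A$. Discs. $U^0=\star$, $U^{k+1}=d_k^-\to_{U^k}d_k^+$; $D^n$ has variables $d_0^-,d_0^+,\dots,d_{n-1}^-,d_{n-1}^+,d_n$ with $d_k^\pm:U^k$, $d_n:U^n$. For a type $A$ over $\Gamma$ with $\dim A=n$ and a term $t$, $\{A,t\}:D^n\to\Gamma$ is the substitution with $d_n\mapsto t$ and $U^n[\![\{A,t\}]\!]\equiv A$. $\mathrm{id}(A,t)=\mathrm{Coh}_{(D^n;d_n\to_{U^n}d_n)}[\{A,t\}]$; terms of this form are identities. Terms $\mathrm{Coh}_{(D^n;U^n)}[\{A,t\}]$ are unary composites. Trees. A tree is a (possibly empty) finite list of trees; $\Sigma T=[T]$; $+\!\!+$ is concatenation. $\mathrm h([\,])=0$, $\mathrm h([T_0,\dots,T_n])=1+\max_k\mathrm h(T_k)$; $\mathrm{th}([T_0])=1+\mathrm{th}(T_0)$ and $\mathrm{th}(T)=0$ if $\mathrm{len}(T)\ne1$; $T$ is linear if $\mathrm{th}(T)=\mathrm h(T)$. $T^{[\,]}=T$, $T^{k::P}=(T_k)^P$. The wedge $\Gamma\vee\Delta$ of nonempty contexts is $\Gamma$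 followed by the entries of $\Delta$ other than its first, with the first variable of $\Delta$ replaced by the last $0$-dimensional variable of $\Gamma$. $\lfloor[\,]\rfloor=D^0$, $\lfloor[T_0,\dots,T_n]\rfloor=\Sigma\lfloor T_0\rfloor\vee\cdots\vee\Sigma\lfloor T_n\rfloor$. A path of $T$ is a list $q+\!\!+[n]$ with $q$ indexing a subtree $T^q$ and $0\le n\le\mathrm{len}(T^q)$; paths are identified with the variables of $\lfloor T\rfloor$: $[n]$ is the $n$-th $0$-dimensional variable (from $0$), and $k::p$ is the variable coming from the variable $p$ of $\lfloor T_k\rfloor$ in the $k$-th wedge summand. $\mathrm{inc}_k:\Sigma\lfloor T_k\rfloor\to\lfloor T\rfloor$ sends $N\mapsto[k]$, $S\mapsto[k+1]$, $p\mapsto k::p$. $\lfloor\Sigma^n[\,]\rfloor\equiv D^n$. A labelling $L:T\to\Gamma$ is a function from paths of $T$ to terms over $\Gamma$, identified with the substitution $\lfloor T\rfloor\to\Gamma$ with these entries; $L_i(p)=L(i::p)$. Standard constructions. $\partial_0(T)=[\,]$, $\partial_{n+1}([T_0,\dots,T_m])=[\partial_n(T_0),\dots,\partial_n(T_m)]$; $\delta_n^\epsilon(T):\lfloor\partial_n(T)\rfloor\to\lfloor T\rfloor$ is given on paths by $\delta_0^-([0])=[0]$, $\delta_0^+([0])=[\mathrm{len}(T)]$, $\delta_{n+1}^\epsilon(T)([k])=[k]$, $\delta_{n+1}^\epsilon(T)(k::p)=k::\delta_n^\epsilon(T_k)(p)$. $\mathcal U_T^0=\star$, $\mathcal U_T^{n+1}=\mathcal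 T^n_{\partial_n(T)}[\![\delta_n^-(T)]\!]\to_{\mathcal U^n_T}\mathcal T^n_{\partial_n(T)}[\![\delta_n^+(T)]\!]$; $\mathcal C_T^n=\mathrm{Coh}_{(\lfloor T\rfloor;\mathcal U_T^n)}[\mathrm{id}]$; $\mathcal T_{[\,]}^0$ is the path $[0]$, $\mathcal T^{n+1}_{[T_0]}=\Sigma\mathcal T^n_{T_0}$, and $\mathcal T_T^n=\mathcal C_T^n$ otherwise. Insertion. A branch $P$ of $S$ is a nonempty list indexing a linear subtree $S^P$; $\overline P$ is $P$ followed by $\mathrm h(S^P)+1$ zeros (a path of $S$); $\mathrm{bh}(P)=\mathrm{len}(P)-1$, $\mathrm{lh}(P)=\mathrm{len}(\overline P)-1$. $(S,P,T)$ is an insertion point if $\mathrm{bh}(P)\le\mathrm{th}(T)$ and $\mathrm{lh}(P)\ge\mathrm h(T)$. Let $S=[S_0,\dots,S_n]$, $m=\mathrm{len}(T)$. Inserted tree: $S\ll_{[k]}T=[S_0,\dots,S_{k-1}]+\!\!+T+\!\!+[S_{k+1},\dots,S_n]$; for $P=k::Q$ with $Q$ nonempty (so $T=[T_0]$), $S\ll_PT=[S_0,\dots,S_{k-1},S_k\ll_QT_0,S_{k+1},\dots,S_n]$. Interior $\iota:\lfloor T\rfloor\to\lfloor S\ll_PT\rfloor$: for $P=[k]$, $\iota([j])=[k+j]$, $\iota(j::p)=(k+j)::p$; for $P=k::Q$, $\iota([j])=[k+j]$, $\iota(0::p)=\Sigma(\iota_{S_k,Q,T_0}(p))[\![\mathrm{inc}_k]\!]$.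 Exterior $\kappa:\lfloor S\rfloor\to\lfloor S\ll_PT\rfloor$: for $P=[k]$, $\kappa([j])=[j]$ if $j\le k$ and $[j+m-1]$ if $j>k$; $\kappa(j::p)=j::p$ if $j<k$ and $(j+m-1)::p$ if $j>k$; $\kappa(k::p)=(0::p)[\![\{\mathcal U_T^d,\mathcal C_T^d\}]\!][\![\iota]\!]$, where $d=\mathrm h(S_k)+1$ and $0::p$ is a path of $\Sigma S_k$, i.e. a variable of $D^d$. For $P=k::Q$, $\kappa([j])=[j]$, $\kappa(j::p)=j::p$ if $j\neq k$, $\kappa(k::p)=\Sigma(\kappa_{S_k,Q,T_0}(p))[\![\mathrm{inc}_k]\!]$. Inserted labelling of $L:S\to\Gamma$, $M:T\to\Gamma$: for $P=[k]$, $(L\ll_PM)([j])$ is $L[j]$ if $j<k$, $M[j-k]$ if $k\le j\le k+m$, $L[j-m+1]$ if $j>k+m$; $(L\ll_PM)(j::p)$ is $L(j::p)$ if $j<k$, $M((j-k)::p)$ if $k\le j<k+m$, $L((j-m+1)::p)$ if $j\ge k+m$. For $P=k::Q$, $(L\ll_PM)([j])$ is $M[0],M[1]$ for $j=k,k+1$ and $L[j]$ otherwise; $(L\ll_PM)(j::p)=L(j::p)$ for $j\ne k$, and $(L\ll_PM)(k::p)=(L_k\ll_QM_0)(p)$. $(S,P,T,\Gamma,L,M)$ is an insertion redex if moreover $L(\overline P)\equiv\mathcal C_T^{\mathrm{lh}(P)}[\![M]\!]$. Rule sets. $\mathrm{dr}$: all $(\Gamma,\mathrm{Coh}_{(D^n;U^n)}[\{A,t\}],t)$,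 $n=\dim A$. $\mathrm{ecr}'$: all $(\Gamma,\mathrm{Coh}_{(\Delta;s\to_As)}[\sigma],\mathrm{id}(A[\![\sigma]\!],s[\![\sigma]\!]))$ whose first term is not an identity. $\mathrm{insert}'$: all $(\Gamma,\mathrm{Coh}_{(\lfloor S\rfloor;A)}[L],\mathrm{Coh}_{(\lfloor S\ll_PT\rfloor;A[\![\kappa]\!])}[L\ll_PM])$ for an insertion redex $(S,P,T,\Gamma,L,M)$ and a type $A$ over $\lfloor S\rfloor$ such that $\mathrm{Coh}_{(\lfloor S\rfloor;A)}[L]$ is neither an identity nor a unary composite, and $L(\overline P)\equiv\mathcal C_T^{\mathrm{lh}(P)}[\![M]\!]$ is either an identity, or a standard composite (i.e. $\mathrm{lh}(P)=\mathrm h(T)$) which is not a unary composite. $\mathrm{sua}'=\mathrm{dr}\cup\mathrm{ecr}'\cup\mathrm{insert}'$. Reduction. For a rule set $\mathcal R$, $\rightsquigarrow_{\mathcal R}$ is the relation on well-formed terms, types and substitutions (of $\mathrm{Catt}_{\mathcal R}$) generated by: $s\rightsquigarrow t$ if $(\Gamma,s,t)\in\mathcal R$; $\mathrm{Coh}_{(\Delta;A)}[\sigma]\rightsquigarrow\mathrm{Coh}_{(\Delta;B)}[\sigma]$ if $A\rightsquigarrow B$; $\mathrm{Coh}_{(\Delta;A)}[\sigma]\rightsquigarrow\mathrm{Coh}_{(\Delta;A)}[\tau]$ if $\sigma\rightsquigarrow\tau$; $s\to_At$ reduces by reducing exactly one of $s,A,t$; a substitution reduces by reducing exactly one entry. 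-}

module Defs where

open import Data.Fin as Fin using (Fin; zero; suc; inject₁; fromℕ)
open import Data.Fin.Subset using (Subset; inside; outside; _∈_; _∪_; _─_; ⁅_⁆; ⊥)
open import Data.Nat using (ℕ; zero; suc; _+_; _*_; _⊔_; _≤_; z≤n; s≤s)
open import Data.Nat.Properties using (<-cmp; m≤m⊔n; suc-injective)
open import Data.Product using (∃-syntax; _×_)
open import Data.Sign using (Sign)
open import Data.Sum using (_⊎_)
open import Data.Vec using (Vec; []; _∷_; lookup; map; tabulate)
open import Function using (_∘_)
open import Level using (0ℓ)
open import Relation.Binary.Definitions using (tri<; tri≈; tri>)
open import Relation.Binary.PropositionalEquality
  using (_≡_; refl; sym; trans; cong; subst)
open import Relation.Nullary using (¬_)
open import Relation.Unary using (Pred; _≐_)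

private
  variable
    l m n : ℕ

-- De Bruijn indices: syntax over a context only depends on its number of
-- variables, index zero is the most recent variable, and the head of a
-- substitution is its entry at the most recent variable.  Propositional
-- equality is therefore syntactic equality up to renaming.

infixl 5 _▹_
infix  6 _⇒[_]_

data Ctx : ℕ → Set
data Ty  : ℕ → Set
data Tm  : ℕ → Set

data Ctx where
  ∅   : Ctx 0
  _▹_ : Ctx n → Ty n → Ctx (suc n)

data Ty where
  ⋆      : Ty n
  _⇒[_]_ : (s : Tm n) (A : Ty n) (t : Tm n) → Ty n

data Tm where
  var : Fin n → Tm n
  coh : (Δ : Ctx m) (A : Ty m) (σ : Vec (Tm n) m) → Tm n

-- Substitutions from a context of length m to one of length n.
Sub : ℕ → ℕ → Set
Sub m n = Vec (Tm n) m

wkTm  : Tm n → Tm (suc n)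
wkSub : Sub m n → Sub m (suc n)

wkTm (var x)     = var (suc x)
wkTm (coh Δ A σ) = coh Δ A (wkSub σ)

wkSub []      = []
wkSub (t ∷ σ) = wkTm t ∷ wkSub σ

wkTy : Ty n → Ty (suc n)
wkTy ⋆            = ⋆
wkTy (s ⇒[ A ] t) = wkTm s ⇒[ wkTy A ] wkTm t

infixl 8 _⟦_⟧ _⟦_⟧ᵀ _•_

_⟦_⟧ : Tm m → Sub m n → Tm n
_•_  : Sub l m → Sub m n → Sub l n

var x     ⟦ σ ⟧ = lookup σ x
coh Δ A τ ⟦ σ ⟧ = coh Δ A (τ • σ)

[]      • σ = []
(t ∷ τ) • σ = t ⟦ σ ⟧ ∷ (τ • σ)

_⟦_⟧ᵀ : Ty m → Sub m n → Ty n
⋆            ⟦ σ ⟧ᵀ = ⋆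
(s ⇒[ A ] t) ⟦ σ ⟧ᵀ = s ⟦ σ ⟧ ⇒[ A ⟦ σ ⟧ᵀ ] t ⟦ σ ⟧

idSub : Sub n n
idSub = tabulate var

infixl 6 _‼_

_‼_ : Ctx n → Fin n → Ty n
(Γ ▹ A) ‼ zero  = wkTy A
(Γ ▹ A) ‼ suc x = wkTy (Γ ‼ x)

dim : Ty n → ℕ
dim ⋆            = 0
dim (s ⇒[ A ] t) = suc (dim A)

dimCtx : Ctx n → ℕ
dimCtx ∅       = 0
dimCtx (Γ ▹ A) = dimCtx Γ ⊔ dim A

north south : Fin (2 + n)
north {n} = fromℕ (suc n)
south {n} = inject₁ (fromℕ n)

susp : ∀ {a} {A : Set a} → A → A → Vec A n → Vec A (2 + n)
susp a b []       = b ∷ a ∷ []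
susp a b (x ∷ xs) = x ∷ susp a b xs

ΣCtx : Ctx n → Ctx (2 + n)
ΣTy  : Ty n → Ty (2 + n)
ΣTm  : Tm n → Tm (2 + n)
ΣSub : Sub m n → Sub (2 + m) (2 + n)

ΣCtx ∅       = ∅ ▹ ⋆ ▹ ⋆
ΣCtx (Γ ▹ A) = ΣCtx Γ ▹ ΣTy A

ΣTy ⋆            = var north ⇒[ ⋆ ] var south
ΣTy (s ⇒[ A ] t) = ΣTm s ⇒[ ΣTy A ] ΣTm t

ΣTm (var x)     = var (inject₁ (inject₁ x))
ΣTm (coh Δ A σ) = coh (ΣCtx Δ) (ΣTy A) (ΣSub σ)

ΣSub []      = var south ∷ var north ∷ []
ΣSub (t ∷ σ) = ΣTm t ∷ ΣSub σ

FV    : Tm n → Subset n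
FVSub : Sub m n → Subset n

FV (var x)     = ⁅ x ⁆
FV (coh Δ A σ) = FVSub σ

FVSub []      = ⊥
FVSub (t ∷ σ) = FVSub σ ∪ FV t

FVTy : Ty n → Subset n
FVTy ⋆            = ⊥
FVTy (s ⇒[ A ] t) = FV s ∪ FVTy A ∪ FV t

data Closure (Γ : Ctx n) (U : Subset n) : Pred (Fin n) 0ℓ where
  base : ∀ {x} → x ∈ U → Closure Γ U x
  step : ∀ {x y} → Closure Γ U x → y ∈ FVTy (Γ ‼ x) → Closure Γ U y

Supp : Ctx n → Tm n → Pred (Fin n) 0ℓ
Supp Γ t = Closure Γ (FV t)

infix 4 _⊢ps_∶_ _⊢ps

data _⊢ps_∶_ : Ctx n → Tm n → Ty n → Set where
  pss : ∅ ▹ ⋆ ⊢ps var zero ∶ ⋆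
  pse : ∀ {Γ : Ctx n} {x A} → Γ ⊢ps x ∶ A →
        Γ ▹ A ▹ (wkTm x ⇒[ wkTy A ] var zero)
          ⊢ps var zero ∶ wkTm (wkTm x) ⇒[ wkTy (wkTy A) ] var (suc zero)
  psd : ∀ {Γ : Ctx n} {x s A t} → Γ ⊢ps x ∶ s ⇒[ A ] t → Γ ⊢ps t ∶ A

data _⊢ps (Γ : Ctx n) : Set where
  ps : ∀ {x} → Γ ⊢ps x ∶ ⋆ → Γ ⊢ps

-- The subject x of Γ ⊢ps x ∶ A is always a variable, so FV x is {x}.
∂ps : ∀ {Γ : Ctx n} {x A} → ℕ → Sign → Γ ⊢ps x ∶ A → Subset n
∂ps i ε pss = ⁅ zero ⁆
∂ps i ε (pse {x = x} {A = A} d) with <-cmp i (dim A) | ε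
... | tri< _ _ _ | _      = outside ∷ outside ∷ ∂ps i ε d
... | tri≈ _ _ _ | Sign.- = outside ∷ outside ∷ ∂ps i Sign.- d
... | tri≈ _ _ _ | Sign.+ = outside ∷ inside ∷ (∂ps i Sign.+ d ─ FV x)
... | tri> _ _ _ | _      = inside ∷ inside ∷ ∂ps i ε d
∂ps i ε (psd d) = ∂ps i ε d

∂Ctx : {Γ : Ctx n} → ℕ → Sign → Γ ⊢ps → Subset n
∂Ctx i ε (ps d) = ∂ps i ε d

Regular : Ctx n → Pred (Fin n) 0ℓ → Pred (Fin n) 0ℓ → Set
Regular Δ U V = ∃[ d ] ∃[ i ]
    dimCtx Δ ≤ suc i
  × U ≐ (_∈ ∂Ctx {Γ = Δ} i Sign.- d)
  × V ≐ (_∈ ∂Ctx {Γ = Δ} i Sign.+ d)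

RuleSet : Set₁
RuleSet = ∀ {n} → Ctx n → Tm n → Tm n → Set

module Catt (R : RuleSet) where

  infix 4 _⊢ _⊢ᵀ_ _⊢_∶_ _⊢ˢ_∶_ _⊢_≈_ _⊢ᵀ_≈_ _⊢ˢ_≈_

  data _⊢     : Ctx n → Set
  data _⊢ᵀ_   (Γ : Ctx n) : Ty n → Set
  data _⊢_∶_  (Γ : Ctx n) : Tm n → Ty n → Set
  data _⊢ˢ_∶_ (Γ : Ctx n) : Sub m n → Ctx m → Set
  data _⊢_≈_  (Γ : Ctx n) : Tm n → Tm n → Set
  data _⊢ᵀ_≈_ (Γ : Ctx n) : Ty n → Ty n → Set
  data _⊢ˢ_≈_ (Γ : Ctx n) : Sub m n → Sub m n → Set

  data _⊢ where
    ∅   : ∅ ⊢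
    _▹_ : ∀ {Γ : Ctx n} {A} → Γ ⊢ → Γ ⊢ᵀ A → Γ ▹ A ⊢

  data _⊢ᵀ_ Γ where
    ⋆   : Γ ⊢ᵀ ⋆
    arr : ∀ {s A t} → Γ ⊢ᵀ A → Γ ⊢ s ∶ A → Γ ⊢ t ∶ A → Γ ⊢ᵀ s ⇒[ A ] t

  data _⊢_∶_ Γ where
    var  : ∀ x → Γ ⊢ var x ∶ Γ ‼ x
    conv : ∀ {t A B} → Γ ⊢ t ∶ A → Γ ⊢ᵀ A ≈ B → Γ ⊢ t ∶ B
    coh  : ∀ {Δ : Ctx m} {s A t σ} →
           Δ ⊢ps → Δ ⊢ᵀ s ⇒[ A ] t → Γ ⊢ˢ σ ∶ Δ →
           Regular Δ (Supp Δ s) (Supp Δ t) →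
           Γ ⊢ coh Δ (s ⇒[ A ] t) σ ∶ (s ⇒[ A ] t) ⟦ σ ⟧ᵀ

  data _⊢ˢ_∶_ Γ where
    []  : Γ ⊢ˢ [] ∶ ∅
    _∷_ : ∀ {Δ : Ctx m} {A σ t} →
          Γ ⊢ t ∶ A ⟦ σ ⟧ᵀ → Γ ⊢ˢ σ ∶ Δ → Γ ⊢ˢ t ∷ σ ∶ Δ ▹ A

  data _⊢_≈_ Γ where
    var-refl : ∀ x → Γ ⊢ var x ≈ var x
    ≈-sym    : ∀ {s t} → Γ ⊢ s ≈ t → Γ ⊢ t ≈ s
    ≈-trans  : ∀ {s t u} → Γ ⊢ s ≈ t → Γ ⊢ t ≈ u → Γ ⊢ s ≈ u
    coh      : ∀ {Δ : Ctx m} {A B σ τ} →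
               Δ ⊢ᵀ A ≈ B → Γ ⊢ˢ σ ≈ τ → Γ ⊢ coh Δ A σ ≈ coh Δ B τ
    rule     : ∀ {s t A} → R Γ s t → Γ ⊢ s ∶ A → Γ ⊢ s ≈ t

  data _⊢ᵀ_≈_ Γ where
    ⋆   : Γ ⊢ᵀ ⋆ ≈ ⋆
    arr : ∀ {s A t s′ A′ t′} →
          Γ ⊢ s ≈ s′ → Γ ⊢ᵀ A ≈ A′ → Γ ⊢ t ≈ t′ →
          Γ ⊢ᵀ s ⇒[ A ] t ≈ s′ ⇒[ A′ ] t′

  data _⊢ˢ_≈_ Γ where
    []  : Γ ⊢ˢ [] ≈ []
    _∷_ : ∀ {s t} {σ τ : Sub m _} →
          Γ ⊢ s ≈ t → Γ ⊢ˢ σ ≈ τ → Γ ⊢ˢ s ∷ σ ≈ t ∷ τ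

  infix 4 _⊢_⟶_ _⊢ᵀ_⟶_ _⊢ˢ_⟶_ _⊢_⇝_

  data _⊢_⟶_  (Γ : Ctx n) : Tm n → Tm n → Set
  data _⊢ᵀ_⟶_ (Γ : Ctx n) : Ty n → Ty n → Set
  data _⊢ˢ_⟶_ (Γ : Ctx n) : Sub m n → Sub m n → Set

  data _⊢_⟶_ Γ where
    rule   : ∀ {s t} → R Γ s t → Γ ⊢ s ⟶ t
    coh-ty : ∀ {Δ : Ctx m} {A B σ} →
             Δ ⊢ᵀ A ⟶ B → Γ ⊢ coh Δ A σ ⟶ coh Δ B σ
    coh-sub : ∀ {Δ : Ctx m} {A σ τ} →
              Γ ⊢ˢ σ ⟶ τ → Γ ⊢ coh Δ A σ ⟶ coh Δ A τ

  data _⊢ᵀ_⟶_ Γ where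
    src  : ∀ {s s′ A t} → Γ ⊢ s ⟶ s′ → Γ ⊢ᵀ s ⇒[ A ] t ⟶ s′ ⇒[ A ] t
    base : ∀ {s A A′ t} → Γ ⊢ᵀ A ⟶ A′ → Γ ⊢ᵀ s ⇒[ A ] t ⟶ s ⇒[ A′ ] t
    tgt  : ∀ {s A t t′} → Γ ⊢ t ⟶ t′ → Γ ⊢ᵀ s ⇒[ A ] t ⟶ s ⇒[ A ] t′

  data _⊢ˢ_⟶_ Γ where
    head : ∀ {t t′} {σ : Sub m _} → Γ ⊢ t ⟶ t′ → Γ ⊢ˢ t ∷ σ ⟶ t′ ∷ σ
    tail : ∀ {t} {σ σ′ : Sub m _} → Γ ⊢ˢ σ ⟶ σ′ → Γ ⊢ˢ t ∷ σ ⟶ t ∷ σ′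

  WellFormed : Ctx n → Tm n → Set
  WellFormed Γ t = ∃[ A ] Γ ⊢ t ∶ A

  -- All components of a well-formed term are well-formed, so restricting
  -- the two ends of a step also restricts the steps it is generated from.
  _⊢_⇝_ : Ctx n → Tm n → Tm n → Set
  Γ ⊢ s ⇝ t = WellFormed Γ s × WellFormed Γ t × Γ ⊢ s ⟶ t

Sphere     : ∀ n → Ctx (n * 2)
SphereType : ∀ n → Ty (n * 2)

Sphere zero    = ∅
Sphere (suc n) = Sphere n ▹ SphereType n ▹ wkTy (SphereType n)

SphereType zero    = ⋆
SphereType (suc n) =
  var (suc zero) ⇒[ wkTy (wkTy (SphereType n)) ] var zero

Disc : ∀ n → Ctx (suc (n * 2))
Disc n = Sphere n ▹ SphereType n

-- U^n over the disc, rather than over the sphere of its proper variables.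
DiscType : ∀ n → Ty (suc (n * 2))
DiscType n = wkTy (SphereType n)

fromSphere : (A : Ty n) → Sub (dim A * 2) n
fromSphere ⋆            = []
fromSphere (s ⇒[ A ] t) = t ∷ s ∷ fromSphere A

fromDisc : (A : Ty n) → Tm n → Sub (suc (dim A * 2)) n
fromDisc A t = t ∷ fromSphere A

identity : Ty n → Tm n → Tm n
identity A t =
  coh (Disc d) (var zero ⇒[ DiscType d ] var zero) (fromDisc A t)
  where d = dim A

unary : Ty n → Tm n → Tm n
unary A t = coh (Disc (dim A)) (DiscType (dim A)) (fromDisc A t)

IsIdentity IsUnary : Tm n → Set
IsIdentity t = ∃[ A ] ∃[ s ] t ≡ identity A s
IsUnary    t = ∃[ A ] ∃[ s ] t ≡ unary A s

infixr 5 _∷_ _++_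

-- The second argument of _∷_ is the tree formed by the remaining entries.
data Tree : Set where
  []  : Tree
  _∷_ : Tree → Tree → Tree

_++_ : Tree → Tree → Tree
[]       ++ U = U
(T ∷ Ts) ++ U = T ∷ (Ts ++ U)

height : Tree → ℕ
height []       = 0
height (T ∷ Ts) = suc (height T) ⊔ height Ts

trunkHeight : Tree → ℕ
trunkHeight []           = 0
trunkHeight (T ∷ [])     = suc (trunkHeight T)
trunkHeight (_ ∷ _ ∷ _)  = 0

Linear : Tree → Set
Linear T = trunkHeight T ≡ height T

-- A path is a list of numbers, whose first entry is written in unary:
-- next increments the first entry, so next (k ∷ p) is (suc k) ∷ p.
data Path : Tree → Set where
  [0]  : ∀ {T} → Path T
  0∷_  : ∀ {T Ts} → Path T → Path (T ∷ Ts)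
  next : ∀ {T Ts} → Path Ts → Path (T ∷ Ts)

-- The length of a path, minus one.
depth : ∀ {T} → Path T → ℕ
depth [0]      = 0
depth (0∷ p)   = suc (depth p)
depth (next p) = depth p

[len] : ∀ {T} → Path T
[len] {[]}     = [0]
[len] {T ∷ Ts} = next [len]

-- The most recent variable of type ⋆.  The value is irrelevant if there is
-- none, which does not occur for the contexts of trees.
last₀ : Ctx (suc n) → Fin (suc n)
last₀             (Γ ▹ ⋆)            = zero
last₀ {n = zero}  (∅ ▹ (_ ⇒[ _ ] _)) = zero
last₀ {n = suc n} (Γ ▹ (_ ⇒[ _ ] _)) = suc (last₀ Γ)

inl : ∀ m → Fin (suc n) → Fin (suc (m + n))
inl zero    x = x
inl (suc m) x = suc (inl m x)

inr : ∀ m → Fin (suc n) → Fin (suc m) → Fin (suc (m + n))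
inr zero    b zero    = b
inr (suc m) b zero    = zero
inr (suc m) b (suc x) = suc (inr m b x)

infixr 5 _∨_

_∨_ : Ctx (suc n) → Ctx (suc m) → Ctx (suc (m + n))
Γ ∨ (∅ ▹ A)                   = Γ
_∨_ {m = suc m} Γ (Δ ▹ B ▹ A) =
  (Γ ∨ (Δ ▹ B)) ▹ A ⟦ tabulate (var ∘ inr m (last₀ Γ)) ⟧ᵀ

-- The entries of a substitution out of a wedge sum: those over the left
-- summand, then those over the right summand except at its first variable.
wedge : ∀ {a} {A : Set a} →
        Vec A (suc n) → Vec A (suc m) → Vec A (suc (m + n))
wedge xs (y ∷ [])     = xs
wedge xs (y ∷ z ∷ ys) = y ∷ wedge xs (z ∷ ys)

size : Tree → ℕ
size []       = 0
size (T ∷ Ts) = size Ts + (2 + size T)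

-- D⁰ is a right unit for the wedge sum.
⌊_⌋ : (T : Tree) → Ctx (suc (size T))
⌊ [] ⌋     = Disc 0
⌊ T ∷ Ts ⌋ = ΣCtx ⌊ T ⌋ ∨ ⌊ Ts ⌋

-- The identification of paths with variables, in both directions:
-- pathVar p is the variable p, and paths T lists all paths of T in the order
-- of the variables of ⌊ T ⌋.
pathVar : ∀ T → Path T → Fin (suc (size T))
pathVar T        [0]      = fromℕ (size T)
pathVar (T ∷ Ts) (0∷ p)   = inl (size Ts) (inject₁ (inject₁ (pathVar T p)))
pathVar (T ∷ Ts) (next p) = inr (size Ts) (last₀ (ΣCtx ⌊ T ⌋)) (pathVar Ts p)

paths : ∀ T → Vec (Path T) (suc (size T))
paths []       = [0] ∷ []
paths (T ∷ Ts) =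
  wedge (susp [0] (next [0]) (map 0∷_ (paths T))) (map next (paths Ts))

path : ∀ T → Path T → Tm (suc (size T))
path T p = var (pathVar T p)

Labelling : Tree → ℕ → Set
Labelling T n = Path T → Tm n

toSub : ∀ {T} → Labelling T n → Sub (suc (size T)) n
toSub {T = T} L = map L (paths T)

-- inc₀, and the inclusion of the other wedge summands; inc_k is inc₀
-- followed by k of the latter.
inc₀ : ∀ T Ts → Sub (2 + suc (size T)) (suc (size (T ∷ Ts)))
inc₀ T Ts = susp (p [0]) (p (next [0])) (map (λ q → p (0∷ q)) (paths T))
  where p = path (T ∷ Ts)

incNext : ∀ T Ts → Sub (suc (size Ts)) (suc (size (T ∷ Ts)))
incNext T Ts = toSub (λ p → path (T ∷ Ts) (next p))

∂ : ℕ → Tree → Tree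
∂ zero    T        = []
∂ (suc n) []       = []
∂ (suc n) (T ∷ Ts) = ∂ n T ∷ ∂ (suc n) Ts

δ : ∀ n → Sign → ∀ T → Path (∂ n T) → Path T
δ zero    Sign.- T        [0]      = [0]
δ zero    Sign.+ T        [0]      = [len]
δ (suc n) ε      []       [0]      = [0]
δ (suc n) ε      (T ∷ Ts) [0]      = [0]
δ (suc n) ε      (T ∷ Ts) (0∷ p)   = 0∷ δ n ε T p
δ (suc n) ε      (T ∷ Ts) (next p) = next (δ (suc n) ε Ts p)

𝒰 : ℕ → ∀ T → Ty (suc (size T))
𝒞 : ℕ → ∀ T → Tm (suc (size T))
𝒯 : ℕ → ∀ T → Tm (suc (size T))

𝒰 zero    T = ⋆
𝒰 (suc n) T =
  𝒯 n (∂ n T) ⟦ toSub (path T ∘ δ n Sign.- T) ⟧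
    ⇒[ 𝒰 n T ]
  𝒯 n (∂ n T) ⟦ toSub (path T ∘ δ n Sign.+ T) ⟧

𝒞 n T = coh ⌊ T ⌋ (𝒰 n T) idSub

𝒯 zero    []       = path [] [0]
𝒯 (suc n) (T ∷ []) = ΣTm (𝒯 n T)
𝒯 n       T        = 𝒞 n T

dim-𝒰 : ∀ n T → dim (𝒰 n T) ≡ n
dim-𝒰 zero    T = refl
dim-𝒰 (suc n) T = cong suc (dim-𝒰 n T)

size-linear : ∀ T → Linear T → size T ≡ height T * 2
size-linear []           lin = refl
size-linear (T ∷ [])     lin =
  cong (2 +_) (size-linear T (suc-injective lin))
size-linear (T ∷ U ∷ Us) lin
  with () ← subst (suc (height T) ≤_) (sym lin) (m≤m⊔n (suc (height T)) (height (U ∷ Us)))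

-- Branches are written like paths.
data Branch : Tree → Set where
  [0]  : ∀ {T Ts} → Linear T → Branch (T ∷ Ts)
  0∷_  : ∀ {T Ts} → Branch T → Branch (T ∷ Ts)
  next : ∀ {T Ts} → Branch Ts → Branch (T ∷ Ts)

-- In a linear tree T, the path consisting of height T + 1 zeros.
zeros : ∀ T → Path T
zeros []      = [0]
zeros (T ∷ _) = 0∷ zeros T

overline : ∀ {T} → Branch T → Path T
overline ([0] {T} _) = 0∷ zeros T
overline (0∷ P)      = 0∷ overline P
overline (next P)    = next (overline P)

branchHeight : ∀ {T} → Branch T → ℕ
branchHeight ([0] _)  = 0
branchHeight (0∷ P)   = suc (branchHeight P)
branchHeight (next P) = branchHeight P

leafHeight : ∀ {T} → Branch T → ℕ
leafHeight P = depth (overline P)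

-- Insertion only needs the condition bh(P) ≤ th(T), which forces T to be a
-- singleton when P has more than one entry.
insert : ∀ S (P : Branch S) T → branchHeight P ≤ trunkHeight T → Tree
insert (S ∷ Ss) ([0] _)  T        _       = T ++ Ss
insert (S ∷ Ss) (0∷ P)   (T ∷ []) (s≤s b) = insert S P T b ∷ Ss
insert (S ∷ Ss) (next P) T        b       = S ∷ insert Ss P T b

++⁺ˡ : ∀ {T} U → Path T → Path (T ++ U)
++⁺ˡ U [0]      = [0]
++⁺ˡ U (0∷ p)   = 0∷ p
++⁺ˡ U (next p) = next (++⁺ˡ U p)

++⁺ʳ : ∀ T {U} → Path U → Path (T ++ U)
++⁺ʳ []       p = p
++⁺ʳ (T ∷ Ts) p = next (++⁺ʳ Ts p)

-- The interior sends paths to paths: Σ(q)[inc_k] is the path k ∷ q.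
ι : ∀ S (P : Branch S) T (b : branchHeight P ≤ trunkHeight T) →
    Path T → Path (insert S P T b)
ι (S ∷ Ss) ([0] _)  T        b       p          = ++⁺ˡ Ss p
ι (S ∷ Ss) (0∷ P)   (T ∷ []) (s≤s b) [0]        = [0]
ι (S ∷ Ss) (0∷ P)   (T ∷ []) (s≤s b) (0∷ p)     = 0∷ ι S P T b p
ι (S ∷ Ss) (0∷ P)   (T ∷ []) (s≤s b) (next [0]) = next [0]
ι (S ∷ Ss) (next P) T        b       p          = next (ι Ss P T b p)

-- A path of a linear tree T, as a variable of the disc ⌊ T ⌋.
discVar : ∀ {T} → Linear T → Path T → ∀ {d} → height T ≡ d →
          Fin (suc (d * 2))
discVar {T} lin p eq =
  Fin.cast (cong suc (trans (size-linear T lin) (cong (_* 2) eq))) (pathVar T p)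

κ : ∀ S (P : Branch S) T (b : branchHeight P ≤ trunkHeight T) →
    Labelling S (suc (size (insert S P T b)))
κ (S ∷ Ss) ([0] lin) T b [0] = path (T ++ Ss) [0]
κ (S ∷ Ss) ([0] lin) T b (0∷ p) =
  var (discVar {S ∷ []} (cong suc lin) (0∷ p) (sym (dim-𝒰 d T)))
    ⟦ fromDisc (𝒰 d T) (𝒞 d T) ⟧
    ⟦ toSub (path (T ++ Ss) ∘ ι (S ∷ Ss) ([0] lin) T b) ⟧
  where d = suc (height S)
κ (S ∷ Ss) ([0] lin) T b (next p) = path (T ++ Ss) (++⁺ʳ T p)
κ (S ∷ Ss) (0∷ P) (T ∷ []) (s≤s b) [0] = path (insert S P T b ∷ Ss) [0]
κ (S ∷ Ss) (0∷ P) (T ∷ []) (s≤s b) (0∷ p) =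
  ΣTm (κ S P T b p) ⟦ inc₀ (insert S P T b) Ss ⟧
κ (S ∷ Ss) (0∷ P) (T ∷ []) (s≤s b) (next p) =
  path (insert S P T b ∷ Ss) (next p)
κ (S ∷ Ss) (next P) T b [0]      = path (S ∷ insert Ss P T b) [0]
κ (S ∷ Ss) (next P) T b (0∷ p)   = path (S ∷ insert Ss P T b) (0∷ p)
κ (S ∷ Ss) (next P) T b (next p) =
  κ Ss P T b p ⟦ incNext S (insert Ss P T b) ⟧

-- Where the two labellings meet, at [len T], the left one is used.
append : ∀ {T U} → Labelling T n → Labelling U n → Labelling (T ++ U) n
append {T = []}     M L [0]      = M [0]
append {T = []}     M L (0∷ p)   = L (0∷ p)
append {T = []}     M L (next p) = L (next p)
append {T = T ∷ Ts} M L [0]      = M [0]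
append {T = T ∷ Ts} M L (0∷ p)   = M (0∷ p)
append {T = T ∷ Ts} M L (next p) = append (M ∘ next) L p

insertLabelling :
  ∀ S (P : Branch S) T (b : branchHeight P ≤ trunkHeight T) →
  Labelling S n → Labelling T n → Labelling (insert S P T b) n
insertLabelling (S ∷ Ss) ([0] _) T _ L M p = append M (L ∘ next) p
insertLabelling (S ∷ Ss) (0∷ P) (T ∷ []) (s≤s b) L M [0]        = M [0]
insertLabelling (S ∷ Ss) (0∷ P) (T ∷ []) (s≤s b) L M (0∷ p)     =
  insertLabelling S P T b (L ∘ 0∷_) (M ∘ 0∷_) p
insertLabelling (S ∷ Ss) (0∷ P) (T ∷ []) (s≤s b) L M (next [0]) = M (next [0])
insertLabelling (S ∷ Ss) (0∷ P) (T ∷ []) (s≤s b) L M (next p)   = L (next p)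
insertLabelling (S ∷ Ss) (next P) T b L M [0]      = L [0]
insertLabelling (S ∷ Ss) (next P) T b L M (0∷ p)   = L (0∷ p)
insertLabelling (S ∷ Ss) (next P) T b L M (next p) =
  insertLabelling Ss P T b (L ∘ next) M p

record InsertionRedex (S : Tree) (P : Branch S) (T : Tree)
                      (L : Labelling S n) (M : Labelling T n) : Set where
  field
    bh≤th : branchHeight P ≤ trunkHeight T
    h≤lh  : height T ≤ leafHeight P
    label : L (overline P) ≡ 𝒞 (leafHeight P) T ⟦ toSub M ⟧

open InsertionRedex using (bh≤th)

data dr {n} (Γ : Ctx n) : Tm n → Tm n → Set where
  disc-removal : ∀ A t → dr Γ (unary A t) t

data ecr′ {n} (Γ : Ctx n) : Tm n → Tm n → Set where
  endo-coherence-removal :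
    ∀ (Δ : Ctx m) s A (σ : Sub m n) →
    ¬ IsIdentity (coh Δ (s ⇒[ A ] s) σ) →
    ecr′ Γ (coh Δ (s ⇒[ A ] s) σ) (identity (A ⟦ σ ⟧ᵀ) (s ⟦ σ ⟧))

-- The disjunction says that L(P̄), a standard coherence of height lh(P) over
-- T, is an identity or a standard composite that is not unary.
data insert′ {n} (Γ : Ctx n) : Tm n → Tm n → Set where
  insertion :
    ∀ {S P T} {L : Labelling S n} {M : Labelling T n}
    (r : InsertionRedex S P T L M) (A : Ty (suc (size S))) →
    ¬ IsIdentity (coh ⌊ S ⌋ A (toSub L)) →
    ¬ IsUnary (coh ⌊ S ⌋ A (toSub L)) →
    IsIdentity (L (overline P))
      ⊎ (leafHeight P ≡ height T × ¬ IsUnary (L (overline P))) →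
    insert′ Γ
      (coh ⌊ S ⌋ A (toSub L))
      (coh ⌊ insert S P T (bh≤th r) ⌋
           (A ⟦ toSub (κ S P T (bh≤th r)) ⟧ᵀ)
           (toSub (insertLabelling S P T (bh≤th r) L M)))

sua′ : RuleSet
sua′ Γ s t = dr Γ s t ⊎ ecr′ Γ s t ⊎ insert′ Γ s t

{-# OPTIONS --safe #-}

-- By induction on N, equal terms whose types have dimension below N are joinable.
-- For the step, reduction of terms of dimension at most N terminates.  Every rule
-- decreases the number of coherences of each dimension, compared lexicographically
-- from the top, where identities count as dimension zero and the types of coherences
-- are not counted.  A reduction inside the type of a coherence preserves or decreases
-- these numbers, and cannot go on forever since the terms in that type have lower
-- dimension.  Hence local confluence suffices.
--
-- The critical idea is to drop the side conditions of insertion: whenever L(P̄) is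
-- 𝒞_T[M], the terms Coh_(S;A)[L] and Coh_(S≪T;A[κ])[L≪M] are joinable.  Where the rule
-- does not apply, disc removal, endo-coherence removal, or the insertion of a disc of
-- dimension one less bridges the gap.  Two insertions into S, or one into S and one into
-- the label of its leaf, can then be followed by further insertions that lead to the
-- same labelled tree, up to labels that are equal and of lower dimension.  The resulting
-- types are equal as well, because every L is equal to κ followed by L≪M: applied to the
-- identity labelling, this turns a comparison of exteriors into one of labellings.  The
-- induction hypothesis joins these types and labels.

module Submission where

open import Defs
open import Data.Bool using (true; false)
open import Data.Empty using (⊥-elim) renaming (⊥ to Empty)
open import Data.Fin using (Fin; zero; suc; inject₁; fromℕ)
import Data.Fin as Fin
open import Data.Fin.Subset using (Subset; _∈_; _∉_; _∪_; _─_; ⁅_⁆)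
open import Data.Fin.Subset.Properties
  using (x∈⁅x⁆; x∈⁅y⁆⇒x≡y; x∈p∪q⁻; x∈p∪q⁺; ∉⊥; p─q⊆p; x∈p∧x∉q⇒x∈p─q; drop-there)
open import Data.Vec.Base using (here; there)
open import Data.List.Properties using () renaming (++-assoc to ++ˡ-assoc; map-++ to mapˡ-++; ∷-injective to ∷ˡ-injective)
open import Data.Nat using (ℕ; zero; suc; _+_; _*_; _⊔_; _⊓_; _≤_; _<_; z≤n; s≤s; s≤s⁻¹)
open import Data.Nat.Properties
open import Data.Nat.Solver using (module +-*-Solver)
open import Induction.WellFounded using (Acc; acc)
open import Data.Product using (Σ; ∃-syntax; _×_; _,_; proj₁; proj₂)
open import Data.Sign using (Sign)
open import Data.Sum using (_⊎_; inj₁; inj₂)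
open import Data.Unit using (⊤; tt)
open import Data.List using (List) renaming ([] to []ˡ; _∷_ to _∷ˡ_; _++_ to _++ˡ_; map to mapˡ)
open import Data.Vec using (Vec; []; _∷_; lookup; map; tabulate; toList)
open import Data.Vec.Properties
  using (lookup-map; lookup∘tabulate; tabulate∘lookup; tabulate-cong; map-cong; map-∘; tabulate-∘)
open import Function using (_∘_; id; case_of_)
open import Relation.Binary.Construct.Closure.ReflexiveTransitive using (Star; _◅_; _◅◅_; gmap) renaming (ε to done)
open import Relation.Binary.Definitions using (tri<; tri≈; tri>)
open import Relation.Binary.PropositionalEquality
  using (_≡_; _≢_; refl; sym; trans; cong; cong₂; subst; subst₂; module ≡-Reasoning)
open import Relation.Binary.Rewriting using (Confluent)
open import Relation.Nullary using (¬_; Dec; yes; no)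
open import Relation.Unary using (Pred; _≐_)

open Catt sua′

private
  variable
    k l m n : ℕ

-- Substitution and suspension

-- The results of conflicting insertions agree only up to equality. Where two branches meet, the
-- surviving label depends on the order, and the pulled-back type depends on the route. So the
-- induction on dimension carries joinability of equal terms, not merely confluence. A second
-- obstacle is that the bridges are zigzags, and some of their corners are not obtained as reducts
-- of the peak. Newman's lemma in its usual form gives nothing there. The well-founded relation
-- `Below` therefore admits every typed term of smaller cost, and its induction hypothesis makes all
-- corners confluent. All this presupposes that equality preserves typing. For insertion this means
-- that supports stay regular boundaries after pulling back along `κ`, which is why boundaries are
-- redescribed independently of ps-derivations and, over trees, as sets of paths. Finally, trees
-- reached by different routes are only propositionally equal, so labellings of different trees are
-- compared by the structural relation `Sim`.

lookup-ext : ∀ {a} {A : Set a} {xs ys : Vec A n} →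
             (∀ x → lookup xs x ≡ lookup ys x) → xs ≡ ys
lookup-ext {xs = xs} {ys} e =
  trans (sym (tabulate∘lookup xs)) (trans (tabulate-cong e) (tabulate∘lookup ys))

lookup-• : ∀ (τ : Sub l m) (σ : Sub m n) x → lookup (τ • σ) x ≡ lookup τ x ⟦ σ ⟧
lookup-• (t ∷ τ) σ zero    = refl
lookup-• (t ∷ τ) σ (suc x) = lookup-• τ σ x

⟦⟧-• : ∀ (t : Tm l) (τ : Sub l m) (σ : Sub m n) → t ⟦ τ ⟧ ⟦ σ ⟧ ≡ t ⟦ τ • σ ⟧
•-assoc : ∀ (ρ : Sub k l) (τ : Sub l m) (σ : Sub m n) → (ρ • τ) • σ ≡ ρ • (τ • σ)
⟦⟧-• (var x)     τ σ = sym (lookup-• τ σ x)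
⟦⟧-• (coh Δ A ρ) τ σ = cong (coh Δ A) (•-assoc ρ τ σ)
•-assoc []      τ σ = refl
•-assoc (t ∷ ρ) τ σ = cong₂ _∷_ (⟦⟧-• t τ σ) (•-assoc ρ τ σ)

arr-cong : ∀ {s s′ t t′ : Tm n} {A A′} → s ≡ s′ → A ≡ A′ → t ≡ t′ →
           s ⇒[ A ] t ≡ s′ ⇒[ A′ ] t′
arr-cong refl refl refl = refl

⟦⟧ᵀ-• : ∀ (A : Ty l) (τ : Sub l m) (σ : Sub m n) → A ⟦ τ ⟧ᵀ ⟦ σ ⟧ᵀ ≡ A ⟦ τ • σ ⟧ᵀ
⟦⟧ᵀ-• ⋆            τ σ = refl
⟦⟧ᵀ-• (s ⇒[ A ] t) τ σ = arr-cong (⟦⟧-• s τ σ) (⟦⟧ᵀ-• A τ σ) (⟦⟧-• t τ σ)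

⟦id⟧ : ∀ (t : Tm n) → t ⟦ idSub ⟧ ≡ t
•-id : ∀ (τ : Sub m n) → τ • idSub ≡ τ
⟦id⟧ (var x)     = lookup∘tabulate var x
⟦id⟧ (coh Δ A τ) = cong (coh Δ A) (•-id τ)
•-id []      = refl
•-id (t ∷ τ) = cong₂ _∷_ (⟦id⟧ t) (•-id τ)

⟦id⟧ᵀ : ∀ (A : Ty n) → A ⟦ idSub ⟧ᵀ ≡ A
⟦id⟧ᵀ ⋆            = refl
⟦id⟧ᵀ (s ⇒[ A ] t) = arr-cong (⟦id⟧ s) (⟦id⟧ᵀ A) (⟦id⟧ t)

lookup-id : ∀ (x : Fin n) → lookup idSub x ≡ var x
lookup-id = lookup∘tabulate var

lookup-var-• : ∀ (f : Fin m → Fin n) (σ : Sub n l) x →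
               lookup (tabulate (var ∘ f) • σ) x ≡ lookup σ (f x)
lookup-var-• f σ x =
  trans (lookup-• (tabulate (var ∘ f)) σ x) (cong (_⟦ σ ⟧) (lookup∘tabulate (var ∘ f) x))

id-• : ∀ (σ : Sub m n) → idSub • σ ≡ σ
id-• σ = lookup-ext (lookup-var-• id σ)

wk-∷ : ∀ (t : Tm m) {u} (σ : Sub m n) → wkTm t ⟦ u ∷ σ ⟧ ≡ t ⟦ σ ⟧
wkSub-∷ : ∀ (τ : Sub l m) {u} (σ : Sub m n) → wkSub τ • (u ∷ σ) ≡ τ • σ
wk-∷ (var x)     σ = refl
wk-∷ (coh Δ A τ) σ = cong (coh Δ A) (wkSub-∷ τ σ)
wkSub-∷ []      σ = refl
wkSub-∷ (t ∷ τ) σ = cong₂ _∷_ (wk-∷ t σ) (wkSub-∷ τ σ)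

wkTy-∷ : ∀ (A : Ty m) {u} (σ : Sub m n) → wkTy A ⟦ u ∷ σ ⟧ᵀ ≡ A ⟦ σ ⟧ᵀ
wkTy-∷ ⋆            σ = refl
wkTy-∷ (s ⇒[ A ] t) σ = arr-cong (wk-∷ s σ) (wkTy-∷ A σ) (wk-∷ t σ)

lookup-wkSub : ∀ (σ : Sub m n) x → lookup (wkSub σ) x ≡ wkTm (lookup σ x)
lookup-wkSub (t ∷ σ) zero    = refl
lookup-wkSub (t ∷ σ) (suc x) = lookup-wkSub σ x

wk-⟦⟧ : ∀ (t : Tm m) (σ : Sub m n) → wkTm (t ⟦ σ ⟧) ≡ t ⟦ wkSub σ ⟧
wkSub-• : ∀ (τ : Sub l m) (σ : Sub m n) → wkSub (τ • σ) ≡ τ • wkSub σ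
wk-⟦⟧ (var x)     σ = sym (lookup-wkSub σ x)
wk-⟦⟧ (coh Δ A τ) σ = cong (coh Δ A) (wkSub-• τ σ)
wkSub-• []      σ = refl
wkSub-• (t ∷ τ) σ = cong₂ _∷_ (wk-⟦⟧ t σ) (wkSub-• τ σ)

wkTy-⟦⟧ : ∀ (A : Ty m) (σ : Sub m n) → wkTy (A ⟦ σ ⟧ᵀ) ≡ A ⟦ wkSub σ ⟧ᵀ
wkTy-⟦⟧ ⋆            σ = refl
wkTy-⟦⟧ (s ⇒[ A ] t) σ = arr-cong (wk-⟦⟧ s σ) (wkTy-⟦⟧ A σ) (wk-⟦⟧ t σ)

wkSub-tabulate : ∀ (f : Fin m → Tm n) → wkSub (tabulate f) ≡ tabulate (wkTm ∘ f)
wkSub-tabulate f = lookup-ext λ x →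
  trans (lookup-wkSub (tabulate f) x)
    (trans (cong wkTm (lookup∘tabulate f x)) (sym (lookup∘tabulate (wkTm ∘ f) x)))

shift : Sub n (suc n)
shift = tabulate λ x → var (suc x)

wkTy-sub : ∀ (A : Ty n) → wkTy A ≡ A ⟦ shift ⟧ᵀ
wkTy-sub A = trans (cong wkTy (sym (⟦id⟧ᵀ A)))
  (trans (wkTy-⟦⟧ A idSub) (cong (A ⟦_⟧ᵀ) (wkSub-tabulate var)))

dim-⟦⟧ : ∀ (A : Ty m) (σ : Sub m n) → dim (A ⟦ σ ⟧ᵀ) ≡ dim A
dim-⟦⟧ ⋆            σ = refl
dim-⟦⟧ (s ⇒[ A ] t) σ = cong suc (dim-⟦⟧ A σ)

dim-wk : ∀ (A : Ty n) → dim (wkTy A) ≡ dim A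
dim-wk ⋆            = refl
dim-wk (s ⇒[ A ] t) = cong suc (dim-wk A)

lookup-ΣSub : ∀ (σ : Sub m n) x →
  lookup (ΣSub σ) (inject₁ (inject₁ x)) ≡ ΣTm (lookup σ x)
lookup-ΣSub (t ∷ σ) zero    = refl
lookup-ΣSub (t ∷ σ) (suc x) = lookup-ΣSub σ x

lookup-susp-inj : ∀ {a} {A : Set a} {x y : A} (xs : Vec A n) i →
                  lookup (susp x y xs) (inject₁ (inject₁ i)) ≡ lookup xs i
lookup-susp-inj (x ∷ xs) zero    = refl
lookup-susp-inj (x ∷ xs) (suc i) = lookup-susp-inj xs i

lookup-susp-north : ∀ {a} {A : Set a} {x y : A} (xs : Vec A n) →
                    lookup (susp x y xs) north ≡ x
lookup-susp-north []       = refl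
lookup-susp-north (x ∷ xs) = lookup-susp-north xs

lookup-susp-south : ∀ {a} {A : Set a} {x y : A} (xs : Vec A n) →
                    lookup (susp x y xs) south ≡ y
lookup-susp-south []       = refl
lookup-susp-south (x ∷ xs) = lookup-susp-south xs

ΣSub-susp : ∀ (σ : Sub m n) → ΣSub σ ≡ susp (var north) (var south) (map ΣTm σ)
ΣSub-susp []      = refl
ΣSub-susp (t ∷ σ) = cong (ΣTm t ∷_) (ΣSub-susp σ)

susp-• : ∀ {a b : Tm m} (τ : Sub l m) (σ : Sub m n) →
         susp a b τ • σ ≡ susp (a ⟦ σ ⟧) (b ⟦ σ ⟧) (τ • σ)
susp-• []      σ = refl
susp-• (t ∷ τ) σ = cong (t ⟦ σ ⟧ ∷_) (susp-• τ σ)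

ΣTm-⟦⟧ : ∀ (t : Tm m) (σ : Sub m n) → ΣTm (t ⟦ σ ⟧) ≡ ΣTm t ⟦ ΣSub σ ⟧
ΣSub-• : ∀ (τ : Sub l m) (σ : Sub m n) → ΣSub (τ • σ) ≡ ΣSub τ • ΣSub σ
ΣTm-⟦⟧ (var x)     σ = sym (lookup-ΣSub σ x)
ΣTm-⟦⟧ (coh Δ A τ) σ = cong (coh (ΣCtx Δ) (ΣTy A)) (ΣSub-• τ σ)
ΣSub-• [] σ = cong₂ (λ s t → s ∷ t ∷ [])
  (sym (trans (cong (λ ρ → lookup ρ south) (ΣSub-susp σ)) (lookup-susp-south (map ΣTm σ))))
  (sym (trans (cong (λ ρ → lookup ρ north) (ΣSub-susp σ)) (lookup-susp-north (map ΣTm σ))))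
ΣSub-• (t ∷ τ) σ = cong₂ _∷_ (ΣTm-⟦⟧ t σ) (ΣSub-• τ σ)

ΣTm-wk : ∀ (t : Tm n) → ΣTm (wkTm t) ≡ wkTm (ΣTm t)
ΣSub-wk : ∀ (σ : Sub m n) → ΣSub (wkSub σ) ≡ wkSub (ΣSub σ)
ΣTm-wk (var x)     = refl
ΣTm-wk (coh Δ A σ) = cong (coh (ΣCtx Δ) (ΣTy A)) (ΣSub-wk σ)
ΣSub-wk []      = refl
ΣSub-wk (t ∷ σ) = cong₂ _∷_ (ΣTm-wk t) (ΣSub-wk σ)

ΣTy-wk : ∀ (A : Ty n) → ΣTy (wkTy A) ≡ wkTy (ΣTy A)
ΣTy-wk ⋆            = refl
ΣTy-wk (s ⇒[ A ] t) = arr-cong (ΣTm-wk s) (ΣTy-wk A) (ΣTm-wk t)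

idSub-susp : ΣSub (idSub {n}) ≡ idSub
idSub-susp {zero}  = refl
idSub-susp {suc n} = cong (var zero ∷_)
  (trans (cong ΣSub (sym (wkSub-tabulate var)))
    (trans (ΣSub-wk idSub) (trans (cong wkSub (idSub-susp {n})) (wkSub-tabulate var))))

ΣCtx-‼ : ∀ (Γ : Ctx n) x → ΣCtx Γ ‼ inject₁ (inject₁ x) ≡ ΣTy (Γ ‼ x)
ΣCtx-‼ (Γ ▹ A) zero    = sym (ΣTy-wk A)
ΣCtx-‼ (Γ ▹ A) (suc x) = trans (cong wkTy (ΣCtx-‼ Γ x)) (sym (ΣTy-wk (Γ ‼ x)))

-- Wedge sums, and paths as the variables of a tree context

lookup-wedge-inl : ∀ {a} {A : Set a} m (xs : Vec A (suc n)) (ys : Vec A (suc m)) x →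
                   lookup (wedge xs ys) (inl m x) ≡ lookup xs x
lookup-wedge-inl zero    xs (y ∷ [])     x = refl
lookup-wedge-inl (suc m) xs (y ∷ z ∷ ys) x = lookup-wedge-inl m xs (z ∷ ys) x

lookup-wedge-inr : ∀ {a} {A : Set a} m (xs : Vec A (suc n)) (ys : Vec A (suc m)) b →
                   lookup xs b ≡ lookup ys (fromℕ m) → ∀ x →
                   lookup (wedge xs ys) (inr m b x) ≡ lookup ys x
lookup-wedge-inr zero    xs (y ∷ [])     b e zero    = e
lookup-wedge-inr (suc m) xs (y ∷ z ∷ ys) b e zero    = refl
lookup-wedge-inr (suc m) xs (y ∷ z ∷ ys) b e (suc x) = lookup-wedge-inr m xs (z ∷ ys) b e x

inl-fromℕ : ∀ m n → inl m (fromℕ n) ≡ fromℕ (m + n)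
inl-fromℕ zero    n = refl
inl-fromℕ (suc m) n = cong suc (inl-fromℕ m n)

inr-fromℕ : ∀ m (b : Fin (suc n)) → inr m b (fromℕ m) ≡ inl m b
inr-fromℕ zero    b = refl
inr-fromℕ (suc m) b = cong suc (inr-fromℕ m b)

last₀-Σ : ∀ (Γ : Ctx n) → last₀ (ΣCtx Γ) ≡ south
last₀-Σ ∅                    = refl
last₀-Σ (Γ ▹ ⋆)              = cong suc (last₀-Σ Γ)
last₀-Σ (Γ ▹ (_ ⇒[ _ ] _))   = cong suc (last₀-Σ Γ)

map-susp : ∀ {a b} {A : Set a} {B : Set b} (f : A → B) x y (xs : Vec A n) →
           map f (susp x y xs) ≡ susp (f x) (f y) (map f xs)
map-susp f x y []       = refl
map-susp f x y (z ∷ xs) = cong (f z ∷_) (map-susp f x y xs)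

map-wedge : ∀ {a b} {A : Set a} {B : Set b} (f : A → B) (xs : Vec A (suc n)) (ys : Vec A (suc m)) →
            map f (wedge xs ys) ≡ wedge (map f xs) (map f ys)
map-wedge f xs (y ∷ [])     = refl
map-wedge f xs (y ∷ z ∷ ys) = cong (f y ∷_) (map-wedge f xs (z ∷ ys))

susp-tabulate : ∀ {a} {A : Set a} (f : Fin (2 + n) → A) →
  susp (f north) (f south) (tabulate (λ x → f (inject₁ (inject₁ x)))) ≡ tabulate f
susp-tabulate {zero}  f = refl
susp-tabulate {suc n} f = cong (f zero ∷_) (susp-tabulate (λ x → f (suc x)))

wedge-tabulate : ∀ {a} {A : Set a} m (f : Fin (suc (m + n)) → A) b →
  wedge (tabulate (λ x → f (inl m x))) (tabulate (λ x → f (inr m b x))) ≡ tabulate f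
wedge-tabulate zero    f b = refl
wedge-tabulate (suc m) f b = cong (f zero ∷_) (wedge-tabulate m (λ x → f (suc x)) b)

0∷ᵖ_ : ∀ {T Ts} → Path T → Path (T ∷ Ts)
0∷ᵖ p = 0∷ p

nextᵖ : ∀ {T Ts} → Path Ts → Path (T ∷ Ts)
nextᵖ p = next p

suspPaths : ∀ T Ts → Vec (Path (T ∷ Ts)) (2 + suc (size T))
suspPaths T Ts = susp [0] (next [0]) (map 0∷_ (paths T))

nextPaths : ∀ T Ts → Vec (Path (T ∷ Ts)) (suc (size Ts))
nextPaths T Ts = map next (paths Ts)

paths-first : ∀ T → lookup (paths T) (fromℕ (size T)) ≡ [0]
paths-first [] = refl
paths-first (T ∷ Ts) = begin
  lookup (paths (T ∷ Ts)) (fromℕ (size Ts + (2 + size T)))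
    ≡⟨ cong (lookup (paths (T ∷ Ts))) (inl-fromℕ (size Ts) (2 + size T)) ⟨
  lookup (paths (T ∷ Ts)) (inl (size Ts) (fromℕ (2 + size T)))
    ≡⟨ lookup-wedge-inl (size Ts) (suspPaths T Ts) (nextPaths T Ts) _ ⟩
  lookup (suspPaths T Ts) north
    ≡⟨ lookup-susp-north (map (0∷ᵖ_ {T} {Ts}) (paths T)) ⟩
  [0] ∎
  where open ≡-Reasoning

-- The compatibility that `lookup-wedge-inr` asks for: the south pole of the first block and the
-- first point of the remaining blocks are one path.
paths-glue : ∀ T Ts → lookup (suspPaths T Ts) (last₀ (ΣCtx ⌊ T ⌋))
             ≡ lookup (nextPaths T Ts) (fromℕ (size Ts))
paths-glue T Ts = trans
  (trans (cong (lookup (suspPaths T Ts)) (last₀-Σ ⌊ T ⌋))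
         (lookup-susp-south (map (0∷ᵖ_ {T} {Ts}) (paths T))))
  (sym (trans (lookup-map (fromℕ (size Ts)) nextᵖ (paths Ts)) (cong nextᵖ (paths-first Ts))))

lookup-paths : ∀ T p → lookup (paths T) (pathVar T p) ≡ p
lookup-paths T        [0]      = paths-first T
lookup-paths (T ∷ Ts) (0∷ p)   =
  trans (lookup-wedge-inl (size Ts) (suspPaths T Ts) (nextPaths T Ts) _)
    (trans (lookup-susp-inj (map (0∷ᵖ_ {T} {Ts}) (paths T)) (pathVar T p))
      (trans (lookup-map (pathVar T p) 0∷ᵖ_ (paths T)) (cong 0∷ᵖ_ (lookup-paths T p))))
lookup-paths (T ∷ Ts) (next p) =
  trans (lookup-wedge-inr (size Ts) (suspPaths T Ts) (nextPaths T Ts) _ (paths-glue T Ts) _)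
    (trans (lookup-map (pathVar Ts p) nextᵖ (paths Ts)) (cong next (lookup-paths Ts p)))

pathVar-next[0] : ∀ T Ts → pathVar (T ∷ Ts) (next [0]) ≡ inl (size Ts) south
pathVar-next[0] T Ts =
  trans (inr-fromℕ (size Ts) _) (cong (inl (size Ts)) (last₀-Σ ⌊ T ⌋))

pathVar-[0] : ∀ T Ts → pathVar (T ∷ Ts) [0] ≡ inl (size Ts) north
pathVar-[0] T Ts = sym (inl-fromℕ (size Ts) (2 + size T))

map-pathVar : ∀ T → map (pathVar T) (paths T) ≡ tabulate id
map-pathVar []       = refl
map-pathVar (T ∷ Ts) = begin
  map v (wedge (suspPaths T Ts) (nextPaths T Ts))
    ≡⟨ map-wedge v (suspPaths T Ts) (nextPaths T Ts) ⟩
  wedge (map v (suspPaths T Ts)) (map v (nextPaths T Ts))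
    ≡⟨ cong₂ wedge left right ⟩
  wedge (tabulate (inl (size Ts))) (tabulate (inr (size Ts) b))
    ≡⟨ wedge-tabulate (size Ts) id b ⟩
  tabulate id ∎
  where
  open ≡-Reasoning
  v = pathVar (T ∷ Ts)
  b = last₀ (ΣCtx ⌊ T ⌋)
  g : ∀ {n} → Fin (suc (size T)) → Fin (suc (n + (2 + size T)))
  g {n} x = inl n (inject₁ (inject₁ x))
  left : map v (suspPaths T Ts) ≡ tabulate (inl (size Ts))
  left = begin
    map v (suspPaths T Ts)
      ≡⟨ map-susp v [0] (next [0]) (map (0∷ᵖ_ {T} {Ts}) (paths T)) ⟩
    susp (v [0]) (v (next [0])) (map v (map (0∷ᵖ_ {T} {Ts}) (paths T)))
      ≡⟨ cong (λ x → susp x (v (next [0])) (map v (map (0∷ᵖ_ {T} {Ts}) (paths T)))) (pathVar-[0] T Ts) ⟩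
    susp (inl (size Ts) north) (v (next [0])) (map v (map (0∷ᵖ_ {T} {Ts}) (paths T)))
      ≡⟨ cong₂ (susp (inl (size Ts) north)) (pathVar-next[0] T Ts)
           (trans (sym (map-∘ v 0∷ᵖ_ (paths T))) (trans (map-∘ g (pathVar T) (paths T))
             (trans (cong (map g) (map-pathVar T)) (sym (tabulate-∘ g id))))) ⟩
    susp (inl (size Ts) north) (inl (size Ts) south) (tabulate g)
      ≡⟨ susp-tabulate (inl (size Ts)) ⟩
    tabulate (inl (size Ts)) ∎
  right : map v (nextPaths T Ts) ≡ tabulate (inr (size Ts) b)
  right = trans (sym (map-∘ v nextᵖ (paths Ts)))
    (trans (map-∘ (inr (size Ts) b) (pathVar Ts) (paths Ts))
      (trans (cong (map (inr (size Ts) b)) (map-pathVar Ts)) (sym (tabulate-∘ (inr (size Ts) b) id))))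

varPath : ∀ T → Fin (suc (size T)) → Path T
varPath T = lookup (paths T)

pathVar-varPath : ∀ T x → pathVar T (varPath T x) ≡ x
pathVar-varPath T x = trans (sym (lookup-map x (pathVar T) (paths T)))
  (trans (cong (λ xs → lookup xs x) (map-pathVar T)) (lookup∘tabulate id x))

lookup-toSub : ∀ {T} (L : Labelling T n) p → lookup (toSub L) (pathVar T p) ≡ L p
lookup-toSub {T = T} L p =
  trans (lookup-map (pathVar T p) L (paths T)) (cong L (lookup-paths T p))

lookup-toSub-var : ∀ {T} (L : Labelling T n) x → lookup (toSub L) x ≡ L (varPath T x)
lookup-toSub-var {T = T} L x = lookup-map x L (paths T)

toSub-cong : ∀ {T} {L M : Labelling T n} → (∀ p → L p ≡ M p) → toSub L ≡ toSub M
toSub-cong {T = T} e = map-cong e (paths T)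

map-• : ∀ {a} {A : Set a} (f : A → Tm m) (xs : Vec A l) (σ : Sub m n) →
        map f xs • σ ≡ map (λ x → f x ⟦ σ ⟧) xs
map-• f []       σ = refl
map-• f (x ∷ xs) σ = cong (f x ⟦ σ ⟧ ∷_) (map-• f xs σ)

toSub-• : ∀ {T} (L : Labelling T m) (σ : Sub m n) → toSub L • σ ≡ toSub (λ p → L p ⟦ σ ⟧)
toSub-• {T = T} L σ = map-• L (paths T) σ

toLab : ∀ {T} → Sub (suc (size T)) n → Labelling T n
toLab {T = T} σ p = lookup σ (pathVar T p)

toSub-toLab : ∀ {T} (σ : Sub (suc (size T)) n) → toSub (toLab {T = T} σ) ≡ σ
toSub-toLab {T = T} σ = lookup-ext λ x →
  trans (lookup-toSub-var (toLab {T = T} σ) x) (cong (lookup σ) (pathVar-varPath T x))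

toSub-path : ∀ T → toSub (path T) ≡ idSub
toSub-path T = lookup-ext λ x → trans (lookup-toSub-var (path T) x)
  (trans (cong var (pathVar-varPath T x)) (sym (lookup-id x)))

-- The type that the label of a path must have. The base type makes the recursion structural:
-- entering a subtree replaces it by the arrow between the two neighbouring labels, so neither
-- suspension nor wedge appears.
tyP : ∀ {T} → Ty n → Labelling T n → Path T → Ty n
tyP A L [0]      = A
tyP A L (0∷ p)   = tyP (L [0] ⇒[ A ] L (next [0])) (λ q → L (0∷ q)) p
tyP A L (next p) = tyP A (λ q → L (next q)) p

tyP-⟦⟧ : ∀ {T} A (L : Labelling T m) p (σ : Sub m n) →
         tyP A L p ⟦ σ ⟧ᵀ ≡ tyP (A ⟦ σ ⟧ᵀ) (λ q → L q ⟦ σ ⟧) p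
tyP-⟦⟧ A L [0]      σ = refl
tyP-⟦⟧ A L (0∷ p)   σ = tyP-⟦⟧ _ _ p σ
tyP-⟦⟧ A L (next p) σ = tyP-⟦⟧ A _ p σ

tyP-ext : ∀ {T} A {L M : Labelling T n} → (∀ p → L p ≡ M p) → ∀ p → tyP A L p ≡ tyP A M p
tyP-ext A e [0]      = refl
tyP-ext A {L} {M} e (0∷ p) = trans (tyP-ext _ (λ q → e (0∷ q)) p)
  (cong (λ B → tyP B (λ q → M (0∷ q)) p) (arr-cong (e [0]) refl (e (next [0]))))
tyP-ext A e (next p) = tyP-ext A (λ q → e (next q)) p

dim-tyP : ∀ {T} A (L : Labelling T n) p → dim (tyP A L p) ≡ dim A + depth p
dim-tyP A L [0]      = sym (+-identityʳ (dim A))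
dim-tyP A L (0∷ p)   = trans (dim-tyP _ _ p) (sym (+-suc (dim A) (depth p)))
dim-tyP A L (next p) = dim-tyP A _ p

tyP-Σ : ∀ {T} A (L : Labelling T n) p → ΣTy (tyP A L p) ≡ tyP (ΣTy A) (λ q → ΣTm (L q)) p
tyP-Σ A L [0]      = refl
tyP-Σ A L (0∷ p)   = tyP-Σ _ _ p
tyP-Σ A L (next p) = tyP-Σ A _ p

inlSub : ∀ m → Sub (suc n) (suc (m + n))
inlSub m = tabulate λ x → var (inl m x)

inrSub : ∀ m → Fin (suc n) → Sub (suc m) (suc (m + n))
inrSub m b = tabulate λ x → var (inr m b x)

wk-inr : ∀ m (b : Fin (suc n)) → wkSub (inrSub m b) ≡ tabulate (λ x → var (suc (inr m b x)))
wk-inr m b = wkSub-tabulate (λ x → var (inr m b x))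

wk-inl : ∀ {n} m → wkSub (inlSub {n} m) ≡ inlSub (suc m)
wk-inl m = wkSub-tabulate (λ x → var (inl m x))

∨-‼-inl : ∀ (Γ : Ctx (suc n)) (Δ : Ctx (suc m)) x →
          (Γ ∨ Δ) ‼ inl m x ≡ (Γ ‼ x) ⟦ inlSub m ⟧ᵀ
∨-‼-inl Γ (∅ ▹ A) x = sym (⟦id⟧ᵀ (Γ ‼ x))
∨-‼-inl {n = n} {m = suc m} Γ (Δ ▹ B ▹ A) x = trans (cong wkTy (∨-‼-inl Γ (Δ ▹ B) x))
  (trans (wkTy-⟦⟧ (Γ ‼ x) (inlSub m)) (cong (λ σ → (Γ ‼ x) ⟦ σ ⟧ᵀ) (wk-inl {n} m)))

-- The wedge discards the first entry of its right argument and puts a point of the left one in its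
-- place; types of variables survive this only if the discarded entry has type `⋆`.
First⋆ : Ctx (suc n) → Set
First⋆ (∅ ▹ A)     = A ≡ ⋆
First⋆ (Γ ▹ B ▹ A) = First⋆ (Γ ▹ B)

first⋆ : ∀ (Γ : Ctx (suc n)) → First⋆ Γ → Γ ‼ fromℕ n ≡ ⋆
first⋆ (∅ ▹ A)     e = cong wkTy e
first⋆ (Γ ▹ B ▹ A) e = cong wkTy (first⋆ (Γ ▹ B) e)

∨-‼-inr : ∀ (Γ : Ctx (suc n)) (Δ : Ctx (suc m)) → First⋆ Δ → Γ ‼ last₀ Γ ≡ ⋆ → ∀ x →
          (Γ ∨ Δ) ‼ inr m (last₀ Γ) x ≡ (Δ ‼ x) ⟦ inrSub m (last₀ Γ) ⟧ᵀ
∨-‼-inr Γ (∅ ▹ A) refl e zero = e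
∨-‼-inr {m = suc m} Γ (Δ ▹ B ▹ A) f e zero =
  trans (wkTy-⟦⟧ A _) (trans (cong (A ⟦_⟧ᵀ) (wk-inr m (last₀ Γ)))
    (sym (wkTy-∷ A _)))
∨-‼-inr {m = suc m} Γ (Δ ▹ B ▹ A) f e (suc x) =
  trans (cong wkTy (∨-‼-inr Γ (Δ ▹ B) f e x))
    (trans (wkTy-⟦⟧ ((Δ ▹ B) ‼ x) _) (trans (cong (((Δ ▹ B) ‼ x) ⟦_⟧ᵀ) (wk-inr m (last₀ Γ)))
      (sym (wkTy-∷ ((Δ ▹ B) ‼ x) _))))

First⋆-Σ : ∀ (Γ : Ctx n) → First⋆ (ΣCtx Γ)
First⋆-Σ ∅           = refl
First⋆-Σ (∅ ▹ A)     = refl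
First⋆-Σ (Γ ▹ B ▹ A) = First⋆-Σ (Γ ▹ B)

First⋆-∨ : ∀ (Γ : Ctx (suc n)) (Δ : Ctx (suc m)) → First⋆ Γ → First⋆ (Γ ∨ Δ)
First⋆-∨ Γ (∅ ▹ A) e = e
First⋆-∨ {n = n} Γ (∅ ▹ B ▹ A) e = lem Γ e
  where
  lem : ∀ {A} (Γ : Ctx (suc n)) → First⋆ Γ → First⋆ (Γ ▹ A)
  lem (∅ ▹ B)     e = e
  lem (Γ ▹ C ▹ B) e = e
First⋆-∨ Γ (Δ ▹ C ▹ B ▹ A) e = First⋆-∨ Γ (Δ ▹ C ▹ B) e

First⋆-⌊⌋ : ∀ T → First⋆ ⌊ T ⌋
First⋆-⌊⌋ []       = refl
First⋆-⌊⌋ (T ∷ Ts) = First⋆-∨ (ΣCtx ⌊ T ⌋) ⌊ Ts ⌋ (First⋆-Σ ⌊ T ⌋)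

Σ-last₀ : ∀ (Γ : Ctx n) → ΣCtx Γ ‼ last₀ (ΣCtx Γ) ≡ ⋆
Σ-last₀ Γ = trans (cong (ΣCtx Γ ‼_) (last₀-Σ Γ)) (lem Γ)
  where
  lem : ∀ {n} (Γ : Ctx n) → ΣCtx Γ ‼ south ≡ ⋆
  lem ∅       = refl
  lem (Γ ▹ A) = cong wkTy (lem Γ)

-- Ties the contexts, built by suspension and wedge, to the pathwise types `tyP`. Typed
-- substitutions out of a tree thereby become labellings that are typed path by path.
⌊⌋-‼ : ∀ T p → ⌊ T ⌋ ‼ pathVar T p ≡ tyP ⋆ (path T) p
⌊⌋-‼ T        [0]      = first⋆ ⌊ T ⌋ (First⋆-⌊⌋ T)
⌊⌋-‼ (T ∷ Ts) (0∷ p)   = begin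
  (ΣCtx ⌊ T ⌋ ∨ ⌊ Ts ⌋) ‼ inl (size Ts) (inject₁ (inject₁ (pathVar T p)))
    ≡⟨ ∨-‼-inl (ΣCtx ⌊ T ⌋) ⌊ Ts ⌋ _ ⟩
  (ΣCtx ⌊ T ⌋ ‼ inject₁ (inject₁ (pathVar T p))) ⟦ inlSub (size Ts) ⟧ᵀ
    ≡⟨ cong (_⟦ inlSub (size Ts) ⟧ᵀ) (ΣCtx-‼ ⌊ T ⌋ (pathVar T p)) ⟩
  ΣTy (⌊ T ⌋ ‼ pathVar T p) ⟦ inlSub (size Ts) ⟧ᵀ
    ≡⟨ cong (λ A → ΣTy A ⟦ inlSub (size Ts) ⟧ᵀ) (⌊⌋-‼ T p) ⟩
  ΣTy (tyP ⋆ (path T) p) ⟦ inlSub (size Ts) ⟧ᵀ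
    ≡⟨ cong (_⟦ inlSub (size Ts) ⟧ᵀ) (tyP-Σ ⋆ (path T) p) ⟩
  tyP (var north ⇒[ ⋆ ] var south) (λ q → ΣTm (path T q)) p ⟦ inlSub (size Ts) ⟧ᵀ
    ≡⟨ tyP-⟦⟧ _ (λ q → ΣTm (path T q)) p (inlSub (size Ts)) ⟩
  tyP (lookup (inlSub (size Ts)) north ⇒[ ⋆ ] lookup (inlSub (size Ts)) south)
      (λ q → ΣTm (path T q) ⟦ inlSub (size Ts) ⟧) p
    ≡⟨ tyP-ext _ (λ q → lookup∘tabulate (λ x → var (inl (size Ts) x)) _) p ⟩
  tyP (lookup (inlSub (size Ts)) north ⇒[ ⋆ ] lookup (inlSub (size Ts)) south)
      (λ q → path (T ∷ Ts) (0∷ q)) p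
    ≡⟨ cong (λ A → tyP A (λ q → path (T ∷ Ts) (0∷ q)) p) (arr-cong
         (trans (lookup∘tabulate (λ x → var (inl (size Ts) x)) north) (cong var (sym (pathVar-[0] T Ts))))
         refl
         (trans (lookup∘tabulate (λ x → var (inl (size Ts) x)) south) (cong var (sym (pathVar-next[0] T Ts))))) ⟩
  tyP (path (T ∷ Ts) [0] ⇒[ ⋆ ] path (T ∷ Ts) (next [0])) (λ q → path (T ∷ Ts) (0∷ q)) p ∎
  where open ≡-Reasoning
⌊⌋-‼ (T ∷ Ts) (next p) =
  trans (∨-‼-inr (ΣCtx ⌊ T ⌋) ⌊ Ts ⌋ (First⋆-⌊⌋ Ts) (Σ-last₀ ⌊ T ⌋) (pathVar Ts p))
    (trans (cong (_⟦ inrSub (size Ts) b ⟧ᵀ) (⌊⌋-‼ Ts p))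
      (trans (tyP-⟦⟧ ⋆ (path Ts) p (inrSub (size Ts) b))
        (tyP-ext ⋆ (λ q → lookup∘tabulate (λ x → var (inr (size Ts) b x)) (pathVar Ts q)) p)))
  where b = last₀ (ΣCtx ⌊ T ⌋)

⌊⌋-‼-toSub : ∀ {T} (L : Labelling T n) p → (⌊ T ⌋ ‼ pathVar T p) ⟦ toSub L ⟧ᵀ ≡ tyP ⋆ L p
⌊⌋-‼-toSub {T = T} L p = trans (cong (_⟦ toSub L ⟧ᵀ) (⌊⌋-‼ T p))
  (trans (tyP-⟦⟧ ⋆ (path T) p (toSub L)) (tyP-ext ⋆ (lookup-toSub L) p))

append-rel : ∀ {T U} (R : Tm n → Tm m → Set)
  {M : Labelling T n} {M′ : Labelling T m} {L : Labelling U n} {L′ : Labelling U m} →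
  (∀ p → R (M p) (M′ p)) → (∀ p → R (L p) (L′ p)) → ∀ p → R (append M L p) (append M′ L′ p)
append-rel {T = []}     R e f [0]      = e [0]
append-rel {T = []}     R e f (0∷ p)   = f (0∷ p)
append-rel {T = []}     R e f (next p) = f (next p)
append-rel {T = T ∷ Ts} R e f [0]      = e [0]
append-rel {T = T ∷ Ts} R e f (0∷ p)   = e (0∷ p)
append-rel {T = T ∷ Ts} R e f (next p) = append-rel R (λ q → e (next q)) f p

-- Parametricity: every label of the result is copied from `L` or from `M`. It is applied to
-- equality, to reduction and, with one side ignored, to predicates on labels.
insert-rel : ∀ S P T b (R : Tm n → Tm m → Set)
  {L : Labelling S n} {L′ : Labelling S m} {M : Labelling T n} {M′ : Labelling T m} →
  (∀ p → R (L p) (L′ p)) → (∀ p → R (M p) (M′ p)) →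
  ∀ p → R (insertLabelling S P T b L M p) (insertLabelling S P T b L′ M′ p)
insert-rel (S ∷ Ss) ([0] _)  T        b       R e f p = append-rel R f (λ q → e (next q)) p
insert-rel (S ∷ Ss) (0∷ P)   (T ∷ []) (s≤s b) R e f [0] = f [0]
insert-rel (S ∷ Ss) (0∷ P)   (T ∷ []) (s≤s b) R e f (0∷ p) =
  insert-rel S P T b R (λ q → e (0∷ q)) (λ q → f (0∷ q)) p
insert-rel (S ∷ Ss) (0∷ P)   (T ∷ []) (s≤s b) R e f (next [0]) = f (next [0])
insert-rel (S ∷ Ss) (0∷ P)   (T ∷ []) (s≤s b) R e f (next (0∷ p)) = e (next (0∷ p))
insert-rel (S ∷ Ss) (0∷ P)   (T ∷ []) (s≤s b) R e f (next (next p)) = e (next (next p))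
insert-rel (S ∷ Ss) (next P) T        b       R e f [0] = e [0]
insert-rel (S ∷ Ss) (next P) T        b       R e f (0∷ p) = e (0∷ p)
insert-rel (S ∷ Ss) (next P) T        b       R e f (next p) =
  insert-rel Ss P T b R (λ q → e (next q)) f p

-- Substitution preserves `dim` only propositionally, so the two spheres have different index types.
-- Quantifying over a consumer `F` of spheres of every dimension avoids transports.
fromSphere-⟦⟧ : ∀ {a} {X : Set a} (F : ∀ d → Sub (d * 2) n → X) (A : Ty m) (σ : Sub m n) →
  F (dim A) (fromSphere A • σ) ≡ F (dim (A ⟦ σ ⟧ᵀ)) (fromSphere (A ⟦ σ ⟧ᵀ))
fromSphere-⟦⟧ F ⋆            σ = refl
fromSphere-⟦⟧ F (s ⇒[ A ] t) σ =
  fromSphere-⟦⟧ (λ d τ → F (suc d) (t ⟦ σ ⟧ ∷ s ⟦ σ ⟧ ∷ τ)) A σ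

identity-⟦⟧ : ∀ (A : Ty m) t (σ : Sub m n) → identity A t ⟦ σ ⟧ ≡ identity (A ⟦ σ ⟧ᵀ) (t ⟦ σ ⟧)
identity-⟦⟧ A t σ = fromSphere-⟦⟧
  (λ d τ → coh (Disc d) (var zero ⇒[ DiscType d ] var zero) (t ⟦ σ ⟧ ∷ τ)) A σ

unary-⟦⟧ : ∀ (A : Ty m) t (σ : Sub m n) → unary A t ⟦ σ ⟧ ≡ unary (A ⟦ σ ⟧ᵀ) (t ⟦ σ ⟧)
unary-⟦⟧ A t σ = fromSphere-⟦⟧ (λ d τ → coh (Disc d) (DiscType d) (t ⟦ σ ⟧ ∷ τ)) A σ

sphereTy : ∀ d → Sub (d * 2) n → Ty n
sphereTy zero    []          = ⋆
sphereTy (suc d) (t ∷ s ∷ τ) = s ⇒[ sphereTy d τ ] t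

fromSphere-sphereTy : ∀ {a} {X : Set a} (F : ∀ d → Sub (d * 2) n → X) d (τ : Sub (d * 2) n) →
  F d τ ≡ F (dim (sphereTy d τ)) (fromSphere (sphereTy d τ))
fromSphere-sphereTy F zero    []          = refl
fromSphere-sphereTy F (suc d) (t ∷ s ∷ τ) =
  fromSphere-sphereTy (λ d τ → F (suc d) (t ∷ s ∷ τ)) d τ

-- Being an identity depends on the context and type of a coherence, never on its substitution.
-- Stated in this form, the side conditions of the rules are visibly stable under substitution and
-- under reduction of arguments.
data IdShape : ∀ {m} → Ctx m → Ty m → Set where
  idShape : ∀ d → IdShape (Disc d) (var zero ⇒[ DiscType d ] var zero)

data UnShape : ∀ {m} → Ctx m → Ty m → Set where
  unShape : ∀ d → UnShape (Disc d) (DiscType d)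

id⇒shape : ∀ {Δ : Ctx m} {A} {σ : Sub m n} → IsIdentity (coh Δ A σ) → IdShape Δ A
id⇒shape (A , t , refl) = idShape (dim A)

un⇒shape : ∀ {Δ : Ctx m} {A} {σ : Sub m n} → IsUnary (coh Δ A σ) → UnShape Δ A
un⇒shape (A , t , refl) = unShape (dim A)

shape⇒id : ∀ {Δ : Ctx m} {A} {σ : Sub m n} → IdShape Δ A → IsIdentity (coh Δ A σ)
shape⇒id {σ = t ∷ σ} (idShape d) = sphereTy d σ , t , fromSphere-sphereTy
  (λ d τ → coh (Disc d) (var zero ⇒[ DiscType d ] var zero) (t ∷ τ)) d σ

shape⇒un : ∀ {Δ : Ctx m} {A} {σ : Sub m n} → UnShape Δ A → IsUnary (coh Δ A σ)
shape⇒un {σ = t ∷ σ} (unShape d) = sphereTy d σ , t , fromSphere-sphereTy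
  (λ d τ → coh (Disc d) (DiscType d) (t ∷ τ)) d σ

id-⟦⟧⁻ : ∀ {Δ : Ctx l} {A} {τ : Sub l m} {σ : Sub l n} →
         IsIdentity (coh Δ A τ) → IsIdentity (coh Δ A σ)
id-⟦⟧⁻ i = shape⇒id (id⇒shape i)

un-⟦⟧⁻ : ∀ {Δ : Ctx l} {A} {τ : Sub l m} {σ : Sub l n} →
         IsUnary (coh Δ A τ) → IsUnary (coh Δ A σ)
un-⟦⟧⁻ i = shape⇒un (un⇒shape i)

-- Stability of rules, typing and equality under substitution

sua-⟦⟧ : ∀ {Γ : Ctx m} {Θ : Ctx n} {s t} (σ : Sub m n) → sua′ Γ s t → sua′ Θ (s ⟦ σ ⟧) (t ⟦ σ ⟧)
sua-⟦⟧ {Θ = Θ} σ (inj₁ (disc-removal A t)) =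
  subst (λ s → sua′ Θ s (t ⟦ σ ⟧)) (sym (unary-⟦⟧ A t σ)) (inj₁ (disc-removal _ _))
sua-⟦⟧ {Θ = Θ} σ (inj₂ (inj₁ (endo-coherence-removal Δ s A τ ¬i))) =
  subst (sua′ Θ _) (sym (trans (identity-⟦⟧ (A ⟦ τ ⟧ᵀ) (s ⟦ τ ⟧) σ)
      (cong₂ identity (⟦⟧ᵀ-• A τ σ) (⟦⟧-• s τ σ))))
    (inj₂ (inj₁ (endo-coherence-removal Δ s A (τ • σ) (λ i → ¬i (id-⟦⟧⁻ i)))))
sua-⟦⟧ {Θ = Θ} σ (inj₂ (inj₂ (insertion {S} {P} {T} {L} {M} r A ¬i ¬u c))) =
  subst₂ (λ τ ρ → sua′ Θ (coh ⌊ S ⌋ A τ) (coh ⌊ insert S P T b ⌋ (A ⟦ toSub (κ S P T b) ⟧ᵀ) ρ))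
    (sym (toSub-• L σ))
    (trans (toSub-cong (insert-rel S P T b (λ s t → s ≡ t ⟦ σ ⟧) (λ p → refl) (λ p → refl)))
       (sym (toSub-• (insertLabelling S P T b L M) σ)))
    (inj₂ (inj₂ (insertion r′ A (λ i → ¬i (id-⟦⟧⁻ i)) (λ i → ¬u (un-⟦⟧⁻ i)) (cond c))))
  where
  b = InsertionRedex.bh≤th r
  lab : L (overline P) ⟦ σ ⟧ ≡ 𝒞 (leafHeight P) T ⟦ toSub (λ p → M p ⟦ σ ⟧) ⟧
  lab = trans (cong (_⟦ σ ⟧) (InsertionRedex.label r))
    (trans (⟦⟧-• (𝒞 (leafHeight P) T) (toSub M) σ) (cong (𝒞 (leafHeight P) T ⟦_⟧) (toSub-• M σ)))
  r′ : InsertionRedex S P T (λ p → L p ⟦ σ ⟧) (λ p → M p ⟦ σ ⟧)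
  r′ = record { bh≤th = b ; h≤lh = InsertionRedex.h≤lh r ; label = lab }
  cond : IsIdentity (L (overline P)) ⊎ (leafHeight P ≡ height T × ¬ IsUnary (L (overline P))) →
    IsIdentity (L (overline P) ⟦ σ ⟧)
      ⊎ (leafHeight P ≡ height T × ¬ IsUnary (L (overline P) ⟦ σ ⟧))
  cond (inj₁ i) = inj₁ (subst IsIdentity (sym lab)
    (id-⟦⟧⁻ (subst IsIdentity (InsertionRedex.label r) i)))
  cond (inj₂ (e , ¬v)) = inj₂ (e , λ v → ¬v (subst IsUnary (sym (InsertionRedex.label r))
    (un-⟦⟧⁻ (subst IsUnary lab v))))

⊢lookup : ∀ {Γ : Ctx n} {Δ : Ctx m} {σ} → Γ ⊢ˢ σ ∶ Δ → ∀ x → Γ ⊢ lookup σ x ∶ (Δ ‼ x) ⟦ σ ⟧ᵀ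
⊢lookup {Γ = Γ} {Δ ▹ A} {t ∷ σ} (d ∷ ds) zero =
  subst (Γ ⊢ t ∶_) (sym (wkTy-∷ A σ)) d
⊢lookup {Γ = Γ} {Δ ▹ A} {t ∷ σ} (d ∷ ds) (suc x) =
  subst (Γ ⊢ lookup σ x ∶_) (sym (wkTy-∷ (Δ ‼ x) σ)) (⊢lookup ds x)

⊢sub : ∀ {Γ : Ctx n} (Δ : Ctx m) {σ} → (∀ x → Γ ⊢ lookup σ x ∶ (Δ ‼ x) ⟦ σ ⟧ᵀ) → Γ ⊢ˢ σ ∶ Δ
⊢sub ∅ {[]} e = []
⊢sub {Γ = Γ} (Δ ▹ A) {t ∷ σ} e =
  subst (Γ ⊢ t ∶_) (wkTy-∷ A σ) (e zero)
    ∷ ⊢sub Δ (λ x → subst (Γ ⊢ lookup σ x ∶_) (wkTy-∷ (Δ ‼ x) σ) (e (suc x)))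

-- The claims are mutual because conversion puts equalities into typing derivations, while `rule`
-- puts typing derivations into equalities.
⊢ᵀ-⟦⟧ : ∀ {Γ : Ctx n} {Δ : Ctx m} {σ A} → Γ ⊢ˢ σ ∶ Δ → Δ ⊢ᵀ A → Γ ⊢ᵀ A ⟦ σ ⟧ᵀ
⊢-⟦⟧  : ∀ {Γ : Ctx n} {Δ : Ctx m} {σ t A} → Γ ⊢ˢ σ ∶ Δ → Δ ⊢ t ∶ A → Γ ⊢ t ⟦ σ ⟧ ∶ A ⟦ σ ⟧ᵀ
⊢ˢ-•  : ∀ {Γ : Ctx n} {Δ : Ctx m} {Θ : Ctx l} {σ τ} → Γ ⊢ˢ σ ∶ Δ → Δ ⊢ˢ τ ∶ Θ → Γ ⊢ˢ τ • σ ∶ Θ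
≈-⟦⟧  : ∀ {Γ : Ctx n} {Δ : Ctx m} {σ s t} → Γ ⊢ˢ σ ∶ Δ → Δ ⊢ s ≈ t → Γ ⊢ s ⟦ σ ⟧ ≈ t ⟦ σ ⟧
≈ᵀ-⟦⟧ : ∀ {Γ : Ctx n} {Δ : Ctx m} {σ A B} → Γ ⊢ˢ σ ∶ Δ → Δ ⊢ᵀ A ≈ B → Γ ⊢ᵀ A ⟦ σ ⟧ᵀ ≈ B ⟦ σ ⟧ᵀ
≈ˢ-⟦⟧ : ∀ {Γ : Ctx n} {Δ : Ctx m} {σ} {τ ρ : Sub l m} → Γ ⊢ˢ σ ∶ Δ → Δ ⊢ˢ τ ≈ ρ →
        Γ ⊢ˢ τ • σ ≈ ρ • σ
≈-refl  : ∀ {Γ : Ctx n} t → Γ ⊢ t ≈ t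
≈ˢ-refl : ∀ {Γ : Ctx n} (σ : Sub m n) → Γ ⊢ˢ σ ≈ σ
≈ᵀ-refl : ∀ {Γ : Ctx n} A → Γ ⊢ᵀ A ≈ A

≈-refl (var x)     = var-refl x
≈-refl (coh Δ A σ) = coh (≈ᵀ-refl A) (≈ˢ-refl σ)
≈ˢ-refl []      = []
≈ˢ-refl (t ∷ σ) = ≈-refl t ∷ ≈ˢ-refl σ
≈ᵀ-refl ⋆            = ⋆
≈ᵀ-refl (s ⇒[ A ] t) = arr (≈-refl s) (≈ᵀ-refl A) (≈-refl t)

⊢ᵀ-⟦⟧ d ⋆             = ⋆
⊢ᵀ-⟦⟧ d (arr A s t)   = arr (⊢ᵀ-⟦⟧ d A) (⊢-⟦⟧ d s) (⊢-⟦⟧ d t)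
⊢-⟦⟧ d (var x)        = ⊢lookup d x
⊢-⟦⟧ d (conv t e)     = conv (⊢-⟦⟧ d t) (≈ᵀ-⟦⟧ d e)
⊢-⟦⟧ {Γ = Γ} {σ = σ} d (coh {Δ = Θ} {s} {A} {t} {τ} p a ts r) =
  subst (Γ ⊢ coh Θ (s ⇒[ A ] t) (τ • σ) ∶_) (sym (⟦⟧ᵀ-• (s ⇒[ A ] t) τ σ))
    (coh {Δ = Θ} p a (⊢ˢ-• d ts) r)
⊢ˢ-• d []             = []
⊢ˢ-• {Γ = Γ} {σ = σ} d (_∷_ {A = A} {τ} {t} h ts) =
  subst (Γ ⊢ t ⟦ σ ⟧ ∶_) (⟦⟧ᵀ-• A τ σ) (⊢-⟦⟧ d h) ∷ ⊢ˢ-• d ts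
≈-⟦⟧ d (var-refl x)   = ≈-refl _
≈-⟦⟧ d (≈-sym e)      = ≈-sym (≈-⟦⟧ d e)
≈-⟦⟧ d (≈-trans e f)  = ≈-trans (≈-⟦⟧ d e) (≈-⟦⟧ d f)
≈-⟦⟧ d (coh A e)      = coh A (≈ˢ-⟦⟧ d e)
≈-⟦⟧ {σ = σ} d (rule r t) = rule (sua-⟦⟧ σ r) (⊢-⟦⟧ d t)
≈ᵀ-⟦⟧ d ⋆             = ⋆
≈ᵀ-⟦⟧ d (arr s A t)   = arr (≈-⟦⟧ d s) (≈ᵀ-⟦⟧ d A) (≈-⟦⟧ d t)
≈ˢ-⟦⟧ d []            = []
≈ˢ-⟦⟧ d (h ∷ e)       = ≈-⟦⟧ d h ∷ ≈ˢ-⟦⟧ d e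

≈ˢ-lookup : ∀ {Γ : Ctx n} {σ τ : Sub m n} → Γ ⊢ˢ σ ≈ τ → ∀ x → Γ ⊢ lookup σ x ≈ lookup τ x
≈ˢ-lookup (h ∷ e) zero    = h
≈ˢ-lookup (h ∷ e) (suc x) = ≈ˢ-lookup e x

≈ˢ-ext : ∀ {Γ : Ctx n} {σ τ : Sub m n} → (∀ x → Γ ⊢ lookup σ x ≈ lookup τ x) → Γ ⊢ˢ σ ≈ τ
≈ˢ-ext {σ = []}    {[]}    e = []
≈ˢ-ext {σ = s ∷ σ} {t ∷ τ} e = e zero ∷ ≈ˢ-ext (λ x → e (suc x))

≈ˢ-toSub : ∀ {Γ : Ctx n} {T} {L M : Labelling T n} → (∀ p → Γ ⊢ L p ≈ M p) →
           Γ ⊢ˢ toSub L ≈ toSub M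
≈ˢ-toSub {Γ = Γ} {T} {L} {M} e = ≈ˢ-ext λ x →
  subst₂ (Γ ⊢_≈_) (sym (lookup-toSub-var L x)) (sym (lookup-toSub-var M x)) (e (varPath T x))

⟦⟧-≈ : ∀ {Γ : Ctx n} (t : Tm m) {σ τ : Sub m n} → Γ ⊢ˢ σ ≈ τ → Γ ⊢ t ⟦ σ ⟧ ≈ t ⟦ τ ⟧
•-≈  : ∀ {Γ : Ctx n} (ρ : Sub l m) {σ τ : Sub m n} → Γ ⊢ˢ σ ≈ τ → Γ ⊢ˢ ρ • σ ≈ ρ • τ
⟦⟧-≈ (var x)     e = ≈ˢ-lookup e x
⟦⟧-≈ (coh Δ A ρ) e = coh (≈ᵀ-refl A) (•-≈ ρ e)
•-≈ []      e = []
•-≈ (t ∷ ρ) e = ⟦⟧-≈ t e ∷ •-≈ ρ e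

⟦⟧ᵀ-≈ : ∀ {Γ : Ctx n} (A : Ty m) {σ τ : Sub m n} → Γ ⊢ˢ σ ≈ τ → Γ ⊢ᵀ A ⟦ σ ⟧ᵀ ≈ A ⟦ τ ⟧ᵀ
⟦⟧ᵀ-≈ ⋆            e = ⋆
⟦⟧ᵀ-≈ (s ⇒[ A ] t) e = arr (⟦⟧-≈ s e) (⟦⟧ᵀ-≈ A e) (⟦⟧-≈ t e)

≈ᵀ-sym : ∀ {Γ : Ctx n} {A B} → Γ ⊢ᵀ A ≈ B → Γ ⊢ᵀ B ≈ A
≈ᵀ-sym ⋆           = ⋆
≈ᵀ-sym (arr s A t) = arr (≈-sym s) (≈ᵀ-sym A) (≈-sym t)

≈ᵀ-trans : ∀ {Γ : Ctx n} {A B C} → Γ ⊢ᵀ A ≈ B → Γ ⊢ᵀ B ≈ C → Γ ⊢ᵀ A ≈ C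
≈ᵀ-trans ⋆           ⋆              = ⋆
≈ᵀ-trans (arr s A t) (arr s′ A′ t′) = arr (≈-trans s s′) (≈ᵀ-trans A A′) (≈-trans t t′)

≈ˢ-sym : ∀ {Γ : Ctx n} {σ τ : Sub m n} → Γ ⊢ˢ σ ≈ τ → Γ ⊢ˢ τ ≈ σ
≈ˢ-sym []      = []
≈ˢ-sym (h ∷ e) = ≈-sym h ∷ ≈ˢ-sym e

≈-reflexive : ∀ {Γ : Ctx n} {s t} → s ≡ t → Γ ⊢ s ≈ t
≈-reflexive refl = ≈-refl _

dim-≈ : ∀ {Γ : Ctx n} {A B} → Γ ⊢ᵀ A ≈ B → dim A ≡ dim B
dim-≈ ⋆           = refl
dim-≈ (arr _ e _) = cong suc (dim-≈ e)

-- Inversion of typing, and well-typed labellings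

data CohInv (Γ : Ctx n) (Δ : Ctx m) : Ty m → Sub m n → Ty n → Set where
  cohInv : ∀ {s A t σ B} → Δ ⊢ps → Δ ⊢ᵀ s ⇒[ A ] t → Γ ⊢ˢ σ ∶ Δ →
           Regular Δ (Supp Δ s) (Supp Δ t) → Γ ⊢ᵀ (s ⇒[ A ] t) ⟦ σ ⟧ᵀ ≈ B →
           CohInv Γ Δ (s ⇒[ A ] t) σ B

coh-inv : ∀ {Γ : Ctx n} {Δ : Ctx m} {A σ B} → Γ ⊢ coh Δ A σ ∶ B → CohInv Γ Δ A σ B
coh-inv (conv d e) with coh-inv d
... | cohInv p a ts r f = cohInv p a ts r (≈ᵀ-trans f e)
coh-inv (coh p a ts r) = cohInv p a ts r (≈ᵀ-refl _)

var-inv : ∀ {Γ : Ctx n} {x B} → Γ ⊢ var x ∶ B → Γ ⊢ᵀ Γ ‼ x ≈ B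
var-inv (var x)    = ≈ᵀ-refl _
var-inv (conv d e) = ≈ᵀ-trans (var-inv d) e

type-unique : ∀ {Γ : Ctx n} {t A B} → Γ ⊢ t ∶ A → Γ ⊢ t ∶ B → Γ ⊢ᵀ A ≈ B
type-unique {t = var x} d e = ≈ᵀ-trans (≈ᵀ-sym (var-inv d)) (var-inv e)
type-unique {t = coh Δ A σ} d e with coh-inv d | coh-inv e
... | cohInv _ _ _ _ f | cohInv _ _ _ _ g = ≈ᵀ-trans (≈ᵀ-sym f) g

WL : ∀ {T} → Ctx n → Ty n → Labelling T n → Set
WL Γ A L = ∀ p → Γ ⊢ L p ∶ tyP A L p

WL⇒⊢ˢ : ∀ {Γ : Ctx n} {T} {L : Labelling T n} → WL Γ ⋆ L → Γ ⊢ˢ toSub L ∶ ⌊ T ⌋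
WL⇒⊢ˢ {Γ = Γ} {T} {L} w = ⊢sub ⌊ T ⌋ λ x →
  subst (λ y → Γ ⊢ lookup (toSub L) y ∶ (⌊ T ⌋ ‼ y) ⟦ toSub L ⟧ᵀ) (pathVar-varPath T x)
    (subst₂ (Γ ⊢_∶_) (sym (lookup-toSub L (varPath T x))) (sym (⌊⌋-‼-toSub L (varPath T x)))
      (w (varPath T x)))

⊢ˢ⇒WL : ∀ {Γ : Ctx n} {T} {L : Labelling T n} → Γ ⊢ˢ toSub L ∶ ⌊ T ⌋ → WL Γ ⋆ L
⊢ˢ⇒WL {Γ = Γ} {T} {L} d p =
  subst₂ (Γ ⊢_∶_) (lookup-toSub L p) (⌊⌋-‼-toSub L p) (⊢lookup d (pathVar T p))

WL-path : ∀ T → WL ⌊ T ⌋ ⋆ (path T)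
WL-path T p = subst (⌊ T ⌋ ⊢ path T p ∶_) (⌊⌋-‼ T p) (var (pathVar T p))

⊢id : ∀ {Γ : Ctx n} → Γ ⊢ˢ idSub ∶ Γ
⊢id {Γ = Γ} = ⊢sub Γ λ x → subst₂ (Γ ⊢_∶_) (sym (lookup-id x)) (sym (⟦id⟧ᵀ (Γ ‼ x))) (var x)

-- Boundaries of ps-contexts

x∈p─q⇒x∉q : ∀ (p q : Subset n) {x} → x ∈ p ─ q → x ∉ q
x∈p─q⇒x∉q (_ ∷ p)      (_ ∷ q)       (there x∈) (there x∈q) = x∈p─q⇒x∉q p q x∈ x∈q
x∈p─q⇒x∉q (true ∷ p)   (true ∷ q)    () here
x∈p─q⇒x∉q (false ∷ p)  (true ∷ q)    () here

EndIs : Sign → Ty n → Fin n → Set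
EndIs ε      ⋆            z = Empty
EndIs Sign.- (s ⇒[ A ] t) z = s ≡ var z
EndIs Sign.+ (s ⇒[ A ] t) z = t ≡ var z

opp : Sign → Sign
opp Sign.- = Sign.+
opp Sign.+ = Sign.-

End : Sign → Ctx n → Fin n → Set
End ε Γ z = ∃[ y ] EndIs ε (Γ ‼ y) z

-- An intrinsic description of the boundary ∂_i^ε of a ps-context: the
-- variables of dimension below i, and those of dimension i that are not an
-- opposite end of another variable.
Bdry : Sign → ℕ → Ctx n → Fin n → Set
Bdry ε i Γ y = (dim (Γ ‼ y) < i) ⊎ (dim (Γ ‼ y) ≡ i × ¬ End (opp ε) Γ y)

EndIs-wk⁺ : ∀ ε (A : Ty n) z → EndIs ε A z → EndIs ε (wkTy A) (suc z)
EndIs-wk⁺ Sign.- (s ⇒[ A ] t) z e = cong wkTm e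
EndIs-wk⁺ Sign.+ (s ⇒[ A ] t) z e = cong wkTm e

wkTm≡var : ∀ (t : Tm n) {z} → wkTm t ≡ var z → ∃[ y ] z ≡ suc y × t ≡ var y
wkTm≡var (var x) refl = x , refl , refl

EndIs-wk⁻ : ∀ ε (A : Ty n) {z} → EndIs ε (wkTy A) z → ∃[ y ] z ≡ suc y × EndIs ε A y
EndIs-wk⁻ Sign.- (s ⇒[ A ] t) e = wkTm≡var s e
EndIs-wk⁻ Sign.+ (s ⇒[ A ] t) e = wkTm≡var t e

EndIs-≡ : ∀ ε {A B : Ty n} {z} → A ≡ B → EndIs ε A z → EndIs ε B z
EndIs-≡ ε refl e = e

data VarTy (Γ : Ctx n) : Ty n → Set where
  ⋆   : VarTy Γ ⋆
  arr : ∀ {A} x y → Γ ‼ x ≡ A → Γ ‼ y ≡ A → VarTy Γ A → VarTy Γ (var x ⇒[ A ] var y)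

VarTy-wk : ∀ {Γ : Ctx n} {A B} → VarTy Γ A → VarTy (Γ ▹ B) (wkTy A)
VarTy-wk ⋆                = ⋆
VarTy-wk (arr x y e f a) = arr (suc x) (suc y) (cong wkTy e) (cong wkTy f) (VarTy-wk a)

ps-focus : ∀ {Γ : Ctx n} {x A} → Γ ⊢ps x ∶ A → VarTy Γ A × (∃[ v ] x ≡ var v × Γ ‼ v ≡ A)
ps-focus pss = ⋆ , zero , refl , refl
ps-focus (pse d) with ps-focus d
... | a , v , refl , e =
  arr (suc (suc v)) (suc zero) (cong (wkTy ∘ wkTy) e) refl (VarTy-wk (VarTy-wk a)) , zero , refl , refl
ps-focus (psd d) with ps-focus d
... | arr x y e f a , _ = a , y , refl , f

ps-VarTy : ∀ {Γ : Ctx n} {x A} → Γ ⊢ps x ∶ A → ∀ y → VarTy Γ (Γ ‼ y)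
ps-VarTy pss     zero          = ⋆
ps-VarTy (pse d) zero          = proj₁ (ps-focus (pse d))
ps-VarTy (pse d) (suc zero)    = VarTy-wk (VarTy-wk (proj₁ (ps-focus d)))
ps-VarTy (pse d) (suc (suc y)) = VarTy-wk (VarTy-wk (ps-VarTy d y))
ps-VarTy (psd d) y             = ps-VarTy d y

dim-wk² : ∀ (A : Ty n) → dim (wkTy (wkTy A)) ≡ dim A
dim-wk² A = trans (dim-wk (wkTy A)) (dim-wk A)

-- The new point repeats the type of `v` and so brings no new ends; the new arrow has only its
-- source `v` among the old variables. Hence the single extra alternative.
End-wk⁻ : ∀ ε {Γ : Ctx n} {v A z} → Γ ‼ v ≡ A →
  End ε (Γ ▹ A ▹ (var (suc v) ⇒[ wkTy A ] var zero)) (suc (suc z)) → End ε Γ z ⊎ (ε ≡ Sign.- × z ≡ v)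
End-wk⁻ Sign.- e (zero , refl) = inj₂ (refl , refl)
End-wk⁻ ε {A = A} {z} e (suc zero , p) with EndIs-wk⁻ ε (wkTy A) p
... | _ , refl , q with EndIs-wk⁻ ε A q
...   | _ , refl , r = inj₁ (_ , EndIs-≡ ε (sym e) r)
End-wk⁻ ε {Γ = Γ} e (suc (suc y) , p) with EndIs-wk⁻ ε (wkTy (Γ ‼ y)) p
... | _ , refl , q with EndIs-wk⁻ ε (Γ ‼ y) q
...   | _ , refl , r = inj₁ (y , r)

End-wk⁺ : ∀ ε {Γ : Ctx n} {A B z} → End ε Γ z → End ε (Γ ▹ A ▹ B) (suc (suc z))
End-wk⁺ ε {Γ = Γ} (y , p) = suc (suc y) , EndIs-wk⁺ ε (wkTy (Γ ‼ y)) _ (EndIs-wk⁺ ε (Γ ‼ y) _ p)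

¬End-src-1 : ∀ {Γ : Ctx n} {v A} → ¬ End Sign.- (Γ ▹ A ▹ (var (suc v) ⇒[ wkTy A ] var zero)) (suc zero)
¬End-src-1 (zero , ())
¬End-src-1 {A = A} (suc zero , p) with EndIs-wk⁻ Sign.- (wkTy A) p
... | zero , refl , q with EndIs-wk⁻ Sign.- A q
...   | _ , () , _
¬End-src-1 {Γ = Γ} (suc (suc y) , p) with EndIs-wk⁻ Sign.- (wkTy (Γ ‼ y)) p
... | zero , refl , q with EndIs-wk⁻ Sign.- (Γ ‼ y) q
...   | _ , () , _

¬End-0 : ∀ ε {Γ : Ctx n} {v A} → ¬ End ε (Γ ▹ A ▹ (var (suc v) ⇒[ wkTy A ] var zero)) zero
¬End-0 Sign.- (zero , ())
¬End-0 Sign.+ (zero , ())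
¬End-0 ε {A = A} (suc zero , p) with EndIs-wk⁻ ε (wkTy A) p
... | _ , () , _
¬End-0 ε {Γ = Γ} (suc (suc y) , p) with EndIs-wk⁻ ε (wkTy (Γ ‼ y)) p
... | _ , () , _

-- At each extension the two descriptions change alike. The new arrow makes its target a plus end,
-- which keeps it out of the source boundary of that dimension, and makes `x` a minus end, which is
-- what the removal of `FV x` from the target boundary expresses.
∂⇒Bdry : ∀ i ε {Γ : Ctx n} {x A} (d : Γ ⊢ps x ∶ A) {y} → y ∈ ∂ps i ε d → Bdry ε i Γ y
∂⇒Bdry i ε pss here with i
... | zero  = inj₂ (refl , ¬e ε)
  where
  ¬e : ∀ ε → ¬ End (opp ε) (∅ ▹ ⋆) zero
  ¬e ε      (zero , ())
... | suc _ = inj₁ (s≤s z≤n)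
∂⇒Bdry i ε (psd d) y∈ = ∂⇒Bdry i ε d y∈
∂⇒Bdry i ε {Γ = Γ ▹ A ▹ _} (pse d) {y} y∈ with ps-focus d
... | a , v , refl , e with <-cmp i (dim A) | ε
∂⇒Bdry i ε {Γ = Γ ▹ A ▹ _} (pse d) {suc (suc y)} (there (there y∈)) | a , v , refl , e | tri< i<A _ _ | ε′
  with ∂⇒Bdry i ε′ d y∈
... | inj₁ lt = inj₁ (subst (_< i) (sym (dim-wk² (Γ ‼ y))) lt)
... | inj₂ (eq , ¬e) = inj₂ (trans (dim-wk² (Γ ‼ y)) eq , λ f → case End-wk⁻ (opp ε′) e f of λ where
    (inj₁ g) → ¬e g
    (inj₂ (_ , refl)) → <-irrefl (trans (sym eq) (cong dim e)) i<A)
∂⇒Bdry i ε {Γ = Γ ▹ A ▹ _} (pse d) {suc (suc y)} (there (there y∈)) | a , v , refl , e | tri≈ _ i≡A _ | Sign.-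
  with ∂⇒Bdry i Sign.- d y∈
... | inj₁ lt = inj₁ (subst (_< i) (sym (dim-wk² (Γ ‼ y))) lt)
... | inj₂ (eq , ¬e) = inj₂ (trans (dim-wk² (Γ ‼ y)) eq , λ f → case End-wk⁻ Sign.+ e f of λ where
    (inj₁ g) → ¬e g
    (inj₂ (() , _)))
∂⇒Bdry i ε {Γ = Γ ▹ A ▹ _} (pse d) {suc zero} (there here) | a , v , refl , e | tri≈ _ i≡A _ | Sign.+ =
  inj₂ (trans (dim-wk² A) (sym i≡A) , ¬End-src-1)
∂⇒Bdry i ε {Γ = Γ ▹ A ▹ _} (pse d) {suc (suc y)} (there (there y∈)) | a , v , refl , e | tri≈ _ i≡A _ | Sign.+
  with ∂⇒Bdry i Sign.+ d (p─q⊆p (∂ps i Sign.+ d) ⁅ v ⁆ y∈)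
... | inj₁ lt = inj₁ (subst (_< i) (sym (dim-wk² (Γ ‼ y))) lt)
... | inj₂ (eq , ¬e) = inj₂ (trans (dim-wk² (Γ ‼ y)) eq , λ f → case End-wk⁻ Sign.- e f of λ where
    (inj₁ g) → ¬e g
    (inj₂ (_ , refl)) → x∈p─q⇒x∉q (∂ps i Sign.+ d) ⁅ v ⁆ y∈ (x∈⁅x⁆ v))
∂⇒Bdry i ε {Γ = Γ ▹ A ▹ _} (pse d) {zero} here | a , v , refl , e | tri> _ _ A<i | ε′ with m≤n⇒m<n∨m≡n A<i
... | inj₁ lt = inj₁ (subst (λ k → suc k < i) (sym (dim-wk² A)) lt)
... | inj₂ eq = inj₂ (trans (cong suc (dim-wk² A)) eq , ¬End-0 (opp ε′))
∂⇒Bdry i ε {Γ = Γ ▹ A ▹ _} (pse d) {suc zero} (there here) | a , v , refl , e | tri> _ _ A<i | ε′ =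
  inj₁ (subst (_< i) (sym (dim-wk² A)) A<i)
∂⇒Bdry i ε {Γ = Γ ▹ A ▹ _} (pse d) {suc (suc y)} (there (there y∈)) | a , v , refl , e | tri> _ _ A<i | ε′
  with ∂⇒Bdry i ε′ d y∈
... | inj₁ lt = inj₁ (subst (_< i) (sym (dim-wk² (Γ ‼ y))) lt)
... | inj₂ (eq , ¬e) = inj₂ (trans (dim-wk² (Γ ‼ y)) eq , λ f → case End-wk⁻ (opp ε′) e f of λ where
    (inj₁ g) → ¬e g
    (inj₂ (_ , refl)) → <-irrefl (trans (cong dim (sym e)) eq) A<i)

Bdry-wk⁻ : ∀ {ε i} {Γ : Ctx n} {A B y} → Bdry ε i (Γ ▹ A ▹ B) (suc (suc y)) → Bdry ε i Γ y
Bdry-wk⁻ {i = i} {Γ} {y = y} (inj₁ lt) = inj₁ (subst (_< i) (dim-wk² (Γ ‼ y)) lt)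
Bdry-wk⁻ {ε = ε} {Γ = Γ} {y = y} (inj₂ (eq , ¬e)) =
  inj₂ (trans (sym (dim-wk² (Γ ‼ y))) eq , λ f → ¬e (End-wk⁺ (opp ε) f))

Bdry-dim : ∀ {ε i} {Γ : Ctx n} {y} → Bdry ε i Γ y → dim (Γ ‼ y) ≤ i
Bdry-dim (inj₁ lt)      = <⇒≤ lt
Bdry-dim (inj₂ (eq , _)) = ≤-reflexive eq

Bdry⇒∂ : ∀ i ε {Γ : Ctx n} {x A} (d : Γ ⊢ps x ∶ A) {y} → Bdry ε i Γ y → y ∈ ∂ps i ε d
Bdry⇒∂ i ε pss {zero} b = here
Bdry⇒∂ i ε (psd d) b = Bdry⇒∂ i ε d b
Bdry⇒∂ i ε {Γ = Γ ▹ A ▹ _} (pse d) {y} b with ps-focus d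
... | a , v , refl , e with <-cmp i (dim A) | ε
Bdry⇒∂ i ε {Γ = Γ ▹ A ▹ _} (pse d) {zero} b | a , v , refl , e | tri< i<A _ _ | ε′ =
  ⊥-elim (<-irrefl refl (<-trans i<A (≤-trans (≤-reflexive (cong suc (sym (dim-wk² A))))
    (Bdry-dim {Γ = Γ ▹ A ▹ _} {zero} b))))
Bdry⇒∂ i ε {Γ = Γ ▹ A ▹ _} (pse d) {suc zero} b | a , v , refl , e | tri< i<A _ _ | ε′ =
  ⊥-elim (<-irrefl refl (≤-trans (s≤s (≤-trans (≤-reflexive (sym (dim-wk² A)))
    (Bdry-dim {Γ = Γ ▹ A ▹ _} {suc zero} b))) i<A))
Bdry⇒∂ i ε {Γ = Γ ▹ A ▹ _} (pse d) {suc (suc y)} b | a , v , refl , e | tri< i<A _ _ | ε′ =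
  there (there (Bdry⇒∂ i ε′ d (Bdry-wk⁻ b)))
Bdry⇒∂ i ε {Γ = Γ ▹ A ▹ _} (pse d) {zero} b | a , v , refl , e | tri≈ _ i≡A _ | ε′ =
  ⊥-elim (<-irrefl (sym i≡A) (≤-trans (≤-reflexive (cong suc (sym (dim-wk² A))))
    (Bdry-dim {Γ = Γ ▹ A ▹ _} {zero} b)))
Bdry⇒∂ i ε {Γ = Γ ▹ A ▹ _} (pse d) {suc zero} (inj₁ lt) | a , v , refl , e | tri≈ _ i≡A _ | Sign.- =
  ⊥-elim (<-irrefl (sym i≡A) (subst (_< i) (dim-wk² A) lt))
Bdry⇒∂ i ε {Γ = Γ ▹ A ▹ _} (pse d) {suc zero} (inj₂ (_ , ¬e)) | a , v , refl , e | tri≈ _ i≡A _ | Sign.- =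
  ⊥-elim (¬e (zero , refl))
Bdry⇒∂ i ε {Γ = Γ ▹ A ▹ _} (pse d) {suc (suc y)} b | a , v , refl , e | tri≈ _ i≡A _ | Sign.- =
  there (there (Bdry⇒∂ i Sign.- d (Bdry-wk⁻ b)))
Bdry⇒∂ i ε {Γ = Γ ▹ A ▹ _} (pse d) {suc zero} b | a , v , refl , e | tri≈ _ i≡A _ | Sign.+ = there here
Bdry⇒∂ i ε {Γ = Γ ▹ A ▹ _} (pse d) {suc (suc y)} b | a , v , refl , e | tri≈ _ i≡A _ | Sign.+ =
  there (there (x∈p∧x∉q⇒x∈p─q (Bdry⇒∂ i Sign.+ d (Bdry-wk⁻ b)) λ y∈ → nope (x∈⁅y⁆⇒x≡y v y∈) b))
  where
  nope : y ≡ v → ¬ Bdry Sign.+ i (Γ ▹ A ▹ (var (suc v) ⇒[ wkTy A ] var zero)) (suc (suc y))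
  nope refl (inj₁ lt) = <-irrefl (trans (cong dim e) (sym i≡A)) (subst (_< i) (dim-wk² (Γ ‼ y)) lt)
  nope refl (inj₂ (_ , ¬e)) = ¬e (zero , refl)
Bdry⇒∂ i ε {Γ = Γ ▹ A ▹ _} (pse d) {zero} b | a , v , refl , e | tri> _ _ A<i | ε′ = here
Bdry⇒∂ i ε {Γ = Γ ▹ A ▹ _} (pse d) {suc zero} b | a , v , refl , e | tri> _ _ A<i | ε′ = there here
Bdry⇒∂ i ε {Γ = Γ ▹ A ▹ _} (pse d) {suc (suc y)} b | a , v , refl , e | tri> _ _ A<i | ε′ =
  there (there (Bdry⇒∂ i ε′ d (Bdry-wk⁻ b)))

dim-‼ : ∀ (Γ : Ctx n) x → dim (Γ ‼ x) ≤ dimCtx Γ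
dim-‼ (Γ ▹ A) zero    = ≤-trans (≤-reflexive (dim-wk A)) (m≤n⊔m (dimCtx Γ) (dim A))
dim-‼ (Γ ▹ A) (suc x) = ≤-trans (≤-reflexive (dim-wk (Γ ‼ x)))
  (≤-trans (dim-‼ Γ x) (m≤m⊔n (dimCtx Γ) (dim A)))

-- The witness for the lower bound in `coh-dim`: a term whose support is this boundary uses the
-- variable found here, and so has at least its dimension.
∂-wide : ∀ i {Γ : Ctx n} {x A} (d : Γ ⊢ps x ∶ A) →
         ∃[ y ] y ∈ ∂ps i Sign.- d × (i ≤ dim (Γ ‼ y) ⊎ dimCtx Γ ≤ dim (Γ ‼ y))
∂-wide i pss = zero , here , inj₂ z≤n
∂-wide i (psd d) = ∂-wide i d
∂-wide i {Γ = Γ ▹ A ▹ _} (pse {x = x} d) with ps-focus d | ∂-wide i d | <-cmp i (dim A)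
... | _ , v , _ , e | y , y∈ , inj₁ le | tri< i<A _ _ =
  suc (suc y) , there (there y∈) , inj₁ (≤-trans le (≤-reflexive (sym (dim-wk² (Γ ‼ y)))))
... | _ , v , _ , e | y , y∈ , inj₂ le | tri< i<A _ _ =
  suc (suc y) , there (there y∈) , inj₁ (≤-trans (<⇒≤ i<A) (≤-trans (≤-reflexive (cong dim (sym e)))
    (≤-trans (dim-‼ Γ v) (≤-trans le (≤-reflexive (sym (dim-wk² (Γ ‼ y))))))))
... | _ , v , _ , e | y , y∈ , inj₁ le | tri≈ _ i≡A _ =
  suc (suc y) , there (there y∈) , inj₁ (≤-trans le (≤-reflexive (sym (dim-wk² (Γ ‼ y)))))
... | _ , v , _ , e | y , y∈ , inj₂ le | tri≈ _ i≡A _ =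
  suc (suc y) , there (there y∈) , inj₁ (≤-trans (≤-reflexive (trans i≡A (cong dim (sym e))))
    (≤-trans (dim-‼ Γ v) (≤-trans le (≤-reflexive (sym (dim-wk² (Γ ‼ y)))))))
... | _ , v , _ , e | y , y∈ , inj₁ le | tri> _ _ A<i =
  suc (suc y) , there (there y∈) , inj₁ (≤-trans le (≤-reflexive (sym (dim-wk² (Γ ‼ y)))))
... | _ , v , _ , e | y , y∈ , inj₂ le | tri> _ _ A<i with ≤-total (suc (dim (wkTy A))) (dim (Γ ‼ y))
...   | inj₁ le′ = suc (suc y) , there (there y∈) , inj₂ (≤-trans
          (⊔-lub (⊔-lub le (≤-trans (≤-trans (n≤1+n _) (≤-reflexive (cong suc (sym (dim-wk A))))) le′)) le′)
          (≤-reflexive (sym (dim-wk² (Γ ‼ y)))))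
...   | inj₂ le′ = zero , here , inj₂ (≤-trans
          (⊔-lub (⊔-lub (≤-trans le le′) (≤-trans (≤-reflexive (sym (dim-wk A))) (n≤1+n _))) ≤-refl)
          (≤-reflexive (cong suc (sym (dim-wk (wkTy A))))))

-- The two ends of an endo-coherence have one and the same support, so this rules out regularity at
-- any `i` below the dimension of the context. The boundary is then the whole context, and each end
-- uses every variable.
∂-distinct : ∀ i {Γ : Ctx n} {x A} (d : Γ ⊢ps x ∶ A) → i < dimCtx Γ →
             ∃[ y ] y ∈ ∂ps i Sign.+ d × y ∉ ∂ps i Sign.- d
∂-distinct i (psd d) lt = ∂-distinct i d lt
∂-distinct i {Γ = Γ ▹ A ▹ _} (pse d) lt with ps-focus d | <-cmp i (dim A)
... | _ , v , _ , e | tri< i<A _ _ =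
  let y , y∈ , y∉ = ∂-distinct i d (<-≤-trans i<A (≤-trans (≤-reflexive (cong dim (sym e))) (dim-‼ Γ v)))
  in suc (suc y) , there (there y∈) , λ p → y∉ (drop-there (drop-there p))
... | _ , v , _ , e | tri≈ _ i≡A _ = suc zero , there here , λ { (there ()) }
... | _ , v , _ , e | tri> _ _ A<i =
  let y , y∈ , y∉ = ∂-distinct i d lt′
  in suc (suc y) , there (there y∈) , λ p → y∉ (drop-there (drop-there p))
  where
  lt′ : i < dimCtx Γ
  lt′ with ≤-total (dimCtx Γ) i
  ... | inj₂ i≤Γ with m≤n⇒m<n∨m≡n i≤Γ
  ...   | inj₁ i<Γ = i<Γ
  ...   | inj₂ refl = ⊥-elim (<-irrefl refl (<-≤-trans lt (⊔-lub (⊔-lub ≤-refl (<⇒≤ A<i))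
            (≤-trans (≤-reflexive (cong suc (dim-wk A))) A<i))))
  lt′ | inj₁ Γ≤i = ⊥-elim (<-irrefl refl (<-≤-trans lt (⊔-lub (⊔-lub Γ≤i (<⇒≤ A<i))
            (≤-trans (≤-reflexive (cong suc (dim-wk A))) A<i))))

EndIs-dim : ∀ {Γ : Ctx n} {A} → VarTy Γ A → ∀ ε {z} → EndIs ε A z → suc (dim (Γ ‼ z)) ≡ dim A
EndIs-dim (arr x y e f a) Sign.- refl = cong (suc ∘ dim) e
EndIs-dim (arr x y e f a) Sign.+ refl = cong (suc ∘ dim) f

Bdry-full : ∀ ε {i} {Γ : Ctx n} → (∀ y → VarTy Γ (Γ ‼ y)) → dimCtx Γ ≤ i → ∀ y → Bdry ε i Γ y
Bdry-full ε {i} {Γ} v le y with m≤n⇒m<n∨m≡n (≤-trans (dim-‼ Γ y) le)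
... | inj₁ lt = inj₁ lt
... | inj₂ eq = inj₂ (eq , λ (z , e) → <-irrefl refl (≤-trans (≤-reflexive (cong suc (sym eq)))
    (≤-trans (≤-reflexive (EndIs-dim (v z) (opp ε) e)) (≤-trans (dim-‼ Γ z) le))))

-- Supports

FVSub-lookup⁺ : ∀ (σ : Sub m n) z {x} → x ∈ FV (lookup σ z) → x ∈ FVSub σ
FVSub-lookup⁺ (t ∷ σ) zero    x∈ = x∈p∪q⁺ (inj₂ x∈)
FVSub-lookup⁺ (t ∷ σ) (suc z) x∈ = x∈p∪q⁺ (inj₁ (FVSub-lookup⁺ σ z x∈))

FVSub-lookup⁻ : ∀ (σ : Sub m n) {x} → x ∈ FVSub σ → ∃[ z ] x ∈ FV (lookup σ z)
FVSub-lookup⁻ []      x∈ = ⊥-elim (∉⊥ x∈)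
FVSub-lookup⁻ (t ∷ σ) x∈ with x∈p∪q⁻ (FVSub σ) (FV t) x∈
... | inj₁ y∈ = let z , z∈ = FVSub-lookup⁻ σ y∈ in suc z , z∈
... | inj₂ y∈ = zero , y∈

FV-⟦⟧⁺ : ∀ (t : Tm m) (σ : Sub m n) {x y} → y ∈ FV t → x ∈ FV (lookup σ y) → x ∈ FV (t ⟦ σ ⟧)
FVSub-•⁺ : ∀ (τ : Sub l m) (σ : Sub m n) {x y} → y ∈ FVSub τ → x ∈ FV (lookup σ y) →
           x ∈ FVSub (τ • σ)
FV-⟦⟧⁺ (var z) σ {x} y∈ x∈ = subst (λ w → x ∈ FV (lookup σ w)) (x∈⁅y⁆⇒x≡y z y∈) x∈
FV-⟦⟧⁺ (coh Δ A τ) σ y∈ x∈ = FVSub-•⁺ τ σ y∈ x∈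
FVSub-•⁺ []      σ y∈ x∈ = ⊥-elim (∉⊥ y∈)
FVSub-•⁺ (t ∷ τ) σ y∈ x∈ with x∈p∪q⁻ (FVSub τ) (FV t) y∈
... | inj₁ z∈ = x∈p∪q⁺ (inj₁ (FVSub-•⁺ τ σ z∈ x∈))
... | inj₂ z∈ = x∈p∪q⁺ (inj₂ (FV-⟦⟧⁺ t σ z∈ x∈))

FV-⟦⟧⁻ : ∀ (t : Tm m) (σ : Sub m n) {x} → x ∈ FV (t ⟦ σ ⟧) → ∃[ y ] y ∈ FV t × x ∈ FV (lookup σ y)
FVSub-•⁻ : ∀ (τ : Sub l m) (σ : Sub m n) {x} → x ∈ FVSub (τ • σ) →
           ∃[ y ] y ∈ FVSub τ × x ∈ FV (lookup σ y)
FV-⟦⟧⁻ (var z)     σ x∈ = z , x∈⁅x⁆ z , x∈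
FV-⟦⟧⁻ (coh Δ A τ) σ x∈ = FVSub-•⁻ τ σ x∈
FVSub-•⁻ []      σ x∈ = ⊥-elim (∉⊥ x∈)
FVSub-•⁻ (t ∷ τ) σ x∈ with x∈p∪q⁻ (FVSub (τ • σ)) (FV (t ⟦ σ ⟧)) x∈
... | inj₁ z∈ = let y , y∈ , e = FVSub-•⁻ τ σ z∈ in y , x∈p∪q⁺ (inj₁ y∈) , e
... | inj₂ z∈ = let y , y∈ , e = FV-⟦⟧⁻ t σ z∈ in y , x∈p∪q⁺ (inj₂ y∈) , e

FVTy-src : ∀ (s : Tm n) A t {x} → x ∈ FV s → x ∈ FVTy (s ⇒[ A ] t)
FVTy-src s A t x∈ = x∈p∪q⁺ (inj₁ x∈)

FVTy-base : ∀ (s : Tm n) A t {x} → x ∈ FVTy A → x ∈ FVTy (s ⇒[ A ] t)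
FVTy-base s A t x∈ = x∈p∪q⁺ (inj₂ (x∈p∪q⁺ (inj₁ x∈)))

FVTy-tgt : ∀ (s : Tm n) A t {x} → x ∈ FV t → x ∈ FVTy (s ⇒[ A ] t)
FVTy-tgt s A t x∈ = x∈p∪q⁺ (inj₂ (x∈p∪q⁺ (inj₂ x∈)))

FVTy⁻ : ∀ (s : Tm n) A t {x} → x ∈ FVTy (s ⇒[ A ] t) → x ∈ FV s ⊎ x ∈ FVTy A ⊎ x ∈ FV t
FVTy⁻ s A t x∈ with x∈p∪q⁻ (FV s) (FVTy A ∪ FV t) x∈
... | inj₁ y∈ = inj₁ y∈
... | inj₂ y∈ = inj₂ (x∈p∪q⁻ (FVTy A) (FV t) y∈)

FVTy-⟦⟧⁺ : ∀ (A : Ty m) (σ : Sub m n) {x y} → y ∈ FVTy A → x ∈ FV (lookup σ y) → x ∈ FVTy (A ⟦ σ ⟧ᵀ)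
FVTy-⟦⟧⁺ ⋆ σ y∈ x∈ = ⊥-elim (∉⊥ y∈)
FVTy-⟦⟧⁺ (s ⇒[ A ] t) σ y∈ x∈ with FVTy⁻ s A t y∈
... | inj₁ z∈        = FVTy-src (s ⟦ σ ⟧) (A ⟦ σ ⟧ᵀ) (t ⟦ σ ⟧) (FV-⟦⟧⁺ s σ z∈ x∈)
... | inj₂ (inj₁ z∈) = FVTy-base (s ⟦ σ ⟧) (A ⟦ σ ⟧ᵀ) (t ⟦ σ ⟧) (FVTy-⟦⟧⁺ A σ z∈ x∈)
... | inj₂ (inj₂ z∈) = FVTy-tgt (s ⟦ σ ⟧) (A ⟦ σ ⟧ᵀ) (t ⟦ σ ⟧) (FV-⟦⟧⁺ t σ z∈ x∈)

FVTy-⟦⟧⁻ : ∀ (A : Ty m) (σ : Sub m n) {x} → x ∈ FVTy (A ⟦ σ ⟧ᵀ) → ∃[ y ] y ∈ FVTy A × x ∈ FV (lookup σ y)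
FVTy-⟦⟧⁻ ⋆ σ x∈ = ⊥-elim (∉⊥ x∈)
FVTy-⟦⟧⁻ (s ⇒[ A ] t) σ x∈ with FVTy⁻ (s ⟦ σ ⟧) (A ⟦ σ ⟧ᵀ) (t ⟦ σ ⟧) x∈
... | inj₁ z∈        = let y , y∈ , e = FV-⟦⟧⁻ s σ z∈ in y , FVTy-src s A t y∈ , e
... | inj₂ (inj₁ z∈) = let y , y∈ , e = FVTy-⟦⟧⁻ A σ z∈ in y , FVTy-base s A t y∈ , e
... | inj₂ (inj₂ z∈) = let y , y∈ , e = FV-⟦⟧⁻ t σ z∈ in y , FVTy-tgt s A t y∈ , e

Closure-bind : ∀ {Γ : Ctx n} {U V} → (∀ {x} → x ∈ U → Closure Γ V x) →
               ∀ {x} → Closure Γ U x → Closure Γ V x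
Closure-bind f (base x∈)   = f x∈
Closure-bind f (step c y∈) = step (Closure-bind f c) y∈

SuppTy : Ctx n → Ty n → Fin n → Set
SuppTy Γ A = Closure Γ (FVTy A)

TypedSupp : Ctx n → Ctx m → Sub m n → Set
TypedSupp Γ Δ σ = ∀ x {y} → y ∈ FVTy ((Δ ‼ x) ⟦ σ ⟧ᵀ) → Supp Γ (lookup σ x) y

RegTy : Ctx n → Ty n → Set
RegTy Δ ⋆            = Empty
RegTy Δ (s ⇒[ A ] t) = Regular Δ (Supp Δ s) (Supp Δ t)

-- The part of typedness of a coherence on which its support depends.
SuppReady : Ctx n → Tm n → Set
SuppReady Γ (var x)     = ⊤
SuppReady Γ (coh Δ A σ) = TypedSupp Γ Δ σ × RegTy Δ A

SameSupp : Ctx n → Tm n → Tm n → Set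
SameSupp Γ s t = (∀ {y} → Supp Γ s y → Supp Γ t y) × (∀ {y} → Supp Γ t y → Supp Γ s y)

Supp-⟦⟧ : ∀ {Γ : Ctx n} {Δ : Ctx m} {σ} t → TypedSupp Γ Δ σ →
          ∀ {x y} → Supp Δ t x → y ∈ FV (lookup σ x) → Supp Γ (t ⟦ σ ⟧) y
Supp-⟦⟧ {σ = σ} t d (base x∈) y∈ = base (FV-⟦⟧⁺ t σ x∈ y∈)
Supp-⟦⟧ {Γ = Γ} {Δ} {σ} t d (step {x} c z∈) y∈ =
  Closure-bind (Supp-⟦⟧ t d c) (d x (FVTy-⟦⟧⁺ (Δ ‼ x) σ z∈ y∈))

SphereType-⟦⟧ : ∀ (A : Ty n) → SphereType (dim A) ⟦ fromSphere A ⟧ᵀ ≡ A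
SphereType-⟦⟧ ⋆            = refl
SphereType-⟦⟧ (s ⇒[ A ] t) = arr-cong refl
  (trans (wkTy-∷ (wkTy (SphereType (dim A))) _) (trans (wkTy-∷ (SphereType (dim A)) _) (SphereType-⟦⟧ A))) refl

DiscType-⟦⟧ : ∀ (A : Ty n) t → DiscType (dim A) ⟦ fromDisc A t ⟧ᵀ ≡ A
DiscType-⟦⟧ A t = trans (wkTy-∷ (SphereType (dim A)) (fromSphere A)) (SphereType-⟦⟧ A)

FVSub-fromSphere⁻ : ∀ (A : Ty n) {x} → x ∈ FVSub (fromSphere A) → x ∈ FVTy A
FVSub-fromSphere⁻ ⋆            x∈ = x∈
FVSub-fromSphere⁻ (s ⇒[ A ] t) x∈ with x∈p∪q⁻ (FVSub (fromSphere A) ∪ FV s) (FV t) x∈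
... | inj₂ y∈ = FVTy-tgt s A t y∈
... | inj₁ y∈ with x∈p∪q⁻ (FVSub (fromSphere A)) (FV s) y∈
...   | inj₁ z∈ = FVTy-base s A t (FVSub-fromSphere⁻ A z∈)
...   | inj₂ z∈ = FVTy-src s A t z∈

regular-endo-dim : ∀ {Δ : Ctx n} {U} → ((Δ⊢ , i , _) : Regular Δ U U) → dimCtx Δ ≤ i
regular-endo-dim {Δ = Δ} (ps d , i , le , (f , g) , (f′ , g′)) with m≤n⇒m<n∨m≡n le
... | inj₁ (s≤s lt) = lt
... | inj₂ eq with ∂-distinct i d (≤-reflexive (sym eq))
...   | y , y∈ , y∉ = ⊥-elim (y∉ (f (g′ y∈)))

regular-endo-full : ∀ {Δ : Ctx n} {U} → Regular Δ U U → ∀ x → U x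
regular-endo-full {Δ = Δ} r@(ps d , i , le , (f , g) , _) x =
  g (Bdry⇒∂ i Sign.- d (Bdry-full Sign.- (ps-VarTy d) (regular-endo-dim r) x))

append-++⁺ˡ : ∀ {T} U (M : Labelling T n) (L : Labelling U n) q → append M L (++⁺ˡ U q) ≡ M q
append-++⁺ˡ {T = []}     U M L [0]      = refl
append-++⁺ˡ {T = T ∷ Ts} U M L [0]      = refl
append-++⁺ˡ {T = T ∷ Ts} U M L (0∷ q)   = refl
append-++⁺ˡ {T = T ∷ Ts} U M L (next q) = append-++⁺ˡ U (λ p → M (next p)) L q

data Positive : ∀ {T} → Path T → Set where
  0∷_  : ∀ {T Ts} (p : Path T) → Positive {T ∷ Ts} (0∷ p)
  next : ∀ {T Ts} (p : Path Ts) → Positive {T ∷ Ts} (next p)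

append-++⁺ʳ : ∀ T {U} (M : Labelling T n) (L : Labelling U n) {q} → Positive q →
              append M L (++⁺ʳ T q) ≡ L q
append-++⁺ʳ []       M L (0∷ p)   = refl
append-++⁺ʳ []       M L (next p) = refl
append-++⁺ʳ (T ∷ Ts) M L q        = append-++⁺ʳ Ts (λ p → M (next p)) L q

ins : ∀ S (P : Branch S) T (b : branchHeight P ≤ trunkHeight T) →
      Labelling S n → Labelling T n → Labelling (insert S P T b) n
ins = insertLabelling

ins-ι : ∀ S P T b (L : Labelling S n) M q → ins S P T b L M (ι S P T b q) ≡ M q
ins-ι (S ∷ Ss) ([0] _)  T        b       L M q          = append-++⁺ˡ Ss M (λ p → L (next p)) q
ins-ι (S ∷ Ss) (0∷ P)   (T ∷ []) (s≤s b) L M [0]        = refl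
ins-ι (S ∷ Ss) (0∷ P)   (T ∷ []) (s≤s b) L M (0∷ q)     = ins-ι S P T b _ _ q
ins-ι (S ∷ Ss) (0∷ P)   (T ∷ []) (s≤s b) L M (next [0]) = refl
ins-ι (S ∷ Ss) (next P) T        b       L M q          = ins-ι Ss P T b _ M q

FVTy-tyP : ∀ {T} A (L : Labelling T n) p {y} → y ∈ FVTy A → y ∈ FVTy (tyP A L p)
FVTy-tyP A L [0]      y∈ = y∈
FVTy-tyP A L (0∷ p)   y∈ = FVTy-tyP _ _ p (FVTy-base (L [0]) A (L (next [0])) y∈)
FVTy-tyP A L (next p) y∈ = FVTy-tyP A _ p y∈

FV-linear : ∀ T → Linear T → ∀ A (L : Labelling T n) q {y} → y ∈ FV (L q) →
            y ∈ FVTy (tyP A L (zeros T)) ⊎ y ∈ FV (L (zeros T))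
FV-linear []           lin A L [0]        y∈ = inj₂ y∈
FV-linear (T ∷ [])     lin A L [0]        y∈ = inj₁ (FVTy-tyP _ _ (zeros T) (FVTy-src (L [0]) A (L (next [0])) y∈))
FV-linear (T ∷ [])     lin A L (next [0]) y∈ = inj₁ (FVTy-tyP _ _ (zeros T) (FVTy-tgt (L [0]) A (L (next [0])) y∈))
FV-linear (T ∷ [])     lin A L (0∷ q)     y∈ = FV-linear T (suc-injective lin) _ _ q y∈
FV-linear (T ∷ U ∷ Us) lin A L q y∈ = ⊥-elim (case
  subst (suc (height T) ≤_) (sym lin) (m≤m⊔n (suc (height T)) (height (U ∷ Us))) of λ ())

-- Insertion forgets only labels along the branch. These are the leaf label itself or ends in its
-- type, so their variables remain in the support of the leaf.
ins-cover : ∀ S P T b A (L : Labelling S n) M q {y} → y ∈ FV (L q) →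
  (∃[ p ] y ∈ FV (ins S P T b L M p)) ⊎ (y ∈ FVTy (tyP A L (overline P)) ⊎ y ∈ FV (L (overline P)))
ins-cover (S ∷ Ss) ([0] lin) T b A L M [0] y∈ =
  inj₂ (inj₁ (FVTy-tyP _ _ (zeros S) (FVTy-src (L [0]) A (L (next [0])) y∈)))
ins-cover (S ∷ Ss) ([0] lin) T b A L M (0∷ q) y∈ = inj₂ (FV-linear S lin _ _ q y∈)
ins-cover (S ∷ Ss) ([0] lin) T b A L M (next [0]) y∈ =
  inj₂ (inj₁ (FVTy-tyP _ _ (zeros S) (FVTy-tgt (L [0]) A (L (next [0])) y∈)))
ins-cover (S ∷ Ss) ([0] lin) T b A L M (next (0∷ q)) {y} y∈ =
  inj₁ (_ , subst (λ t → y ∈ FV t) (sym (append-++⁺ʳ T M (λ p → L (next p)) (0∷ q))) y∈)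
ins-cover (S ∷ Ss) ([0] lin) T b A L M (next (next q)) {y} y∈ =
  inj₁ (_ , subst (λ t → y ∈ FV t) (sym (append-++⁺ʳ T M (λ p → L (next p)) (next q))) y∈)
ins-cover (S ∷ Ss) (0∷ P) (T ∷ []) (s≤s b) A L M [0] y∈ =
  inj₂ (inj₁ (FVTy-tyP _ _ (overline P) (FVTy-src (L [0]) A (L (next [0])) y∈)))
ins-cover (S ∷ Ss) (0∷ P) (T ∷ []) (s≤s b) A L M (0∷ q) y∈ with ins-cover S P T b _ _ (λ p → M (0∷ p)) q y∈
... | inj₁ (p , e) = inj₁ (0∷ p , e)
... | inj₂ e       = inj₂ e
ins-cover (S ∷ Ss) (0∷ P) (T ∷ []) (s≤s b) A L M (next [0]) y∈ =
  inj₂ (inj₁ (FVTy-tyP _ _ (overline P) (FVTy-tgt (L [0]) A (L (next [0])) y∈)))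
ins-cover (S ∷ Ss) (0∷ P) (T ∷ []) (s≤s b) A L M (next (0∷ q))   y∈ = inj₁ (next (0∷ q) , y∈)
ins-cover (S ∷ Ss) (0∷ P) (T ∷ []) (s≤s b) A L M (next (next q)) y∈ = inj₁ (next (next q) , y∈)
ins-cover (S ∷ Ss) (next P) T b A L M [0]      y∈ = inj₁ ([0] , y∈)
ins-cover (S ∷ Ss) (next P) T b A L M (0∷ q)   y∈ = inj₁ (0∷ q , y∈)
ins-cover (S ∷ Ss) (next P) T b A L M (next q) y∈ with ins-cover Ss P T b A _ M q y∈
... | inj₁ (p , e) = inj₁ (next p , e)
... | inj₂ e       = inj₂ e

FV-toSub⁺ : ∀ {T} (L : Labelling T n) p {y} → y ∈ FV (L p) → y ∈ FVSub (toSub L)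
FV-toSub⁺ {T = T} L p {y} y∈ = FVSub-lookup⁺ (toSub L) (pathVar T p)
  (subst (λ t → y ∈ FV t) (sym (lookup-toSub L p)) y∈)

FV-toSub⁻ : ∀ {T} (L : Labelling T n) {y} → y ∈ FVSub (toSub L) → ∃[ p ] y ∈ FV (L p)
FV-toSub⁻ {T = T} L {y} y∈ with FVSub-lookup⁻ (toSub L) y∈
... | z , z∈ = varPath T z , subst (λ t → y ∈ FV t) (lookup-toSub-var L z) z∈

𝒞-⟦⟧ : ∀ k T (σ : Sub (suc (size T)) n) → 𝒞 k T ⟦ σ ⟧ ≡ coh ⌊ T ⌋ (𝒰 k T) σ
𝒞-⟦⟧ k T σ = cong (coh ⌊ T ⌋ (𝒰 k T)) (id-• σ)

-- The sphere of a disc occurs in the type of its filler; in an endo-coherence the repeated end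
-- already has full support; and the variables of a leaf that is standard over `M` are those of `M`,
-- all of which reappear along `ι`.
rule-SameSupp : ∀ {Γ : Ctx n} {s t} → sua′ Γ s t → SuppReady Γ s → SameSupp Γ s t
rule-SameSupp {Γ = Γ} (inj₁ (disc-removal A t)) (d , _) =
  Closure-bind f , Closure-bind (λ x∈ → base (x∈p∪q⁺ (inj₂ x∈)))
  where
  f : ∀ {x} → x ∈ FV (unary A t) → Supp Γ t x
  f {x} x∈ with x∈p∪q⁻ (FVSub (fromSphere A)) (FV t) x∈
  ... | inj₂ y∈ = base y∈
  ... | inj₁ y∈ = d zero (subst (λ B → x ∈ FVTy B) (sym (DiscType-⟦⟧ A t)) (FVSub-fromSphere⁻ A y∈))
rule-SameSupp {Γ = Γ} (inj₂ (inj₁ (endo-coherence-removal Δ s A σ ¬i))) (d , r) =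
  Closure-bind f , Closure-bind g
  where
  f : ∀ {x} → x ∈ FVSub σ → Supp Γ (identity (A ⟦ σ ⟧ᵀ) (s ⟦ σ ⟧)) x
  f x∈ with FVSub-lookup⁻ σ x∈
  ... | z , z∈ = Closure-bind (λ y∈ → base (x∈p∪q⁺ (inj₂ y∈)))
                   (Supp-⟦⟧ s d (regular-endo-full r z) z∈)
  g : ∀ {x} → x ∈ FV (identity (A ⟦ σ ⟧ᵀ) (s ⟦ σ ⟧)) → Closure Γ (FVSub σ) x
  g x∈ with x∈p∪q⁻ (FVSub (fromSphere (A ⟦ σ ⟧ᵀ))) (FV (s ⟦ σ ⟧)) x∈
  ... | inj₁ y∈ = let z , _ , e = FVTy-⟦⟧⁻ A σ (FVSub-fromSphere⁻ (A ⟦ σ ⟧ᵀ) y∈)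
                  in base (FVSub-lookup⁺ σ z e)
  ... | inj₂ y∈ = let z , _ , e = FV-⟦⟧⁻ s σ y∈ in base (FVSub-lookup⁺ σ z e)
rule-SameSupp {n = n} {Γ = Γ} (inj₂ (inj₂ (insertion {S} {P} {T} {L} {M} r A _ _ _))) (d , _) =
  Closure-bind f , Closure-bind (λ x∈ → base (g x∈))
  where
  b = InsertionRedex.bh≤th r
  leaf : L (overline P) ≡ coh ⌊ T ⌋ (𝒰 (leafHeight P) T) (toSub M)
  leaf = trans (InsertionRedex.label r) (𝒞-⟦⟧ (leafHeight P) T (toSub M))
  from-leaf : ∀ {x} → x ∈ FV (L (overline P)) → x ∈ FVSub (toSub (ins S P T b L M))
  from-leaf {x} x∈ with FV-toSub⁻ M (subst (λ t → x ∈ FV t) leaf x∈)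
  ... | q , q∈ = FV-toSub⁺ (ins S P T b L M) (ι S P T b q)
                   (subst (λ t → x ∈ FV t) (sym (ins-ι S P T b L M q)) q∈)
  f : ∀ {x} → x ∈ FVSub (toSub L) → Closure Γ (FVSub (toSub (ins S P T b L M))) x
  f {x} x∈ with FV-toSub⁻ L x∈
  ... | q , q∈ with ins-cover S P T b ⋆ L M q q∈
  ...   | inj₁ (p , p∈)    = base (FV-toSub⁺ (ins S P T b L M) p p∈)
  ...   | inj₂ (inj₂ e)    = base (from-leaf e)
  ...   | inj₂ (inj₁ e)    = Closure-bind (λ y∈ → base (from-leaf (subst (λ t → _ ∈ FV t)
            (lookup-toSub L (overline P)) y∈)))
            (d (pathVar S (overline P)) (subst (λ B → x ∈ FVTy B) (sym (⌊⌋-‼-toSub L (overline P))) e))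
  ok : Tm n → Set
  ok t = ∀ {x} → x ∈ FV t → x ∈ FVSub (toSub L)
  g : ok (coh ⌊ insert S P T b ⌋ (A ⟦ toSub (κ S P T b) ⟧ᵀ) (toSub (ins S P T b L M)))
  g x∈ with FV-toSub⁻ (ins S P T b L M) x∈
  ... | q , q∈ = insert-rel S P T b (λ t _ → ok t) {L′ = L} {M′ = M} (λ p → FV-toSub⁺ L p)
      (λ p x∈ → FV-toSub⁺ L (overline P) (subst (λ t → _ ∈ FV t) (sym leaf) (FV-toSub⁺ M p x∈))) q q∈

SameSuppTy : Ctx n → Ty n → Ty n → Set
SameSuppTy Γ A B = (∀ {y} → SuppTy Γ A y → SuppTy Γ B y) × (∀ {y} → SuppTy Γ B y → SuppTy Γ A y)

-- Conversion needs supports to be invariant under equality, and the invariance of a rule needs its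
-- left side to be typed; hence the mutual induction.
⊢-Supp  : ∀ {Γ : Ctx n} {t A} → Γ ⊢ t ∶ A → (∀ {y} → y ∈ FVTy A → Supp Γ t y) × SuppReady Γ t
⊢ˢ-Supp : ∀ {Γ : Ctx n} {Δ : Ctx m} {σ} → Γ ⊢ˢ σ ∶ Δ → TypedSupp Γ Δ σ
≈-Supp  : ∀ {Γ : Ctx n} {s t} → Γ ⊢ s ≈ t → SameSupp Γ s t
≈ᵀ-Supp : ∀ {Γ : Ctx n} {A B} → Γ ⊢ᵀ A ≈ B → SameSuppTy Γ A B
≈ˢ-Supp : ∀ {Γ : Ctx n} {σ τ : Sub m n} → Γ ⊢ˢ σ ≈ τ →
          (∀ {y} → y ∈ FVSub σ → Closure Γ (FVSub τ) y) × (∀ {y} → y ∈ FVSub τ → Closure Γ (FVSub σ) y)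

⊢-Supp (var x) = (λ y∈ → step (base (x∈⁅x⁆ x)) y∈) , tt
⊢-Supp (conv d e) = (λ y∈ → Closure-bind (proj₁ (⊢-Supp d)) (proj₂ (≈ᵀ-Supp e) (base y∈))) , proj₂ (⊢-Supp d)
⊢-Supp {Γ = Γ} (coh {s = s} {A} {t} {σ} p a ts r) =
  (λ y∈ → let z , _ , e = FVTy-⟦⟧⁻ (s ⇒[ A ] t) σ y∈ in base (FVSub-lookup⁺ σ z e)) , ⊢ˢ-Supp ts , r

⊢ˢ-Supp {Δ = Δ ▹ A} (_∷_ {σ = σ} d ds) zero {y} y∈ =
  proj₁ (⊢-Supp d) (subst (λ B → y ∈ FVTy B) (wkTy-∷ A σ) y∈)
⊢ˢ-Supp {Δ = Δ ▹ A} (_∷_ {σ = σ} d ds) (suc x) {y} y∈ =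
  ⊢ˢ-Supp ds x (subst (λ B → y ∈ FVTy B) (wkTy-∷ (Δ ‼ x) σ) y∈)

≈-Supp (var-refl x)  = id , id
≈-Supp (≈-sym e)     = proj₂ (≈-Supp e) , proj₁ (≈-Supp e)
≈-Supp (≈-trans e f) = proj₁ (≈-Supp f) ∘ proj₁ (≈-Supp e) , proj₂ (≈-Supp e) ∘ proj₂ (≈-Supp f)
≈-Supp (coh _ e)     = Closure-bind (proj₁ (≈ˢ-Supp e)) , Closure-bind (proj₂ (≈ˢ-Supp e))
≈-Supp (rule r d)    = rule-SameSupp r (proj₂ (⊢-Supp d))

≈ᵀ-Supp ⋆ = id , id
≈ᵀ-Supp {Γ = Γ} (arr {s} {A} {t} {s′} {A′} {t′} e f g) = Closure-bind to , Closure-bind from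
  where
  to : ∀ {x} → x ∈ FVTy (s ⇒[ A ] t) → SuppTy Γ (s′ ⇒[ A′ ] t′) x
  to x∈ with FVTy⁻ s A t x∈
  ... | inj₁ y∈        = Closure-bind (λ z∈ → base (FVTy-src s′ A′ t′ z∈)) (proj₁ (≈-Supp e) (base y∈))
  ... | inj₂ (inj₁ y∈) = Closure-bind (λ z∈ → base (FVTy-base s′ A′ t′ z∈)) (proj₁ (≈ᵀ-Supp f) (base y∈))
  ... | inj₂ (inj₂ y∈) = Closure-bind (λ z∈ → base (FVTy-tgt s′ A′ t′ z∈)) (proj₁ (≈-Supp g) (base y∈))
  from : ∀ {x} → x ∈ FVTy (s′ ⇒[ A′ ] t′) → SuppTy Γ (s ⇒[ A ] t) x
  from x∈ with FVTy⁻ s′ A′ t′ x∈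
  ... | inj₁ y∈        = Closure-bind (λ z∈ → base (FVTy-src s A t z∈)) (proj₂ (≈-Supp e) (base y∈))
  ... | inj₂ (inj₁ y∈) = Closure-bind (λ z∈ → base (FVTy-base s A t z∈)) (proj₂ (≈ᵀ-Supp f) (base y∈))
  ... | inj₂ (inj₂ y∈) = Closure-bind (λ z∈ → base (FVTy-tgt s A t z∈)) (proj₂ (≈-Supp g) (base y∈))

≈ˢ-Supp [] = base , base
≈ˢ-Supp {Γ = Γ} (_∷_ {s = s} {t = t} {σ = σ} {τ = τ} e f) = to , from
  where
  to : ∀ {y} → y ∈ FVSub (s ∷ σ) → Closure Γ (FVSub (t ∷ τ)) y
  to x∈ with x∈p∪q⁻ (FVSub σ) (FV s) x∈
  ... | inj₁ y∈ = Closure-bind (λ z∈ → base (x∈p∪q⁺ (inj₁ z∈))) (proj₁ (≈ˢ-Supp f) y∈)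
  ... | inj₂ y∈ = Closure-bind (λ z∈ → base (x∈p∪q⁺ (inj₂ z∈))) (proj₁ (≈-Supp e) (base y∈))
  from : ∀ {y} → y ∈ FVSub (t ∷ τ) → Closure Γ (FVSub (s ∷ σ)) y
  from x∈ with x∈p∪q⁻ (FVSub τ) (FV t) x∈
  ... | inj₁ y∈ = Closure-bind (λ z∈ → base (x∈p∪q⁺ (inj₁ z∈))) (proj₂ (≈ˢ-Supp f) y∈)
  ... | inj₂ y∈ = Closure-bind (λ z∈ → base (x∈p∪q⁺ (inj₂ z∈))) (proj₂ (≈-Supp e) (base y∈))

-- Dimension bounds from regularity

VarCtx : Ctx n → Set
VarCtx Γ = ∀ y → VarTy Γ (Γ ‼ y)

FV-VarTy : ∀ {Γ : Ctx n} {A} → VarTy Γ A → ∀ {x} → x ∈ FVTy A → dim (Γ ‼ x) < dim A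
FV-VarTy ⋆ x∈ = ⊥-elim (∉⊥ x∈)
FV-VarTy {Γ = Γ} (arr {A} y z e f a) x∈ with FVTy⁻ (var y) A (var z) x∈
... | inj₁ p rewrite x∈⁅y⁆⇒x≡y y p        = ≤-reflexive (cong (suc ∘ dim) e)
... | inj₂ (inj₁ p)                        = m≤n⇒m≤1+n (FV-VarTy a p)
... | inj₂ (inj₂ p) rewrite x∈⁅y⁆⇒x≡y z p = ≤-reflexive (cong (suc ∘ dim) f)

-- The arguments of a coherence are bounded by the dimension of its context. Regularity bounds this
-- in turn by the dimension of the coherence, because the source boundary is wide and its variables
-- lie in the support of the source.
FV-dim  : ∀ {Γ : Ctx n} {t A} → VarCtx Γ → Γ ⊢ t ∶ A → ∀ {x} → x ∈ FV t → dim (Γ ‼ x) ≤ dim A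
FVSub-dim : ∀ {Γ : Ctx n} {Δ : Ctx m} {σ} → VarCtx Γ → Γ ⊢ˢ σ ∶ Δ →
            ∀ {x} → x ∈ FVSub σ → dim (Γ ‼ x) ≤ dimCtx Δ
Supp-dim : ∀ {Γ : Ctx n} {t A} → VarCtx Γ → Γ ⊢ t ∶ A → ∀ {x} → Supp Γ t x → dim (Γ ‼ x) ≤ dim A
coh-dim : ∀ {Δ : Ctx m} {s A t} → Δ ⊢ s ∶ A → Regular Δ (Supp Δ s) (Supp Δ t) →
          dimCtx Δ ≤ suc (dim A)

FV-dim {Γ = Γ} v (var y) x∈ rewrite x∈⁅y⁆⇒x≡y y x∈ = ≤-refl
FV-dim v (conv d e) x∈ = ≤-trans (FV-dim v d x∈) (≤-reflexive (dim-≈ e))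
FV-dim {Γ = Γ} v (coh {s = s} {A} {t} {σ} p (arr a ds dt) ts r) {x} x∈ =
  ≤-trans (FVSub-dim v ts x∈) (≤-trans (coh-dim {t = t} ds r) (≤-reflexive (cong suc (sym (dim-⟦⟧ A σ)))))
FVSub-dim v [] x∈ = ⊥-elim (∉⊥ x∈)
FVSub-dim v (_∷_ {Δ = Δ} {A = A} {σ = σ} {t = t} d ds) x∈ with x∈p∪q⁻ (FVSub σ) (FV t) x∈
... | inj₁ y∈ = ≤-trans (FVSub-dim v ds y∈) (m≤m⊔n (dimCtx Δ) (dim A))
... | inj₂ y∈ = ≤-trans (FV-dim v d y∈) (≤-trans (≤-reflexive (dim-⟦⟧ A σ)) (m≤n⊔m (dimCtx Δ) (dim A)))
Supp-dim v d (base x∈) = FV-dim v d x∈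
Supp-dim v d (step c y∈) = ≤-trans (<⇒≤ (FV-VarTy (v _) y∈)) (Supp-dim v d c)
coh-dim d r@(ps p , i , le , (f , g) , _) with ∂-wide i p
... | y , y∈ , inj₁ i≤y = ≤-trans le (s≤s (≤-trans i≤y (Supp-dim (ps-VarTy p) d (g y∈))))
... | y , y∈ , inj₂ Δ≤y = m≤n⇒m≤1+n (≤-trans Δ≤y (Supp-dim (ps-VarTy p) d (g y∈)))

-- One better than `coh-dim`, since the boundary is now the whole context. Consequently all
-- arguments of an endo-coherence have strictly lower dimension than the coherence itself.
endo-dim : ∀ {Δ : Ctx m} {s A} → Δ ⊢ s ∶ A → Regular Δ (Supp Δ s) (Supp Δ s) → dimCtx Δ ≤ dim A
endo-dim d r@(ps p , i , le , (f , g) , _) with ∂-wide i p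
... | y , y∈ , inj₁ i≤y = ≤-trans (regular-endo-dim r) (≤-trans i≤y (Supp-dim (ps-VarTy p) d (g y∈)))
... | y , y∈ , inj₂ Δ≤y = ≤-trans Δ≤y (Supp-dim (ps-VarTy p) d (g y∈))

-- Tree contexts are ps-contexts

Σ-ps : ∀ {Γ : Ctx n} {x A} → Γ ⊢ps x ∶ A → ΣCtx Γ ⊢ps ΣTm x ∶ ΣTy A
Σ-ps pss = pse pss
Σ-ps {Γ = Γ ▹ A ▹ _} (pse {x = x} d) =
  subst₂ (λ B C → ΣCtx Γ ▹ ΣTy A ▹ B ⊢ps var zero ∶ C)
    (arr-cong (sym (ΣTm-wk x)) (sym (ΣTy-wk A)) refl)
    (arr-cong (trans (cong wkTm (sym (ΣTm-wk x))) (sym (ΣTm-wk (wkTm x))))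
       (trans (cong wkTy (sym (ΣTy-wk A))) (sym (ΣTy-wk (wkTy A)))) refl)
    (pse (Σ-ps d))
Σ-ps (psd d) = psd (Σ-ps d)

ps-nonempty : ∀ {x A} → ¬ ∅ ⊢ps x ∶ A
ps-nonempty (psd d) = ps-nonempty d

inrSub-suc : ∀ m (b : Fin (suc n)) → inrSub (suc m) b ≡ var zero ∷ wkSub (inrSub m b)
inrSub-suc m b = cong (var zero ∷_) (sym (wk-inr m b))

wk-inrSub : ∀ m (b : Fin (suc n)) t → wkTm t ⟦ inrSub (suc m) b ⟧ ≡ wkTm (t ⟦ inrSub m b ⟧)
wk-inrSub m b t = trans (cong (wkTm t ⟦_⟧) (inrSub-suc m b))
  (trans (wk-∷ t (wkSub (inrSub m b))) (sym (wk-⟦⟧ t (inrSub m b))))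

wkTy-inrSub : ∀ m (b : Fin (suc n)) A → wkTy A ⟦ inrSub (suc m) b ⟧ᵀ ≡ wkTy (A ⟦ inrSub m b ⟧ᵀ)
wkTy-inrSub m b A = trans (cong (wkTy A ⟦_⟧ᵀ) (inrSub-suc m b))
  (trans (wkTy-∷ A (wkSub (inrSub m b))) (sym (wkTy-⟦⟧ A (inrSub m b))))

∨-ps : ∀ {Γ : Ctx (suc n)} {Δ : Ctx (suc m)} {x A} → Γ ⊢ps var (last₀ Γ) ∶ ⋆ → Δ ⊢ps x ∶ A →
       Γ ∨ Δ ⊢ps x ⟦ inrSub m (last₀ Γ) ⟧ ∶ A ⟦ inrSub m (last₀ Γ) ⟧ᵀ
∨-ps c pss = c
∨-ps {Δ = ∅ ▹ A ▹ B} c (pse d) = ⊥-elim (ps-nonempty d)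
∨-ps {Γ = Γ} {Δ = Δ ▹ C ▹ A ▹ _} c (pse {x = x} d) =
  subst₂ (λ B D → (Γ ∨ (Δ ▹ C)) ▹ A ⟦ inrSub _ (last₀ Γ) ⟧ᵀ ▹ B ⊢ps var zero ∶ D)
    (arr-cong (sym (wk-inrSub _ b x)) (sym (wkTy-inrSub _ b A)) refl)
    (arr-cong (sym (trans (wk-inrSub _ b (wkTm x)) (cong wkTm (wk-inrSub _ b x))))
       (sym (trans (wkTy-inrSub _ b (wkTy A)) (cong wkTy (wkTy-inrSub _ b A)))) refl)
    (pse (∨-ps c d))
  where b = last₀ Γ
∨-ps c (psd d) = psd (∨-ps c d)

tree-ps′ : ∀ T → ∃[ x ] ⌊ T ⌋ ⊢ps x ∶ ⋆
tree-ps′ []       = var zero , pss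
tree-ps′ (T ∷ Ts) = _ , ∨-ps
  (subst (λ v → ΣCtx ⌊ T ⌋ ⊢ps var v ∶ ⋆) (sym (last₀-Σ ⌊ T ⌋)) (psd (Σ-ps (proj₂ (tree-ps′ T)))))
  (proj₂ (tree-ps′ Ts))

tree-ps : ∀ T → ⌊ T ⌋ ⊢ps
tree-ps T = ps (proj₂ (tree-ps′ T))

dimCtx-Σ : ∀ (Γ : Ctx n) A → dimCtx (ΣCtx (Γ ▹ A)) ≡ suc (dimCtx (Γ ▹ A))
dim-Σ : ∀ (A : Ty n) → dim (ΣTy A) ≡ suc (dim A)
dim-Σ ⋆            = refl
dim-Σ (s ⇒[ A ] t) = cong suc (dim-Σ A)
dimCtx-Σ ∅       A = dim-Σ A
dimCtx-Σ (Γ ▹ B) A = cong₂ _⊔_ (dimCtx-Σ Γ B) (dim-Σ A)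

dimCtx-∨ : ∀ (Γ : Ctx (suc n)) (Δ : Ctx (suc m)) → First⋆ Δ → dimCtx (Γ ∨ Δ) ≡ dimCtx Γ ⊔ dimCtx Δ
dimCtx-∨ Γ (∅ ▹ A) refl = sym (⊔-identityʳ (dimCtx Γ))
dimCtx-∨ Γ (Δ ▹ B ▹ A) f = trans (cong₂ _⊔_ (dimCtx-∨ Γ (Δ ▹ B) f) (dim-⟦⟧ A _))
  (⊔-assoc (dimCtx Γ) (dimCtx (Δ ▹ B)) (dim A))

dimCtx-⌊⌋ : ∀ T → dimCtx ⌊ T ⌋ ≡ height T
dimCtx-⌊⌋ []       = refl
dimCtx-⌊⌋ (T ∷ Ts) = trans (dimCtx-∨ (ΣCtx ⌊ T ⌋) ⌊ Ts ⌋ (First⋆-⌊⌋ Ts))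
  (cong₂ _⊔_ (trans (lem ⌊ T ⌋) (cong suc (dimCtx-⌊⌋ T))) (dimCtx-⌊⌋ Ts))
  where
  lem : ∀ {n} (Γ : Ctx (suc n)) → dimCtx (ΣCtx Γ) ≡ suc (dimCtx Γ)
  lem (Γ ▹ A) = dimCtx-Σ Γ A

-- Boundaries of trees as sets of paths

IsLast : ∀ {T} → Path T → Set
IsLast {[]}     [0]      = ⊤
IsLast {T ∷ Ts} [0]      = Empty
IsLast          (0∷ p)   = Empty
IsLast          (next p) = IsLast p

IsEnd : ∀ {T} → Sign → Path T → Set
IsEnd Sign.- [0]      = ⊤
IsEnd Sign.- (0∷ p)   = Empty
IsEnd Sign.- (next p) = Empty
IsEnd Sign.+ p        = IsLast p

-- The image of δ_i^ε, as a predicate on paths.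
Bd : ∀ {T} → Sign → ℕ → Path T → Set
Bd ε zero p             = IsEnd ε p
Bd ε (suc i) [0]        = ⊤
Bd ε (suc i) (0∷ p)     = Bd ε i p
Bd ε (suc i) (next p)   = Bd ε (suc i) p

data EndPath (ε : Sign) : ∀ {T} → Path T → Path T → Set where
  0∷_  : ∀ {T Ts q p} → EndPath ε {T} q p → EndPath ε {T ∷ Ts} (0∷ q) (0∷ p)
  next : ∀ {T Ts q p} → EndPath ε {Ts} q p → EndPath ε {T ∷ Ts} (next q) (next p)
  src  : ∀ {T Ts q} → ε ≡ Sign.- → depth q ≡ 0 → EndPath ε {T ∷ Ts} (0∷ q) [0]
  tgt  : ∀ {T Ts q} → ε ≡ Sign.+ → depth q ≡ 0 → EndPath ε {T ∷ Ts} (0∷ q) (next [0])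

EndT : Sign → Ty n → Tm n → Set
EndT ε      ⋆            u = Empty
EndT Sign.- (s ⇒[ A ] t) u = s ≡ u
EndT Sign.+ (s ⇒[ A ] t) u = t ≡ u

tyP-depth0 : ∀ {T} A (L : Labelling T n) q → depth q ≡ 0 → tyP A L q ≡ A
tyP-depth0 A L [0]      e = refl
tyP-depth0 A L (next q) e = tyP-depth0 A _ q e

end-path : ∀ ε {T} (q : Path T) {d} → depth q ≡ suc d → ∃[ p ] EndPath ε q p
end-path ε (next q) e = let p , h = end-path ε q e in next p , next h
end-path ε (0∷ q)   e with depth q in eq
end-path Sign.- (0∷ q) e | zero = [0] , src refl eq
end-path Sign.+ (0∷ q) e | zero = next [0] , tgt refl eq
end-path ε (0∷ q) e | suc d = let p , h = end-path ε q eq in 0∷ p , 0∷ h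

end-tyP : ∀ {ε T} {q p : Path T} → EndPath ε q p → ∀ A (L : Labelling T n) → EndT ε (tyP A L q) (L p)
end-tyP (0∷ h)   A L = end-tyP h _ _
end-tyP (next h) A L = end-tyP h A _
end-tyP {q = 0∷ q} (src refl e) A L rewrite tyP-depth0 (L [0] ⇒[ A ] L (next [0])) (λ r → L (0∷ r)) q e = refl
end-tyP {q = 0∷ q} (tgt refl e) A L rewrite tyP-depth0 (L [0] ⇒[ A ] L (next [0])) (λ r → L (0∷ r)) q e = refl

Bd-low : ∀ ε i {T} (p : Path T) → depth p < i → Bd ε i p
Bd-low ε (suc i) [0]      lt       = tt
Bd-low ε (suc i) (0∷ p)   (s≤s lt) = Bd-low ε i p lt
Bd-low ε (suc i) (next p) lt       = Bd-low ε (suc i) p lt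

IsLast-depth : ∀ {T} (p : Path T) → IsLast p → depth p ≡ 0
IsLast-depth [0]      _ = refl
IsLast-depth (next p) l = IsLast-depth p l

Bd-depth : ∀ ε i {T} (p : Path T) → Bd ε i p → depth p ≤ i
Bd-depth Sign.- zero    [0]      b = z≤n
Bd-depth Sign.+ zero    p        b = ≤-reflexive (IsLast-depth p b)
Bd-depth ε (suc i) [0]      b = z≤n
Bd-depth ε (suc i) (0∷ p)   b = s≤s (Bd-depth ε i p b)
Bd-depth ε (suc i) (next p) b = Bd-depth ε (suc i) p b

-- A positive dichotomy for the negative clause of `Bdry`: a path outside the boundary of its own
-- depth comes with a path of which it is an opposite end.
Bd-or-end : ∀ ε {T} (p : Path T) → Bd ε (depth p) p ⊎ ∃[ q ] EndPath (opp ε) q p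
Bd-or-end ε (0∷ p) with Bd-or-end ε p
... | inj₁ b       = inj₁ b
... | inj₂ (q , h) = inj₂ (0∷ q , 0∷ h)
Bd-or-end Sign.- [0] = inj₁ tt
Bd-or-end Sign.+ {[]}     [0] = inj₁ tt
Bd-or-end Sign.+ {T ∷ Ts} [0] = inj₂ (0∷ [0] , src refl refl)
Bd-or-end ε (next p) with depth p in e | Bd-or-end ε p
... | _     | inj₂ (q , h) = inj₂ (next q , next h)
... | suc d | inj₁ b = inj₁ b
Bd-or-end Sign.- (next [0]) | zero | inj₁ b = inj₂ (0∷ [0] , tgt refl refl)
Bd-or-end Sign.- (next (next p)) | zero | inj₁ ()
Bd-or-end Sign.+ (next p) | zero | inj₁ b = inj₁ b

¬Bd-end : ∀ ε {T} {p q : Path T} → EndPath (opp ε) q p → ¬ Bd ε (depth p) p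
¬Bd-end ε      (0∷ h)       b = ¬Bd-end ε h b
¬Bd-end Sign.- (src () _)   b
¬Bd-end Sign.+ (src refl _) ()
¬Bd-end Sign.- (tgt refl _) ()
¬Bd-end Sign.+ (tgt () _)   b
¬Bd-end ε (next {p = p} h)  b with depth p in e
¬Bd-end Sign.- (next {p = p} h) () | zero
¬Bd-end Sign.+ (next {p = p} h) b | zero  = ¬Bd-end Sign.+ h (subst (λ d → Bd Sign.+ d p) (sym e) b)
¬Bd-end ε      (next {p = p} h) b | suc d = ¬Bd-end ε h (subst (λ d → Bd ε d p) (sym e) b)

pathVar-injective : ∀ {T} {p q : Path T} → pathVar T p ≡ pathVar T q → p ≡ q
pathVar-injective {T} {p} {q} e =
  trans (sym (lookup-paths T p)) (trans (cong (lookup (paths T)) e) (lookup-paths T q))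

var-inj : ∀ {x y : Fin n} → Tm.var x ≡ var y → x ≡ y
var-inj refl = refl

EndIs⇒EndT : ∀ ε (A : Ty n) {z} → EndIs ε A z → EndT ε A (var z)
EndIs⇒EndT Sign.- (s ⇒[ A ] t) e = e
EndIs⇒EndT Sign.+ (s ⇒[ A ] t) e = e

EndT⇒EndIs : ∀ ε (A : Ty n) {z} → EndT ε A (var z) → EndIs ε A z
EndT⇒EndIs Sign.- (s ⇒[ A ] t) e = e
EndT⇒EndIs Sign.+ (s ⇒[ A ] t) e = e

EndT-unique : ∀ ε (A : Ty n) {u v} → EndT ε A u → EndT ε A v → u ≡ v
EndT-unique Sign.- (s ⇒[ A ] t) e f = trans (sym e) f
EndT-unique Sign.+ (s ⇒[ A ] t) e f = trans (sym e) f

dim-path : ∀ {T} (p : Path T) → dim (⌊ T ⌋ ‼ pathVar T p) ≡ depth p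
dim-path {T} p = trans (cong dim (⌊⌋-‼ T p)) (dim-tyP ⋆ (path T) p)

End-tree : ∀ ε {T} (p : Path T) → End ε ⌊ T ⌋ (pathVar T p) → ∃[ q ] EndPath ε q p
End-tree ε {T} p (y , e) = lem (varPath T y)
  (subst (λ y → EndIs ε (⌊ T ⌋ ‼ y) (pathVar T p)) (sym (pathVar-varPath T y)) e)
  where
  lem : ∀ q → EndIs ε (⌊ T ⌋ ‼ pathVar T q) (pathVar T p) → ∃[ q ] EndPath ε q p
  lem q e with subst (λ A → EndT ε A (path T p)) (⌊⌋-‼ T q) (EndIs⇒EndT ε _ e) | depth q in eq
  ... | f | zero = ⊥-elim (subst (λ A → EndT ε A (path T p)) (tyP-depth0 ⋆ (path T) q eq) f)
  ... | f | suc d with end-path ε q eq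
  ...   | r , h with pathVar-injective {p = r} {q = p} (var-inj (EndT-unique ε _ (end-tyP h ⋆ (path T)) f))
  ...     | refl = q , h

Bd⇒Bdry : ∀ ε i {T} (p : Path T) → Bd ε i p → Bdry ε i ⌊ T ⌋ (pathVar T p)
Bd⇒Bdry ε i {T} p b with m≤n⇒m<n∨m≡n (Bd-depth ε i p b)
... | inj₁ lt   = inj₁ (subst (_< i) (sym (dim-path p)) lt)
... | inj₂ refl = inj₂ (dim-path p , λ e → let q , h = End-tree (opp ε) p e in ¬Bd-end ε h b)

Bdry⇒Bd : ∀ ε i {T} (p : Path T) → Bdry ε i ⌊ T ⌋ (pathVar T p) → Bd ε i p
Bdry⇒Bd ε i {T} p (inj₁ lt) = Bd-low ε i p (subst (_< i) (dim-path p) lt)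
Bdry⇒Bd ε i {T} p (inj₂ (eq , ¬e)) with trans (sym (dim-path p)) eq | Bd-or-end ε p
... | refl | inj₁ b = b
... | refl | inj₂ (q , h) = ⊥-elim (¬e (pathVar T q , subst (λ A → EndIs (opp ε) A (pathVar T p))
        (sym (⌊⌋-‼ T q)) (EndT⇒EndIs (opp ε) _ (end-tyP h ⋆ (path T)))))

infix 4 _≐ᵖ_
_≐ᵖ_ : ∀ {T} → (Fin (suc (size T)) → Set) → (Path T → Set) → Set
_≐ᵖ_ {T} U B = ∀ p → (U (pathVar T p) → B p) × (B p → U (pathVar T p))

-- Together with `regular-tree` this turns regularity over a tree into a statement about `Bd`. The
-- intrinsic `Bdry` mediates, so the particular ps-derivation of the context drops out.
tree-regular : ∀ T {U V : Pred (Fin (suc (size T))) _} i → height T ≤ suc i →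
               U ≐ᵖ Bd {T} Sign.- i → V ≐ᵖ Bd {T} Sign.+ i → Regular ⌊ T ⌋ U V
tree-regular T i le f g = tree-ps T , i , ≤-trans (≤-reflexive (dimCtx-⌊⌋ T)) le , eq Sign.- f , eq Sign.+ g
  where
  eq : ∀ ε {U : Pred (Fin (suc (size T))) _} → U ≐ᵖ Bd {T} ε i → U ≐ (_∈ ∂Ctx i ε (tree-ps T))
  eq ε {U} f = (λ {x} u → subst (_∈ ∂Ctx i ε (tree-ps T)) (pathVar-varPath T x)
         (Bdry⇒∂ i ε (proj₂ (tree-ps′ T)) (Bd⇒Bdry ε i (varPath T x)
           (proj₁ (f (varPath T x)) (subst U (sym (pathVar-varPath T x)) u)))))
    , (λ {x} u → subst U (pathVar-varPath T x) (proj₂ (f (varPath T x)) (Bdry⇒Bd ε i (varPath T x)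
         (subst (Bdry ε i ⌊ T ⌋) (sym (pathVar-varPath T x)) (∂⇒Bdry i ε (proj₂ (tree-ps′ T)) u)))))

regular-tree : ∀ T {U V : Pred (Fin (suc (size T))) _} → Regular ⌊ T ⌋ U V →
               ∃[ i ] height T ≤ suc i × U ≐ᵖ Bd {T} Sign.- i × V ≐ᵖ Bd {T} Sign.+ i
regular-tree T (ps d , i , le , f , g) =
  i , ≤-trans (≤-reflexive (sym (dimCtx-⌊⌋ T))) le , eq Sign.- f , eq Sign.+ g
  where
  eq : ∀ ε {U : Pred (Fin (suc (size T))) _} → U ≐ (_∈ ∂ps i ε d) → U ≐ᵖ Bd {T} ε i
  eq ε (f , g) p = (λ u → Bdry⇒Bd ε i p (∂⇒Bdry i ε d (f u))) , (λ b → g (Bdry⇒∂ i ε d (Bd⇒Bdry ε i p b)))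

-- Compares labellings of trees that are not definitionally equal, such as `(U ++ T) ++ V` and
-- `U ++ (T ++ V)`. Equality of the trees is a consequence (`Sim-tree`), so it can be matched on at
-- the end instead of being transported along.
Sim : (Tm m → Tm n → Set) → ∀ T → Labelling T m → ∀ U → Labelling U n → Set
Sim R []       L []       M = R (L [0]) (M [0])
Sim R []       L (_ ∷ _)  M = Empty
Sim R (_ ∷ _)  L []       M = Empty
Sim R (T ∷ Ts) L (U ∷ Us) M = R (L [0]) (M [0])
  × Sim R T (λ p → L (0∷ p)) U (λ p → M (0∷ p))
  × Sim R Ts (λ p → L (next p)) Us (λ p → M (next p))

Sim-tree : ∀ {R : Tm m → Tm n → Set} T {L} U {M} → Sim R T L U M → T ≡ U
Sim-tree []       []       s = refl
Sim-tree (T ∷ Ts) (U ∷ Us) (_ , s , t) = cong₂ _∷_ (Sim-tree T U s) (Sim-tree Ts Us t)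

Sim-elim : ∀ {R : Tm m → Tm n → Set} T {L M} → Sim R T L T M → ∀ p → R (L p) (M p)
Sim-elim []       r           [0]      = r
Sim-elim (T ∷ Ts) (r , _ , _) [0]      = r
Sim-elim (T ∷ Ts) (_ , s , _) (0∷ p)   = Sim-elim T s p
Sim-elim (T ∷ Ts) (_ , _ , s) (next p) = Sim-elim Ts s p

Sim-intro : ∀ {R : Tm m → Tm n → Set} T {L M} → (∀ p → R (L p) (M p)) → Sim R T L T M
Sim-intro []       e = e [0]
Sim-intro (T ∷ Ts) e = e [0] , Sim-intro T (λ p → e (0∷ p)) , Sim-intro Ts (λ p → e (next p))

Sim-≡ : ∀ {a} {X : Set a} (F : ∀ T → Sub (suc (size T)) n → X) {T L U M} →
        Sim _≡_ T L U M → F T (toSub L) ≡ F U (toSub M)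
Sim-≡ F {T} {L} {U} s with Sim-tree T U s
... | refl = cong (F T) (toSub-cong (Sim-elim T s))

-- Standard types and standard coherences

height-∂ : ∀ k T → height (∂ k T) ≤ k
height-∂ zero    T        = z≤n
height-∂ (suc k) []       = z≤n
height-∂ (suc k) (T ∷ Ts) = ⊔-lub (s≤s (height-∂ k T)) (height-∂ (suc k) Ts)

δ-[0] : ∀ k ε T → δ (suc k) ε T [0] ≡ [0]
δ-[0] k ε []       = refl
δ-[0] k ε (T ∷ Ts) = refl

δ-[len] : ∀ k ε T → δ (suc k) ε T [len] ≡ [len]
δ-[len] k ε []       = refl
δ-[len] k ε (T ∷ Ts) = cong next (δ-[len] k ε Ts)

-- Globularity: both `k`-boundaries have the same `i`-boundaries. Through `stdEnd-∂` it lets the two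
-- ends of a standard type share one base type.
∂∂ : ∀ {i k} → i < k → ∀ ε η T (L : Labelling T n) →
     Sim _≡_ (∂ i (∂ k T)) (λ p → L (δ k η T (δ i ε (∂ k T) p))) (∂ i T) (λ p → L (δ i ε T p))
∂∂ {i = zero}  {suc k} lt Sign.- η T L = cong L (δ-[0] k η T)
∂∂ {i = zero}  {suc k} lt Sign.+ η T L = cong L (δ-[len] k η T)
∂∂ {i = suc i} {suc k} lt ε η [] L = refl
∂∂ {i = suc i} {suc k} (s≤s lt) ε η (T ∷ Ts) L =
  refl , ∂∂ lt ε η T (λ p → L (0∷ p)) , ∂∂ (s≤s lt) ε η Ts (λ p → L (next p))

∂-full : ∀ k ε T → height T ≤ k → (L : Labelling T n) →
         Sim _≡_ (∂ k T) (λ p → L (δ k ε T p)) T L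
∂-full zero    Sign.- [] h L = refl
∂-full zero    Sign.+ [] h L = refl
∂-full zero ε (T ∷ Ts) h L with ≤-trans (m≤m⊔n (suc (height T)) (height Ts)) h
... | ()
∂-full (suc k) ε [] h L = refl
∂-full (suc k) ε (T ∷ Ts) h L = refl
  , ∂-full k ε T (s≤s⁻¹ (≤-trans (m≤m⊔n (suc (height T)) (height Ts)) h)) (λ p → L (0∷ p))
  , ∂-full (suc k) ε Ts (≤-trans (m≤n⊔m (suc (height T)) (height Ts)) h) (λ p → L (next p))

tyP-[len] : ∀ {T} A (L : Labelling T n) → tyP A L [len] ≡ A
tyP-[len] {T = []}     A L = refl
tyP-[len] {T = T ∷ Ts} A L = tyP-[len] {T = Ts} A (λ p → L (next p))

tyP-δ : ∀ k ε T A (L : Labelling T n) p → tyP A L (δ k ε T p) ≡ tyP A (λ q → L (δ k ε T q)) p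
tyP-δ zero Sign.- T A L [0] = refl
tyP-δ zero Sign.+ T A L [0] = tyP-[len] A L
tyP-δ (suc k) ε [] A L [0] = refl
tyP-δ (suc k) ε (T ∷ Ts) A L [0] = refl
tyP-δ (suc k) ε (T ∷ Ts) A L (0∷ p) = trans (tyP-δ k ε T _ (λ q → L (0∷ q)) p)
  (cong (λ q → tyP (L [0] ⇒[ A ] L (next q)) (λ q → L (0∷ (δ k ε T q))) p) (sym (δ-[0] k ε Ts)))
tyP-δ (suc k) ε (T ∷ Ts) A L (next p) = tyP-δ (suc k) ε Ts A _ p

WL-δ : ∀ k ε T → WL ⌊ T ⌋ ⋆ (λ p → path T (δ k ε T p))
WL-δ k ε T p = subst (⌊ T ⌋ ⊢ path T (δ k ε T p) ∶_) (tyP-δ k ε T ⋆ (path T) p) (WL-path T (δ k ε T p))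

stdEnd : Sign → ℕ → ∀ T → Tm (suc (size T))
stdEnd ε k T = 𝒯 k (∂ k T) ⟦ toSub (λ p → path T (δ k ε T p)) ⟧

path-⟦⟧ : ∀ {T V} (f : Path V → Path T) (L : Labelling T n) →
  toSub (λ p → path T (f p)) • toSub L ≡ toSub (λ p → L (f p))
path-⟦⟧ f L = trans (toSub-• _ (toSub L)) (toSub-cong (λ p → lookup-toSub L (f p)))

stdEnd-∂ : ∀ {i k} → i < k → ∀ ε η T (L : Labelling T n) →
  stdEnd ε i (∂ k T) ⟦ toSub (λ p → L (δ k η T p)) ⟧ ≡ stdEnd ε i T ⟦ toSub L ⟧
stdEnd-∂ {i = i} {k} lt ε η T L = begin
  𝒯 i (∂ i (∂ k T)) ⟦ toSub (λ p → path (∂ k T) (δ i ε (∂ k T) p)) ⟧ ⟦ toSub (λ p → L (δ k η T p)) ⟧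
    ≡⟨ ⟦⟧-• (𝒯 i (∂ i (∂ k T))) _ _ ⟩
  _ ≡⟨ cong (𝒯 i (∂ i (∂ k T)) ⟦_⟧) (path-⟦⟧ (δ i ε (∂ k T)) _) ⟩
  𝒯 i (∂ i (∂ k T)) ⟦ toSub (λ p → L (δ k η T (δ i ε (∂ k T) p))) ⟧
    ≡⟨ Sim-≡ (λ V σ → 𝒯 i V ⟦ σ ⟧) (∂∂ lt ε η T L) ⟩
  𝒯 i (∂ i T) ⟦ toSub (λ p → L (δ i ε T p)) ⟧
    ≡⟨ cong (𝒯 i (∂ i T) ⟦_⟧) (path-⟦⟧ (δ i ε T) L) ⟨
  _ ≡⟨ ⟦⟧-• (𝒯 i (∂ i T)) _ _ ⟨
  𝒯 i (∂ i T) ⟦ toSub (λ p → path T (δ i ε T p)) ⟧ ⟦ toSub L ⟧ ∎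
  where open ≡-Reasoning

𝒰-∂ : ∀ {i k} → i ≤ k → ∀ η T (L : Labelling T n) →
  𝒰 i (∂ k T) ⟦ toSub (λ p → L (δ k η T p)) ⟧ᵀ ≡ 𝒰 i T ⟦ toSub L ⟧ᵀ
𝒰-∂ {i = zero}  le η T L = refl
𝒰-∂ {i = suc i} le η T L =
  arr-cong (stdEnd-∂ le Sign.- η T L) (𝒰-∂ (<⇒≤ le) η T L) (stdEnd-∂ le Sign.+ η T L)

toSub-single : ∀ {T} (L : Labelling (T ∷ []) n) →
  toSub L ≡ susp (L [0]) (L (next [0])) (toSub (λ p → L (0∷ p)))
toSub-single {T = T} L = trans (map-susp L [0] (next [0]) (map 0∷ᵖ_ (paths T)))
  (cong (susp (L [0]) (L (next [0]))) (sym (map-∘ L 0∷ᵖ_ (paths T))))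

toSub-Σ : ∀ {T V} (f : Path V → Path T) (g : Path (V ∷ []) → Path (T ∷ [])) → g [0] ≡ [0] →
  g (next [0]) ≡ next [0] → (∀ p → g (0∷ p) ≡ 0∷ (f p)) →
  toSub (λ p → path (T ∷ []) (g p)) ≡ ΣSub (toSub (λ p → path T (f p)))
toSub-Σ {T} {V} f g e₀ e₁ e = begin
  toSub (λ p → path (T ∷ []) (g p))
    ≡⟨ toSub-single (λ p → path (T ∷ []) (g p)) ⟩
  susp (path (T ∷ []) (g [0])) (path (T ∷ []) (g (next [0]))) (toSub (λ p → path (T ∷ []) (g (0∷ p))))
    ≡⟨ cong₂ (λ s → susp s (path (T ∷ []) (g (next [0])))) (cong (path (T ∷ [])) e₀)
         (toSub-cong (λ p → cong (path (T ∷ [])) (e p))) ⟩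
  susp (var north) (path (T ∷ []) (g (next [0]))) (toSub (λ p → path (T ∷ []) (0∷ (f p))))
    ≡⟨ cong₂ (susp (var north)) (trans (cong (path (T ∷ [])) e₁) (cong var (last₀-Σ ⌊ T ⌋)))
         (map-∘ ΣTm (λ p → path T (f p)) (paths V)) ⟩
  susp (var north) (var south) (map ΣTm (toSub (λ p → path T (f p))))
    ≡⟨ ΣSub-susp _ ⟨
  ΣSub (toSub (λ p → path T (f p))) ∎
  where open ≡-Reasoning

𝒰-Σ : ∀ k T → 𝒰 (suc k) (T ∷ []) ≡ ΣTy (𝒰 k T)
stdEnd-Σ : ∀ ε k T → stdEnd ε (suc k) (T ∷ []) ≡ ΣTm (stdEnd ε k T)
stdEnd-Σ ε k T = trans (cong (ΣTm (𝒯 k (∂ k T)) ⟦_⟧)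
    (toSub-Σ (δ k ε T) (δ (suc k) ε (T ∷ [])) refl refl (λ p → refl)))
  (sym (ΣTm-⟦⟧ (𝒯 k (∂ k T)) _))
𝒰-Σ zero    T = arr-cong refl refl (cong var (last₀-Σ ⌊ T ⌋))
𝒰-Σ (suc k) T = arr-cong (stdEnd-Σ Sign.- k T) (𝒰-Σ k T) (stdEnd-Σ Sign.+ k T)

discTree : ℕ → Tree
discTree zero    = []
discTree (suc k) = discTree k ∷ []

-- In dimensions at least the height, the recursion of `𝒯` through singleton trees has only two
-- outcomes: the top variable, when the tree is the disc of exactly that dimension, and `𝒞`
-- otherwise.
data Standard : ℕ → Tree → Set where
  disc     : ∀ {k} → 𝒯 k (discTree k) ≡ path (discTree k) (zeros (discTree k)) → Standard k (discTree k)
  non-disc : ∀ {k T} → T ≢ discTree k → 𝒯 k T ≡ 𝒞 k T → Standard k T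

standard : ∀ k T → height T ≤ k → Standard k T
standard zero    []           h = disc refl
standard (suc k) []           h = non-disc (λ ()) refl
standard (suc k) (T ∷ [])     h with standard k T (s≤s⁻¹ h)
... | disc e       = disc (cong ΣTm e)
... | non-disc d e = non-disc (λ { refl → d refl })
        (trans (cong ΣTm e) (cong₂ (coh (ΣCtx ⌊ T ⌋)) (sym (𝒰-Σ k T)) idSub-susp))
standard (suc k) (T ∷ U ∷ Us) h = non-disc (λ ()) refl
standard zero (T ∷ Ts) h with ≤-trans (m≤m⊔n (suc (height T)) (height Ts)) h
... | ()

disc-linear : ∀ k → Linear (discTree k)
disc-linear zero    = refl
disc-linear (suc k) = cong suc (disc-linear k)

disc-type : ∀ k → ⌊ discTree k ⌋ ‼ pathVar (discTree k) (zeros (discTree k)) ≡ 𝒰 k (discTree k)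
disc-type zero    = refl
disc-type (suc k) = trans (ΣCtx-‼ ⌊ discTree k ⌋ _) (trans (cong ΣTy (disc-type k)) (sym (𝒰-Σ k (discTree k))))

IsLast-[len] : ∀ T → IsLast {T} [len]
IsLast-[len] []       = tt
IsLast-[len] (T ∷ Ts) = IsLast-[len] Ts

δ-Bd : ∀ k ε T p → Bd ε k (δ k ε T p)
δ-Bd zero    Sign.- T        [0]      = tt
δ-Bd zero    Sign.+ T        [0]      = IsLast-[len] T
δ-Bd (suc k) ε      []       [0]      = tt
δ-Bd (suc k) ε      (T ∷ Ts) [0]      = tt
δ-Bd (suc k) ε      (T ∷ Ts) (0∷ p)   = δ-Bd k ε T p
δ-Bd (suc k) ε      (T ∷ Ts) (next p) = δ-Bd (suc k) ε Ts p

IsLast⇒[len] : ∀ {T} (p : Path T) → IsLast p → [len] ≡ p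
IsLast⇒[len] {[]}     [0]      l = refl
IsLast⇒[len] {T ∷ Ts} (next p) l = cong next (IsLast⇒[len] p l)

Bd⇒δ : ∀ k ε T p → Bd ε k p → ∃[ q ] δ k ε T q ≡ p
Bd⇒δ zero Sign.- T [0] b = [0] , refl
Bd⇒δ zero Sign.+ T p   b = [0] , IsLast⇒[len] p b
Bd⇒δ (suc k) ε []       [0]      b = [0] , refl
Bd⇒δ (suc k) ε (T ∷ Ts) [0]      b = [0] , refl
Bd⇒δ (suc k) ε (T ∷ Ts) (0∷ p)   b = let q , e = Bd⇒δ k ε T p b in 0∷ q , cong 0∷_ e
Bd⇒δ (suc k) ε (T ∷ Ts) (next p) b = let q , e = Bd⇒δ (suc k) ε Ts p b in next q , cong next e

tree-VarCtx : ∀ T → VarCtx ⌊ T ⌋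
tree-VarCtx T = ps-VarTy (proj₂ (tree-ps′ T))

-- The variables of a type have strictly lower dimension than a variable of that type.
Closure-Bd : ∀ {T U ε k} → (∀ p → pathVar T p ∈ U → Bd ε k p) → ∀ {y} → Closure ⌊ T ⌋ U y →
             Bd ε k (varPath T y)
Closure-Bd {T} {U} f {y} (base y∈) = f (varPath T y) (subst (_∈ U) (sym (pathVar-varPath T y)) y∈)
Closure-Bd {T} {U} {ε} {k} f (step {x} {y} c y∈) = Bd-low ε k (varPath T y) (<-≤-trans
  (subst₂ _<_ (dim-varPath y) (dim-varPath x) (FV-VarTy (tree-VarCtx T x) y∈))
  (Bd-depth ε k (varPath T x) (Closure-Bd {T} {ε = ε} {k} f c)))
  where
  dim-varPath : ∀ z → dim (⌊ T ⌋ ‼ z) ≡ depth (varPath T z)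
  dim-varPath z = trans (cong (λ w → dim (⌊ T ⌋ ‼ w)) (sym (pathVar-varPath T z))) (dim-path (varPath T z))

∈-path : ∀ {T} {p q : Path T} → pathVar T p ∈ FV (path T q) → p ≡ q
∈-path {T} {p} {q} p∈ = pathVar-injective {p = p} {q} (x∈⁅y⁆⇒x≡y (pathVar T q) p∈)

FV-std : ∀ {T V} (f : Path V → Path T) t p → pathVar T p ∈ FV (t ⟦ toSub (λ q → path T (f q)) ⟧) →
         ∃[ q ] f q ≡ p
FV-std {T} {V} f t p p∈ with FV-⟦⟧⁻ t _ p∈
... | z , _ , e = varPath V z , sym (∈-path {T} (subst (λ s → pathVar T p ∈ FV s)
        (lookup-toSub-var (λ q → path T (f q)) z) e))

stdEnd-Supp⇒ : ∀ ε k T {y} → Supp ⌊ T ⌋ (stdEnd ε k T) y → Bd ε k (varPath T y)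
stdEnd-Supp⇒ ε k T = Closure-Bd {T} {ε = ε} {k} λ p p∈ →
  let q , e = FV-std (δ k ε T) (𝒯 k (∂ k T)) p p∈ in subst (Bd ε k) e (δ-Bd k ε T q)

stdEnd-Supp⇐ : ∀ ε k T p → Bd ε k p → Supp ⌊ T ⌋ (stdEnd ε k T) (pathVar T p)
stdEnd-Supp⇐ ε k T p b with Bd⇒δ k ε T p b
... | q , refl = lem (∂ k T) (δ k ε T) (WL-δ k ε T) (standard k (∂ k T) (height-∂ k T)) q
  where
  lem : ∀ V (f : Path V → Path T) → WL ⌊ T ⌋ ⋆ (λ p → path T (f p)) → Standard k V → ∀ q →
        Supp ⌊ T ⌋ (𝒯 k V ⟦ toSub (λ p → path T (f p)) ⟧) (pathVar T (f q))
  lem V f w (non-disc _ e) q rewrite e = base (FV-⟦⟧⁺ (𝒞 k V) (toSub (λ p → path T (f p)))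
    (FVSub-lookup⁺ idSub (pathVar V q) (subst (λ t → pathVar V q ∈ FV t) (sym (lookup-id (pathVar V q))) (x∈⁅x⁆ _)))
    (subst (λ t → pathVar T (f q) ∈ FV t) (sym (lookup-toSub (λ p → path T (f p)) q)) (x∈⁅x⁆ _)))
  -- For a disc the end is a single variable; the remaining variables enter the support through the
  -- type of that variable.
  lem V f w (disc e) q rewrite e | lookup-toSub (λ p → path T (f p)) (zeros V)
    with FV-linear V (disc-linear k) ⋆ (λ p → path T (f p)) q (x∈⁅x⁆ _)
  ... | inj₁ y∈ = proj₁ (⊢-Supp (w (zeros V))) y∈
  ... | inj₂ y∈ = base y∈

stdEnd-≐ : ∀ ε k T → _≐ᵖ_ {T} (Supp ⌊ T ⌋ (stdEnd ε k T)) (Bd ε k)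
stdEnd-≐ ε k T p =
    (λ u → subst (Bd ε k) (lookup-paths T p) (stdEnd-Supp⇒ ε k T u))
  , stdEnd-Supp⇐ ε k T p

𝒰-regular : ∀ k T → height T ≤ suc k →
  Regular ⌊ T ⌋ (Supp ⌊ T ⌋ (stdEnd Sign.- k T)) (Supp ⌊ T ⌋ (stdEnd Sign.+ k T))
𝒰-regular k T h = tree-regular T k h (stdEnd-≐ Sign.- k T) (stdEnd-≐ Sign.+ k T)

-- The typing of `𝒰` enters as an argument, which keeps this lemma outside the mutual recursion that
-- establishes it.
𝒰⇒𝒞-typed : ∀ k T → height T ≤ suc k → ⌊ T ⌋ ⊢ᵀ 𝒰 (suc k) T → ⌊ T ⌋ ⊢ 𝒞 (suc k) T ∶ 𝒰 (suc k) T
𝒰⇒𝒞-typed k T h u = subst (⌊ T ⌋ ⊢ 𝒞 (suc k) T ∶_) (⟦id⟧ᵀ (𝒰 (suc k) T))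
  (coh (tree-ps T) u ⊢id (𝒰-regular k T h))

𝒰⇒𝒯-typed : ∀ k T → height T ≤ suc k → ⌊ T ⌋ ⊢ᵀ 𝒰 (suc k) T → ⌊ T ⌋ ⊢ 𝒯 (suc k) T ∶ 𝒰 (suc k) T
𝒰⇒𝒯-typed k T h u with standard (suc k) T h
... | disc e = subst₂ (⌊ T ⌋ ⊢_∶_) (sym e) (disc-type (suc k)) (var (pathVar T (zeros T)))
... | non-disc _ e = subst (⌊ T ⌋ ⊢_∶ 𝒰 (suc k) T) (sym e) (𝒰⇒𝒞-typed k T h u)

𝒰-well-typed : ∀ k T → ⌊ T ⌋ ⊢ᵀ 𝒰 k T
stdEnd-typed : ∀ ε k T → ⌊ T ⌋ ⊢ stdEnd ε k T ∶ 𝒰 k T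
𝒯-typed : ∀ k T → height T ≤ k → ⌊ T ⌋ ⊢ 𝒯 k T ∶ 𝒰 k T

𝒰-well-typed zero    T = ⋆
𝒰-well-typed (suc k) T = arr (𝒰-well-typed k T) (stdEnd-typed Sign.- k T) (stdEnd-typed Sign.+ k T)

stdEnd-typed ε k T = subst (⌊ T ⌋ ⊢ stdEnd ε k T ∶_)
  (trans (𝒰-∂ ≤-refl ε T (path T)) (trans (cong (𝒰 k T ⟦_⟧ᵀ) (toSub-path T)) (⟦id⟧ᵀ (𝒰 k T))))
  (⊢-⟦⟧ (WL⇒⊢ˢ (WL-δ k ε T)) (𝒯-typed k (∂ k T) (height-∂ k T)))

𝒯-typed zero    []       h = var zero
𝒯-typed zero    (T ∷ Ts) h with ≤-trans (m≤m⊔n (suc (height T)) (height Ts)) h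
... | ()
𝒯-typed (suc k) T h = 𝒰⇒𝒯-typed k T h (𝒰-well-typed (suc k) T)

𝒞-typed : ∀ k T → height T ≤ suc k → ⌊ T ⌋ ⊢ 𝒞 (suc k) T ∶ 𝒰 (suc k) T
𝒞-typed k T h = 𝒰⇒𝒞-typed k T h (𝒰-well-typed (suc k) T)

-- Exterior and inserted labellings

-- The source and target of a disc in every dimension. The family is total in the dimension, so it
-- needs no length index, and `up` passes to a subtree by forgetting dimension zero.
Ends : ℕ → Set
Ends n = Sign → ℕ → Tm n

up : Ends n → Ends n
up e ε i = e ε (suc i)

discLab : ∀ {T} → Ends n → Tm n → Labelling T n
discLab {T = []}     e t [0]      = t
discLab {T = T ∷ Ts} e t [0]      = e Sign.- 0
discLab {T = T ∷ Ts} e t (0∷ p)   = discLab (up e) t p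
discLab {T = T ∷ Ts} e t (next p) = e Sign.+ 0

-- The exterior labelling of S obtained from a labelling ρ of the inserted tree
-- and from the ends e and the filler t of a disc, which label the branch.
exterior : ∀ S (P : Branch S) T b → Labelling (insert S P T b) n → Ends n → Tm n → Labelling S n
exterior (S ∷ Ss) ([0] _)  T        b       ρ e t [0]      = ρ [0]
exterior (S ∷ Ss) ([0] _)  T        b       ρ e t (0∷ p)   = discLab (up e) t p
exterior (S ∷ Ss) ([0] _)  T        b       ρ e t (next p) = ρ (++⁺ʳ T p)
exterior (S ∷ Ss) (0∷ P)   (T ∷ []) (s≤s b) ρ e t [0]      = ρ [0]
exterior (S ∷ Ss) (0∷ P)   (T ∷ []) (s≤s b) ρ e t (0∷ p)   = exterior S P T b (λ q → ρ (0∷ q)) (up e) t p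
exterior (S ∷ Ss) (0∷ P)   (T ∷ []) (s≤s b) ρ e t (next p) = ρ (next p)
exterior (S ∷ Ss) (next P) T        b       ρ e t [0]      = ρ [0]
exterior (S ∷ Ss) (next P) T        b       ρ e t (0∷ p)   = ρ (0∷ p)
exterior (S ∷ Ss) (next P) T        b       ρ e t (next p) = exterior Ss P T b (λ q → ρ (next q)) e t p

discLab-rel : ∀ {T} (R : Tm m → Tm n → Set) {e e′ t t′} → (∀ ε i → R (e ε i) (e′ ε i)) → R t t′ →
              ∀ p → R (discLab {T = T} e t p) (discLab e′ t′ p)
discLab-rel {T = []}     R f g [0]      = g
discLab-rel {T = T ∷ Ts} R f g [0]      = f _ _
discLab-rel {T = T ∷ Ts} R f g (0∷ p)   = discLab-rel R (λ ε i → f ε (suc i)) g p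
discLab-rel {T = T ∷ Ts} R f g (next p) = f _ _

exterior-rel : ∀ S P T b (R : Tm m → Tm n → Set) {ρ ρ′ e e′ t t′} → (∀ p → R (ρ p) (ρ′ p)) →
         (∀ ε i → R (e ε i) (e′ ε i)) → R t t′ →
         ∀ p → R (exterior S P T b ρ e t p) (exterior S P T b ρ′ e′ t′ p)
exterior-rel (S ∷ Ss) ([0] _)  T        b       R h f g [0]      = h _
exterior-rel (S ∷ Ss) ([0] _)  T        b       R h f g (0∷ p)   = discLab-rel R (λ ε i → f ε (suc i)) g p
exterior-rel (S ∷ Ss) ([0] _)  T        b       R h f g (next p) = h _
exterior-rel (S ∷ Ss) (0∷ P)   (T ∷ []) (s≤s b) R h f g [0]      = h _
exterior-rel (S ∷ Ss) (0∷ P)   (T ∷ []) (s≤s b) R h f g (0∷ p)   =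
  exterior-rel S P T b R (λ q → h (0∷ q)) (λ ε i → f ε (suc i)) g p
exterior-rel (S ∷ Ss) (0∷ P)   (T ∷ []) (s≤s b) R h f g (next p) = h _
exterior-rel (S ∷ Ss) (next P) T        b       R h f g [0]      = h _
exterior-rel (S ∷ Ss) (next P) T        b       R h f g (0∷ p)   = h _
exterior-rel (S ∷ Ss) (next P) T        b       R h f g (next p) =
  exterior-rel Ss P T b R (λ q → h (next q)) f g p

append-++ : ∀ T {U} (ρ : Labelling (T ++ U) n) p →
            append (λ q → ρ (++⁺ˡ U q)) (λ q → ρ (++⁺ʳ T q)) p ≡ ρ p
append-++ []       ρ [0]      = refl
append-++ []       ρ (0∷ p)   = refl
append-++ []       ρ (next p) = refl
append-++ (T ∷ Ts) ρ [0]      = refl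
append-++ (T ∷ Ts) ρ (0∷ p)   = refl
append-++ (T ∷ Ts) ρ (next p) = append-++ Ts (λ q → ρ (next q)) p

-- One half of the universal property of the inserted tree: a labelling is recovered syntactically
-- from its restrictions to `S` and `T`. The other half, `exterior-ins`, holds only up to equality.
ins-exterior-ι : ∀ S P T b (ρ : Labelling (insert S P T b) n) e t p →
           ins S P T b (exterior S P T b ρ e t) (λ q → ρ (ι S P T b q)) p ≡ ρ p
ins-exterior-ι (S ∷ Ss) ([0] _)  T        b       ρ e t p               = append-++ T ρ p
ins-exterior-ι (S ∷ Ss) (0∷ P)   (T ∷ []) (s≤s b) ρ e t [0]             = refl
ins-exterior-ι (S ∷ Ss) (0∷ P)   (T ∷ []) (s≤s b) ρ e t (0∷ p)          = ins-exterior-ι S P T b (λ q → ρ (0∷ q)) (up e) t p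
ins-exterior-ι (S ∷ Ss) (0∷ P)   (T ∷ []) (s≤s b) ρ e t (next [0])      = refl
ins-exterior-ι (S ∷ Ss) (0∷ P)   (T ∷ []) (s≤s b) ρ e t (next (0∷ p))   = refl
ins-exterior-ι (S ∷ Ss) (0∷ P)   (T ∷ []) (s≤s b) ρ e t (next (next p)) = refl
ins-exterior-ι (S ∷ Ss) (next P) T        b       ρ e t [0]             = refl
ins-exterior-ι (S ∷ Ss) (next P) T        b       ρ e t (0∷ p)          = refl
ins-exterior-ι (S ∷ Ss) (next P) T        b       ρ e t (next p)        = ins-exterior-ι Ss P T b (λ q → ρ (next q)) e t p

mk : Ends n → ℕ → Ty n
mk e zero    = ⋆
mk e (suc k) = e Sign.- k ⇒[ mk e k ] e Sign.+ k

𝒰-mk : ∀ k T (σ : Sub (suc (size T)) n) → 𝒰 k T ⟦ σ ⟧ᵀ ≡ mk (λ ε i → stdEnd ε i T ⟦ σ ⟧) k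
𝒰-mk zero    T σ = refl
𝒰-mk (suc k) T σ = arr-cong refl (𝒰-mk k T σ) refl

-- The cast in `discVar` relates vectors whose lengths agree only propositionally; comparing their
-- lists of entries avoids a transport.
toList-lookup : ∀ {a} {A : Set a} {xs : Vec A m} {ys : Vec A n} → toList xs ≡ toList ys →
                ∀ .(e : n ≡ m) x → lookup xs (Fin.cast e x) ≡ lookup ys x
toList-lookup {xs = x ∷ xs} {y ∷ ys} eq e zero    = headˡ eq
  where
  headˡ : ∀ {a} {A : Set a} {x y : A} {xs ys} → x ∷ˡ xs ≡ y ∷ˡ ys → x ≡ y
  headˡ refl = refl
toList-lookup {xs = x ∷ xs} {y ∷ ys} eq e (suc i) = toList-lookup {xs = xs} {ys} (tailˡ eq) (suc-injective e) i
  where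
  tailˡ : ∀ {a} {A : Set a} {x y : A} {xs ys} → x ∷ˡ xs ≡ y ∷ˡ ys → xs ≡ ys
  tailˡ refl = refl

sphereList : Ends n → ℕ → List (Tm n)
sphereList e zero    = []ˡ
sphereList e (suc k) = e Sign.+ k ∷ˡ e Sign.- k ∷ˡ sphereList e k

sphereList-up : ∀ (e : Ends n) k →
  sphereList e (suc k) ≡ sphereList (up e) k ++ˡ (e Sign.+ 0 ∷ˡ e Sign.- 0 ∷ˡ []ˡ)
sphereList-up e zero    = refl
sphereList-up e (suc k) = cong (λ xs → e Sign.+ (suc k) ∷ˡ e Sign.- (suc k) ∷ˡ xs) (sphereList-up e k)

toList-susp : ∀ {a} {A : Set a} (x y : A) (zs : Vec A n) → toList (susp x y zs) ≡ toList zs ++ˡ (y ∷ˡ x ∷ˡ []ˡ)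
toList-susp x y []       = refl
toList-susp x y (z ∷ zs) = cong (z ∷ˡ_) (toList-susp x y zs)

toList-fromSphere : ∀ (e : Ends n) k → toList (fromSphere (mk e k)) ≡ sphereList e k
toList-fromSphere e zero    = refl
toList-fromSphere e (suc k) = cong (λ xs → e Sign.+ k ∷ˡ e Sign.- k ∷ˡ xs) (toList-fromSphere e k)

toList-discLab : ∀ T → Linear T → ∀ (e : Ends n) t →
                 toList (toSub (discLab {T = T} e t)) ≡ t ∷ˡ sphereList e (height T)
toList-discLab []       lin e t = refl
toList-discLab (T ∷ []) lin e t =
  trans (cong toList (toSub-single (discLab {T = T ∷ []} e t)))
    (trans (toList-susp _ _ (toSub (discLab {T = T} (up e) t)))
      (trans (cong (_++ˡ (e Sign.+ 0 ∷ˡ e Sign.- 0 ∷ˡ []ˡ)) (toList-discLab T (suc-injective lin) (up e) t))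
        (cong (t ∷ˡ_) (sym (sphereList-up e (height T))))))
toList-discLab (T ∷ U ∷ Us) lin e t = ⊥-elim (case
  subst (suc (height T) ≤_) (sym lin) (m≤m⊔n (suc (height T)) (height (U ∷ Us))) of λ ())

lookup-disc : ∀ {T} (lin : Linear T) p {A : Ty n} {t} (e : Ends n) (eq : height T ≡ dim A) →
              A ≡ mk e (height T) → lookup (fromDisc A t) (discVar lin p eq) ≡ discLab e t p
lookup-disc {T = T} lin p {t = t} e eq refl =
  trans (toList-lookup {xs = fromDisc (mk e (height T)) t} {toSub (discLab {T = T} e t)}
    (trans (cong (t ∷ˡ_) (toList-fromSphere e (height T))) (sym (toList-discLab T lin e t))) _ (pathVar T p))
    (lookup-toSub (discLab e t) p)

depth-zeros : ∀ T → Linear T → depth (zeros T) ≡ height T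
depth-zeros []       lin = refl
depth-zeros (T ∷ []) lin = cong suc (depth-zeros T (suc-injective lin))
depth-zeros (T ∷ U ∷ Us) lin = ⊥-elim (case
  subst (suc (height T) ≤_) (sym lin) (m≤m⊔n (suc (height T)) (height (U ∷ Us))) of λ ())

ends : ∀ {T} → Labelling T n → Ends n
ends {T = T} M ε i = stdEnd ε i T ⟦ toSub M ⟧

𝒞-Σ : ∀ k T → 𝒞 (suc k) (T ∷ []) ≡ ΣTm (𝒞 k T)
𝒞-Σ k T = cong₂ (coh (ΣCtx ⌊ T ⌋)) (𝒰-Σ k T) (sym idSub-susp)

ΣSub-inc₀ : ∀ {T R Ss} (f : Path T → Path R) (g : Path (T ∷ []) → Path (R ∷ Ss)) → g [0] ≡ [0] →
  g (next [0]) ≡ next [0] → (∀ p → g (0∷ p) ≡ 0∷ (f p)) →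
  ΣSub (toSub (λ p → path R (f p))) • inc₀ R Ss ≡ toSub (λ p → path (R ∷ Ss) (g p))
ΣSub-inc₀ {T} {R} {Ss} f g e₀ e₁ e = begin
  ΣSub τ • inc₀ R Ss
    ≡⟨ cong (_• inc₀ R Ss) (ΣSub-susp τ) ⟩
  susp (var north) (var south) (map ΣTm τ) • inc₀ R Ss
    ≡⟨ susp-• (map ΣTm τ) (inc₀ R Ss) ⟩
  susp (lookup (inc₀ R Ss) north) (lookup (inc₀ R Ss) south) (map ΣTm τ • inc₀ R Ss)
    ≡⟨ cong₂ (λ s t → susp s t (map ΣTm τ • inc₀ R Ss)) (lookup-susp-north (map _ (paths R)))
         (lookup-susp-south (map _ (paths R))) ⟩
  susp (path (R ∷ Ss) [0]) (path (R ∷ Ss) (next [0])) (map ΣTm τ • inc₀ R Ss)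
    ≡⟨ cong₂ (susp (path (R ∷ Ss) [0])) (cong (path (R ∷ Ss)) (sym e₁)) (trans (map-• ΣTm τ (inc₀ R Ss))
         (trans (sym (map-∘ _ (λ p → path R (f p)) (paths T))) (map-cong inj (paths T)))) ⟩
  susp (path (R ∷ Ss) [0]) (path (R ∷ Ss) (g (next [0]))) (toSub (λ p → path (R ∷ Ss) (g (0∷ p))))
    ≡⟨ cong (λ s → susp s (path (R ∷ Ss) (g (next [0]))) (toSub (λ p → path (R ∷ Ss) (g (0∷ p)))))
         (cong (path (R ∷ Ss)) (sym e₀)) ⟩
  susp (path (R ∷ Ss) (g [0])) (path (R ∷ Ss) (g (next [0]))) (toSub (λ p → path (R ∷ Ss) (g (0∷ p))))
    ≡⟨ toSub-single (λ p → path (R ∷ Ss) (g p)) ⟨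
  toSub (λ p → path (R ∷ Ss) (g p)) ∎
  where
  open ≡-Reasoning
  τ = toSub (λ p → path R (f p))
  inj : ∀ p → ΣTm (path R (f p)) ⟦ inc₀ R Ss ⟧ ≡ path (R ∷ Ss) (g (0∷ p))
  inj p = trans (lookup-susp-inj (map _ (paths R)) (pathVar R (f p)))
    (trans (lookup-map (pathVar R (f p)) _ (paths R))
      (cong (path (R ∷ Ss)) (trans (cong 0∷_ (lookup-paths R (f p))) (sym (e p)))))

ιSub : ∀ S P T b → Labelling T (suc (size (insert S P T b)))
ιSub S P T b q = path (insert S P T b) (ι S P T b q)

-- Exhibits `κ` as the exterior of the generic labelling. Facts about `κ` are then proved for
-- arbitrary `ρ`, `e` and `t`, a generality that the recursion into subtrees preserves.
κ-exterior : ∀ S P T b p → κ S P T b p ≡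
       exterior S P T b (path (insert S P T b)) (ends (ιSub S P T b)) (𝒞 (leafHeight P) T ⟦ toSub (ιSub S P T b) ⟧) p
κ-exterior (S ∷ Ss) ([0] lin) T b [0] = refl
κ-exterior (S ∷ Ss) ([0] lin) T b (0∷ p) =
  trans (cong (_⟦ toSub (ιSub (S ∷ Ss) ([0] lin) T b) ⟧)
      (lookup-disc {T = S ∷ []} (cong suc lin) (0∷ p) (λ ε i → stdEnd ε i T) (sym (dim-𝒰 d T))
        (trans (sym (⟦id⟧ᵀ (𝒰 d T))) (trans (𝒰-mk d T idSub) (mk-cong (λ ε i → ⟦id⟧ (stdEnd ε i T)) d)))))
    (trans (discLab-rel (λ s t → s ⟦ toSub (ιSub (S ∷ Ss) ([0] lin) T b) ⟧ ≡ t) (λ ε i → refl) refl p)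
      (cong (λ k → discLab (up (ends (ιSub (S ∷ Ss) ([0] lin) T b)))
        (𝒞 (suc k) T ⟦ toSub (ιSub (S ∷ Ss) ([0] lin) T b) ⟧) p) (sym (depth-zeros S lin))))
  where
  d = suc (height S)
  mk-cong : ∀ {n} {e e′ : Ends n} → (∀ ε i → e ε i ≡ e′ ε i) → ∀ k → mk e k ≡ mk e′ k
  mk-cong f zero    = refl
  mk-cong f (suc k) = arr-cong (f _ k) (mk-cong f k) (f _ k)
κ-exterior (S ∷ Ss) ([0] lin) T b (next p) = refl
κ-exterior (S ∷ Ss) (0∷ P) (T ∷ []) (s≤s b) [0] = refl
κ-exterior (S ∷ Ss) (0∷ P) (T ∷ []) (s≤s b) (0∷ p) =
  trans (cong (λ t → ΣTm t ⟦ inc₀ R Ss ⟧) (κ-exterior S P T b p))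
    (exterior-rel S P T b (λ s t → ΣTm s ⟦ inc₀ R Ss ⟧ ≡ t)
      (λ q → trans (lookup-susp-inj (map _ (paths R)) (pathVar R q))
        (trans (lookup-map (pathVar R q) _ (paths R)) (cong (λ r → path (R ∷ Ss) (0∷ r)) (lookup-paths R q))))
      (λ ε i → push (stdEnd ε i T) (stdEnd-Σ ε i T)) (push (𝒞 (leafHeight P) T) (𝒞-Σ (leafHeight P) T)) p)
  where
  R = insert S P T b
  push : ∀ t {t′} → t′ ≡ ΣTm t → ΣTm (t ⟦ toSub (ιSub S P T b) ⟧) ⟦ inc₀ R Ss ⟧
         ≡ t′ ⟦ toSub (ιSub (S ∷ Ss) (0∷ P) (T ∷ []) (s≤s b)) ⟧
  push t refl = trans (cong (_⟦ inc₀ R Ss ⟧) (ΣTm-⟦⟧ t (toSub (ιSub S P T b))))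
    (trans (⟦⟧-• (ΣTm t) _ (inc₀ R Ss)) (cong (ΣTm t ⟦_⟧)
      (ΣSub-inc₀ (ι S P T b) (ι (S ∷ Ss) (0∷ P) (T ∷ []) (s≤s b)) refl refl (λ p → refl))))
κ-exterior (S ∷ Ss) (0∷ P) (T ∷ []) (s≤s b) (next p) = refl
κ-exterior (S ∷ Ss) (next P) T b [0]      = refl
κ-exterior (S ∷ Ss) (next P) T b (0∷ p)   = refl
κ-exterior (S ∷ Ss) (next P) T b (next p) =
  trans (cong (_⟦ incNext S R ⟧) (κ-exterior Ss P T b p))
    (exterior-rel Ss P T b (λ s t → s ⟦ incNext S R ⟧ ≡ t) (λ q → lookup-toSub (λ p → path (S ∷ R) (next p)) q)
      (λ ε i → push (stdEnd ε i T)) (push (𝒞 (leafHeight P) T)) p)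
  where
  R = insert Ss P T b
  push : ∀ t → t ⟦ toSub (ιSub Ss P T b) ⟧ ⟦ incNext S R ⟧ ≡ t ⟦ toSub (ιSub (S ∷ Ss) (next P) T b) ⟧
  push t = trans (⟦⟧-• t _ _) (cong (t ⟦_⟧) (trans (toSub-• (ιSub Ss P T b) (incNext S R))
    (toSub-cong (λ q → lookup-toSub (λ p → path (S ∷ R) (next p)) (ι Ss P T b q)))))

κ-⟦⟧ : ∀ S P T b (ρ : Labelling (insert S P T b) n) p → κ S P T b p ⟦ toSub ρ ⟧ ≡
       exterior S P T b ρ (ends (λ q → ρ (ι S P T b q))) (𝒞 (leafHeight P) T ⟦ toSub (λ q → ρ (ι S P T b q)) ⟧) p
κ-⟦⟧ S P T b ρ p = trans (cong (_⟦ toSub ρ ⟧) (κ-exterior S P T b p))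
  (exterior-rel S P T b (λ s t → s ⟦ toSub ρ ⟧ ≡ t) (lookup-toSub ρ) (λ ε i → push (stdEnd ε i T))
    (push (𝒞 (leafHeight P) T)) p)
  where
  push : ∀ t → t ⟦ toSub (ιSub S P T b) ⟧ ⟦ toSub ρ ⟧ ≡ t ⟦ toSub (λ q → ρ (ι S P T b q)) ⟧
  push t = trans (⟦⟧-• t _ _) (cong (t ⟦_⟧) (path-⟦⟧ (ι S P T b) ρ))

-- Trunks, and the typing of exteriors and inserted labellings

end : ∀ {T} → Sign → Path T
end Sign.- = [0]
end Sign.+ = [len]

trunk : Sign → ℕ → ∀ T → Path T
trunk ε zero    T        = end ε
trunk ε (suc i) (T ∷ []) = 0∷ trunk ε i T
trunk ε (suc i) _        = [0]

stdEnd-trunk : ∀ ε i T → i ≤ trunkHeight T → stdEnd ε i T ≡ path T (trunk ε i T)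
stdEnd-trunk Sign.- zero    T        h = refl
stdEnd-trunk Sign.+ zero    T        h = refl
stdEnd-trunk ε      (suc i) (T ∷ []) h =
  trans (stdEnd-Σ ε i T) (cong ΣTm (stdEnd-trunk ε i T (s≤s⁻¹ h)))

-- A branch that goes down several levels forces `T` to be a singleton at each of them. Along this
-- trunk the ends of a standard coherence are actual labels, which is how the disc on the branch
-- meets the inserted labelling.
Trunk : ∀ T → Labelling T n → Ends n → Set
Trunk T M e = ∀ ε i → i ≤ trunkHeight T → e ε i ≡ M (trunk ε i T)

Trunk-up : ∀ {T} (M : Labelling (T ∷ []) n) {e} → Trunk (T ∷ []) M e → Trunk T (λ p → M (0∷ p)) (up e)
Trunk-up M h ε i le = h ε (suc i) (s≤s le)

Trunk-ends : ∀ {T} (M : Labelling T n) → Trunk T M (ends M)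
Trunk-ends {T = T} M ε i le =
  trans (cong (_⟦ toSub M ⟧) (stdEnd-trunk ε i T le)) (lookup-toSub M (trunk ε i T))

mkB : Ty n → Ends n → ℕ → Ty n
mkB A e zero    = A
mkB A e (suc k) = e Sign.- k ⇒[ mkB A e k ] e Sign.+ k

mkB-up : ∀ (A : Ty n) e k → mkB (e Sign.- 0 ⇒[ A ] e Sign.+ 0) (up e) k ≡ mkB A e (suc k)
mkB-up A e zero    = refl
mkB-up A e (suc k) = arr-cong refl (mkB-up A e k) refl

mkB-⋆ : ∀ (e : Ends n) k → mk e k ≡ mkB ⋆ e k
mkB-⋆ e zero    = refl
mkB-⋆ e (suc k) = arr-cong refl (mkB-⋆ e k) refl

exterior-[0] : ∀ S P T b (ρ : Labelling (insert S P T b) n) e t → exterior S P T b ρ e t [0] ≡ ρ [0]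
exterior-[0] (S ∷ Ss) ([0] _)  T        b       ρ e t = refl
exterior-[0] (S ∷ Ss) (0∷ P)   (T ∷ []) (s≤s b) ρ e t = refl
exterior-[0] (S ∷ Ss) (next P) T        b       ρ e t = refl

++⁺ʳ-[0] : ∀ T {U} → ++⁺ʳ T {U} [0] ≡ ++⁺ˡ {T} U [len]
++⁺ʳ-[0] []       = refl
++⁺ʳ-[0] (T ∷ Ts) = cong next (++⁺ʳ-[0] Ts)

tyP-++⁺ʳ : ∀ T {U} A (ρ : Labelling (T ++ U) n) p → tyP A ρ (++⁺ʳ T p) ≡ tyP A (λ q → ρ (++⁺ʳ T q)) p
tyP-++⁺ʳ []       A ρ p = refl
tyP-++⁺ʳ (T ∷ Ts) A ρ p = tyP-++⁺ʳ Ts A (λ q → ρ (next q)) p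

tyP-++⁺ˡ : ∀ {T U} A (ρ : Labelling (T ++ U) n) p → tyP A ρ (++⁺ˡ {T} U p) ≡ tyP A (λ q → ρ (++⁺ˡ {T} U q)) p
tyP-++⁺ˡ A ρ [0]      = refl
tyP-++⁺ˡ A ρ (0∷ p)   = refl
tyP-++⁺ˡ {U = U} A ρ (next {Ts = Ts} p) = tyP-++⁺ˡ {T = Ts} {U} A (λ q → ρ (next q)) p

tyP-ι : ∀ S P T b A (ρ : Labelling (insert S P T b) n) p →
        tyP A ρ (ι S P T b p) ≡ tyP A (λ q → ρ (ι S P T b q)) p
tyP-ι (S ∷ Ss) ([0] _)  T        b       A ρ p          = tyP-++⁺ˡ {T = T} {Ss} A ρ p
tyP-ι (S ∷ Ss) (0∷ P)   (T ∷ []) (s≤s b) A ρ [0]        = refl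
tyP-ι (S ∷ Ss) (0∷ P)   (T ∷ []) (s≤s b) A ρ (0∷ p)     = tyP-ι S P T b _ (λ q → ρ (0∷ q)) p
tyP-ι (S ∷ Ss) (0∷ P)   (T ∷ []) (s≤s b) A ρ (next [0]) = refl
tyP-ι (S ∷ Ss) (next P) T        b       A ρ p          = tyP-ι Ss P T b A (λ q → ρ (next q)) p

WL-ι : ∀ {Γ : Ctx n} S P T b {A} {ρ : Labelling (insert S P T b) n} → WL Γ A ρ → WL Γ A (λ q → ρ (ι S P T b q))
WL-ι {Γ = Γ} S P T b {A} {ρ} w p = subst (Γ ⊢ ρ (ι S P T b p) ∶_) (tyP-ι S P T b A ρ p) (w (ι S P T b p))

DiscTyped : Ctx n → Ty n → Ends n → Tm n → ℕ → Set
DiscTyped Γ A e t k = (∀ ε i → i < k → Γ ⊢ e ε i ∶ mkB A e i) × Γ ⊢ t ∶ mkB A e k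

DiscTyped-up : ∀ {Γ : Ctx n} {A e t k} → DiscTyped Γ A e t (suc k) →
               DiscTyped Γ (e Sign.- 0 ⇒[ A ] e Sign.+ 0) (up e) t k
DiscTyped-up {Γ = Γ} {A} {e} {t} {k} (f , g) =
    (λ ε i lt → subst (Γ ⊢ e ε (suc i) ∶_) (sym (mkB-up A e i)) (f ε (suc i) (s≤s lt)))
  , subst (Γ ⊢ t ∶_) (sym (mkB-up A e k)) g

linear-single : ∀ {a} {X : Set a} T U Us → Linear (T ∷ U ∷ Us) → X
linear-single T U Us lin with
  subst (suc (height T) ≤_) (sym lin) (m≤m⊔n (suc (height T)) (height (U ∷ Us)))
... | ()

discLab-typed : ∀ {Γ : Ctx n} T → Linear T → ∀ {A e t} → DiscTyped Γ A e t (depth (zeros T)) →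
                WL Γ A (discLab {T = T} e t)
discLab-typed []           lin (f , g) [0]        = g
discLab-typed (T ∷ [])     lin (f , g) [0]        = f _ 0 (s≤s z≤n)
discLab-typed (T ∷ [])     lin d       (0∷ p)     = discLab-typed T (suc-injective lin) (DiscTyped-up d) p
discLab-typed (T ∷ [])     lin (f , g) (next [0]) = f _ 0 (s≤s z≤n)
discLab-typed (T ∷ U ∷ Us) lin d       p          = linear-single T U Us lin

-- The branch carries a disc that is typed over its own ends; `Trunk` identifies these with the
-- neighbouring labels of `ρ`, over which the branch must be typed.
exterior-typed : ∀ {Γ : Ctx n} S P T b {A ρ e t} → WL Γ A ρ → Trunk T (λ q → ρ (ι S P T b q)) e →
           DiscTyped Γ A e t (leafHeight P) → WL Γ A (exterior S P T b ρ e t)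
exterior-typed (S ∷ Ss) ([0] _) T b w h d [0] = w [0]
exterior-typed {Γ = Γ} (S ∷ Ss) ([0] lin) T b {A} {ρ} {e} {t} w h d (0∷ p) =
  subst (λ B → Γ ⊢ discLab (up e) t p ∶ tyP B (discLab (up e) t) p)
    (arr-cong (h Sign.- 0 z≤n) refl (trans (h Sign.+ 0 z≤n) (cong ρ (sym (++⁺ʳ-[0] T)))))
    (discLab-typed S lin (DiscTyped-up d) p)
exterior-typed {Γ = Γ} (S ∷ Ss) ([0] lin) T b {A} {ρ} w h d (next p) =
  subst (Γ ⊢ ρ (++⁺ʳ T p) ∶_) (tyP-++⁺ʳ T A ρ p) (w (++⁺ʳ T p))
exterior-typed (S ∷ Ss) (0∷ P) (T ∷ []) (s≤s b) w h d [0] = w [0]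
exterior-typed {Γ = Γ} (S ∷ Ss) (0∷ P) (T ∷ []) (s≤s b) {A} {ρ} {e} {t} w h d (0∷ p) =
  exterior-typed S P T b (λ q → w (0∷ q)) (Trunk-up (λ q → ρ (ι (S ∷ Ss) (0∷ P) (T ∷ []) (s≤s b) q)) h)
    (subst (λ B → DiscTyped Γ B (up e) t (leafHeight P)) (arr-cong (h Sign.- 0 z≤n) refl (h Sign.+ 0 z≤n))
      (DiscTyped-up d)) p
exterior-typed (S ∷ Ss) (0∷ P) (T ∷ []) (s≤s b) w h d (next p) = w (next p)
exterior-typed (S ∷ Ss) (next P) T b w h d [0] = w [0]
exterior-typed {Γ = Γ} (S ∷ Ss) (next P) T b {A} {ρ} {e} {t} w h d (0∷ p) =
  subst (λ u → Γ ⊢ ρ (0∷ p) ∶ tyP (ρ [0] ⇒[ A ] u) (λ q → ρ (0∷ q)) p)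
    (sym (exterior-[0] Ss P T b (λ q → ρ (next q)) e t)) (w (0∷ p))
exterior-typed (S ∷ Ss) (next P) T b w h d (next p) = exterior-typed Ss P T b (λ q → w (next q)) h d p

leafHeight-suc : ∀ {S} (P : Branch S) → ∃[ k ] leafHeight P ≡ suc k
leafHeight-suc ([0] _)  = _ , refl
leafHeight-suc (0∷ P)   = _ , refl
leafHeight-suc (next P) = leafHeight-suc P

𝒞-leaf-typed : ∀ {S} (P : Branch S) T → height T ≤ leafHeight P →
               ⌊ T ⌋ ⊢ 𝒞 (leafHeight P) T ∶ 𝒰 (leafHeight P) T
𝒞-leaf-typed P T h with leafHeight P | leafHeight-suc P
... | .(suc k) | k , refl = 𝒞-typed k T h

std-DiscTyped : ∀ {Γ : Ctx n} {S} (P : Branch S) T → height T ≤ leafHeight P → ∀ {M : Labelling T n} →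
  WL Γ ⋆ M → DiscTyped Γ ⋆ (ends M) (𝒞 (leafHeight P) T ⟦ toSub M ⟧) (leafHeight P)
std-DiscTyped {Γ = Γ} P T h {M} w =
    (λ ε i _ → subst (Γ ⊢ ends M ε i ∶_) (𝒰-mkB i) (⊢-⟦⟧ (WL⇒⊢ˢ w) (stdEnd-typed ε i T)))
  , subst (Γ ⊢ 𝒞 (leafHeight P) T ⟦ toSub M ⟧ ∶_) (𝒰-mkB (leafHeight P)) (⊢-⟦⟧ (WL⇒⊢ˢ w) (𝒞-leaf-typed P T h))
  where
  𝒰-mkB : ∀ k → 𝒰 k T ⟦ toSub M ⟧ᵀ ≡ mkB ⋆ (ends M) k
  𝒰-mkB k = trans (𝒰-mk k T (toSub M)) (mkB-⋆ (ends M) k)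

exterior-WL : ∀ {Γ : Ctx n} S P T b {ρ} → height T ≤ leafHeight P → WL Γ ⋆ ρ →
  WL Γ ⋆ (exterior S P T b ρ (ends (λ q → ρ (ι S P T b q))) (𝒞 (leafHeight P) T ⟦ toSub (λ q → ρ (ι S P T b q)) ⟧))
exterior-WL S P T b h w =
  exterior-typed S P T b w (Trunk-ends _) (std-DiscTyped P T h (WL-ι S P T b w))

κ-WL : ∀ S P T b → height T ≤ leafHeight P → WL ⌊ insert S P T b ⌋ ⋆ (κ S P T b)
κ-WL S P T b h p = subst₂ (⌊ R ⌋ ⊢_∶_) (sym (κ-exterior S P T b p)) (tyP-ext ⋆ (λ q → sym (κ-exterior S P T b q)) p)
  (exterior-WL S P T b h (WL-path R) p)
  where R = insert S P T b

tyP-≈ : ∀ {Γ : Ctx n} {T A B} {L M : Labelling T n} → Γ ⊢ᵀ A ≈ B → (∀ p → Γ ⊢ L p ≈ M p) →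
        ∀ p → Γ ⊢ᵀ tyP A L p ≈ tyP B M p
tyP-≈ e f [0]      = e
tyP-≈ e f (0∷ p)   = tyP-≈ (arr (f [0]) e (f (next [0]))) (λ q → f (0∷ q)) p
tyP-≈ e f (next p) = tyP-≈ e (λ q → f (next q)) p

tyP-base : ∀ {Γ : Ctx n} {T A B} (L : Labelling T n) → Γ ⊢ᵀ A ≈ B → ∀ p → Γ ⊢ᵀ tyP A L p ≈ tyP B L p
tyP-base L e = tyP-≈ e (λ p → ≈-refl (L p))

tyP⇒base : ∀ {Γ : Ctx n} {T} A B (L : Labelling T n) e q → Γ ⊢ᵀ tyP A L q ≈ mkB B e (depth q) → Γ ⊢ᵀ A ≈ B
tyP⇒base A B L e [0]      h = h
tyP⇒base A B L e (next q) h = tyP⇒base A B _ e q h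
tyP⇒base {Γ = Γ} A B L e (0∷ q) h
  with tyP⇒base _ _ _ (up e) q (subst (Γ ⊢ᵀ tyP A L (0∷ q) ≈_) (sym (mkB-up B e (depth q))) h)
... | arr _ f _ = f

-- Equality of arrow types is componentwise, so an equality between types of leaves can be peeled
-- down to the arrow at the bottom.
tyP⇒ends : ∀ {Γ : Ctx n} {T Ts} A B (L : Labelling (T ∷ Ts) n) e q →
  Γ ⊢ᵀ tyP A L (0∷ q) ≈ mkB B e (suc (depth q)) →
  Γ ⊢ᵀ L [0] ⇒[ A ] L (next [0]) ≈ e Sign.- 0 ⇒[ B ] e Sign.+ 0
tyP⇒ends {Γ = Γ} A B L e q h =
  tyP⇒base _ _ _ (up e) q (subst (Γ ⊢ᵀ tyP A L (0∷ q) ≈_) (sym (mkB-up B e (depth q))) h)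

-- The agreement of a labelling of S with a labelling of T on the variables
-- which an insertion identifies.
Overlap : (Tm n → Tm n → Set) → ∀ S (P : Branch S) T → branchHeight P ≤ trunkHeight T →
          Labelling S n → Labelling T n → Set
Overlap R (S ∷ Ss) ([0] _)  T        b       L M = R (L [0]) (M [0]) × R (L (next [0])) (M [len])
Overlap R (S ∷ Ss) (0∷ P)   (T ∷ []) (s≤s b) L M = R (L [0]) (M [0]) × R (L (next [0])) (M (next [0]))
  × Overlap R S P T b (λ p → L (0∷ p)) (λ p → M (0∷ p))
Overlap R (S ∷ Ss) (next P) T        b       L M = Overlap R Ss P T b (λ p → L (next p)) M

-- Exactly the agreement that the induction on dimension can turn into joinability.
LowEq : ℕ → Ctx n → Tm n → Tm n → Set
LowEq d Γ s t = s ≡ t ⊎ (Γ ⊢ s ≈ t × ∃[ A ] Γ ⊢ s ∶ A × dim A < d)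

LowEq⇒≈ : ∀ {d} {Γ : Ctx n} {s t} → LowEq d Γ s t → Γ ⊢ s ≈ t
LowEq⇒≈ (inj₁ refl)    = ≈-refl _
LowEq⇒≈ (inj₂ (e , _)) = e

-- The leaf has two types: one read off from `L`, the other, as a standard coherence, with ends in
-- `M`. Comparing them dimension by dimension identifies the labels along the branch, all of which
-- lie strictly below the leaf.
overlaps : ∀ {Γ : Ctx n} {d} S P T b {A B L M e} → WL Γ A L → Trunk T M e →
  Γ ⊢ᵀ tyP A L (overline P) ≈ mkB B e (leafHeight P) → dim A + leafHeight P ≤ d →
  Overlap (LowEq d Γ) S P T b L M
overlaps {Γ = Γ} {d} (S ∷ Ss) ([0] _) T b {A} {B} {L} {M} {e} w h q lt with tyP⇒ends A B L e (zeros S) q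
... | arr f _ g = inj₂ (subst (Γ ⊢ L [0] ≈_) (h Sign.- 0 z≤n) f , A , w [0] , lt′)
                , inj₂ (subst (Γ ⊢ L (next [0]) ≈_) (h Sign.+ 0 z≤n) g , A , w (next [0]) , lt′)
  where lt′ = ≤-trans (≤-trans (s≤s (m≤m+n (dim A) _)) (≤-reflexive (sym (+-suc (dim A) _)))) lt
overlaps {Γ = Γ} {d} (S ∷ Ss) (0∷ P) (T ∷ []) (s≤s b) {A} {B} {L} {M} {e} w h q lt with tyP⇒ends A B L e (overline P) q
... | arr f _ g = inj₂ (subst (Γ ⊢ L [0] ≈_) (h Sign.- 0 z≤n) f , A , w [0] , lt′)
                , inj₂ (subst (Γ ⊢ L (next [0]) ≈_) (h Sign.+ 0 z≤n) g , A , w (next [0]) , lt′)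
                , overlaps S P T b (λ p → w (0∷ p)) (Trunk-up M h)
                    (subst (Γ ⊢ᵀ tyP A L (0∷ overline P) ≈_) (sym (mkB-up B e (leafHeight P))) q)
                    (≤-trans (≤-reflexive (sym (+-suc (dim A) (leafHeight P)))) lt)
  where lt′ = ≤-trans (≤-trans (s≤s (m≤m+n (dim A) _)) (≤-reflexive (sym (+-suc (dim A) _)))) lt
overlaps (S ∷ Ss) (next P) T b w h q lt = overlaps Ss P T b (λ p → w (next p)) h q lt

discLab-≈ : ∀ {Γ : Ctx n} {d} T → Linear T → ∀ {A B L e} → WL Γ A L →
  Γ ⊢ᵀ tyP A L (zeros T) ≈ mkB B e (depth (zeros T)) → dim A + depth (zeros T) ≤ d →
  ∀ p → LowEq d Γ (L p) (discLab {T = T} e (L (zeros T)) p)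
discLab-≈ [] lin w q lt [0] = inj₁ refl
discLab-≈ (T ∷ []) lin {A} {B} {L} {e} w q lt p with tyP⇒ends A B L e (zeros T) q
discLab-≈ (T ∷ []) lin {A} w q lt [0]        | arr f _ g = inj₂ (f , A , w [0] ,
  ≤-trans (≤-trans (s≤s (m≤m+n (dim A) _)) (≤-reflexive (sym (+-suc (dim A) _)))) lt)
discLab-≈ (T ∷ []) lin {A} w q lt (next [0]) | arr f _ g = inj₂ (g , A , w (next [0]) ,
  ≤-trans (≤-trans (s≤s (m≤m+n (dim A) _)) (≤-reflexive (sym (+-suc (dim A) _)))) lt)
discLab-≈ {Γ = Γ} (T ∷ []) lin {A} {B} {L} {e} w q lt (0∷ p) | arr f _ g =
  discLab-≈ T (suc-injective lin) (λ r → w (0∷ r))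
    (subst (Γ ⊢ᵀ tyP A L (0∷ zeros T) ≈_) (sym (mkB-up B e (depth (zeros T)))) q)
    (≤-trans (≤-reflexive (sym (+-suc (dim A) _))) lt) p
discLab-≈ (T ∷ U ∷ Us) lin w q lt p = linear-single T U Us lin

append-[0] : ∀ {T U} (M : Labelling T n) (L : Labelling U n) → append M L [0] ≡ M [0]
append-[0] {T = []}     M L = refl
append-[0] {T = T ∷ Ts} M L = refl

append-join : ∀ T {U} (M : Labelling T n) (L : Labelling U n) → append M L (++⁺ʳ T [0]) ≡ M [len]
append-join T {U} M L = trans (cong (append M L) (++⁺ʳ-[0] T)) (append-++⁺ˡ U M L [len])

-- Every labelling is the exterior followed by the inserted labelling.
exterior-ins : ∀ {Γ : Ctx n} {d} S P T b {A B L M e} → WL Γ A L → Trunk T M e →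
  Γ ⊢ᵀ tyP A L (overline P) ≈ mkB B e (leafHeight P) → dim A + leafHeight P ≤ d →
  Overlap (LowEq d Γ) S P T b L M →
  ∀ p → LowEq d Γ (L p) (exterior S P T b (ins S P T b L M) e (L (overline P)) p)
exterior-ins {Γ = Γ} {d} (S ∷ Ss) ([0] _) T b {L = L} {M} w h q lt (o , _) [0] =
  subst (LowEq d Γ (L [0])) (sym (append-[0] M (λ r → L (next r)))) o
exterior-ins {Γ = Γ} (S ∷ Ss) ([0] lin) T b {A} {B} {L} {M} {e} w h q lt o (0∷ p) =
  discLab-≈ S lin (λ r → w (0∷ r))
    (subst (Γ ⊢ᵀ tyP A L (0∷ zeros S) ≈_) (sym (mkB-up B e (depth (zeros S)))) q)
    (≤-trans (≤-reflexive (sym (+-suc (dim A) _))) lt) p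
exterior-ins {Γ = Γ} {d} (S ∷ Ss) ([0] _) T b {L = L} {M} w h q lt (_ , o) (next [0]) =
  subst (LowEq d Γ (L (next [0]))) (sym (append-join T M (λ r → L (next r)))) o
exterior-ins (S ∷ Ss) ([0] _) T b {L = L} {M} w h q lt o (next (0∷ p)) =
  inj₁ (sym (append-++⁺ʳ T M (λ r → L (next r)) (0∷ p)))
exterior-ins (S ∷ Ss) ([0] _) T b {L = L} {M} w h q lt o (next (next p)) =
  inj₁ (sym (append-++⁺ʳ T M (λ r → L (next r)) (next p)))
exterior-ins (S ∷ Ss) (0∷ P) (T ∷ []) (s≤s b) w h q lt (o , _) [0] = o
exterior-ins {Γ = Γ} (S ∷ Ss) (0∷ P) (T ∷ []) (s≤s b) {A} {B} {L} {M} {e} w h q lt (_ , _ , o) (0∷ p) =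
  exterior-ins S P T b (λ p → w (0∷ p)) (Trunk-up M h)
    (subst (Γ ⊢ᵀ tyP A L (0∷ overline P) ≈_) (sym (mkB-up B e (leafHeight P))) q)
    (≤-trans (≤-reflexive (sym (+-suc (dim A) (leafHeight P)))) lt) o p
exterior-ins (S ∷ Ss) (0∷ P) (T ∷ []) (s≤s b) w h q lt (_ , o , _) (next [0]) = o
exterior-ins (S ∷ Ss) (0∷ P) (T ∷ []) (s≤s b) w h q lt o (next (0∷ p))   = inj₁ refl
exterior-ins (S ∷ Ss) (0∷ P) (T ∷ []) (s≤s b) w h q lt o (next (next p)) = inj₁ refl
exterior-ins (S ∷ Ss) (next P) T b w h q lt o [0]      = inj₁ refl
exterior-ins (S ∷ Ss) (next P) T b w h q lt o (0∷ p)   = inj₁ refl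
exterior-ins (S ∷ Ss) (next P) T b w h q lt o (next p) = exterior-ins Ss P T b (λ r → w (next r)) h q lt o p

ins-[0] : ∀ {Γ : Ctx n} {d} S P T b {L M} → Overlap (LowEq d Γ) S P T b L M →
          LowEq d Γ (L [0]) (ins S P T b L M [0])
ins-[0] {Γ = Γ} {d} (S ∷ Ss) ([0] _) T b {L} {M} (o , _) =
  subst (LowEq d Γ (L [0])) (sym (append-[0] M (λ r → L (next r)))) o
ins-[0] (S ∷ Ss) (0∷ P)   (T ∷ []) (s≤s b) (o , _) = o
ins-[0] (S ∷ Ss) (next P) T        b       o       = inj₁ refl

append-WL : ∀ {Γ : Ctx n} T {U A B} {M : Labelling T n} {L : Labelling U n} → WL Γ B M → WL Γ A L →
  Γ ⊢ᵀ B ≈ A → Γ ⊢ L [0] ≈ M [len] → WL Γ A (append M L)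
append-WL []       w v e o [0]      = conv (w [0]) e
append-WL [] {L = L} w v e o (0∷ p) = conv (v (0∷ p)) (tyP-base (λ r → L (0∷ r)) (arr o (≈ᵀ-refl _) (≈-refl _)) p)
append-WL []       w v e o (next p) = v (next p)
append-WL (T ∷ Ts) w v e o [0]      = conv (w [0]) e
append-WL (T ∷ Ts) {M = M} {L} w v e o (0∷ p) = conv (w (0∷ p)) (tyP-base (λ r → M (0∷ r))
  (arr (≈-refl _) e (≈-reflexive (sym (append-[0] (λ r → M (next r)) L)))) p)
append-WL (T ∷ Ts) w v e o (next p) = append-WL Ts (λ r → w (next r)) v e o p

-- Copied labels keep their terms but acquire new neighbours, hence new types. The overlap supplies
-- the conversions.
ins-WL : ∀ {Γ : Ctx n} {d} S P T b {A B L M} → WL Γ A L → WL Γ B M → Γ ⊢ᵀ B ≈ A →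
         Overlap (LowEq d Γ) S P T b L M → WL Γ A (ins S P T b L M)
ins-WL (S ∷ Ss) ([0] _) T b w v e (_ , o) = append-WL T v (λ r → w (next r)) e (LowEq⇒≈ o)
ins-WL (S ∷ Ss) (0∷ P) (T ∷ []) (s≤s b) w v e o [0] = conv (v [0]) e
ins-WL (S ∷ Ss) (0∷ P) (T ∷ []) (s≤s b) {A} {B} {L} {M} w v e (o₀ , o₁ , o) (0∷ p) =
  conv (ins-WL S P T b (λ r → w (0∷ r)) (λ r → v (0∷ r))
         (arr (≈-sym (LowEq⇒≈ o₀)) e (≈-sym (LowEq⇒≈ o₁))) o p)
    (tyP-base _ (arr (LowEq⇒≈ o₀) (≈ᵀ-refl A) (LowEq⇒≈ o₁)) p)
ins-WL (S ∷ Ss) (0∷ P) (T ∷ []) (s≤s b) w v e o (next [0]) = conv (v (next [0])) e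
ins-WL (S ∷ Ss) (0∷ P) (T ∷ []) (s≤s b) {L = L} w v e (_ , o , _) (next (0∷ p)) =
  conv (w (next (0∷ p))) (tyP-base (λ r → L (next (0∷ r))) (arr (LowEq⇒≈ o) (≈ᵀ-refl _) (≈-refl _)) p)
ins-WL (S ∷ Ss) (0∷ P) (T ∷ []) (s≤s b) w v e o (next (next p)) = w (next (next p))
ins-WL (S ∷ Ss) (next P) T b w v e o [0] = w [0]
ins-WL (S ∷ Ss) (next P) T b {L = L} w v e o (0∷ p) = conv (w (0∷ p))
  (tyP-base (λ r → L (0∷ r)) (arr (≈-refl _) (≈ᵀ-refl _) (LowEq⇒≈ (ins-[0] Ss P T b o))) p)
ins-WL (S ∷ Ss) (next P) T b w v e o (next p) = ins-WL Ss P T b (λ r → w (next r)) v e o p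

-- Insertion preserves regularity of supports

Bd-full : ∀ ε {i T} → height T ≤ i → ∀ (q : Path T) → Bd ε i q
Bd-full ε {i} {T} h q =
  Bdry⇒Bd ε i q (Bdry-full ε (tree-VarCtx T) (≤-trans (≤-reflexive (dimCtx-⌊⌋ T)) h) (pathVar T q))

Bd-up : ∀ ε η {i j T} (q : Path T) → i < j → Bd η i q → Bd ε j q
Bd-up ε η {i} {j} q lt b = Bd-low ε j q (≤-<-trans (Bd-depth η i q b) lt)

Bd-++⁺ˡ : ∀ ε i {T} U (q : Path T) → Bd ε (suc i) q → Bd ε (suc i) (++⁺ˡ U q)
Bd-++⁺ˡ ε i U [0]      b = tt
Bd-++⁺ˡ ε i U (0∷ q)   b = b
Bd-++⁺ˡ ε i U (next q) b = Bd-++⁺ˡ ε i U q b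

Bd-++⁺ʳ : ∀ ε i T {U} (q : Path U) → Bd ε (suc i) q → Bd ε (suc i) (++⁺ʳ T q)
Bd-++⁺ʳ ε i []       q b = b
Bd-++⁺ʳ ε i (T ∷ Ts) q b = Bd-++⁺ʳ ε i Ts q b

IsLast-++⁺ʳ : ∀ T {U} (q : Path U) → IsLast q → IsLast (++⁺ʳ T q)
IsLast-++⁺ʳ []       q l = l
IsLast-++⁺ʳ (T ∷ Ts) q l = IsLast-++⁺ʳ Ts q l

[len]-++⁺ʳ : ∀ T {U} → ++⁺ʳ T {U} [len] ≡ [len]
[len]-++⁺ʳ []       = refl
[len]-++⁺ʳ (T ∷ Ts) = cong next ([len]-++⁺ʳ Ts)

data SplitPath {T U} : Path (T ++ U) → Set where
  left  : ∀ q → SplitPath (++⁺ˡ {T} U q)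
  right : ∀ q → SplitPath (++⁺ʳ T {U} q)

splitPath : ∀ T {U} (r : Path (T ++ U)) → SplitPath {T} {U} r
splitPath []       r        = right r
splitPath (T ∷ Ts) [0]      = left [0]
splitPath (T ∷ Ts) (0∷ r)   = left (0∷ r)
splitPath (T ∷ Ts) (next r) with splitPath Ts r
... | left q  = left (next q)
... | right q = right q

Bd-++⁺ˡ⁻ : ∀ ε i {T} U (q : Path T) → Bd ε (suc i) (++⁺ˡ U q) → Bd ε (suc i) q
Bd-++⁺ˡ⁻ ε i U [0]      b = tt
Bd-++⁺ˡ⁻ ε i U (0∷ q)   b = b
Bd-++⁺ˡ⁻ ε i U (next q) b = Bd-++⁺ˡ⁻ ε i U q b

Bd-++⁺ʳ⁻ : ∀ ε i T {U} (q : Path U) → Bd ε (suc i) (++⁺ʳ T q) → Bd ε (suc i) q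
Bd-++⁺ʳ⁻ ε i []       q b = b
Bd-++⁺ʳ⁻ ε i (T ∷ Ts) q b = Bd-++⁺ʳ⁻ ε i Ts q b

-- The offset `k` is the depth at which the disc starts: the `j`-th of the remaining ends lives in
-- dimension `k + j` of `T`.
discLab-Bd⇒ : ∀ {X : Set} {T} (Q : Tm n → X → Set) (f : Path T → X) S → Linear S → ∀ k e t →
  (∀ ε j {r} → Q (e ε j) r → ∃[ q ] Bd ε (k + j) q × f q ≡ r) → (∀ {r} → Q t r → ∃[ q ] f q ≡ r) →
  height T ≤ k + depth (zeros S) → ∀ ε i p → Bd ε i p → ∀ {r} → Q (discLab {T = S} e t p) r →
  ∃[ q ] Bd ε (k + i) q × f q ≡ r
discLab-Bd⇒ Q f [] lin k e t g h le ε i [0] b x =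
  let q , eq = h x in q , Bd-full ε (≤-trans le (+-monoʳ-≤ k z≤n)) q , eq
discLab-Bd⇒ Q f (S ∷ []) lin k e t g h le Sign.- zero [0] b x = g _ 0 x
discLab-Bd⇒ Q f (S ∷ []) lin k e t g h le ε (suc i) [0] b x =
  let q , b , eq = g _ 0 x in q , Bd-up ε _ q (+-monoʳ-< k (s≤s z≤n)) b , eq
discLab-Bd⇒ Q f (S ∷ []) lin k e t g h le Sign.+ zero (next [0]) b x = g _ 0 x
discLab-Bd⇒ Q f (S ∷ []) lin k e t g h le ε (suc i) (next [0]) b x =
  let q , b , eq = g _ 0 x in q , Bd-up ε _ q (+-monoʳ-< k (s≤s z≤n)) b , eq
discLab-Bd⇒ Q f (S ∷ []) lin k e t g h le Sign.- zero (0∷ p) () x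
discLab-Bd⇒ Q f (S ∷ []) lin k e t g h le Sign.+ zero (0∷ p) () x
discLab-Bd⇒ Q f (S ∷ []) lin k e t g h le ε (suc i) (0∷ p) b x =
  let q , b , eq = discLab-Bd⇒ Q f S (suc-injective lin) (suc k) (up e) t
        (λ ε j y → let q , b , eq = g ε (suc j) y in q , subst (λ l → Bd ε l q) (+-suc k j) b , eq)
        h (≤-trans le (≤-reflexive (+-suc k _))) ε i p b x
  in q , subst (λ l → Bd ε l q) (sym (+-suc k i)) b , eq
discLab-Bd⇒ Q f (S ∷ U ∷ Us) lin k e t g h le ε i p b x = linear-single S U Us lin

-- `Q` abstracts the occurrence of a variable in a term, because in a subtree it has to be
-- precomposed with `0∷` or `next`. With the converse, `exterior-Bd⇐`, it follows that `κ` sends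
-- each boundary of `S` onto the same boundary of the inserted tree, up to support.
exterior-Bd⇒ : ∀ S P T b {ρ : Labelling (insert S P T b) n} {e t} (Q : Tm n → Path (insert S P T b) → Set) →
  (∀ r {r′} → Q (ρ r) r′ → r ≡ r′) →
  (∀ ε j {r} → Q (e ε j) r → ∃[ q ] Bd ε j q × ι S P T b q ≡ r) →
  (∀ {r} → Q t r → ∃[ q ] ι S P T b q ≡ r) → height T ≤ leafHeight P →
  ∀ ε i p → Bd ε i p → ∀ {r} → Q (exterior S P T b ρ e t p) r → Bd ε i r
exterior-Bd⇒ (S ∷ Ss) ([0] _) T b Q f g h le Sign.- zero [0] c x with f [0] x
... | refl = tt
exterior-Bd⇒ (S ∷ Ss) ([0] _) T b Q f g h le ε (suc i) [0] c x with f [0] x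
... | refl = tt
exterior-Bd⇒ (S ∷ Ss) ([0] _) T b Q f g h le Sign.+ zero (next p) c x with f (++⁺ʳ T p) x
... | refl = IsLast-++⁺ʳ T p c
exterior-Bd⇒ (S ∷ Ss) ([0] _) T b Q f g h le ε (suc i) (next p) c x with f (++⁺ʳ T p) x
... | refl = Bd-++⁺ʳ ε i T p c
exterior-Bd⇒ (S ∷ Ss) ([0] _) T b Q f g h le Sign.- zero (0∷ p) () x
exterior-Bd⇒ (S ∷ Ss) ([0] _) T b Q f g h le Sign.+ zero (0∷ p) () x
exterior-Bd⇒ (S ∷ Ss) ([0] lin) T b {e = e} {t} Q f g h le ε (suc i) (0∷ p) c x
  with discLab-Bd⇒ Q (++⁺ˡ Ss) S lin 1 (up e) t (λ ε j → g ε (suc j)) h le ε i p c x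
... | q , c′ , refl = Bd-++⁺ˡ ε i Ss q c′
exterior-Bd⇒ (S ∷ Ss) (0∷ P) (T ∷ []) (s≤s b) Q f g h le Sign.- zero [0] c x with f [0] x
... | refl = tt
exterior-Bd⇒ (S ∷ Ss) (0∷ P) (T ∷ []) (s≤s b) Q f g h le ε (suc i) [0] c x with f [0] x
... | refl = tt
exterior-Bd⇒ (S ∷ Ss) (0∷ P) (T ∷ []) (s≤s b) Q f g h le Sign.+ zero (next p) c x with f (next p) x
... | refl = c
exterior-Bd⇒ (S ∷ Ss) (0∷ P) (T ∷ []) (s≤s b) Q f g h le ε (suc i) (next p) c x with f (next p) x
... | refl = c
exterior-Bd⇒ (S ∷ Ss) (0∷ P) (T ∷ []) (s≤s b) Q f g h le Sign.- zero (0∷ p) () x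
exterior-Bd⇒ (S ∷ Ss) (0∷ P) (T ∷ []) (s≤s b) Q f g h le Sign.+ zero (0∷ p) () x
exterior-Bd⇒ (S ∷ Ss) (0∷ P) (T ∷ []) (s≤s b) {ρ} {e} {t} Q f g h le ε (suc i) (0∷ p) c {[0]} x = tt
exterior-Bd⇒ (S ∷ Ss) (0∷ P) (T ∷ []) (s≤s b) {ρ} {e} {t} Q f g h le ε (suc i) (0∷ p) c {next r} x
  with exterior-rel S P T b (λ u _ → ∀ {r} → Q u (next r) → r ≡ [0])
         {ρ = λ q → ρ (0∷ q)} {λ q → ρ (0∷ q)} {up e} {up e} {t} {t}
         (λ q y → case f (0∷ q) y of λ ()) (λ ε j y → low (proj₁ (g ε (suc j) y)) (proj₂ (proj₂ (g ε (suc j) y))))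
         (λ y → low (proj₁ (h y)) (proj₂ (h y))) p x
  where
  low : ∀ q {r} → ι (S ∷ Ss) (0∷ P) (T ∷ []) (s≤s b) q ≡ next r → r ≡ [0]
  low (next [0]) refl = refl
... | refl = tt
exterior-Bd⇒ (S ∷ Ss) (0∷ P) (T ∷ []) (s≤s b) Q f g h le ε (suc i) (0∷ p) c {0∷ r} x =
  exterior-Bd⇒ S P T b (λ u r → Q u (0∷ r)) (λ r y → case f (0∷ r) y of λ { refl → refl })
    (λ ε j y → case g ε (suc j) y of λ { (0∷ q , d , refl) → q , d , refl ; (next [0] , _ , ()) })
    (λ y → case h y of λ { (0∷ q , refl) → q , refl ; (next [0] , ()) })
    (s≤s⁻¹ (≤-trans (m≤m⊔n (suc (height T)) 0) le)) ε i p c x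
exterior-Bd⇒ (S ∷ Ss) (next P) T b Q f g h le Sign.- zero [0] c x with f [0] x
... | refl = tt
exterior-Bd⇒ (S ∷ Ss) (next P) T b Q f g h le ε (suc i) [0] c x with f [0] x
... | refl = tt
exterior-Bd⇒ (S ∷ Ss) (next P) T b Q f g h le Sign.- zero (0∷ p) () x
exterior-Bd⇒ (S ∷ Ss) (next P) T b Q f g h le Sign.+ zero (0∷ p) () x
exterior-Bd⇒ (S ∷ Ss) (next P) T b Q f g h le ε (suc i) (0∷ p) c x with f (0∷ p) x
... | refl = c
exterior-Bd⇒ (S ∷ Ss) (next P) T b {ρ} {e} {t} Q f g h le ε i (next p) c {r} x
  with exterior-rel Ss P T b (λ u _ → ∀ {r} → Q u r → ∃[ r′ ] next r′ ≡ r)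
         {ρ = λ q → ρ (next q)} {λ q → ρ (next q)} {e} {e} {t} {t}
         (λ q y → q , f (next q) y) (λ ε j y → _ , proj₂ (proj₂ (g ε j y))) (λ y → _ , proj₂ (h y)) p x
exterior-Bd⇒ (S ∷ Ss) (next P) T b Q f g h le Sign.- zero (next p) () x | r , refl
exterior-Bd⇒ (S ∷ Ss) (next P) T b Q f g h le Sign.+ zero (next p) c x | r , refl =
  exterior-Bd⇒ Ss P T b (λ u r → Q u (next r)) (λ r y → case f (next r) y of λ { refl → refl })
    (λ ε j y → case g ε j y of λ { (q , d , refl) → q , d , refl })
    (λ y → case h y of λ { (q , refl) → q , refl }) le Sign.+ zero p c x
exterior-Bd⇒ (S ∷ Ss) (next P) T b Q f g h le ε (suc i) (next p) c x | r , refl =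
  exterior-Bd⇒ Ss P T b (λ u r → Q u (next r)) (λ r y → case f (next r) y of λ { refl → refl })
    (λ ε j y → case g ε j y of λ { (q , d , refl) → q , d , refl })
    (λ y → case h y of λ { (q , refl) → q , refl }) le ε (suc i) p c x

IsFirst⇒[0] : ∀ {T} (p : Path T) → IsEnd Sign.- p → [0] ≡ p
IsFirst⇒[0] [0] _ = refl

discLab-Bd⇐ : ∀ {T} (Q : Tm n → Path T → Set) S → Linear S → ∀ k e t →
  (∀ ε j q → Bd ε (k + j) q → Q (e ε j) q) → (∀ q → Q t q) → ∀ ε i q → Bd ε (k + i) q →
  ∃[ p ] Bd ε i p × Q (discLab {T = S} e t p) q
discLab-Bd⇐ Q [] lin k e t g h ε i q b = [0] , Bd-full ε {i} {[]} z≤n [0] , h q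
discLab-Bd⇐ Q (S ∷ []) lin k e t g h Sign.- zero q b = [0] , tt , g _ 0 q b
discLab-Bd⇐ Q (S ∷ []) lin k e t g h Sign.+ zero q b = next [0] , tt , g _ 0 q b
discLab-Bd⇐ Q (S ∷ []) lin k e t g h ε (suc i) q b =
  let p , c , x = discLab-Bd⇐ Q S (suc-injective lin) (suc k) (up e) t
        (λ ε j q b → g ε (suc j) q (subst (λ l → Bd ε l q) (sym (+-suc k j)) b)) h ε i q
        (subst (λ l → Bd ε l q) (+-suc k i) b)
  in 0∷ p , c , x
discLab-Bd⇐ Q (S ∷ U ∷ Us) lin k e t g h ε i q b = linear-single S U Us lin

exterior-Bd⇐ : ∀ S P T b {ρ : Labelling (insert S P T b) n} {e t} (Q : Tm n → Path (insert S P T b) → Set) →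
  (∀ r → Q (ρ r) r) → (∀ ε j q → Bd ε j q → Q (e ε j) (ι S P T b q)) → (∀ q → Q t (ι S P T b q)) →
  ∀ ε i r → Bd ε i r → ∃[ p ] Bd ε i p × Q (exterior S P T b ρ e t p) r
exterior-Bd⇐ (S ∷ Ss) ([0] _) T b {ρ} Q f g h Sign.- zero r c = [0] , tt , subst (Q (ρ [0])) (IsFirst⇒[0] r c) (f [0])
exterior-Bd⇐ (S ∷ Ss) ([0] _) T b {ρ} Q f g h Sign.+ zero r c with IsLast⇒[len] r c
... | refl = [len] , IsLast-[len] (S ∷ Ss) , subst (λ p → Q (ρ p) [len]) (sym ([len]-++⁺ʳ T)) (f [len])
exterior-Bd⇐ (S ∷ Ss) ([0] lin) T b {e = e} {t} Q f g h ε (suc i) r c with splitPath T r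
... | right p = next p , Bd-++⁺ʳ⁻ ε i T p c , f (++⁺ʳ T p)
... | left q  =
  let p , c′ , x = discLab-Bd⇐ (λ u q → Q u (++⁺ˡ Ss q)) S lin 1 (up e) t (λ ε j → g ε (suc j)) h ε i q
                     (Bd-++⁺ˡ⁻ ε i Ss q c)
  in 0∷ p , c′ , x
exterior-Bd⇐ (S ∷ Ss) (0∷ P) (T ∷ []) (s≤s b) Q f g h Sign.- zero [0] c = [0] , tt , f [0]
exterior-Bd⇐ (S ∷ Ss) (0∷ P) (T ∷ []) (s≤s b) Q f g h Sign.+ zero (next r) c = next r , c , f (next r)
exterior-Bd⇐ (S ∷ Ss) (0∷ P) (T ∷ []) (s≤s b) Q f g h ε (suc i) [0] c = [0] , tt , f [0]
exterior-Bd⇐ (S ∷ Ss) (0∷ P) (T ∷ []) (s≤s b) Q f g h ε (suc i) (next r) c = next r , c , f (next r)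
exterior-Bd⇐ (S ∷ Ss) (0∷ P) (T ∷ []) (s≤s b) Q f g h ε (suc i) (0∷ r) c =
  let p , c′ , x = exterior-Bd⇐ S P T b (λ u r → Q u (0∷ r)) (λ r → f (0∷ r)) (λ ε j q → g ε (suc j) (0∷ q))
                     (λ q → h (0∷ q)) ε i r c
  in 0∷ p , c′ , x
exterior-Bd⇐ (S ∷ Ss) (next P) T b Q f g h Sign.- zero [0] c = [0] , tt , f [0]
exterior-Bd⇐ (S ∷ Ss) (next P) T b Q f g h ε (suc i) [0] c = [0] , tt , f [0]
exterior-Bd⇐ (S ∷ Ss) (next P) T b Q f g h ε (suc i) (0∷ r) c = 0∷ r , c , f (0∷ r)
exterior-Bd⇐ (S ∷ Ss) (next P) T b Q f g h Sign.+ zero (next r) c =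
  let p , c′ , x = exterior-Bd⇐ Ss P T b (λ u r → Q u (next r)) (λ r → f (next r)) g h Sign.+ zero r c
  in next p , c′ , x
exterior-Bd⇐ (S ∷ Ss) (next P) T b Q f g h ε (suc i) (next r) c =
  let p , c′ , x = exterior-Bd⇐ Ss P T b (λ u r → Q u (next r)) (λ r → f (next r)) g h ε (suc i) r c
  in next p , c′ , x

height-++ : ∀ T U → height (T ++ U) ≡ height T ⊔ height U
height-++ []       U = refl
height-++ (T ∷ Ts) U = trans (cong (suc (height T) ⊔_) (height-++ Ts U)) (sym (⊔-assoc (suc (height T)) (height Ts) (height U)))

height-insert : ∀ S P T b → height T ≤ leafHeight P → height (insert S P T b) ≤ height S
height-insert (S ∷ Ss) ([0] lin) T b h = ≤-trans (≤-reflexive (height-++ T Ss))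
  (⊔-mono-≤ (≤-trans h (≤-reflexive (cong suc (depth-zeros S lin)))) ≤-refl)
height-insert (S ∷ Ss) (0∷ P) (T ∷ []) (s≤s b) h =
  ⊔-mono-≤ (s≤s (height-insert S P T b (s≤s⁻¹ (≤-trans (m≤m⊔n (suc (height T)) 0) h)))) (≤-refl {height Ss})
height-insert (S ∷ Ss) (next P) T b h = ⊔-mono-≤ (≤-refl {suc (height S)}) (height-insert Ss P T b h)

module _ (S : Tree) (P : Branch S) (T : Tree) (b : branchHeight P ≤ trunkHeight T) (h : height T ≤ leafHeight P) where
  private
    R = insert S P T b
    σ = toSub (ιSub S P T b)
    f = ι S P T b

  ι-typed : ⌊ R ⌋ ⊢ˢ σ ∶ ⌊ T ⌋
  ι-typed = WL⇒⊢ˢ (WL-ι S P T b (WL-path R))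

  κ-typed : ⌊ R ⌋ ⊢ˢ toSub (κ S P T b) ∶ ⌊ S ⌋
  κ-typed = WL⇒⊢ˢ (κ-WL S P T b h)

  ι-FV⁻ : ∀ t {r} → pathVar R r ∈ FV (t ⟦ σ ⟧) → ∃[ q ] pathVar T q ∈ FV t × f q ≡ r
  ι-FV⁻ t {r} r∈ with FV-⟦⟧⁻ t σ r∈
  ... | z , z∈ , e = varPath T z , subst (_∈ FV t) (sym (pathVar-varPath T z)) z∈
    , sym (∈-path {R} {r} {f (varPath T z)} (subst (λ u → pathVar R r ∈ FV u) (lookup-toSub-var (ιSub S P T b) z) e))

  ι-Supp : ∀ t q → Supp ⌊ T ⌋ t (pathVar T q) → Supp ⌊ R ⌋ (t ⟦ σ ⟧) (pathVar R (f q))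
  ι-Supp t q s = Supp-⟦⟧ t (⊢ˢ-Supp ι-typed) s
    (subst (λ u → pathVar R (f q) ∈ FV u) (sym (lookup-toSub (ιSub S P T b) q)) (x∈⁅x⁆ _))

  κ-FV : ∀ ε i p → Bd ε i p → ∀ {r} → pathVar R r ∈ FV (κ S P T b p) → Bd ε i r
  κ-FV ε i p c {r} x = exterior-Bd⇒ S P T b (λ u r → pathVar R r ∈ FV u)
    (λ r {r′} y → sym (∈-path {R} {r′} {r} y))
    (λ ε j {r} y → let q , q∈ , e = ι-FV⁻ (stdEnd ε j T) y in q , proj₁ (stdEnd-≐ ε j T q) (base q∈) , e)
    (λ y → let q , _ , e = ι-FV⁻ (𝒞 (leafHeight P) T) y in q , e) h ε i p c
    (subst (λ u → pathVar R r ∈ FV u) (κ-exterior S P T b p) x)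

  κ-Supp : ∀ ε i r → Bd ε i r → ∃[ p ] Bd ε i p × Supp ⌊ R ⌋ (κ S P T b p) (pathVar R r)
  κ-Supp ε i r c with exterior-Bd⇐ S P T b (λ u r → Supp ⌊ R ⌋ u (pathVar R r)) (λ r → base (x∈⁅x⁆ (pathVar R r)))
    (λ ε j q y → ι-Supp (stdEnd ε j T) q (stdEnd-Supp⇐ ε j T q y))
    (λ q → ι-Supp (𝒞 (leafHeight P) T) q (base (FVSub-lookup⁺ idSub (pathVar T q)
       (subst (λ u → pathVar T q ∈ FV u) (sym (lookup-id (pathVar T q))) (x∈⁅x⁆ _))))) ε i r c
  ... | p , c′ , x = p , c′ , subst (λ u → Supp ⌊ R ⌋ u (pathVar R r)) (sym (κ-exterior S P T b p)) x

  κ-≐ : ∀ ε i s → _≐ᵖ_ {S} (Supp ⌊ S ⌋ s) (Bd ε i) →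
        _≐ᵖ_ {R} (Supp ⌊ R ⌋ (s ⟦ toSub (κ S P T b) ⟧)) (Bd ε i)
  κ-≐ ε i s f r =
      (λ u → subst (Bd ε i) (lookup-paths R r) (Closure-Bd {R} {ε = ε} {i} fv u))
    , λ c → let p , c′ , x = κ-Supp ε i r c in
        Closure-bind (λ {y} y∈ → Supp-⟦⟧ s (⊢ˢ-Supp κ-typed) (proj₂ (f p) c′)
          (subst (λ u → y ∈ FV u) (sym (lookup-toSub (κ S P T b) p)) y∈)) x
    where
    fv : ∀ p → pathVar R p ∈ FV (s ⟦ toSub (κ S P T b) ⟧) → Bd ε i p
    fv p p∈ with FV-⟦⟧⁻ s (toSub (κ S P T b)) p∈
    ... | z , z∈ , e = κ-FV ε i (varPath S z)
      (proj₁ (f (varPath S z)) (base (subst (_∈ FV s) (sym (pathVar-varPath S z)) z∈)))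
      (subst (λ u → pathVar R p ∈ FV u) (lookup-toSub-var (κ S P T b) z) e)

  -- Insertion does not increase the height, so the dimension `i` witnessing regularity over `S`
  -- serves again.
  insert-regular : ∀ s t → Regular ⌊ S ⌋ (Supp ⌊ S ⌋ s) (Supp ⌊ S ⌋ t) →
    Regular ⌊ R ⌋ (Supp ⌊ R ⌋ (s ⟦ toSub (κ S P T b) ⟧)) (Supp ⌊ R ⌋ (t ⟦ toSub (κ S P T b) ⟧))
  insert-regular s t r with regular-tree S r
  ... | i , le , f , g = tree-regular R i (≤-trans (height-insert S P T b h) le)
          (κ-≐ Sign.- i s f) (κ-≐ Sign.+ i t g)

-- Subject reduction

inv-sub : ∀ {Γ : Ctx n} {Δ : Ctx m} {A σ B} → CohInv Γ Δ A σ B → Γ ⊢ˢ σ ∶ Δ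
inv-sub (cohInv _ _ s _ _) = s

inv-ty : ∀ {Γ : Ctx n} {Δ : Ctx m} {A σ B} → CohInv Γ Δ A σ B → Γ ⊢ᵀ A ⟦ σ ⟧ᵀ ≈ B
inv-ty (cohInv _ _ _ _ e) = e

VarTy⇒⊢ᵀ : ∀ {Γ : Ctx n} {A} → VarTy Γ A → Γ ⊢ᵀ A
VarTy⇒⊢ᵀ ⋆ = ⋆
VarTy⇒⊢ᵀ {Γ = Γ} (arr x y e f a) =
  arr (VarTy⇒⊢ᵀ a) (subst (Γ ⊢ var x ∶_) e (var x)) (subst (Γ ⊢ var y ∶_) f (var y))

Disc-ps′ : ∀ d → Disc d ⊢ps var zero ∶ DiscType d
Disc-ps′ zero    = pss
Disc-ps′ (suc d) = pse (Disc-ps′ d)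

ps-down : ∀ {Γ : Ctx n} A {x} → Γ ⊢ps x ∶ A → Γ ⊢ps
ps-down ⋆            d = ps d
ps-down (s ⇒[ A ] t) d = ps-down A (psd d)

Disc-ps : ∀ d → Disc d ⊢ps
Disc-ps d = ps-down (DiscType d) (Disc-ps′ d)

FVTy-wk : ∀ (A : Ty n) {x} → x ∈ FVTy A → suc x ∈ FVTy (wkTy A)
FVTy-wk A {x} x∈ = subst (λ B → suc x ∈ FVTy B) (sym (wkTy-sub A)) (FVTy-⟦⟧⁺ A shift x∈
  (subst (λ t → suc x ∈ FV t) (sym (lookup∘tabulate (λ y → var (suc y)) x)) (x∈⁅x⁆ _)))

Sphere-FV : ∀ d x → x ∈ FVTy (SphereType d)
Sphere-FV (suc d) zero          = FVTy-tgt (var (suc zero)) (wkTy (wkTy (SphereType d))) (var zero) (x∈⁅x⁆ _)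
Sphere-FV (suc d) (suc zero)    = FVTy-src (var (suc zero)) (wkTy (wkTy (SphereType d))) (var zero) (x∈⁅x⁆ _)
Sphere-FV (suc d) (suc (suc x)) = FVTy-base (var (suc zero)) (wkTy (wkTy (SphereType d))) (var zero)
  (FVTy-wk (wkTy (SphereType d)) (FVTy-wk (SphereType d) (Sphere-FV d x)))

Disc-Supp : ∀ d x → Supp (Disc d) (var zero) x
Disc-Supp d zero    = base (x∈⁅x⁆ zero)
Disc-Supp d (suc x) = step (base (x∈⁅x⁆ zero)) (FVTy-wk (SphereType d) (Sphere-FV d x))

dim-SphereType : ∀ d → dim (SphereType d) ≡ d
dim-SphereType zero    = refl
dim-SphereType (suc d) = cong suc (trans (dim-wk² (SphereType d)) (dim-SphereType d))

dimCtx-Sphere : ∀ d → dimCtx (Sphere d) ≤ d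
dimCtx-Sphere zero    = z≤n
dimCtx-Sphere (suc d) = ⊔-lub (⊔-lub (m≤n⇒m≤1+n (dimCtx-Sphere d))
  (m≤n⇒m≤1+n (≤-reflexive (dim-SphereType d))))
  (m≤n⇒m≤1+n (≤-reflexive (trans (dim-wk (SphereType d)) (dim-SphereType d))))

Disc-regular : ∀ d → Regular (Disc d) (Supp (Disc d) (var zero)) (Supp (Disc d) (var zero))
Disc-regular d with Disc-ps d
... | ps p = ps p , d , m≤n⇒m≤1+n le , full Sign.- , full Sign.+
  where
  le : dimCtx (Disc d) ≤ d
  le = ⊔-lub (dimCtx-Sphere d) (≤-reflexive (dim-SphereType d))
  full : ∀ ε → Supp (Disc d) (var zero) ≐ (_∈ ∂ps d ε p)
  full ε = (λ {x} _ → Bdry⇒∂ d ε p (Bdry-full ε (ps-VarTy p) le x)) , (λ {x} _ → Disc-Supp d x)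

fromSphere-typed : ∀ {Γ : Ctx n} {A} → Γ ⊢ᵀ A → Γ ⊢ˢ fromSphere A ∶ Sphere (dim A)
fromSphere-typed ⋆ = []
fromSphere-typed {Γ = Γ} (arr {s} {A} {t} a ds dt) =
  subst (Γ ⊢ t ∶_) (sym (trans (wkTy-∷ (SphereType (dim A)) (fromSphere A)) (SphereType-⟦⟧ A))) dt
  ∷ (subst (Γ ⊢ s ∶_) (sym (SphereType-⟦⟧ A)) ds ∷ fromSphere-typed a)

identity-typed : ∀ {Γ : Ctx n} {A t} → Γ ⊢ᵀ A → Γ ⊢ t ∶ A → Γ ⊢ identity A t ∶ t ⇒[ A ] t
identity-typed {Γ = Γ} {A} {t} a dt = subst (Γ ⊢ identity A t ∶_) (arr-cong refl (DiscType-⟦⟧ A t) refl)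
  (coh (Disc-ps d) (arr (VarTy⇒⊢ᵀ (ps-VarTy (Disc-ps′ d) zero)) (var zero) (var zero))
    (subst (Γ ⊢ t ∶_) (sym (SphereType-⟦⟧ A)) dt ∷ fromSphere-typed a) (Disc-regular d))
  where d = dim A

module _ {Γ : Ctx n} (S : Tree) (P : Branch S) (T : Tree) {L : Labelling S n} {M : Labelling T n}
         (w : WL Γ ⋆ L) (lab : L (overline P) ≡ 𝒞 (leafHeight P) T ⟦ toSub M ⟧) where
  private
    inv : CohInv Γ ⌊ T ⌋ (𝒰 (leafHeight P) T) (idSub • toSub M) (tyP ⋆ L (overline P))
    inv = coh-inv (subst (Γ ⊢_∶ tyP ⋆ L (overline P)) lab (w (overline P)))

  redex-M : WL Γ ⋆ M
  redex-M = ⊢ˢ⇒WL (subst (Γ ⊢ˢ_∶ ⌊ T ⌋) (id-• (toSub M)) (inv-sub inv))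

  redex-type : Γ ⊢ᵀ tyP ⋆ L (overline P) ≈ mkB ⋆ (ends M) (leafHeight P)
  redex-type = ≈ᵀ-sym (subst (Γ ⊢ᵀ_≈ tyP ⋆ L (overline P))
    (trans (cong (𝒰 (leafHeight P) T ⟦_⟧ᵀ) (id-• (toSub M)))
      (trans (𝒰-mk (leafHeight P) T (toSub M)) (mkB-⋆ (ends M) (leafHeight P)))) (inv-ty inv))

  module _ (b : branchHeight P ≤ trunkHeight T) {d : ℕ} (le : leafHeight P ≤ d) where
    redex-overlap : Overlap (LowEq d Γ) S P T b L M
    redex-overlap = overlaps S P T b w (Trunk-ends M) redex-type le

    redex-WL : WL Γ ⋆ (ins S P T b L M)
    redex-WL = ins-WL S P T b w redex-M ⋆ redex-overlap

    redex-κ : ∀ p → LowEq d Γ (L p) (κ S P T b p ⟦ toSub (ins S P T b L M) ⟧)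
    redex-κ p = subst (LowEq d Γ (L p))
      (trans (exterior-rel S P T b _≡_ (λ _ → refl)
        (λ ε i → cong (stdEnd ε i T ⟦_⟧) (toSub-cong (λ q → sym (ins-ι S P T b L M q))))
        (trans lab (cong (𝒞 (leafHeight P) T ⟦_⟧) (toSub-cong (λ q → sym (ins-ι S P T b L M q))))) p)
        (sym (κ-⟦⟧ S P T b (ins S P T b L M) p)))
      (exterior-ins S P T b w (Trunk-ends M) redex-type le redex-overlap p)

≈ˢ-κ : ∀ {Γ : Ctx n} {S} {L : Labelling S n} {κ′ : Labelling S m} {K : Sub m n} →
       (∀ p → Γ ⊢ L p ≈ κ′ p ⟦ K ⟧) → Γ ⊢ˢ toSub L ≈ toSub κ′ • K
≈ˢ-κ {Γ = Γ} {L = L} {κ′} {K} e =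
  subst (Γ ⊢ˢ toSub L ≈_) (sym (toSub-• κ′ K)) (≈ˢ-toSub e)

insert-typed : ∀ {Γ : Ctx n} S P T b {L : Labelling S n} {M A B} → height T ≤ leafHeight P →
  L (overline P) ≡ 𝒞 (leafHeight P) T ⟦ toSub M ⟧ → Γ ⊢ coh ⌊ S ⌋ A (toSub L) ∶ B →
  Γ ⊢ coh ⌊ insert S P T b ⌋ (A ⟦ toSub (κ S P T b) ⟧ᵀ) (toSub (ins S P T b L M)) ∶ B
insert-typed {Γ = Γ} S P T b {L} {M} h lab d with coh-inv d
... | cohInv {s} {A} {t} p a ds r e = conv
  (coh (tree-ps (insert S P T b)) (⊢ᵀ-⟦⟧ (κ-typed S P T b h) a)
    (WL⇒⊢ˢ (redex-WL S P T w lab b ≤-refl)) (insert-regular S P T b h s t r))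
  (≈ᵀ-trans (subst (Γ ⊢ᵀ_≈ (s ⇒[ A ] t) ⟦ toSub L ⟧ᵀ) (sym (⟦⟧ᵀ-• (s ⇒[ A ] t) _ _))
    (⟦⟧ᵀ-≈ (s ⇒[ A ] t) (≈ˢ-sym (≈ˢ-κ (λ p → LowEq⇒≈ (redex-κ S P T w lab b ≤-refl p)))))) e)
  where w = ⊢ˢ⇒WL ds

rule-typed : ∀ {Γ : Ctx n} {s t A} → sua′ Γ s t → Γ ⊢ s ∶ A → Γ ⊢ t ∶ A
rule-typed {Γ = Γ} (inj₁ (disc-removal A t)) d with coh-inv d
... | i with inv-sub i
...   | dt ∷ _ = conv (subst (Γ ⊢ t ∶_) (SphereType-⟦⟧ A) dt)
                   (subst (Γ ⊢ᵀ_≈ _) (DiscType-⟦⟧ A t) (inv-ty i))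
rule-typed (inj₂ (inj₁ (endo-coherence-removal Δ s A σ _))) d with coh-inv d
... | cohInv _ (arr a ds _) dσ _ e = conv (identity-typed (⊢ᵀ-⟦⟧ dσ a) (⊢-⟦⟧ dσ ds)) e
rule-typed (inj₂ (inj₂ (insertion {S} {P} {T} r A _ _ _))) d =
  insert-typed S P T (InsertionRedex.bh≤th r) (InsertionRedex.h≤lh r) (InsertionRedex.label r) d

Regular-≈ : ∀ {Δ : Ctx m} {s s′ t t′} → SameSupp Δ s s′ → SameSupp Δ t t′ →
            Regular Δ (Supp Δ s) (Supp Δ t) → Regular Δ (Supp Δ s′) (Supp Δ t′)
Regular-≈ (f , f′) (g , g′) (d , i , le , (u , u′) , (v , v′)) =
  d , i , le , (u ∘ f′ , f ∘ u′) , (v ∘ g′ , g ∘ v′)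

inv-type : ∀ {Γ : Ctx n} {Δ : Ctx m} {A σ B} → CohInv Γ Δ A σ B → Δ ⊢ᵀ A
inv-type (cohInv _ a _ _ _) = a

coh-≈ : ∀ {Γ : Ctx n} {Δ : Ctx m} {A B σ τ C} → CohInv Γ Δ A σ C → Δ ⊢ᵀ A ≈ B → Δ ⊢ᵀ B → Γ ⊢ˢ τ ∶ Δ →
        Γ ⊢ᵀ B ⟦ τ ⟧ᵀ ≈ C → Γ ⊢ coh Δ B τ ∶ C
coh-≈ (cohInv p _ _ r _) (arr {s = s} {t = t} {s′} {t′ = t′} e _ f) b d g =
  conv (coh p b d (Regular-≈ {s = s} {s′} {t} {t′} (≈-Supp e) (≈-Supp f) r)) g

-- Symmetry of equality requires both directions at once. Backwards along a rule, the left side is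
-- already typed by the premise of `rule`, and uniqueness of types adjusts the type.
≈-typed : ∀ {Γ : Ctx n} {s t A} → Γ ⊢ s ≈ t → (Γ ⊢ s ∶ A → Γ ⊢ t ∶ A) × (Γ ⊢ t ∶ A → Γ ⊢ s ∶ A)
≈ᵀ-typed : ∀ {Γ : Ctx n} {A B} → Γ ⊢ᵀ A ≈ B → (Γ ⊢ᵀ A → Γ ⊢ᵀ B) × (Γ ⊢ᵀ B → Γ ⊢ᵀ A)
≈ˢ-typed : ∀ {Γ : Ctx n} {Δ : Ctx m} {σ τ} → Γ ⊢ˢ σ ≈ τ → (Γ ⊢ˢ σ ∶ Δ → Γ ⊢ˢ τ ∶ Δ) × (Γ ⊢ˢ τ ∶ Δ → Γ ⊢ˢ σ ∶ Δ)
≈-typed (var-refl x)  = id , id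
≈-typed (≈-sym e)     = proj₂ (≈-typed e) , proj₁ (≈-typed e)
≈-typed (≈-trans e f) = proj₁ (≈-typed f) ∘ proj₁ (≈-typed e) , proj₂ (≈-typed e) ∘ proj₂ (≈-typed f)
≈-typed (rule r d)    = rule-typed r , λ d′ → conv d (type-unique (rule-typed r d) d′)
≈-typed (coh {A = A} {B} e f) =
    (λ d → let i = coh-inv d in coh-≈ i e (proj₁ (≈ᵀ-typed e) (inv-type i)) (proj₁ (≈ˢ-typed f) (inv-sub i))
      (≈ᵀ-trans (≈ᵀ-sym (≈ᵀ-trans (≈ᵀ-⟦⟧ (inv-sub i) e) (⟦⟧ᵀ-≈ B f))) (inv-ty i)))
  , (λ d → let i = coh-inv d in coh-≈ i (≈ᵀ-sym e) (proj₂ (≈ᵀ-typed e) (inv-type i)) (proj₂ (≈ˢ-typed f) (inv-sub i))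
      (≈ᵀ-trans (≈ᵀ-trans (⟦⟧ᵀ-≈ A f) (≈ᵀ-⟦⟧ (inv-sub i) e)) (inv-ty i)))
≈ᵀ-typed ⋆           = id , id
≈ᵀ-typed (arr e f g) =
    (λ { (arr a s t) → arr (proj₁ (≈ᵀ-typed f) a) (conv (proj₁ (≈-typed e) s) f) (conv (proj₁ (≈-typed g) t) f) })
  , (λ { (arr a s t) → arr (proj₂ (≈ᵀ-typed f) a) (conv (proj₂ (≈-typed e) s) (≈ᵀ-sym f))
                           (conv (proj₂ (≈-typed g) t) (≈ᵀ-sym f)) })
≈ˢ-typed [] = id , id
≈ˢ-typed (e ∷ f) =
    (λ { (_∷_ {A = A} d ds) → conv (proj₁ (≈-typed e) d) (⟦⟧ᵀ-≈ A f) ∷ proj₁ (≈ˢ-typed f) ds })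
  , (λ { (_∷_ {A = A} d ds) → conv (proj₂ (≈-typed e) d) (⟦⟧ᵀ-≈ A (≈ˢ-sym f)) ∷ proj₂ (≈ˢ-typed f) ds })

⟶⇒≈ : ∀ {Γ : Ctx n} {s t A} → Γ ⊢ s ∶ A → Γ ⊢ s ⟶ t → Γ ⊢ s ≈ t
⟶ᵀ⇒≈ : ∀ {Γ : Ctx n} {A B} → Γ ⊢ᵀ A → Γ ⊢ᵀ A ⟶ B → Γ ⊢ᵀ A ≈ B
⟶ˢ⇒≈ : ∀ {Γ : Ctx n} {Δ : Ctx m} {σ τ} → Γ ⊢ˢ σ ∶ Δ → Γ ⊢ˢ σ ⟶ τ → Γ ⊢ˢ σ ≈ τ
⟶⇒≈ (conv d e) r           = ⟶⇒≈ d r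
⟶⇒≈ d          (rule r)    = rule r d
⟶⇒≈ (coh p a ds r) (coh-ty s)  = coh (⟶ᵀ⇒≈ a s) (≈ˢ-refl _)
⟶⇒≈ (coh p a ds r) (coh-sub s) = coh (≈ᵀ-refl _) (⟶ˢ⇒≈ ds s)
⟶ᵀ⇒≈ (arr a s t) (src r)  = arr (⟶⇒≈ s r) (≈ᵀ-refl _) (≈-refl _)
⟶ᵀ⇒≈ (arr a s t) (base r) = arr (≈-refl _) (⟶ᵀ⇒≈ a r) (≈-refl _)
⟶ᵀ⇒≈ (arr a s t) (tgt r)  = arr (≈-refl _) (≈ᵀ-refl _) (⟶⇒≈ t r)
⟶ˢ⇒≈ (d ∷ ds) (head r) = ⟶⇒≈ d r ∷ ≈ˢ-refl _
⟶ˢ⇒≈ (d ∷ ds) (tail r) = ≈-refl _ ∷ ⟶ˢ⇒≈ ds r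

⟶-typed : ∀ {Γ : Ctx n} {s t A} → Γ ⊢ s ∶ A → Γ ⊢ s ⟶ t → Γ ⊢ t ∶ A
⟶-typed d r = proj₁ (≈-typed (⟶⇒≈ d r)) d

-- Commuting insertions

Sim-refl : ∀ {R : Tm n → Tm n → Set} → (∀ t → R t t) → ∀ T {L : Labelling T n} → Sim R T L T L
Sim-refl r T = Sim-intro T (λ p → r _)

append-[] : ∀ T (M : Labelling T n) (L : Labelling [] n) → Sim _≡_ (T ++ []) (append M L) T M
append-[] []       M L = refl
append-[] (T ∷ Ts) M L = refl , Sim-refl (λ _ → refl) T , append-[] Ts (λ p → M (next p)) L

-- A linear tree is nothing but its branch, and insertion overwrites the branch.
linear-insert : ∀ S → Linear S → ∀ P T b (L : Labelling S n) M →
                Sim _≡_ (insert S P T b) (ins S P T b L M) T M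
linear-insert (S ∷ [])     lin ([0] _) T        b       L M = append-[] T M (λ p → L (next p))
linear-insert (S ∷ [])     lin (0∷ P)  (T ∷ []) (s≤s b) L M =
  refl , linear-insert S (suc-injective lin) P T b _ _ , refl
linear-insert (S ∷ U ∷ Us) lin P       T        b       L M = linear-single S U Us lin

-- Distinct branches can reach one leaf, since a linear subtree may be entered to any depth before
-- stopping. Critical pairs are therefore sorted by leaf rather than by branch.
data Same : ∀ {S} → Branch S → Branch S → Set where
  [0]-[0]   : ∀ {S Ss} {l l′ : Linear S} → Same {S ∷ Ss} ([0] l) ([0] l′)
  [0]-0∷    : ∀ {S Ss} {l : Linear S} {Q} → Same {S ∷ Ss} ([0] l) (0∷ Q)
  0∷-[0]    : ∀ {S Ss} {l : Linear S} {P} → Same {S ∷ Ss} (0∷ P) ([0] l)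
  0∷-0∷     : ∀ {S Ss} {P Q : Branch S} → Same P Q → Same {S ∷ Ss} (0∷ P) (0∷ Q)
  next-next : ∀ {S Ss} {P Q : Branch Ss} → Same P Q → Same {S ∷ Ss} (next P) (next Q)

data Before : ∀ {S} → Branch S → Branch S → Set where
  [0]-next  : ∀ {S Ss} {l : Linear S} {Q} → Before {S ∷ Ss} ([0] l) (next Q)
  0∷-next   : ∀ {S Ss} {P : Branch S} {Q} → Before {S ∷ Ss} (0∷ P) (next Q)
  0∷-0∷     : ∀ {S Ss} {P Q : Branch S} → Before P Q → Before {S ∷ Ss} (0∷ P) (0∷ Q)
  next-next : ∀ {S Ss} {P Q : Branch Ss} → Before P Q → Before {S ∷ Ss} (next P) (next Q)

compare : ∀ {S} (P Q : Branch S) → Same P Q ⊎ Before P Q ⊎ Before Q P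
compare ([0] _)  ([0] _)  = inj₁ [0]-[0]
compare ([0] _)  (0∷ Q)   = inj₁ [0]-0∷
compare ([0] _)  (next Q) = inj₂ (inj₁ [0]-next)
compare (0∷ P)   ([0] _)  = inj₁ 0∷-[0]
compare (0∷ P)   (next Q) = inj₂ (inj₁ 0∷-next)
compare (next P) ([0] _)  = inj₂ (inj₂ [0]-next)
compare (next P) (0∷ Q)   = inj₂ (inj₂ 0∷-next)
compare (0∷ P)   (0∷ Q)   with compare P Q
... | inj₁ s        = inj₁ (0∷-0∷ s)
... | inj₂ (inj₁ s) = inj₂ (inj₁ (0∷-0∷ s))
... | inj₂ (inj₂ s) = inj₂ (inj₂ (0∷-0∷ s))
compare (next P) (next Q) with compare P Q
... | inj₁ s        = inj₁ (next-next s)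
... | inj₂ (inj₁ s) = inj₂ (inj₁ (next-next s))
... | inj₂ (inj₂ s) = inj₂ (inj₂ (next-next s))

overline-linear : ∀ {S} → Linear S → (P : Branch S) → overline P ≡ zeros S
overline-linear {S ∷ []}     lin ([0] _) = refl
overline-linear {S ∷ []}     lin (0∷ P)  = cong 0∷_ (overline-linear (suc-injective lin) P)
overline-linear {S ∷ U ∷ Us} lin P       = linear-single S U Us lin

same-leaf : ∀ {S} {P Q : Branch S} → Same P Q → overline P ≡ overline Q
same-leaf [0]-[0]              = refl
same-leaf ([0]-0∷ {l = l} {Q}) = cong 0∷_ (sym (overline-linear l Q))
same-leaf (0∷-[0] {l = l} {P}) = cong 0∷_ (overline-linear l P)
same-leaf (0∷-0∷ s)            = cong 0∷_ (same-leaf s)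
same-leaf (next-next s)        = cong next (same-leaf s)

Sim-sym : ∀ {R : Tm m → Tm n → Set} T {L} U {M} → Sim R T L U M → Sim (λ s t → R t s) U M T L
Sim-sym []       []       r           = r
Sim-sym (T ∷ Ts) (U ∷ Us) (r , s , t) = r , Sim-sym T U s , Sim-sym Ts Us t

Sim-map : ∀ {R R′ : Tm m → Tm n → Set} → (∀ {s t} → R s t → R′ s t) → ∀ T {L} U {M} → Sim R T L U M → Sim R′ T L U M
Sim-map f []       []       r           = f r
Sim-map f (T ∷ Ts) (U ∷ Us) (r , s , t) = f r , Sim-map f T U s , Sim-map f Ts Us t

Sim-trans : ∀ {R : Tm k → Tm l → Set} {R′ : Tm l → Tm m → Set} {R″ : Tm k → Tm m → Set} →
  (∀ {s t u} → R s t → R′ t u → R″ s u) → ∀ T {L} U {M} V {N} → Sim R T L U M → Sim R′ U M V N → Sim R″ T L V N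
Sim-trans f []       []       []       r           r′             = f r r′
Sim-trans f (T ∷ Ts) (U ∷ Us) (V ∷ Vs) (r , s , t) (r′ , s′ , t′) =
  f r r′ , Sim-trans f T U V s s′ , Sim-trans f Ts Us Vs t t′

same-insert : ∀ {S} {P Q : Branch S} → Same P Q → ∀ T b c (L : Labelling S n) M →
              Sim _≡_ (insert S P T b) (ins S P T b L M) (insert S Q T c) (ins S Q T c L M)
same-insert {S = S ∷ Ss} [0]-[0] T b c L M = Sim-refl (λ _ → refl) (T ++ Ss)
same-insert {S = S ∷ Ss} ([0]-0∷ {l = l} {Q}) (T ∷ []) b (s≤s c) L M =
  refl , Sim-sym (insert S Q T c) T (Sim-map sym (insert S Q T c) T (linear-insert S l Q T c _ _))
  , Sim-intro Ss λ { [0] → refl ; (0∷ p) → refl ; (next p) → refl }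
same-insert {S = S ∷ Ss} (0∷-[0] {l = l} {P}) (T ∷ []) (s≤s b) c L M =
  refl , linear-insert S l P T b _ _ , Sim-intro Ss λ { [0] → refl ; (0∷ p) → refl ; (next p) → refl }
same-insert {S = S ∷ Ss} (0∷-0∷ s) (T ∷ []) (s≤s b) (s≤s c) L M =
  refl , same-insert s T b c _ _ , Sim-intro Ss λ { [0] → refl ; (0∷ p) → refl ; (next p) → refl }
same-insert {S = S ∷ Ss} (next-next s) T b c L M =
  refl , Sim-refl (λ _ → refl) S , same-insert s T b c _ M

++⁺ʳ-branch : ∀ T {U} → Branch U → Branch (T ++ U)
++⁺ʳ-branch []       Q = Q
++⁺ʳ-branch (T ∷ Ts) Q = next (++⁺ʳ-branch Ts Q)

++⁺ʳ-bh : ∀ T {U} (Q : Branch U) → branchHeight (++⁺ʳ-branch T Q) ≡ branchHeight Q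
++⁺ʳ-bh []       Q = refl
++⁺ʳ-bh (T ∷ Ts) Q = ++⁺ʳ-bh Ts Q

overline-++⁺ʳ : ∀ T {U} (Q : Branch U) → overline (++⁺ʳ-branch T Q) ≡ ++⁺ʳ T (overline Q)
overline-++⁺ʳ []       Q = refl
overline-++⁺ʳ (T ∷ Ts) Q = cong next (overline-++⁺ʳ Ts Q)

depth-++⁺ʳ : ∀ T {U} (q : Path U) → depth (++⁺ʳ T q) ≡ depth q
depth-++⁺ʳ []       q = refl
depth-++⁺ʳ (T ∷ Ts) q = depth-++⁺ʳ Ts q

overline-positive : ∀ {S} (P : Branch S) → Positive (overline P)
overline-positive ([0] _)  = 0∷ _
overline-positive (0∷ P)   = 0∷ _
overline-positive (next P) = next _

-- For P before Q, the branch Q after an insertion at P, and conversely.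
moveʳ : ∀ {S} {P Q : Branch S} → Before P Q → ∀ T b → Branch (insert S P T b)
moveʳ ([0]-next {Q = Q}) T        b       = ++⁺ʳ-branch T Q
moveʳ (0∷-next {Q = Q})  (T ∷ []) (s≤s b) = next Q
moveʳ (0∷-0∷ s)          (T ∷ []) (s≤s b) = 0∷ moveʳ s T b
moveʳ (next-next s)      T        b       = next (moveʳ s T b)

moveˡ : ∀ {S} {P Q : Branch S} → Before P Q → ∀ U c → Branch (insert S Q U c)
moveˡ ([0]-next {l = l}) U        c       = [0] l
moveˡ (0∷-next {P = P})  U        c       = 0∷ P
moveˡ (0∷-0∷ s)          (U ∷ []) (s≤s c) = 0∷ moveˡ s U c
moveˡ (next-next s)      U        c       = next (moveˡ s U c)

moveʳ-bh : ∀ {S} {P Q : Branch S} (s : Before P Q) T b → branchHeight (moveʳ s T b) ≡ branchHeight Q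
moveʳ-bh ([0]-next {Q = Q}) T        b       = ++⁺ʳ-bh T Q
moveʳ-bh 0∷-next            (T ∷ []) (s≤s b) = refl
moveʳ-bh (0∷-0∷ s)          (T ∷ []) (s≤s b) = cong suc (moveʳ-bh s T b)
moveʳ-bh (next-next s)      T        b       = moveʳ-bh s T b

moveˡ-bh : ∀ {S} {P Q : Branch S} (s : Before P Q) U c → branchHeight (moveˡ s U c) ≡ branchHeight P
moveˡ-bh [0]-next      U        c       = refl
moveˡ-bh 0∷-next       U        c       = refl
moveˡ-bh (0∷-0∷ s)     (U ∷ []) (s≤s c) = cong suc (moveˡ-bh s U c)
moveˡ-bh (next-next s) U        c       = moveˡ-bh s U c

moveʳ-lh : ∀ {S} {P Q : Branch S} (s : Before P Q) T b → leafHeight (moveʳ s T b) ≡ leafHeight Q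
moveʳ-lh ([0]-next {Q = Q}) T        b       = trans (cong depth (overline-++⁺ʳ T Q)) (depth-++⁺ʳ T (overline Q))
moveʳ-lh 0∷-next            (T ∷ []) (s≤s b) = refl
moveʳ-lh (0∷-0∷ s)          (T ∷ []) (s≤s b) = cong suc (moveʳ-lh s T b)
moveʳ-lh (next-next s)      T        b       = moveʳ-lh s T b

moveˡ-lh : ∀ {S} {P Q : Branch S} (s : Before P Q) U c → leafHeight (moveˡ s U c) ≡ leafHeight P
moveˡ-lh [0]-next      U        c       = refl
moveˡ-lh 0∷-next       U        c       = refl
moveˡ-lh (0∷-0∷ s)     (U ∷ []) (s≤s c) = cong suc (moveˡ-lh s U c)
moveˡ-lh (next-next s) U        c       = moveˡ-lh s U c

ins-moveʳ : ∀ {S} {P Q : Branch S} (s : Before P Q) T b (L : Labelling S n) M →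
            ins S P T b L M (overline (moveʳ s T b)) ≡ L (overline Q)
ins-moveʳ ([0]-next {Q = Q}) T b L M = trans (cong (append M (λ p → L (next p))) (overline-++⁺ʳ T Q))
  (append-++⁺ʳ T M (λ p → L (next p)) (overline-positive Q))
ins-moveʳ (0∷-next {Q = Q}) (T ∷ []) (s≤s b) L M with overline Q | overline-positive Q
... | .(0∷ p)   | 0∷ p   = refl
... | .(next p) | next p = refl
ins-moveʳ (0∷-0∷ s)     (T ∷ []) (s≤s b) L M = ins-moveʳ s T b _ _
ins-moveʳ (next-next s) T        b       L M = ins-moveʳ s T b _ M

ins-moveˡ : ∀ {S} {P Q : Branch S} (s : Before P Q) U c (L : Labelling S n) N →
            ins S Q U c L N (overline (moveˡ s U c)) ≡ L (overline P)
ins-moveˡ [0]-next      U        c       L N = refl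
ins-moveˡ 0∷-next       U        c       L N = refl
ins-moveˡ (0∷-0∷ s)     (U ∷ []) (s≤s c) L N = ins-moveˡ s U c _ _
ins-moveˡ (next-next s) U        c       L N = ins-moveˡ s U c _ N

exterior-moveʳ : ∀ {S} {P Q : Branch S} (s : Before P Q) T b (ρ : Labelling (insert S P T b) n) e t →
           exterior S P T b ρ e t (overline Q) ≡ ρ (overline (moveʳ s T b))
exterior-moveʳ ([0]-next {Q = Q}) T b ρ e t = cong ρ (sym (overline-++⁺ʳ T Q))
exterior-moveʳ 0∷-next       (T ∷ []) (s≤s b) ρ e t = refl
exterior-moveʳ (0∷-0∷ s)     (T ∷ []) (s≤s b) ρ e t = exterior-moveʳ s T b _ _ t
exterior-moveʳ (next-next s) T        b       ρ e t = exterior-moveʳ s T b _ e t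

-- The commutation of insertions is used twice: with plain equality over a generic labelling, to
-- compare exteriors, and with `LowEq` over the given labelling.
record IsEq (R : Tm n → Tm n → Set) : Set where
  field
    rf : ∀ {s} → R s s
    sy : ∀ {s t} → R s t → R t s
    tr : ∀ {s t u} → R s t → R t u → R s u

module _ {R : Tm n → Tm n → Set} (E : IsEq R) where
  open IsEq E

  ins-[0]-rel : ∀ S P T b {L M} → Overlap R S P T b L M → R (L [0]) (ins S P T b L M [0])
  ins-[0]-rel (S ∷ Ss) ([0] _) T b {L} {M} (o , _) = subst (R (L [0])) (sym (append-[0] M (λ p → L (next p)))) o
  ins-[0]-rel (S ∷ Ss) (0∷ P)   (T ∷ []) (s≤s b) (o , _) = o
  ins-[0]-rel (S ∷ Ss) (next P) T        b       o       = rf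

  append-nil : ∀ {U} {M : Labelling [] n} {L : Labelling U n} → R (L [0]) (M [0]) → ∀ p → R (L p) (append M L p)
  append-nil o [0]      = o
  append-nil o (0∷ p)   = rf
  append-nil o (next p) = rf

  parallel-append : ∀ T {Ss} {M : Labelling T n} {L : Labelling Ss n} Q U c c′ {N} →
    R (L [0]) (M [len]) → Overlap R Ss Q U c L N →
    Sim R (insert (T ++ Ss) (++⁺ʳ-branch T Q) U c′) (ins (T ++ Ss) (++⁺ʳ-branch T Q) U c′ (append M L) N)
      (T ++ insert Ss Q U c) (append M (ins Ss Q U c L N))
  parallel-append [] {Ss} {M} {L} Q U c c′ {N} o ov with ≤-irrelevant c c′
  ... | refl = Sim-intro (insert Ss Q U c) λ p → tr
        (sy (insert-rel Ss Q U c R (append-nil o) (λ _ → rf) p))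
        (append-nil (tr (sy (ins-[0]-rel Ss Q U c ov)) o) p)
  parallel-append (T ∷ Ts) Q U c c′ o ov =
    rf , Sim-refl (λ _ → rf) T , parallel-append Ts Q U c c′ o ov

  ins-next-rel : ∀ S Ss (P : Branch S) T b {L : Labelling (S ∷ Ss) n} {M : Labelling (T ∷ []) n} →
    R (L (next [0])) (M (next [0])) → ∀ p → R (L (next p)) (ins (S ∷ Ss) (0∷ P) (T ∷ []) (s≤s b) L M (next p))
  ins-next-rel S Ss P T b o [0]      = o
  ins-next-rel S Ss P T b o (0∷ p)   = rf
  ins-next-rel S Ss P T b o (next p) = rf

  -- Branches may share boundary paths, and there the label depends on which insertion came last.
  -- The candidates are related through the corresponding label of `L` by the two overlaps;
  -- elsewhere both orders copy the same label.
  parallel : ∀ {S} {P Q : Branch S} (s : Before P Q) T b U c b′ c′ {L M N} →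
    Overlap R S P T b L M → Overlap R S Q U c L N →
    Sim R (insert (insert S P T b) (moveʳ s T b) U c′) (ins _ (moveʳ s T b) U c′ (ins S P T b L M) N)
      (insert (insert S Q U c) (moveˡ s U c) T b′) (ins _ (moveˡ s U c) T b′ (ins S Q U c L N) M)
  parallel ([0]-next {Q = Q}) T b U c b′ c′ (_ , o) o′ = parallel-append T Q U c c′ o o′
  parallel (0∷-next {S = S} {Ss} {P} {Q}) (T ∷ []) (s≤s b) U c (s≤s b′) c′ {L} {M} {N} (o , o₁ , ov) o′
    with ≤-irrelevant b b′ | ≤-irrelevant c c′
  ... | refl | refl = rf , Sim-refl (λ _ → rf) (insert S P T b) , Sim-intro (insert Ss Q U c) λ p →
        tr (sy (insert-rel Ss Q U c R (ins-next-rel S Ss P T b {L} {M} o₁) (λ _ → rf) p))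
          (ins-next-rel S (insert Ss Q U c) P T b {ins (S ∷ Ss) (next Q) U c L N} {M}
            (tr (sy (ins-[0]-rel Ss Q U c o′)) o₁) p)
  parallel (0∷-0∷ {Ss = Ss} s) (T ∷ []) (s≤s b) (U ∷ []) (s≤s c) (s≤s b′) (s≤s c′) (o , o₁ , ov) (o′ , o₁′ , ov′) =
    tr (sy o′) o , parallel s T b U c b′ c′ ov ov′ , Sim-intro Ss λ where
      [0]      → tr (sy o₁′) o₁
      (0∷ p)   → rf
      (next p) → rf
  parallel (next-next {S = S} s) T b U c b′ c′ o o′ = rf , Sim-refl (λ _ → rf) S , parallel s T b U c b′ c′ o o′

++⁺ˡ-branch : ∀ {T} U → Branch T → Branch (T ++ U)
++⁺ˡ-branch U ([0] l)  = [0] l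
++⁺ˡ-branch U (0∷ Q)   = 0∷ Q
++⁺ˡ-branch U (next Q) = next (++⁺ˡ-branch U Q)

-- The branch Q of a non-linear tree T, after the insertion of T.
nest : ∀ {S} (P : Branch S) T b → ¬ Linear T → Branch T → Branch (insert S P T b)
nest {S ∷ Ss} ([0] _)  T        b       ¬l Q       = ++⁺ˡ-branch Ss Q
nest {S ∷ Ss} (0∷ P)   (T ∷ []) (s≤s b) ¬l ([0] l) = ⊥-elim (¬l (cong suc l))
nest {S ∷ Ss} (0∷ P)   (T ∷ []) (s≤s b) ¬l (0∷ Q)  = 0∷ nest P T b (λ l → ¬l (cong suc l)) Q
nest {S ∷ Ss} (next P) T        b       ¬l Q       = next (nest P T b ¬l Q)

++⁺ˡ-overline : ∀ {T} U (Q : Branch T) → overline (++⁺ˡ-branch U Q) ≡ ++⁺ˡ U (overline Q)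
++⁺ˡ-overline U ([0] l)  = refl
++⁺ˡ-overline U (0∷ Q)   = refl
++⁺ˡ-overline U (next Q) = cong next (++⁺ˡ-overline U Q)

nest-overline : ∀ {S} (P : Branch S) T b ¬l Q → overline (nest P T b ¬l Q) ≡ ι S P T b (overline Q)
nest-overline {S ∷ Ss} ([0] _)  T        b       ¬l Q       = ++⁺ˡ-overline Ss Q
nest-overline {S ∷ Ss} (0∷ P)   (T ∷ []) (s≤s b) ¬l ([0] l) = ⊥-elim (¬l (cong suc l))
nest-overline {S ∷ Ss} (0∷ P)   (T ∷ []) (s≤s b) ¬l (0∷ Q)  = cong 0∷_ (nest-overline P T b _ Q)
nest-overline {S ∷ Ss} (next P) T        b       ¬l Q       = cong next (nest-overline P T b ¬l Q)

++⁺ˡ-bh : ∀ {T} U (Q : Branch T) → branchHeight (++⁺ˡ-branch U Q) ≡ branchHeight Q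
++⁺ˡ-bh U ([0] l)  = refl
++⁺ˡ-bh U (0∷ Q)   = refl
++⁺ˡ-bh U (next Q) = ++⁺ˡ-bh U Q

nest-bh : ∀ {S} (P : Branch S) T b ¬l Q → branchHeight (nest P T b ¬l Q) ≡ branchHeight Q
nest-bh {S ∷ Ss} ([0] _)  T        b       ¬l Q       = ++⁺ˡ-bh Ss Q
nest-bh {S ∷ Ss} (0∷ P)   (T ∷ []) (s≤s b) ¬l ([0] l) = ⊥-elim (¬l (cong suc l))
nest-bh {S ∷ Ss} (0∷ P)   (T ∷ []) (s≤s b) ¬l (0∷ Q)  = cong suc (nest-bh P T b _ Q)
nest-bh {S ∷ Ss} (next P) T        b       ¬l Q       = nest-bh P T b ¬l Q

depth-++⁺ˡ : ∀ {T} U (q : Path T) → depth (++⁺ˡ U q) ≡ depth q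
depth-++⁺ˡ U [0]      = refl
depth-++⁺ˡ U (0∷ q)   = refl
depth-++⁺ˡ U (next q) = depth-++⁺ˡ U q

depth-ι : ∀ S P T b q → depth (ι S P T b q) ≡ depth q
depth-ι (S ∷ Ss) ([0] _)  T        b       q          = depth-++⁺ˡ Ss q
depth-ι (S ∷ Ss) (0∷ P)   (T ∷ []) (s≤s b) [0]        = refl
depth-ι (S ∷ Ss) (0∷ P)   (T ∷ []) (s≤s b) (0∷ q)     = cong suc (depth-ι S P T b q)
depth-ι (S ∷ Ss) (0∷ P)   (T ∷ []) (s≤s b) (next [0]) = refl
depth-ι (S ∷ Ss) (next P) T        b       q          = depth-ι Ss P T b q

nest-lh : ∀ {S} (P : Branch S) T b ¬l Q → leafHeight (nest P T b ¬l Q) ≡ leafHeight Q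
nest-lh {S} P T b ¬l Q = trans (cong depth (nest-overline P T b ¬l Q)) (depth-ι S P T b (overline Q))

-- Guarantees that the combined tree can still be inserted at the outer branch.
insert-trunk : ∀ T Q U c → ¬ Linear T → trunkHeight T ≤ trunkHeight (insert T Q U c)
insert-trunk (T ∷ [])      ([0] l)  U        c       ¬l = ⊥-elim (¬l (cong suc l))
insert-trunk (T ∷ [])      (0∷ Q)   (U ∷ []) (s≤s c) ¬l = s≤s (insert-trunk T Q U c (λ l → ¬l (cong suc l)))
insert-trunk (T ∷ T′ ∷ Ts) Q        U        c       ¬l = z≤n

append-assoc : ∀ U T V (N : Labelling U n) (M : Labelling T n) (L : Labelling V n) →
  Sim _≡_ ((U ++ T) ++ V) (append (append N M) L) (U ++ (T ++ V)) (append N (append M L))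
append-assoc [] [] V N M L = Sim-intro V λ { [0] → refl ; (0∷ p) → refl ; (next p) → refl }
append-assoc [] (T ∷ Ts) V N M L =
  Sim-intro (T ∷ (Ts ++ V)) {append (append N M) L} {append N (append M L)} λ { [0] → refl ; (0∷ p) → refl ; (next p) → refl }
append-assoc (U ∷ Us) T V N M L =
  refl , Sim-refl (λ _ → refl) U , append-assoc Us T V (λ p → N (next p)) M L

nested-append : ∀ T V Q U c c′ {M : Labelling T n} {L : Labelling V n} {N} →
  Sim _≡_ (insert T Q U c ++ V) (append (ins T Q U c M N) L)
    (insert (T ++ V) (++⁺ˡ-branch V Q) U c′) (ins (T ++ V) (++⁺ˡ-branch V Q) U c′ (append M L) N)
nested-append (T ∷ Ts) V ([0] _) U c c′ = append-assoc U Ts V _ _ _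
nested-append (T ∷ Ts) V (0∷ Q) (U ∷ []) (s≤s c) (s≤s c′) {M} {L} {N} with ≤-irrelevant c c′
... | refl = refl , Sim-refl (λ _ → refl) (insert T Q U c) , Sim-intro (Ts ++ V) (lem Ts M)
  where
  lem : ∀ Ts (M : Labelling (T ∷ Ts) _) p →
        append (λ q → ins (T ∷ Ts) (0∷ Q) (U ∷ []) (s≤s c) M N (next q)) L p
          ≡ ins (T ∷ (Ts ++ V)) (0∷ Q) (U ∷ []) (s≤s c) (append M L) N (next p)
  lem []        M [0]      = refl
  lem []        M (0∷ p)   = refl
  lem []        M (next p) = refl
  lem (T₁ ∷ Ts) M [0]      = refl
  lem (T₁ ∷ Ts) M (0∷ p)   = refl
  lem (T₁ ∷ Ts) M (next p) = refl
nested-append (T ∷ Ts) V (next Q) U c c′ = refl , Sim-refl (λ _ → refl) T , nested-append Ts V Q U c c′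

-- Unlike in `parallel` the agreement is syntactic; at the root of the branch it is associativity of
-- `append`.
nested : ∀ {S} (P : Branch S) T b ¬l Q U c b′ c′ {L : Labelling S n} {M : Labelling T n} {N} →
  Sim _≡_ (insert S P (insert T Q U c) b′) (ins S P (insert T Q U c) b′ L (ins T Q U c M N))
    (insert (insert S P T b) (nest P T b ¬l Q) U c′) (ins _ (nest P T b ¬l Q) U c′ (ins S P T b L M) N)
nested {S = S ∷ Ss} ([0] _) T b ¬l Q U c b′ c′ = nested-append T Ss Q U c c′
nested {S = S ∷ Ss} (0∷ P) (T ∷ []) (s≤s b) ¬l ([0] l) U c b′ c′ = ⊥-elim (¬l (cong suc l))
nested {S = S ∷ Ss} (0∷ P) (T ∷ []) (s≤s b) ¬l (0∷ Q) (U ∷ []) (s≤s c) (s≤s b′) (s≤s c′) =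
  refl , nested P T b _ Q U c b′ c′ , Sim-intro Ss λ { [0] → refl ; (0∷ p) → refl ; (next p) → refl }
nested {S = S ∷ Ss} (next P) T b ¬l Q U c b′ c′ =
  refl , Sim-refl (λ _ → refl) S , nested P T b ¬l Q U c b′ c′

disc-Sim : ∀ S V → Linear S → Linear V → height S ≡ height V → ∀ (ρ : Labelling V n) e t →
  Trunk V ρ e → t ≡ ρ (zeros V) → Sim _≡_ S (discLab {T = S} e t) V ρ
disc-Sim []           []           l l′ h ρ e t f g = g
disc-Sim []           (V ∷ [])     l l′ () ρ e t f g
disc-Sim (S ∷ [])     []           l l′ () ρ e t f g
disc-Sim (S ∷ [])     (V ∷ [])     l l′ h ρ e t f g = f Sign.- 0 z≤n
  , disc-Sim S V (suc-injective l) (suc-injective l′) (suc-injective h) (λ p → ρ (0∷ p)) (up e) t (Trunk-up ρ f) g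
  , f Sign.+ 0 z≤n
disc-Sim (S ∷ U ∷ Us) V            l l′ h ρ e t f g = linear-single S U Us l
disc-Sim S            (V ∷ U ∷ Us) l l′ h ρ e t f g = linear-single V U Us l′

-- A linear tree of the height of the leaf replaces the branch by a copy of itself. This is the case
-- of a unary composite at the leaf.
trivial-insert : ∀ S P V b → Linear V → leafHeight P ≡ height V → ∀ (ρ : Labelling (insert S P V b) n) e t →
  Trunk V (λ q → ρ (ι S P V b q)) e → t ≡ ρ (ι S P V b (zeros V)) →
  Sim _≡_ S (exterior S P V b ρ e t) (insert S P V b) ρ
trivial-insert (S ∷ Ss) ([0] l) [] b l′ () ρ e t f g
trivial-insert (S ∷ Ss) ([0] l) (V ∷ []) b l′ h ρ e t f g = refl
  , disc-Sim S V l (suc-injective l′) (trans (sym (depth-zeros S l)) (suc-injective h)) (λ p → ρ (0∷ p)) (up e) t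
      (Trunk-up (λ q → ρ (++⁺ˡ {V ∷ []} Ss q)) f) g
  , Sim-refl (λ _ → refl) Ss
trivial-insert (S ∷ Ss) ([0] l) (V ∷ U ∷ Us) b l′ h ρ e t f g = linear-single V U Us l′
trivial-insert (S ∷ Ss) (0∷ P) (V ∷ []) (s≤s b) l′ h ρ e t f g = refl
  , trivial-insert S P V b (suc-injective l′) (suc-injective h) (λ p → ρ (0∷ p)) (up e) t
      (Trunk-up (λ q → ρ (ι (S ∷ Ss) (0∷ P) (V ∷ []) (s≤s b) q)) f) g
  , Sim-refl (λ _ → refl) Ss
trivial-insert (S ∷ Ss) (next P) V b l′ h ρ e t f g =
  refl , Sim-refl (λ _ → refl) S , trivial-insert Ss P V b l′ h (λ p → ρ (next p)) e t f g

-- The branch P after the insertion of a disc of dimension one less.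
shorten : ∀ {S} (P : Branch S) k b → branchHeight P < k → Branch (insert S P (discTree k) b)
shorten {S ∷ Ss} ([0] _)  (suc k) b       lt       = [0] (disc-linear k)
shorten {S ∷ Ss} (0∷ P)   (suc k) (s≤s b) (s≤s lt) = 0∷ shorten P k b lt
shorten {S ∷ Ss} (next P) k       b       lt       = next (shorten P k b lt)

shorten-bh : ∀ {S} (P : Branch S) k b lt → branchHeight (shorten P k b lt) ≡ branchHeight P
shorten-bh {S ∷ Ss} ([0] _)  (suc k) b       lt       = refl
shorten-bh {S ∷ Ss} (0∷ P)   (suc k) (s≤s b) (s≤s lt) = cong suc (shorten-bh P k b lt)
shorten-bh {S ∷ Ss} (next P) k       b       lt       = shorten-bh P k b lt

shorten-overline : ∀ {S} (P : Branch S) k b lt →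
  overline (shorten P k b lt) ≡ ι S P (discTree k) b (zeros (discTree k))
shorten-overline {S ∷ Ss} ([0] _)  (suc k) b       lt       = refl
shorten-overline {S ∷ Ss} (0∷ P)   (suc k) (s≤s b) (s≤s lt) = cong 0∷_ (shorten-overline P k b lt)
shorten-overline {S ∷ Ss} (next P) k       b       lt       = cong next (shorten-overline P k b lt)

append-irrelevant : ∀ T {U} {M : Labelling T n} {L L′ : Labelling U n} →
  (∀ {p} → Positive p → L p ≡ L′ p) → ∀ p → append M L p ≡ append M L′ p
append-irrelevant []       e [0]      = refl
append-irrelevant []       e (0∷ p)   = e (0∷ p)
append-irrelevant []       e (next p) = e (next p)
append-irrelevant (T ∷ Ts) e [0]      = refl
append-irrelevant (T ∷ Ts) e (0∷ p)   = refl
append-irrelevant (T ∷ Ts) e (next p) = append-irrelevant Ts e p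

-- The second insertion overwrites all that the disc contributed, so the detour through the disc
-- leaves no trace.
shorten-insert : ∀ {S} (P : Branch S) k b lt V c c′ {L : Labelling S n} {K : Labelling (discTree k) n} {M} →
  Sim _≡_ (insert (insert S P (discTree k) b) (shorten P k b lt) V c′)
    (ins _ (shorten P k b lt) V c′ (ins S P (discTree k) b L K) M)
    (insert S P V c) (ins S P V c L M)
shorten-insert {S = S ∷ Ss} ([0] _) (suc k) b lt V c c′ {L} {K} = Sim-intro (V ++ Ss)
  (append-irrelevant V λ { (0∷ p) → refl ; (next p) → refl })
shorten-insert {S = S ∷ Ss} (0∷ P) (suc k) (s≤s b) (s≤s lt) (V ∷ []) (s≤s c) (s≤s c′) =
  refl , shorten-insert P k b lt V c c′ , Sim-intro Ss λ { [0] → refl ; (0∷ p) → refl ; (next p) → refl }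
shorten-insert {S = S ∷ Ss} (next P) k b lt V c c′ =
  refl , Sim-refl (λ _ → refl) S , shorten-insert P k b lt V c c′

ins-irrelevant : ∀ S P T b {L L′ : Labelling S n} {M} → (∀ {p} → p ≢ overline P → L p ≡ L′ p) →
  ∀ p → ins S P T b L M p ≡ ins S P T b L′ M p
ins-irrelevant (S ∷ Ss) ([0] _) T b e p = append-irrelevant T (λ _ → e λ ()) p
ins-irrelevant (S ∷ Ss) (0∷ P) (T ∷ []) (s≤s b) e [0] = refl
ins-irrelevant (S ∷ Ss) (0∷ P) (T ∷ []) (s≤s b) e (0∷ p) =
  ins-irrelevant S P T b (λ ne → e λ { refl → ne refl }) p
ins-irrelevant (S ∷ Ss) (0∷ P) (T ∷ []) (s≤s b) e (next [0]) = refl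
ins-irrelevant (S ∷ Ss) (0∷ P) (T ∷ []) (s≤s b) e (next (0∷ p)) = e λ ()
ins-irrelevant (S ∷ Ss) (0∷ P) (T ∷ []) (s≤s b) e (next (next p)) = e λ ()
ins-irrelevant (S ∷ Ss) (next P) T b e [0] = e λ ()
ins-irrelevant (S ∷ Ss) (next P) T b e (0∷ p) = e λ ()
ins-irrelevant (S ∷ Ss) (next P) T b e (next p) = ins-irrelevant Ss P T b (λ ne → e λ { refl → ne refl }) p

-- Discs as trees

-- The contexts `⌊ discTree k ⌋` and `Disc k` have sizes that agree only propositionally. Bundling
-- size, context and type makes their equality homogeneous.
TyCtx : Set
TyCtx = Σ ℕ λ m → Ctx m × Ty m

coh-cong : ∀ {m m′} {Γ : Ctx m} {Γ′ : Ctx m′} {A A′} {σ : Sub m n} {σ′ : Sub m′ n} →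
  _≡_ {A = TyCtx} (m , Γ , A) (m′ , Γ′ , A′) → toList σ ≡ toList σ′ → coh Γ A σ ≡ coh Γ′ A′ σ′
coh-cong {σ = σ} {σ′} refl e = cong (coh _ _) (toList-inj σ σ′ e)
  where
  toList-inj : ∀ {a} {A : Set a} {m} (xs ys : Vec A m) → toList xs ≡ toList ys → xs ≡ ys
  toList-inj []       []       e = refl
  toList-inj (x ∷ xs) (y ∷ ys) e = cong₂ _∷_ (proj₁ (∷ˡ-injective e)) (toList-inj xs ys (proj₂ (∷ˡ-injective e)))

Σ-SphereType : ∀ k → ΣTy (SphereType k) ≡ SphereType (suc k)
Σ-SphereType zero    = refl
Σ-SphereType (suc k) = arr-cong refl (trans (ΣTy-wk (wkTy (SphereType k)))
  (cong wkTy (trans (ΣTy-wk (SphereType k)) (cong wkTy (Σ-SphereType k))))) refl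

Σ-DiscType : ∀ k → ΣTy (DiscType k) ≡ DiscType (suc k)
Σ-DiscType k = trans (ΣTy-wk (SphereType k)) (cong wkTy (Σ-SphereType k))

Σ-Sphere : ∀ k → ΣCtx (Sphere k) ≡ Sphere (suc k)
Σ-Sphere zero    = refl
Σ-Sphere (suc k) = cong₂ _▹_ (cong₂ _▹_ (Σ-Sphere k) (Σ-SphereType k)) (Σ-DiscType k)

idType : ∀ k → Ty (suc (k * 2))
idType k = var zero ⇒[ DiscType k ] var zero

suspend : TyCtx → TyCtx
suspend (m , Γ , A) = 2 + m , ΣCtx Γ , ΣTy A

disc-unary : ∀ k → _≡_ {A = TyCtx} (_ , ⌊ discTree k ⌋ , 𝒰 k (discTree k)) (_ , Disc k , DiscType k)
disc-unary zero    = refl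
disc-unary (suc k) = trans (cong (λ A → _ , ⌊ discTree (suc k) ⌋ , A) (𝒰-Σ k (discTree k)))
  (trans (cong suspend (disc-unary k))
    (cong₂ (λ Γ A → _ , Γ , A) (cong₂ _▹_ (Σ-Sphere k) (Σ-SphereType k)) (Σ-DiscType k)))

disc-identity : ∀ k → _≡_ {A = TyCtx} (_ , ⌊ discTree k ⌋ , 𝒰 (suc k) (discTree k)) (_ , Disc k , idType k)
disc-identity zero    = refl
disc-identity (suc k) = trans (cong (λ A → _ , ⌊ discTree (suc k) ⌋ , A) (𝒰-Σ (suc k) (discTree k)))
  (trans (cong suspend (disc-identity k))
    (cong₂ (λ Γ A → _ , Γ , A) (cong₂ _▹_ (Σ-Sphere k) (Σ-SphereType k)) (arr-cong refl (Σ-DiscType k) refl)))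

height-disc : ∀ k → height (discTree k) ≡ k
height-disc zero    = refl
height-disc (suc k) = cong suc (height-disc k)

dim-mk : ∀ (e : Ends n) k → dim (mk e k) ≡ k
dim-mk e zero    = refl
dim-mk e (suc k) = cong suc (dim-mk e k)

toList-disc : ∀ k (e : Ends n) t → toList (toSub (discLab {T = discTree k} e t)) ≡ toList (fromDisc (mk e k) t)
toList-disc k e t = trans (toList-discLab (discTree k) (disc-linear k) e t)
  (cong (t ∷ˡ_) (trans (cong (sphereList e) (height-disc k)) (sym (toList-fromSphere e k))))

std-identity : ∀ k (e : Ends n) t →
  coh ⌊ discTree k ⌋ (𝒰 (suc k) (discTree k)) (toSub (discLab {T = discTree k} e t)) ≡ identity (mk e k) t
std-identity k e t = coh-cong (trans (disc-identity k)
  (cong (λ d → _ , Disc d , idType d) (sym (dim-mk e k)))) (toList-disc k e t)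

std-unary : ∀ k (e : Ends n) t →
  coh ⌊ discTree k ⌋ (𝒰 k (discTree k)) (toSub (discLab {T = discTree k} e t)) ≡ unary (mk e k) t
std-unary k e t = coh-cong (trans (disc-unary k)
  (cong (λ d → _ , Disc d , DiscType d) (sym (dim-mk e k)))) (toList-disc k e t)

trunkEnds : ∀ {T} → Labelling T n → Ends n
trunkEnds {T = T} K ε i = K (trunk ε i T)

toSub-disc : ∀ k (K : Labelling (discTree k) n) →
  toSub (discLab {T = discTree k} (trunkEnds K) (K (zeros (discTree k)))) ≡ toSub K
toSub-disc k K = toSub-cong (Sim-elim (discTree k) (disc-Sim (discTree k) (discTree k) (disc-linear k)
  (disc-linear k) refl K (trunkEnds K) (K (zeros (discTree k))) (λ ε i _ → refl) refl))

-- Recovering a tree from its context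

profile : Ctx n → List ℕ
profile ∅       = []ˡ
profile (Γ ▹ A) = profile Γ ++ˡ (dim A ∷ˡ []ˡ)

-- The dimensions of the variables after the first point. A zero opens the block of the next subtree
-- and the positive entries after it form the suspension of that subtree, so the list can be parsed
-- back uniquely.
blocks : Tree → List ℕ
blocks []       = []ˡ
blocks (T ∷ Ts) = 0 ∷ˡ (mapˡ suc (0 ∷ˡ blocks T) ++ˡ blocks Ts)

profile-Σ : ∀ (Γ : Ctx n) → profile (ΣCtx Γ) ≡ 0 ∷ˡ 0 ∷ˡ mapˡ suc (profile Γ)
profile-Σ ∅       = refl
profile-Σ (Γ ▹ A) = trans (cong₂ (λ xs d → xs ++ˡ (d ∷ˡ []ˡ)) (profile-Σ Γ) (dim-Σ A))
  (cong (λ xs → 0 ∷ˡ 0 ∷ˡ xs) (sym (mapˡ-++ suc (profile Γ) (dim A ∷ˡ []ˡ))))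

profile-∨ : ∀ (Γ : Ctx (suc n)) (Δ : Ctx (suc m)) {xs} → First⋆ Δ → profile Δ ≡ 0 ∷ˡ xs →
            profile (Γ ∨ Δ) ≡ profile Γ ++ˡ xs
profile-∨ Γ (∅ ▹ A) {xs} refl refl = sym (lem (profile Γ))
  where
  lem : ∀ (ys : List ℕ) → ys ++ˡ []ˡ ≡ ys
  lem []ˡ       = refl
  lem (y ∷ˡ ys) = cong (y ∷ˡ_) (lem ys)
profile-∨ Γ (Δ ▹ B ▹ A) {xs} f e with profile (Δ ▹ B) in eq
... | []ˡ = ⊥-elim (lem Δ eq)
  where
  lem : ∀ {k} (Δ : Ctx k) {x} → profile Δ ++ˡ (x ∷ˡ []ˡ) ≢ []ˡ
  lem Δ with profile Δ
  ... | []ˡ = λ ()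
  ... | _ ∷ˡ _ = λ ()
... | y ∷ˡ ys with ∷ˡ-injective e
...   | refl , refl = trans (cong₂ (λ zs d → zs ++ˡ (d ∷ˡ []ˡ)) (profile-∨ Γ (Δ ▹ B) {ys} f eq)
                                  (dim-⟦⟧ A _)) (++ˡ-assoc (profile Γ) ys _)

profile-⌊⌋ : ∀ T → profile ⌊ T ⌋ ≡ 0 ∷ˡ blocks T
profile-⌊⌋ []       = refl
profile-⌊⌋ (T ∷ Ts) = trans (profile-∨ (ΣCtx ⌊ T ⌋) ⌊ Ts ⌋ (First⋆-⌊⌋ Ts) (profile-⌊⌋ Ts))
  (cong (_++ˡ blocks Ts) (trans (profile-Σ ⌊ T ⌋) (cong (λ xs → 0 ∷ˡ 0 ∷ˡ mapˡ suc xs) (profile-⌊⌋ T))))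

split-blocks : ∀ (xs ys : List ℕ) Ts Us → mapˡ suc xs ++ˡ blocks Ts ≡ mapˡ suc ys ++ˡ blocks Us →
               xs ≡ ys × blocks Ts ≡ blocks Us
split-blocks []ˡ       []ˡ       Ts       Us       e = refl , e
split-blocks []ˡ       (y ∷ˡ ys) []       Us       ()
split-blocks []ˡ       (y ∷ˡ ys) (T ∷ Ts) Us       ()
split-blocks (x ∷ˡ xs) []ˡ       Ts       []       ()
split-blocks (x ∷ˡ xs) []ˡ       Ts       (U ∷ Us) ()
split-blocks (x ∷ˡ xs) (y ∷ˡ ys) Ts       Us       e with ∷ˡ-injective e
... | refl , e′ with split-blocks xs ys Ts Us e′
...   | refl , e″ = refl , e″

blocks-injective : ∀ T U → blocks T ≡ blocks U → T ≡ U
blocks-injective []       []       e = refl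
blocks-injective (T ∷ Ts) (U ∷ Us) e
  with split-blocks (0 ∷ˡ blocks T) (0 ∷ˡ blocks U) Ts Us (proj₂ (∷ˡ-injective e))
... | e₁ , e₂ = cong₂ _∷_ (blocks-injective T U (proj₂ (∷ˡ-injective e₁))) (blocks-injective Ts Us e₂)

⌊⌋-injective : ∀ T U → profile ⌊ T ⌋ ≡ profile ⌊ U ⌋ → T ≡ U
⌊⌋-injective T U e = blocks-injective T U
  (proj₂ (∷ˡ-injective (trans (sym (profile-⌊⌋ T)) (trans e (profile-⌊⌋ U)))))

coh-inj : ∀ {Δ : Ctx m} {A B} {σ τ : Sub m n} → Tm.coh Δ A σ ≡ coh Δ B τ → A ≡ B × σ ≡ τ
coh-inj refl = refl , refl

cohProfile : Tm n → List ℕ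
cohProfile (var x)     = []ˡ
cohProfile (coh Δ A σ) = profile Δ

coh-tree : ∀ T U {A B σ τ} → Tm.coh {n = n} ⌊ T ⌋ A σ ≡ coh ⌊ U ⌋ B τ → T ≡ U
coh-tree T U e = ⌊⌋-injective T U (cong cohProfile e)

TyCtx-inj : ∀ {Γ : Ctx m} {A B} → _≡_ {A = TyCtx} (m , Γ , A) (m , Γ , B) → A ≡ B
TyCtx-inj refl = refl

UnShape-ctx : ∀ {Δ : Ctx m} {A} → UnShape Δ A → ∃[ d ] _≡_ {A = TyCtx} (m , Δ , A) (_ , Disc d , DiscType d)
UnShape-ctx (unShape d) = d , refl

IdShape-ctx : ∀ {Δ : Ctx m} {A} → IdShape Δ A → ∃[ d ] _≡_ {A = TyCtx} (m , Δ , A) (_ , Disc d , idType d)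
IdShape-ctx (idShape d) = d , refl

data UnTree : ∀ V → Ty (suc (size V)) → Set where
  unTree : ∀ d → UnTree (discTree d) (𝒰 d (discTree d))

data IdTree : ∀ V → Ty (suc (size V)) → Set where
  idTree : ∀ d → IdTree (discTree d) (𝒰 (suc d) (discTree d))

UnShape⇒UnTree : ∀ {V A} → UnShape ⌊ V ⌋ A → UnTree V A
UnShape⇒UnTree {V} s with UnShape-ctx s
... | d , e with trans e (sym (disc-unary d))
...   | f with ⌊⌋-injective V (discTree d) (cong (λ x → profile (proj₁ (proj₂ x))) f)
...     | refl with TyCtx-inj f
...       | refl = unTree d

IdShape⇒IdTree : ∀ {V A} → IdShape ⌊ V ⌋ A → IdTree V A
IdShape⇒IdTree {V} s with IdShape-ctx s
... | d , e with trans e (sym (disc-identity d))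
...   | f with ⌊⌋-injective V (discTree d) (cong (λ x → profile (proj₁ (proj₂ x))) f)
...     | refl with TyCtx-inj f
...       | refl = idTree d

ctx-UnShape : ∀ {Δ : Ctx m} {A d} → _≡_ {A = TyCtx} (m , Δ , A) (_ , Disc d , DiscType d) → UnShape Δ A
ctx-UnShape {d = d} refl = unShape d

ctx-IdShape : ∀ {Δ : Ctx m} {A d} → _≡_ {A = TyCtx} (m , Δ , A) (_ , Disc d , idType d) → IdShape Δ A
ctx-IdShape {d = d} refl = idShape d

-- Decidable equality of syntax and of shapes

infix 4 _≟ᶜ_ _≟ᵀ_ _≟ᵗ_ _≟ˢ_

_≟ᶜ_ : (Γ Δ : Ctx n) → Dec (Γ ≡ Δ)
_≟ᵀ_ : (A B : Ty n) → Dec (A ≡ B)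
_≟ᵗ_ : (s t : Tm n) → Dec (s ≡ t)
_≟ˢ_ : (σ τ : Sub m n) → Dec (σ ≡ τ)
∅ ≟ᶜ ∅ = yes refl
(Γ ▹ A) ≟ᶜ (Δ ▹ B) with Γ ≟ᶜ Δ | A ≟ᵀ B
... | yes refl | yes refl = yes refl
... | no ¬e    | _        = no λ { refl → ¬e refl }
... | _        | no ¬e    = no λ { refl → ¬e refl }
⋆ ≟ᵀ ⋆ = yes refl
⋆ ≟ᵀ (_ ⇒[ _ ] _) = no λ ()
(_ ⇒[ _ ] _) ≟ᵀ ⋆ = no λ ()
(s ⇒[ A ] t) ≟ᵀ (s′ ⇒[ A′ ] t′) with s ≟ᵗ s′ | A ≟ᵀ A′ | t ≟ᵗ t′
... | yes refl | yes refl | yes refl = yes refl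
... | no ¬e    | _        | _        = no λ { refl → ¬e refl }
... | _        | no ¬e    | _        = no λ { refl → ¬e refl }
... | _        | _        | no ¬e    = no λ { refl → ¬e refl }
var x ≟ᵗ var y with x Fin.≟ y
... | yes refl = yes refl
... | no ¬e    = no λ { refl → ¬e refl }
var x ≟ᵗ coh _ _ _ = no λ ()
coh _ _ _ ≟ᵗ var x = no λ ()
coh {m = k} Δ A σ ≟ᵗ coh {m = l} Θ B τ with k ≟ l
... | no ¬e = no λ { refl → ¬e refl }
... | yes refl with Δ ≟ᶜ Θ | A ≟ᵀ B | σ ≟ˢ τ
...   | yes refl | yes refl | yes refl = yes refl
...   | no ¬e    | _        | _        = no λ { refl → ¬e refl }
...   | _        | no ¬e    | _        = no λ { refl → ¬e refl }
...   | _        | _        | no ¬e    = no λ { refl → ¬e refl }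
[] ≟ˢ [] = yes refl
(s ∷ σ) ≟ˢ (t ∷ τ) with s ≟ᵗ t | σ ≟ˢ τ
... | yes refl | yes refl = yes refl
... | no ¬e    | _        = no λ { refl → ¬e refl }
... | _        | no ¬e    = no λ { refl → ¬e refl }

TyCtx-≟ : ∀ (x y : TyCtx) → Dec (x ≡ y)
TyCtx-≟ (k , Δ , A) (l , Θ , B) with k ≟ l
... | no ¬e = no λ { refl → ¬e refl }
... | yes refl with Δ ≟ᶜ Θ | A ≟ᵀ B
...   | yes refl | yes refl = yes refl
...   | no ¬e    | _        = no λ { refl → ¬e refl }
...   | _        | no ¬e    = no λ { refl → ¬e refl }

dim-DiscType : ∀ d → dim (DiscType d) ≡ d
dim-DiscType d = trans (dim-wk (SphereType d)) (dim-SphereType d)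

unShape? : ∀ (Δ : Ctx m) A → Dec (UnShape Δ A)
unShape? Δ A with TyCtx-≟ (_ , Δ , A) (_ , Disc (dim A) , DiscType (dim A))
... | yes e = yes (ctx-UnShape e)
... | no ¬e = no λ { (unShape d) → ¬e (cong (λ d → _ , Disc d , DiscType d) (sym (dim-DiscType d))) }

idShape? : ∀ (Δ : Ctx m) A → Dec (IdShape Δ A)
idShape? Δ ⋆ = no λ ()
idShape? Δ A@(_ ⇒[ B ] _) with TyCtx-≟ (_ , Δ , A) (_ , Disc (dim B) , idType (dim B))
... | yes e = yes (ctx-IdShape e)
... | no ¬e = no λ { (idShape d) → ¬e (cong (λ d → _ , Disc d , idType d) (sym (dim-DiscType d))) }

-- Iterated insertions up to lower-dimensional equality

LowEq-IsEq : ∀ {d} {Γ : Ctx n} → IsEq (LowEq d Γ)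
LowEq-IsEq = record
  { rf = inj₁ refl
  ; sy = λ { (inj₁ refl) → inj₁ refl
           ; (inj₂ (e , A , d , lt)) → inj₂ (≈-sym e , A , proj₁ (≈-typed e) d , lt) }
  ; tr = λ { (inj₁ refl) f → f
           ; (inj₂ e) (inj₁ refl) → inj₂ e
           ; (inj₂ (e , A , d , lt)) (inj₂ (f , _)) → inj₂ (≈-trans e f , A , d , lt) } }

≈-IsEq : ∀ {Γ : Ctx n} → IsEq (Γ ⊢_≈_)
≈-IsEq = record { rf = ≈-refl _ ; sy = ≈-sym ; tr = ≈-trans }

-- The gap left by every comparison of routes: one tree, equal types, and labels that agree up to
-- lower dimension. `near-join` closes it by the induction hypothesis.
data Near (d : ℕ) (Γ : Ctx n) : Tm n → Tm n → Set where
  near : ∀ {R A B} {K K′ : Labelling R n} → ⌊ R ⌋ ⊢ᵀ A ≈ B → (∀ p → LowEq d Γ (K p) (K′ p)) →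
         Near d Γ (coh ⌊ R ⌋ A (toSub K)) (coh ⌊ R ⌋ B (toSub K′))

Near-sym : ∀ {d} {Γ : Ctx n} {s t} → Near d Γ s t → Near d Γ t s
Near-sym (near e f) = near (≈ᵀ-sym e) (λ p → IsEq.sy LowEq-IsEq (f p))

infixl 5 _⨾_

_⨾_ : ∀ {S} → Labelling S m → Sub m n → Labelling S n
(L ⨾ σ) p = L p ⟦ σ ⟧

WL-⨾ : ∀ {Γ : Ctx n} {Δ : Ctx m} {S} {L : Labelling S m} {σ} → WL Δ ⋆ L → Γ ⊢ˢ σ ∶ Δ → WL Γ ⋆ (L ⨾ σ)
WL-⨾ {Γ = Γ} {L = L} {σ} w d p = subst (Γ ⊢ L p ⟦ σ ⟧ ∶_) (tyP-⟦⟧ ⋆ L p σ) (⊢-⟦⟧ d (w p))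

WL-≈ : ∀ {Γ : Ctx n} {S} {L M : Labelling S n} → WL Γ ⋆ L → (∀ p → Γ ⊢ L p ≈ M p) → WL Γ ⋆ M
WL-≈ w e p = conv (proj₁ (≈-typed (e p)) (w p)) (tyP-≈ ⋆ e p)

⟦path⟧ : ∀ {T} (t : Tm (suc (size T))) → t ⟦ toSub (path T) ⟧ ≡ t
⟦path⟧ {T} t = trans (cong (t ⟦_⟧) (toSub-path T)) (⟦id⟧ t)

⟦path⟧ᵀ : ∀ {T} (A : Ty (suc (size T))) → A ⟦ toSub (path T) ⟧ᵀ ≡ A
⟦path⟧ᵀ {T} A = trans (cong (A ⟦_⟧ᵀ) (toSub-path T)) (⟦id⟧ᵀ A)

-- The exteriors `κ₁` and `κ₂` live over different trees. `K₀` is what the second route makes of the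
-- generic labelling of `R₁`; since it is again equal to the generic labelling, the comparison after
-- composing with `K₀` is a comparison of the exteriors themselves.
near-univ : ∀ {Γ : Ctx n} {S} R₁ R₂ {d A} {κ₁ : Labelling S (suc (size R₁))} {κ₂ : Labelling S (suc (size R₂))}
  {K₀ : Labelling R₂ (suc (size R₁))} {K₁ : Labelling R₁ n} {K₂ : Labelling R₂ n} →
  Sim (⌊ R₁ ⌋ ⊢_≈_) R₁ (path R₁) R₂ K₀ → (∀ p → ⌊ R₁ ⌋ ⊢ κ₁ p ≈ (κ₂ ⨾ toSub K₀) p) →
  Sim (LowEq d Γ) R₁ K₁ R₂ K₂ →
  Near d Γ (coh ⌊ R₁ ⌋ (A ⟦ toSub κ₁ ⟧ᵀ) (toSub K₁)) (coh ⌊ R₂ ⌋ (A ⟦ toSub κ₂ ⟧ᵀ) (toSub K₂))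
near-univ R₁ R₂ {A = A} {κ₂ = κ₂} {K₀} s e s′ with Sim-tree R₁ R₂ s
... | refl = near (⟦⟧ᵀ-≈ A (≈ˢ-toSub λ p → ≈-trans (e p)
    (subst (⌊ R₁ ⌋ ⊢ κ₂ p ⟦ toSub K₀ ⟧ ≈_) (⟦path⟧ {R₁} (κ₂ p)) (⟦⟧-≈ (κ₂ p) (≈ˢ-toSub λ q → ≈-sym (Sim-elim R₁ s q))))))
    (Sim-elim R₁ s′)

record Redex {n} (Γ : Ctx n) (S : Tree) (P : Branch S) (T : Tree) (L : Labelling S n) (M : Labelling T n) : Set where
  constructor redex
  field
    rw : WL Γ ⋆ L
    rh : height T ≤ leafHeight P
    rl : L (overline P) ≡ 𝒞 (leafHeight P) T ⟦ toSub M ⟧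

open Redex public

r-overlap : ∀ {Γ : Ctx n} {d S P T L M} b → Redex Γ S P T L M → leafHeight P ≤ d → Overlap (LowEq d Γ) S P T b L M
r-overlap {S = S} {P} {T} b r le = redex-overlap S P T (rw r) (rl r) b le

Overlap-map : ∀ {R R′ : Tm n → Tm n → Set} → (∀ {s t} → R s t → R′ s t) → ∀ S P T b {L M} →
              Overlap R S P T b L M → Overlap R′ S P T b L M
Overlap-map f (S ∷ Ss) ([0] _)  T        b       (o , o′)     = f o , f o′
Overlap-map f (S ∷ Ss) (0∷ P)   (T ∷ []) (s≤s b) (o , o′ , v) = f o , f o′ , Overlap-map f S P T b v
Overlap-map f (S ∷ Ss) (next P) T        b       o            = Overlap-map f Ss P T b o

r-overlap-≈ : ∀ {Γ : Ctx n} {S P T L M} b → Redex Γ S P T L M → Overlap (Γ ⊢_≈_) S P T b L M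
r-overlap-≈ {S = S} {P} {T} b r = Overlap-map LowEq⇒≈ S P T b (r-overlap b r ≤-refl)

r-ins : ∀ {Γ : Ctx n} {S P T L M} b → Redex Γ S P T L M → WL Γ ⋆ (ins S P T b L M)
r-ins {S = S} {P} {T} b r = redex-WL S P T (rw r) (rl r) b ≤-refl

r-κ : ∀ {Γ : Ctx n} {S P T L M} b → Redex Γ S P T L M → ∀ p → Γ ⊢ L p ≈ (κ S P T b ⨾ toSub (ins S P T b L M)) p
r-κ {S = S} {P} {T} b r p = LowEq⇒≈ (redex-κ S P T (rw r) (rl r) b ≤-refl p)

discLab-leaf : ∀ S → Linear S → ∀ (e : Ends n) t → discLab {T = S} e t (zeros S) ≡ t
discLab-leaf []           l e t = refl
discLab-leaf (S ∷ [])     l e t = discLab-leaf S (suc-injective l) (up e) t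
discLab-leaf (S ∷ U ∷ Us) l e t = linear-single S U Us l

exterior-leaf : ∀ S P T b (ρ : Labelling (insert S P T b) n) e t → exterior S P T b ρ e t (overline P) ≡ t
exterior-leaf (S ∷ Ss) ([0] l)  T        b       ρ e t = discLab-leaf S l (up e) t
exterior-leaf (S ∷ Ss) (0∷ P)   (T ∷ []) (s≤s b) ρ e t = exterior-leaf S P T b (λ q → ρ (0∷ q)) (up e) t
exterior-leaf (S ∷ Ss) (next P) T        b       ρ e t = exterior-leaf Ss P T b (λ q → ρ (next q)) e t

κ-leaf : ∀ S P T b (ρ : Labelling (insert S P T b) n) →
  (κ S P T b ⨾ toSub ρ) (overline P) ≡ 𝒞 (leafHeight P) T ⟦ toSub (λ q → ρ (ι S P T b q)) ⟧
κ-leaf S P T b ρ = trans (κ-⟦⟧ S P T b ρ (overline P)) (exterior-leaf S P T b ρ _ _)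

-- The universal redex: for the generic `ρ`, facts about redexes specialise to facts about `κ`.
κ-redex : ∀ {Γ : Ctx n} S P T b {ρ} → height T ≤ leafHeight P → WL Γ ⋆ ρ →
          Redex Γ S P T (κ S P T b ⨾ toSub ρ) (λ q → ρ (ι S P T b q))
κ-redex S P T b {ρ} h w = redex (WL-⨾ (κ-WL S P T b h) (WL⇒⊢ˢ w)) h (κ-leaf S P T b ρ)

ins-κ-ι : ∀ S P T b (ρ : Labelling (insert S P T b) n) p →
          ins S P T b (κ S P T b ⨾ toSub ρ) (λ q → ρ (ι S P T b q)) p ≡ ρ p
ins-κ-ι S P T b ρ p = trans (insert-rel S P T b _≡_ (κ-⟦⟧ S P T b ρ) (λ _ → refl) p) (ins-exterior-ι S P T b ρ _ _ p)

relabel : ∀ {Γ : Ctx n} {S T j t} {L : Labelling S n} {M} (Q : Branch S) → WL Γ ⋆ L → height T ≤ j →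
  leafHeight Q ≡ j → L (overline Q) ≡ t → t ≡ 𝒞 j T ⟦ toSub M ⟧ → Redex Γ S Q T L M
relabel Q w h refl e₁ e₂ = redex w h (trans e₁ e₂)

module _ {Γ : Ctx n} {S : Tree} {P Q : Branch S} (s : Before P Q) (T U : Tree) {L : Labelling S n} {M N}
         (r : Redex Γ S P T L M) (r′ : Redex Γ S Q U L N) (b : branchHeight P ≤ trunkHeight T)
         (c : branchHeight Q ≤ trunkHeight U) (b′ : branchHeight (moveˡ s U c) ≤ trunkHeight T)
         (c′ : branchHeight (moveʳ s T b) ≤ trunkHeight U) where
  redexʳ : Redex Γ (insert S P T b) (moveʳ s T b) U (ins S P T b L M) N
  redexʳ = relabel (moveʳ s T b) (r-ins b r) (rh r′) (moveʳ-lh s T b) (ins-moveʳ s T b L M) (rl r′)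

  redexˡ : Redex Γ (insert S Q U c) (moveˡ s U c) T (ins S Q U c L N) M
  redexˡ = relabel (moveˡ s U c) (r-ins c r′) (rh r) (moveˡ-lh s U c) (ins-moveˡ s U c L N) (rl r)

parallel-near : ∀ {Γ : Ctx n} {S} {P Q : Branch S} (s : Before P Q) T U {L M N d A}
  (r : Redex Γ S P T L M) (r′ : Redex Γ S Q U L N) b c b′ c′ → leafHeight P ≤ d → leafHeight Q ≤ d →
  Near d Γ
    (coh ⌊ insert (insert S P T b) (moveʳ s T b) U c′ ⌋ (A ⟦ toSub (κ S P T b) ⟧ᵀ ⟦ toSub (κ _ (moveʳ s T b) U c′) ⟧ᵀ)
      (toSub (ins _ (moveʳ s T b) U c′ (ins S P T b L M) N)))
    (coh ⌊ insert (insert S Q U c) (moveˡ s U c) T b′ ⌋ (A ⟦ toSub (κ S Q U c) ⟧ᵀ ⟦ toSub (κ _ (moveˡ s U c) T b′) ⟧ᵀ)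
      (toSub (ins _ (moveˡ s U c) T b′ (ins S Q U c L N) M)))
parallel-near {Γ = Γ} {S} {P} {Q} s T U {L} {M} {N} {d} {A} r r′ b c b′ c′ le le′ =
  subst₂ (λ B C → Near d Γ (coh ⌊ R₁ ⌋ B _) (coh ⌊ R₂ ⌋ C _)) (sym (comp κP κQ′)) (sym (comp κQ κP′))
    (near-univ R₁ R₂ {A = A} sim₀ eq₀ (parallel LowEq-IsEq s T b U c b′ c′ (r-overlap b r le) (r-overlap c r′ le′)))
  where
  P′ = moveˡ s U c
  Q′ = moveʳ s T b
  R₁ = insert (insert S P T b) Q′ U c′
  R₂ = insert (insert S Q U c) P′ T b′
  κP  = κ S P T b
  κQ  = κ S Q U c
  κP′ = κ (insert S Q U c) P′ T b′
  κQ′ = κ (insert S P T b) Q′ U c′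
  comp : ∀ {l} {V : Tree} (κ₁ : Labelling S (suc (size V))) (κ₂ : Labelling V l) →
         A ⟦ toSub κ₁ ⟧ᵀ ⟦ toSub κ₂ ⟧ᵀ ≡ A ⟦ toSub (κ₁ ⨾ toSub κ₂) ⟧ᵀ
  comp κ₁ κ₂ = trans (⟦⟧ᵀ-• A _ _) (cong (A ⟦_⟧ᵀ) (toSub-• κ₁ (toSub κ₂)))
  hT = rh r
  hU′ : height U ≤ leafHeight Q′
  hU′ = ≤-trans (rh r′) (≤-reflexive (sym (moveʳ-lh s T b)))
  wQ′ : WL ⌊ R₁ ⌋ ⋆ κQ′
  wQ′ = κ-WL (insert S P T b) Q′ U c′ hU′
  -- The generic configuration: the identity labelling of `R₁`, restricted to each of `S`, `T` and
  -- `U`. By `id₀` the first route rebuilds the identity from it, so the second route yields the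
  -- `K₀` required by `near-univ`.
  L₀ = κP ⨾ toSub κQ′
  M₀ = λ q → κQ′ (ι S P T b q)
  N₀ = ιSub (insert S P T b) Q′ U c′
  r₀ : Redex ⌊ R₁ ⌋ S P T L₀ M₀
  r₀ = κ-redex S P T b hT wQ′
  leafQ : L₀ (overline Q) ≡ 𝒞 (leafHeight Q′) U ⟦ toSub N₀ ⟧
  leafQ = trans (κ-⟦⟧ S P T b κQ′ (overline Q)) (trans (exterior-moveʳ s T b κQ′ _ _)
    (trans (sym (⟦path⟧ {R₁} (κQ′ (overline Q′)))) (κ-leaf (insert S P T b) Q′ U c′ (path R₁))))
  r₀′ : Redex ⌊ R₁ ⌋ S Q U L₀ N₀
  r₀′ = redex (rw r₀) (rh r′) (trans leafQ (cong (λ k → 𝒞 k U ⟦ toSub N₀ ⟧) (moveʳ-lh s T b)))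
  K₀ = ins (insert S Q U c) P′ T b′ (ins S Q U c L₀ N₀) M₀
  id₀ : ∀ p → ins (insert S P T b) Q′ U c′ (ins S P T b L₀ M₀) N₀ p ≡ path R₁ p
  id₀ p = trans (insert-rel (insert S P T b) Q′ U c′ _≡_
      (λ q → trans (ins-κ-ι S P T b κQ′ q) (sym (⟦path⟧ {R₁} (κQ′ q)))) (λ _ → refl) p)
    (ins-κ-ι (insert S P T b) Q′ U c′ (path R₁) p)
  sim₀ : Sim (⌊ R₁ ⌋ ⊢_≈_) R₁ (path R₁) R₂ K₀
  sim₀ = Sim-trans {R = _≡_} (λ { refl e → e }) R₁ R₁ R₂ (Sim-intro R₁ (λ p → sym (id₀ p)))
    (parallel ≈-IsEq s T b U c b′ c′ (r-overlap-≈ b r₀) (r-overlap-≈ c r₀′))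
  eq₀ : ∀ p → ⌊ R₁ ⌋ ⊢ L₀ p ≈ (κQ ⨾ toSub κP′ ⨾ toSub K₀) p
  eq₀ p = ≈-trans (r-κ c r₀′ p) (subst (⌊ R₁ ⌋ ⊢ κQ p ⟦ toSub (ins S Q U c L₀ N₀) ⟧ ≈_)
    (sym (⟦⟧-• (κQ p) (toSub κP′) (toSub K₀)))
    (⟦⟧-≈ (κQ p) (≈ˢ-κ (r-κ b′ (redexˡ s T U r₀ r₀′ b c b′ c′)))))

upd : ∀ {S} → Labelling S n → Path S → Tm n → Labelling S n
upd {S = S} L q t p with pathVar S p Fin.≟ pathVar S q
... | yes _ = t
... | no  _ = L p

upd-same : ∀ {S} (L : Labelling S n) q t → upd L q t q ≡ t
upd-same {S = S} L q t with pathVar S q Fin.≟ pathVar S q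
... | yes _ = refl
... | no ¬e = ⊥-elim (¬e refl)

upd-other : ∀ {S} (L : Labelling S n) q t {p} → p ≢ q → upd L q t p ≡ L p
upd-other {S = S} L q t {p} ne with pathVar S p Fin.≟ pathVar S q
... | yes e = ⊥-elim (ne (pathVar-injective {p = p} {q} e))
... | no  _ = refl

upd-rel : ∀ {S} {R : Tm n → Tm n → Set} → (∀ {s} → R s s) → ∀ (L : Labelling S n) q {t} → R (L q) t →
          ∀ p → R (L p) (upd L q t p)
upd-rel {S = S} {R} rf L q {t} x p with pathVar S p Fin.≟ pathVar S q
... | yes e = subst (λ r → R (L r) t) (sym (pathVar-injective {p = p} {q} e)) x
... | no  _ = rf

-- A redex asks for a syntactic standard coherence at its leaf. A leaf that is merely equal to one
-- is exchanged for it; the inserted labelling does not see the difference (`ins-upd`).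
upd-redex : ∀ {Γ : Ctx n} {S P T} {L : Labelling S n} {M} → WL Γ ⋆ L → height T ≤ leafHeight P →
  Γ ⊢ L (overline P) ≈ 𝒞 (leafHeight P) T ⟦ toSub M ⟧ →
  Redex Γ S P T (upd L (overline P) (𝒞 (leafHeight P) T ⟦ toSub M ⟧)) M
upd-redex {Γ = Γ} {P = P} {L = L} w h e =
  redex (WL-≈ w (upd-rel {R = Γ ⊢_≈_} (≈-refl _) L (overline P) e)) h (upd-same L (overline P) _)

ins-upd : ∀ S P T b {L : Labelling S n} {M t} p → ins S P T b (upd L (overline P) t) M p ≡ ins S P T b L M p
ins-upd S P T b {L} {M} {t} p = ins-irrelevant S P T b (λ ne → upd-other L (overline P) t ne) p

κ⨾path : ∀ S P T b p → (κ S P T b ⨾ toSub (path (insert S P T b))) p ≡ κ S P T b p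
κ⨾path S P T b p = ⟦path⟧ {insert S P T b} (κ S P T b p)

module _ {S : Tree} (P : Branch S) (T : Tree) (¬l : ¬ Linear T) (Q : Branch T) (U : Tree)
         (h : height T ≤ leafHeight P) (g : height U ≤ leafHeight Q)
         (b : branchHeight P ≤ trunkHeight T) (c : branchHeight Q ≤ trunkHeight U)
         (b′ : branchHeight P ≤ trunkHeight (insert T Q U c))
         (c′ : branchHeight (nest P T b ¬l Q) ≤ trunkHeight U) where
  private
    V = insert T Q U c
    P̂ = nest P T b ¬l Q
    R₁ = insert S P V b′
    R₂ = insert (insert S P T b) P̂ U c′
    κ₂ = κ S P T b ⨾ toSub (κ (insert S P T b) P̂ U c′)

  nested-redex : ∀ {Γ : Ctx n} {L : Labelling S n} {M N} → Redex Γ S P T L M → Redex Γ T Q U M N →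
                 Redex Γ (insert S P T b) P̂ U (ins S P T b L M) N
  nested-redex {L = L} {M} r r′ = relabel P̂ (r-ins b r) g (nest-lh P T b ¬l Q)
    (trans (cong (ins S P T b L M) (nest-overline P T b ¬l Q)) (ins-ι S P T b L M (overline Q))) (rl r′)

  -- Over `R₁` the leaf of the exterior is standard over `V`, whereas the second route expects one
  -- that is standard over `T`. The argument `std` bridges the two; it is established later, using
  -- insertion without side conditions.
  nested-near : ∀ {Γ : Ctx n} {L : Labelling S n} {M N d A} →
    ⌊ V ⌋ ⊢ 𝒞 (leafHeight P) T ⟦ toSub (κ T Q U c) ⟧ ≈ 𝒞 (leafHeight P) V →
    Near d Γ (coh ⌊ R₁ ⌋ (A ⟦ toSub (κ S P V b′) ⟧ᵀ) (toSub (ins S P V b′ L (ins T Q U c M N))))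
      (coh ⌊ R₂ ⌋ (A ⟦ toSub (κ S P T b) ⟧ᵀ ⟦ toSub (κ (insert S P T b) P̂ U c′) ⟧ᵀ)
        (toSub (ins (insert S P T b) P̂ U c′ (ins S P T b L M) N)))
  nested-near {Γ = Γ} {L} {M} {N} {d} {A} std =
    subst (λ B → Near d Γ (coh ⌊ R₁ ⌋ (A ⟦ toSub (κ S P V b′) ⟧ᵀ) (toSub (ins S P V b′ L (ins T Q U c M N)))) (coh ⌊ R₂ ⌋ B _))
      (sym (trans (⟦⟧ᵀ-• A _ _) (cong (A ⟦_⟧ᵀ) (toSub-• (κ S P T b) (toSub (κ (insert S P T b) P̂ U c′))))))
      (near-univ R₁ R₂ {A = A} sim₀ eq₀ (Sim-map inj₁ R₁ R₂ (nested P T b ¬l Q U c b′ c′)))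
    where
    hV : height V ≤ leafHeight P
    hV = ≤-trans (height-insert T Q U c g) h
    L₁ = κ S P V b′
    K₀ = ιSub S P V b′
    M₀ = κ T Q U c ⨾ toSub K₀
    N₀ = λ q → K₀ (ι T Q U c q)
    wK : WL ⌊ R₁ ⌋ ⋆ K₀
    wK = WL-ι S P V b′ (WL-path R₁)
    leaf : ⌊ R₁ ⌋ ⊢ L₁ (overline P) ≈ 𝒞 (leafHeight P) T ⟦ toSub M₀ ⟧
    leaf = ≈-sym (subst₂ (⌊ R₁ ⌋ ⊢_≈_)
      (trans (⟦⟧-• (𝒞 (leafHeight P) T) _ _) (cong (𝒞 (leafHeight P) T ⟦_⟧) (toSub-• (κ T Q U c) (toSub K₀))))
      (trans (sym (κ-leaf S P V b′ (path R₁))) (κ⨾path S P V b′ (overline P)))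
      (≈-⟦⟧ (WL⇒⊢ˢ wK) std))
    L₀ = upd L₁ (overline P) (𝒞 (leafHeight P) T ⟦ toSub M₀ ⟧)
    r₀ : Redex ⌊ R₁ ⌋ S P T L₀ M₀
    r₀ = upd-redex (κ-WL S P V b′ hV) h leaf
    r₀′ : Redex ⌊ R₁ ⌋ T Q U M₀ N₀
    r₀′ = κ-redex T Q U c g wK
    K = ins (insert S P T b) P̂ U c′ (ins S P T b L₀ M₀) N₀
    id₀ : ∀ p → ins S P V b′ L₀ (ins T Q U c M₀ N₀) p ≡ path R₁ p
    id₀ p = trans (ins-upd S P V b′ {L₁} p) (trans
      (insert-rel S P V b′ _≡_ (λ q → sym (κ⨾path S P V b′ q)) (ins-κ-ι T Q U c K₀) p)
      (ins-κ-ι S P V b′ (path R₁) p))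
    sim₀ : Sim (⌊ R₁ ⌋ ⊢_≈_) R₁ (path R₁) R₂ K
    sim₀ = Sim-trans {R = _≡_} {_≡_} (λ { refl refl → ≈-refl _ }) R₁ R₁ R₂ (Sim-intro R₁ (λ p → sym (id₀ p)))
      (nested P T b ¬l Q U c b′ c′)
    eq₀ : ∀ p → ⌊ R₁ ⌋ ⊢ L₁ p ≈ (κ₂ ⨾ toSub K) p
    eq₀ p = ≈-trans (upd-rel {R = ⌊ R₁ ⌋ ⊢_≈_} (≈-refl _) L₁ (overline P) leaf p) (≈-trans (r-κ b r₀ p)
      (subst (⌊ R₁ ⌋ ⊢ κ S P T b p ⟦ toSub (ins S P T b L₀ M₀) ⟧ ≈_) (sym (⟦⟧-• (κ S P T b p) _ (toSub K)))
        (⟦⟧-≈ (κ S P T b p) (≈ˢ-κ (r-κ c′ (nested-redex r₀ r₀′))))))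

stdEnd-full : ∀ ε k V → height V ≤ k → stdEnd ε k V ≡ 𝒯 k V
stdEnd-full ε k V h = trans (Sim-≡ (λ W σ → 𝒯 k W ⟦ σ ⟧) (∂-full k ε V h (path V))) (⟦path⟧ {V} (𝒯 k V))

-- From the height on, both boundaries are the whole tree, so the ends coincide syntactically and
-- endo-coherence removal becomes available.
𝒰-endo : ∀ k V → height V ≤ k → 𝒰 (suc k) V ≡ 𝒯 k V ⇒[ 𝒰 k V ] 𝒯 k V
𝒰-endo k V h = arr-cong (stdEnd-full Sign.- k V h) refl (stdEnd-full Sign.+ k V h)

IdTree-𝒰 : ∀ {k V A} → IdTree V A → A ≡ 𝒰 (suc k) V → V ≡ discTree k
IdTree-𝒰 {k} (idTree d) e with suc-injective (trans (sym (dim-𝒰 (suc d) (discTree d)))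
  (trans (cong dim e) (dim-𝒰 (suc k) (discTree d))))
... | refl = refl

UnTree-𝒰 : ∀ {k V A} → UnTree V A → A ≡ 𝒰 k V → V ≡ discTree k
UnTree-𝒰 {k} (unTree d) e with trans (sym (dim-𝒰 d (discTree d))) (trans (cong dim e) (dim-𝒰 k (discTree d)))
... | refl = refl

toId : ∀ k {V} → Labelling V n → Labelling (discTree k) n
toId k {V} K = discLab (ends K) (𝒯 k V ⟦ toSub K ⟧)

std-ecr : ∀ {Γ : Ctx n} k V (K : Labelling V n) → height V ≤ k → V ≢ discTree k →
          sua′ Γ (𝒞 (suc k) V ⟦ toSub K ⟧) (𝒞 (suc k) (discTree k) ⟦ toSub (toId k K) ⟧)
std-ecr {Γ = Γ} k V K h ne = subst₂ (sua′ Γ)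
  (sym (trans (𝒞-⟦⟧ (suc k) V (toSub K)) (cong (λ A → coh ⌊ V ⌋ A (toSub K)) (𝒰-endo k V h))))
  (trans (cong (λ A → identity A (𝒯 k V ⟦ toSub K ⟧)) (𝒰-mk k V (toSub K)))
    (trans (sym (std-identity k (ends K) (𝒯 k V ⟦ toSub K ⟧))) (sym (𝒞-⟦⟧ (suc k) (discTree k) (toSub (toId k K))))))
  (inj₂ (inj₁ (endo-coherence-removal ⌊ V ⌋ (𝒯 k V) (𝒰 k V) (toSub K)
    (λ i → ne (IdTree-𝒰 (IdShape⇒IdTree (id⇒shape i)) (sym (𝒰-endo k V h)))))))

std-dr : ∀ {Γ : Ctx n} k (K : Labelling (discTree k) n) →
         sua′ Γ (coh ⌊ discTree k ⌋ (𝒰 k (discTree k)) (toSub K)) (K (zeros (discTree k)))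
std-dr {Γ = Γ} k K = subst (λ s → sua′ Γ s (K (zeros (discTree k))))
  (trans (sym (std-unary k (trunkEnds K) _)) (cong (coh ⌊ discTree k ⌋ (𝒰 k (discTree k))) (toSub-disc k K)))
  (inj₁ (disc-removal (mk (trunkEnds K) k) (K (zeros (discTree k)))))

identity-eq : ∀ {Δ : Ctx m} {s B} → IdShape Δ (s ⇒[ B ] s) → ∀ (σ : Sub m n) →
              coh Δ (s ⇒[ B ] s) σ ≡ identity (B ⟦ σ ⟧ᵀ) (s ⟦ σ ⟧)
identity-eq (idShape d) (t ∷ σ) = subst id
  (sym (fromSphere-sphereTy (λ d τ → coh (Disc d) (idType d) (t ∷ τ) ≡ identity (DiscType d ⟦ t ∷ τ ⟧ᵀ) t) d σ))
  (cong (λ A → identity A t) (sym (DiscType-⟦⟧ (sphereTy d σ) t)))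

-- On an identity, which the rule excludes, the right-hand side is the term itself.
ecr-any : ∀ {Γ : Ctx n} (Δ : Ctx m) s B (σ : Sub m n) →
  coh Δ (s ⇒[ B ] s) σ ≡ identity (B ⟦ σ ⟧ᵀ) (s ⟦ σ ⟧)
    ⊎ sua′ Γ (coh Δ (s ⇒[ B ] s) σ) (identity (B ⟦ σ ⟧ᵀ) (s ⟦ σ ⟧))
ecr-any Δ s B σ with idShape? Δ (s ⇒[ B ] s)
... | yes i = inj₁ (identity-eq i σ)
... | no ¬i = inj₂ (inj₂ (inj₁ (endo-coherence-removal Δ s B σ (λ i → ¬i (id⇒shape i)))))

sub-step : ∀ {Γ : Ctx n} {σ τ : Sub m n} x → Γ ⊢ lookup σ x ⟶ lookup τ x →
           (∀ {y} → y ≢ x → lookup σ y ≡ lookup τ y) → Γ ⊢ˢ σ ⟶ τ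
sub-step {σ = s ∷ σ} {t ∷ τ} zero r e with lookup-ext {xs = σ} {τ} (λ x → e {suc x} λ ())
... | refl = head r
sub-step {σ = s ∷ σ} {t ∷ τ} (suc x) r e with e {zero} (λ ())
... | refl = tail (sub-step x r (λ {y} ne → e {suc y} (λ { refl → ne refl })))

upd-step : ∀ {Γ : Ctx n} {S} {L : Labelling S n} q {t} → Γ ⊢ L q ⟶ t → Γ ⊢ˢ toSub L ⟶ toSub (upd L q t)
upd-step {Γ = Γ} {S} {L} q {t} r = sub-step (pathVar S q)
  (subst₂ (Γ ⊢_⟶_) (sym (lookup-toSub L q)) (sym (trans (lookup-toSub (upd L q t) q) (upd-same L q t))) r)
  λ {y} ne → trans (lookup-toSub-var L y) (trans
    (sym (upd-other L q t (λ e → ne (trans (sym (pathVar-varPath S y)) (cong (pathVar S) e)))))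
    (sym (lookup-toSub-var (upd L q t) y)))

trunk≤height : ∀ T → trunkHeight T ≤ height T
trunk≤height []          = z≤n
trunk≤height (T ∷ [])    = s≤s (≤-trans (trunk≤height T) (≤-reflexive refl))
trunk≤height (_ ∷ _ ∷ _) = z≤n

linear-disc : ∀ T → Linear T → T ≡ discTree (height T)
linear-disc []           l = refl
linear-disc (T ∷ [])     l = cong (_∷ []) (linear-disc T (suc-injective l))
linear-disc (T ∷ U ∷ Us) l = linear-single T U Us l

infix 4 _≟ᵉ_

_≟ᵉ_ : (S T : Tree) → Dec (S ≡ T)
[]       ≟ᵉ []       = yes refl
[]       ≟ᵉ (_ ∷ _)  = no λ ()
(_ ∷ _)  ≟ᵉ []       = no λ ()
(S ∷ Ss) ≟ᵉ (T ∷ Ts) with S ≟ᵉ T | Ss ≟ᵉ Ts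
... | yes refl | yes refl = yes refl
... | no ¬e    | _        = no λ { refl → ¬e refl }
... | _        | no ¬e    = no λ { refl → ¬e refl }

depth-disc : ∀ k → depth (zeros (discTree k)) ≡ k
depth-disc k = trans (depth-zeros (discTree k) (disc-linear k)) (height-disc k)

-- Once the unary leaf is removed, the labels agree by `trivial-insert`. For the types, `κ` differs
-- from the relabelling that identifies the two trees by one disc removal, equated in `top`.
trivial-near : ∀ {Γ : Ctx n} {S} (P : Branch S) k b {L : Labelling S n} {K d A} → leafHeight P ≡ suc k →
  Redex Γ S P (discTree (suc k)) L K → leafHeight P ≤ d →
  Near d Γ (coh ⌊ S ⌋ A (toSub (upd L (overline P) (K (zeros (discTree (suc k)))))))
    (coh ⌊ insert S P (discTree (suc k)) b ⌋ (A ⟦ toSub (κ S P (discTree (suc k)) b) ⟧ᵀ)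
      (toSub (ins S P (discTree (suc k)) b L K)))
trivial-near {Γ = Γ} {S} P k b {L} {K} {d} {A} lh r le = subst
    (λ B → Near d Γ (coh ⌊ S ⌋ B (toSub L′)) (coh ⌊ R ⌋ (A ⟦ toSub (κ S P V b) ⟧ᵀ) (toSub (ins S P V b L K))))
    (⟦path⟧ᵀ {S} A) (Near-sym (near-univ R S {A = A} sim₀ eq₀
      (Sim-sym S R (Sim-map (IsEq.sy LowEq-IsEq) S R sim))))
  where
  V = discTree (suc k)
  R = insert S P V b
  hd : leafHeight P ≡ height V
  hd = trans lh (sym (height-disc (suc k)))
  t = K (zeros V)
  L′ = upd L (overline P) t
  lab : L (overline P) ≡ coh ⌊ V ⌋ (𝒰 (suc k) V) (toSub K)
  lab = trans (rl r) (trans (𝒞-⟦⟧ (leafHeight P) V (toSub K)) (cong (λ j → coh ⌊ V ⌋ (𝒰 j V) (toSub K)) lh))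
  L≈ : ∀ p → Γ ⊢ L p ≈ L′ p
  L≈ = upd-rel {R = Γ ⊢_≈_} (≈-refl _) L (overline P)
    (rule (subst (λ s → sua′ Γ s t) (sym lab) (std-dr (suc k) K)) (rw r (overline P)))
  type′ : Γ ⊢ᵀ tyP ⋆ L′ (overline P) ≈ mkB ⋆ (ends K) (leafHeight P)
  type′ = ≈ᵀ-trans (≈ᵀ-sym (tyP-≈ ⋆ L≈ (overline P))) (redex-type S P V (rw r) (rl r))
  trunks : ∀ (ρ : Labelling R _) → (∀ q → ρ (ι S P V b q) ≡ K q) → Trunk V (λ q → ρ (ι S P V b q)) (ends K)
  trunks ρ e ε i lt = trans (Trunk-ends K ε i lt) (sym (e (trunk ε i V)))
  ρ₁ = ins S P V b L′ K
  sim : Sim (LowEq d Γ) S L′ R (ins S P V b L K)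
  sim = Sim-trans {R = LowEq d Γ} {_≡_} (λ { e refl → e }) S S R (Sim-intro S (subst (λ u → ∀ p → LowEq d Γ (L′ p) (exterior S P V b ρ₁ (ends K) u p))
        (upd-same L (overline P) t) (exterior-ins S P V b (WL-≈ (rw r) L≈) (Trunk-ends K) type′ le
          (overlaps S P V b (WL-≈ (rw r) L≈) (Trunk-ends K) type′ le))))
    (Sim-trans {R = _≡_} {_≡_} trans S R R (trivial-insert S P V b (disc-linear (suc k)) hd ρ₁ (ends K) t
        (trunks ρ₁ (ins-ι S P V b L′ K)) (sym (ins-ι S P V b L′ K (zeros V))))
      (Sim-intro R (ins-upd S P V b)))
  rι : Redex ⌊ R ⌋ S P V (κ S P V b ⨾ toSub (path R)) (ιSub S P V b)
  rι = κ-redex S P V b (≤-reflexive (sym hd)) (WL-path R)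
  top : ⌊ R ⌋ ⊢ path R (ι S P V b (zeros V)) ≈ 𝒞 (leafHeight P) V ⟦ toSub (ιSub S P V b) ⟧
  top = ≈-sym (rule (subst (λ s → sua′ ⌊ R ⌋ s (path R (ι S P V b (zeros V))))
      (sym (trans (𝒞-⟦⟧ (leafHeight P) V _) (cong (λ j → coh ⌊ V ⌋ (𝒰 j V) (toSub (ιSub S P V b))) lh)))
      (std-dr (suc k) (ιSub S P V b)))
    (subst (⌊ R ⌋ ⊢_∶ tyP ⋆ (κ S P V b ⨾ toSub (path R)) (overline P)) (rl rι) (rw rι (overline P))))
  klι = exterior S P V b (path R) (ends (ιSub S P V b)) (path R (ι S P V b (zeros V)))
  back : Sim _≡_ R (path R) S klι
  back = Sim-sym S R (Sim-map sym S R (trivial-insert S P V b (disc-linear (suc k)) hd (path R)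
    (ends (ιSub S P V b)) _ (Trunk-ends (ιSub S P V b)) refl))
  klκ : ∀ p → ⌊ R ⌋ ⊢ klι p ≈ κ S P V b p
  klκ p = subst (⌊ R ⌋ ⊢ klι p ≈_) (sym (κ-exterior S P V b p))
    (exterior-rel S P V b (⌊ R ⌋ ⊢_≈_) (λ _ → ≈-refl _) (λ ε i → ≈-refl _) top p)
  sim₀ : Sim (⌊ R ⌋ ⊢_≈_) R (path R) S (κ S P V b)
  sim₀ = Sim-trans {R = _≡_} {⌊ R ⌋ ⊢_≈_} (λ { refl e → e }) R S S back (Sim-intro S klκ)
  eq₀ : ∀ p → ⌊ R ⌋ ⊢ κ S P V b p ≈ (path S ⨾ toSub (κ S P V b)) p
  eq₀ p = ≈-reflexive (sym (lookup-toSub (κ S P V b) p))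

shorten-lh : ∀ {S} (P : Branch S) k b lt → leafHeight (shorten P k b lt) ≡ k
shorten-lh {S} P k b lt = trans (cong depth (shorten-overline P k b lt))
  (trans (depth-ι S P (discTree k) b (zeros (discTree k))) (depth-disc k))

toId-top : ∀ k {V} (K : Labelling V n) → V ≢ discTree k → height V ≤ k → toId k K (zeros (discTree k)) ≡ 𝒞 k V ⟦ toSub K ⟧
toId-top k {V} K ne h = trans (discLab-leaf (discTree k) (disc-linear k) (ends K) _) (cong (_⟦ toSub K ⟧) (lem (standard k V h) ne))
  where
  lem : Standard k V → V ≢ discTree k → 𝒯 k V ≡ 𝒞 k V
  lem (disc _)       ne = ⊥-elim (ne refl)
  lem (non-disc _ e) ne = e

module _ {S : Tree} (P : Branch S) (k : ℕ) (lh : leafHeight P ≡ suc k) (lt : branchHeight P < k) (V : Tree) (h : height V ≤ k)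
         (ne : V ≢ discTree k) (b : branchHeight P ≤ trunkHeight (discTree k)) (c : branchHeight P ≤ trunkHeight V)
         (c′ : branchHeight (shorten P k b lt) ≤ trunkHeight V) where
  private
    D = discTree k
    P₁ = shorten P k b lt
    R₁ = insert (insert S P D b) P₁ V c′
    R₂ = insert S P V c
    hD : height D ≤ leafHeight P
    hD = ≤-trans (≤-reflexive (height-disc k)) (≤-trans (n≤1+n k) (≤-reflexive (sym lh)))
    hV : height V ≤ leafHeight P
    hV = ≤-trans h (≤-trans (n≤1+n k) (≤-reflexive (sym lh)))

  -- The leaf has dimension `k + 1`, above the height of `V`, and is thus an endo-coherence. This is
  -- `L` after removing it: the new leaf is the identity on `𝒯 k V`, which can be inserted as the
  -- disc `D` and leaves a standard leaf one dimension lower.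
  id-label : Labelling S n → Labelling V n → Labelling S n
  id-label L K = upd L (overline P) (𝒞 (suc k) D ⟦ toSub (toId k K) ⟧)

  id-ecr : ∀ {Γ : Ctx n} {L : Labelling S n} {K} → L (overline P) ≡ 𝒞 (leafHeight P) V ⟦ toSub K ⟧ →
           sua′ Γ (L (overline P)) (𝒞 (suc k) D ⟦ toSub (toId k K) ⟧)
  id-ecr {Γ = Γ} {K = K} l = subst (λ s → sua′ Γ s (𝒞 (suc k) D ⟦ toSub (toId k K) ⟧))
    (sym (trans l (cong (λ j → 𝒞 j V ⟦ toSub K ⟧) lh))) (std-ecr k V K h ne)

  id-redex : ∀ {Γ : Ctx n} {L : Labelling S n} {K} → Redex Γ S P V L K → Redex Γ S P D (id-label L K) (toId k K)
  id-redex {Γ = Γ} {L} {K} r = subst (λ j → Redex Γ S P D (upd L (overline P) (𝒞 j D ⟦ toSub (toId k K) ⟧)) (toId k K)) lh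
    (upd-redex (rw r) hD (subst (λ j → Γ ⊢ L (overline P) ≈ 𝒞 j D ⟦ toSub (toId k K) ⟧) (sym lh)
      (rule (id-ecr {L = L} {K} (rl r)) (rw r (overline P)))))

  short-redex : ∀ {Γ : Ctx n} {L : Labelling S n} {K} → Redex Γ S P V L K →
    Redex Γ (insert S P D b) P₁ V (ins S P D b (id-label L K) (toId k K)) K
  short-redex {L = L} {K} r = relabel P₁ (r-ins b (id-redex r)) h (shorten-lh P k b lt)
    (trans (cong (ins S P D b (id-label L K) (toId k K)) (shorten-overline P k b lt))
      (ins-ι S P D b (id-label L K) (toId k K) (zeros D))) (toId-top k K ne h)

  short-Sim : ∀ (L : Labelling S n) K → Sim _≡_ R₂ (ins S P V c L K) R₁
    (ins (insert S P D b) P₁ V c′ (ins S P D b (id-label L K) (toId k K)) K)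
  short-Sim L K = Sim-trans {R = _≡_} {_≡_} trans R₂ R₂ R₁ (Sim-intro R₂ (λ p → sym (ins-upd S P V c {L} {K} p)))
    (Sim-sym R₁ R₂ (Sim-map sym R₁ R₂ (shorten-insert P k b lt V c c′ {id-label L K} {toId k K})))

  short-near : ∀ {Γ : Ctx n} {L : Labelling S n} {K d A} →
    Near d Γ (coh ⌊ R₂ ⌋ (A ⟦ toSub (κ S P V c) ⟧ᵀ) (toSub (ins S P V c L K)))
      (coh ⌊ R₁ ⌋ (A ⟦ toSub (κ S P D b) ⟧ᵀ ⟦ toSub (κ (insert S P D b) P₁ V c′) ⟧ᵀ)
        (toSub (ins (insert S P D b) P₁ V c′ (ins S P D b (id-label L K) (toId k K)) K)))
  short-near {Γ = Γ} {L} {K} {d} {A} =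
    subst (λ B → Near d Γ (coh ⌊ R₂ ⌋ (A ⟦ toSub (κ S P V c) ⟧ᵀ) (toSub (ins S P V c L K))) (coh ⌊ R₁ ⌋ B _))
      (sym (trans (⟦⟧ᵀ-• A _ _) (cong (A ⟦_⟧ᵀ) (toSub-• (κ S P D b) (toSub (κ (insert S P D b) P₁ V c′))))))
      (near-univ R₂ R₁ {A = A} sim₀ eq₀ (Sim-map inj₁ R₂ R₁ (short-Sim L K)))
    where
    K₀ = ιSub S P V c
    L₀ = κ S P V c ⨾ toSub (path R₂)
    r₀ : Redex ⌊ R₂ ⌋ S P V L₀ K₀
    r₀ = κ-redex S P V c hV (WL-path R₂)
    L₁ = id-label L₀ K₀
    J = ins S P D b L₁ (toId k K₀)
    Z = ins (insert S P D b) P₁ V c′ J K₀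
    sim₀ : Sim (⌊ R₂ ⌋ ⊢_≈_) R₂ (path R₂) R₁ Z
    sim₀ = Sim-trans {R = _≡_} {_≡_} (λ { refl refl → ≈-refl _ }) R₂ R₂ R₁
      (Sim-intro R₂ (λ p → sym (ins-κ-ι S P V c (path R₂) p))) (short-Sim L₀ K₀)
    eq₀ : ∀ p → ⌊ R₂ ⌋ ⊢ κ S P V c p ≈ (κ S P D b ⨾ toSub (κ (insert S P D b) P₁ V c′) ⨾ toSub Z) p
    eq₀ p = ≈-trans (≈-reflexive (sym (κ⨾path S P V c p)))
      (≈-trans (upd-rel {R = ⌊ R₂ ⌋ ⊢_≈_} (≈-refl _) L₀ (overline P) (rule (id-ecr {L = L₀} {K₀} (rl r₀)) (rw r₀ (overline P))) p)
      (≈-trans (r-κ b (id-redex r₀) p)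
        (subst (⌊ R₂ ⌋ ⊢ κ S P D b p ⟦ toSub J ⟧ ≈_) (sym (⟦⟧-• (κ S P D b p) _ (toSub Z)))
          (⟦⟧-≈ (κ S P D b p) (≈ˢ-κ (r-κ c′ (short-redex r₀)))))))

-- Insertion without side conditions

near-linear : ∀ {Γ : Ctx n} R V j {d} {K₁ : Labelling R n} {K : Labelling V n} {J : Labelling V (suc (size R))} {A} →
  Sim _≡_ R K₁ V K → Sim _≡_ R (path R) V J → ⌊ R ⌋ ⊢ᵀ 𝒰 j V ⟦ toSub J ⟧ᵀ ≈ A →
  Near d Γ (coh ⌊ V ⌋ (𝒰 j V) (toSub K)) (coh ⌊ R ⌋ A (toSub K₁))
near-linear R V j {J = J} {A} s s′ e with Sim-tree R V s
... | refl = near (subst (⌊ R ⌋ ⊢ᵀ_≈ A) (trans (cong (𝒰 j R ⟦_⟧ᵀ) (toSub-cong (λ p → sym (Sim-elim R s′ p))))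
    (⟦path⟧ᵀ {R} (𝒰 j R))) e) (λ p → inj₁ (sym (Sim-elim R s p)))

zeros-type : ∀ {Γ : Ctx n} e (κ′ : Labelling (discTree e) n) →
  tyP ⋆ κ′ (zeros (discTree e)) ≡ 𝒰 e (discTree e) ⟦ toSub κ′ ⟧ᵀ
zeros-type e κ′ = trans (sym (⌊⌋-‼-toSub κ′ (zeros (discTree e)))) (cong (_⟦ toSub κ′ ⟧ᵀ) (disc-type e))

unary-near : ∀ {Γ : Ctx n} e (P : Branch (discTree e)) V b {d L K} → height V ≤ leafHeight P →
  Near d Γ (coh ⌊ V ⌋ (𝒰 (leafHeight P) V) (toSub K))
    (coh ⌊ insert (discTree e) P V b ⌋ (𝒰 e (discTree e) ⟦ toSub (κ (discTree e) P V b) ⟧ᵀ)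
      (toSub (ins (discTree e) P V b L K)))
unary-near {Γ = Γ} e P V b {L = L} {K} h = near-linear R V (leafHeight P) (linear-insert S (disc-linear e) P V b L K)
  (Sim-trans {R = _≡_} {_≡_} trans R R V (Sim-intro R (λ p → sym (ins-κ-ι S P V b (path R) p)))
    (linear-insert S (disc-linear e) P V b (κ S P V b ⨾ toSub (path R)) (ιSub S P V b)))
  (type-unique (⊢-⟦⟧ (WL⇒⊢ˢ (WL-ι S P V b (WL-path R))) (𝒞-leaf-typed P V h))
    (subst₂ (⌊ R ⌋ ⊢_∶_) (rl r) (trans (tyP-ext ⋆ (κ⨾path S P V b) (overline P))
      (trans (cong (tyP ⋆ (κ S P V b)) (overline-linear (disc-linear e) P)) (zeros-type {Γ = ⌊ R ⌋} e (κ S P V b))))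
      (rw r (overline P))))
  where
  S = discTree e
  R = insert S P V b
  r = κ-redex S P V b h (WL-path R)

leaf-bound : ∀ {Γ : Ctx n} {S} (P : Branch S) {A σ B} → Γ ⊢ coh ⌊ S ⌋ A σ ∶ B → leafHeight P ≤ dim B
leaf-bound {S = S} P d with coh-inv d
... | cohInv {s} {A} {t} {σ} _ (arr a ds dt) _ r e = ≤-trans (≤-reflexive (sym (dim-path (overline P))))
  (≤-trans (dim-‼ ⌊ S ⌋ (pathVar S (overline P))) (≤-trans (coh-dim {t = t} ds r)
    (≤-reflexive (trans (cong suc (sym (dim-⟦⟧ A σ))) (dim-≈ e)))))

dim-coh : ∀ {Γ : Ctx n} {Δ : Ctx m} {A σ B} → Γ ⊢ coh Δ A σ ∶ B → dim A ≡ dim B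
dim-coh {A = A} {σ} d = trans (sym (dim-⟦⟧ A σ)) (dim-≈ (inv-ty (coh-inv d)))

coh-redex : ∀ {Γ : Ctx n} {S P T L M A B} → Γ ⊢ coh ⌊ S ⌋ A (toSub L) ∶ B → height T ≤ leafHeight P →
  L (overline P) ≡ 𝒞 (leafHeight P) T ⟦ toSub M ⟧ → Redex Γ S P T L M
coh-redex d h l = redex (⊢ˢ⇒WL (inv-sub (coh-inv d))) h l

std-IsIdentity : ∀ k (K : Labelling (discTree k) n) → IsIdentity (coh ⌊ discTree k ⌋ (𝒰 (suc k) (discTree k)) (toSub K))
std-IsIdentity k K = shape⇒id (ctx-IdShape (disc-identity k))

target : ∀ S P V b (A : Ty (suc (size S))) → Labelling S n → Labelling V n → Tm n
target S P V b A L K = coh ⌊ insert S P V b ⌋ (A ⟦ toSub (κ S P V b) ⟧ᵀ) (toSub (ins S P V b L K))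

insertion-step : ∀ {Γ : Ctx n} S (P : Branch S) V b {A} {L : Labelling S n} {K} → height V ≤ leafHeight P →
  L (overline P) ≡ 𝒞 (leafHeight P) V ⟦ toSub K ⟧ → ¬ UnShape ⌊ S ⌋ A → ¬ IdShape ⌊ S ⌋ A →
  IsIdentity (L (overline P)) ⊎ (leafHeight P ≡ height V × ¬ IsUnary (L (overline P))) →
  Γ ⊢ coh ⌊ S ⌋ A (toSub L) ⟶ target S P V b A L K
insertion-step S P V b {A} {L} h l ¬u ¬i c =
  rule (inj₂ (inj₂ (insertion (record { bh≤th = b ; h≤lh = h ; label = l }) A (λ i → ¬i (id⇒shape i))
    (λ u → ¬u (un⇒shape u)) c)))

-- The bridging argument runs twice: with typed equality and a trivial `Ok`, to compare standard
-- types, and with joinability and confluence as `Ok`, to resolve peaks.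
module GGI {n : ℕ} {Γ : Ctx n} (d : ℕ) (Rel : Tm n → Tm n → Set) (Ok : Tm n → Set)
  (r-step  : ∀ {x y A} → Γ ⊢ x ∶ A → dim A ≡ d → Ok x → Γ ⊢ x ⟶ y → Rel x y)
  (ok-step : ∀ {x y A} → Γ ⊢ x ∶ A → Ok x → Γ ⊢ x ⟶ y → Ok y)
  (r-near  : ∀ {x y A} → Γ ⊢ x ∶ A → dim A ≡ d → Γ ⊢ y ∶ A → Ok x → Ok y → Near d Γ x y → Rel x y)
  (r-sym   : ∀ {x y} → Rel x y → Rel y x)
  (r-trans : ∀ {x y z} → Rel x y → Rel y z → Rel x z) where

  -- Closed under `Sim` because the recursion in `ggi` reaches the target labels through a detour,
  -- over a tree only propositionally equal to the expected one.
  OkOver : ∀ R → Labelling R n → Set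
  OkOver R K = ∀ {R′ C B} {K′ : Labelling R′ n} → Γ ⊢ coh ⌊ R′ ⌋ C (toSub K′) ∶ B → dim B ≡ d →
    Sim _≡_ R K R′ K′ → Ok (coh ⌊ R′ ⌋ C (toSub K′))

  Goal : ∀ S P V b A → Labelling S n → Labelling V n → Set
  Goal S P V b A L K = Rel (coh ⌊ S ⌋ A (toSub L)) (target S P V b A L K)

  okTarget : ∀ S P V b A {L K B} → Γ ⊢ target S P V b A L K ∶ B → dim B ≡ d →
    OkOver (insert S P V b) (ins S P V b L K) → Ok (target S P V b A L K)
  okTarget S P V b A dt e o = o dt e (Sim-refl (λ _ → refl) (insert S P V b))

  -- Disc removal exposes the leaf. As the leaf is standard over `V`, and inserting `V` into a
  -- linear tree gives `V` back, the leaf and the target differ only in their types.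
  over-unary : ∀ {S A} → UnTree S A → ∀ P V b {L K B} → Γ ⊢ coh ⌊ S ⌋ A (toSub L) ∶ B → dim B ≡ d →
    height V ≤ leafHeight P → L (overline P) ≡ 𝒞 (leafHeight P) V ⟦ toSub K ⟧ →
    Ok (coh ⌊ S ⌋ A (toSub L)) → OkOver (insert S P V b) (ins S P V b L K) → Goal S P V b A L K
  over-unary (unTree e) P V b {L} {K} dt eq h l ok ok′ = r-trans (r-step dt eq ok step₁)
    (r-near (⟶-typed dt step₁) eq (insert-typed S P V b h l dt) (ok-step dt ok step₁)
      (okTarget S P V b (𝒰 e S) (insert-typed S P V b h l dt) eq ok′) (unary-near e P V b h))
    where
    S = discTree e
    step₁ : Γ ⊢ coh ⌊ S ⌋ (𝒰 e S) (toSub L) ⟶ coh ⌊ V ⌋ (𝒰 (leafHeight P) V) (toSub K)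
    step₁ = rule (subst (sua′ Γ _) (trans (cong L (sym (overline-linear (disc-linear e) P)))
      (trans l (𝒞-⟦⟧ (leafHeight P) V (toSub K)))) (std-dr e L))

  -- Pulled back along `κ` the type keeps equal ends, so the target is an endo-coherence. Its
  -- removal yields an identity whose labels are `κ` followed by the inserted labelling, hence near
  -- the original.
  over-identity : ∀ {S A} → IdTree S A → ∀ P V b {L K B} → Γ ⊢ coh ⌊ S ⌋ A (toSub L) ∶ B → dim B ≡ d →
    height V ≤ leafHeight P → L (overline P) ≡ 𝒞 (leafHeight P) V ⟦ toSub K ⟧ →
    Ok (coh ⌊ S ⌋ A (toSub L)) → OkOver (insert S P V b) (ins S P V b L K) → Goal S P V b A L K
  over-identity (idTree e) P V b {L} {K} {B} dt eq h l ok ok′ = r-sym (finish (ecr-any ⌊ R ⌋ (s ⟦ κS ⟧) (C ⟦ κS ⟧ᵀ) I))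
    where
    S = discTree e
    R = insert S P V b
    s = 𝒯 e S
    C = 𝒰 e S
    κS = toSub (κ S P V b)
    I = toSub (ins S P V b L K)
    endo = 𝒰-endo e S (≤-reflexive (height-disc e))
    L′ = κ S P V b ⨾ I
    mid = coh ⌊ S ⌋ (𝒰 (suc e) S) (toSub L′)
    tgt≡ : target S P V b (𝒰 (suc e) S) L K ≡ coh ⌊ R ⌋ (s ⟦ κS ⟧ ⇒[ C ⟦ κS ⟧ᵀ ] s ⟦ κS ⟧) I
    tgt≡ = cong (λ A → coh ⌊ R ⌋ (A ⟦ κS ⟧ᵀ) I) endo
    mid≡ : identity (C ⟦ κS ⟧ᵀ ⟦ I ⟧ᵀ) (s ⟦ κS ⟧ ⟦ I ⟧) ≡ mid
    mid≡ = trans (cong₂ identity (trans (⟦⟧ᵀ-• C κS I) (cong (C ⟦_⟧ᵀ) (toSub-• (κ S P V b) I)))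
                                 (trans (⟦⟧-• s κS I) (cong (s ⟦_⟧) (toSub-• (κ S P V b) I))))
      (trans (sym (identity-eq (subst (IdShape ⌊ S ⌋) endo (ctx-IdShape (disc-identity e))) (toSub L′)))
        (cong (λ A → coh ⌊ S ⌋ A (toSub L′)) (sym endo)))
    tgt-typed : Γ ⊢ target S P V b (𝒰 (suc e) S) L K ∶ B
    tgt-typed = insert-typed S P V b h l dt
    okT : Ok (target S P V b (𝒰 (suc e) S) L K)
    okT = okTarget S P V b (𝒰 (suc e) S) tgt-typed eq ok′
    nr : Near d Γ mid (coh ⌊ S ⌋ (𝒰 (suc e) S) (toSub L))
    nr = Near-sym (near (≈ᵀ-refl _) (redex-κ S P V (rw r) (rl r) b
        (≤-trans (leaf-bound {S = S} P dt) (≤-reflexive eq))))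
      where r = coh-redex {S = S} {P} {V} dt h l
    finish : (coh ⌊ R ⌋ (s ⟦ κS ⟧ ⇒[ C ⟦ κS ⟧ᵀ ] s ⟦ κS ⟧) I ≡ identity (C ⟦ κS ⟧ᵀ ⟦ I ⟧ᵀ) (s ⟦ κS ⟧ ⟦ I ⟧)
      ⊎ sua′ Γ (coh ⌊ R ⌋ (s ⟦ κS ⟧ ⇒[ C ⟦ κS ⟧ᵀ ] s ⟦ κS ⟧) I) (identity (C ⟦ κS ⟧ᵀ ⟦ I ⟧ᵀ) (s ⟦ κS ⟧ ⟦ I ⟧))) →
      Rel (target S P V b (𝒰 (suc e) S) L K) (coh ⌊ S ⌋ (𝒰 (suc e) S) (toSub L))
    finish (inj₁ i) = subst (λ t → Rel t (coh ⌊ S ⌋ (𝒰 (suc e) S) (toSub L))) (sym eq′) (r-near (subst (Γ ⊢_∶ B) eq′ tgt-typed) eq dt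
        (subst Ok eq′ okT) ok nr)
      where eq′ = trans tgt≡ (trans i mid≡)
    finish (inj₂ i) = r-trans (r-step tgt-typed eq okT st)
        (r-near (⟶-typed tgt-typed st) eq dt (ok-step tgt-typed okT st) ok nr)
      where
      st : Γ ⊢ target S P V b (𝒰 (suc e) S) L K ⟶ mid
      st = rule (subst₂ (sua′ Γ) (sym tgt≡) mid≡ i)

  -- `j` bounds the height of the leaf. If `V` is the disc of that dimension, the leaf is a unary
  -- composite and is removed; if `V` is the disc one dimension lower or has full height, the rule
  -- itself applies; in the remaining case the leaf is an endo-coherence.
  ggi : ∀ j S (P : Branch S) V b {A L K B} → leafHeight P ≤ j → Γ ⊢ coh ⌊ S ⌋ A (toSub L) ∶ B → dim B ≡ d →
    height V ≤ leafHeight P → L (overline P) ≡ 𝒞 (leafHeight P) V ⟦ toSub K ⟧ →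
    Ok (coh ⌊ S ⌋ A (toSub L)) → OkOver (insert S P V b) (ins S P V b L K) → Goal S P V b A L K
  ggi j S P V b {A} {L} {K} {B} le dt eq h l ok ok′ with unShape? ⌊ S ⌋ A | idShape? ⌊ S ⌋ A | leafHeight-suc P
  ... | yes u | _     | _ = over-unary (UnShape⇒UnTree u) P V b dt eq h l ok ok′
  ... | no _  | yes i | _ = over-identity (IdShape⇒IdTree i) P V b dt eq h l ok ok′
  ... | no ¬u | no ¬i | k , lh with V ≟ᵉ discTree (suc k) | V ≟ᵉ discTree k | height V ≟ suc k
  ...   | yes refl | _ | _ =
    let st = coh-sub (upd-step {L = L} (overline P) (rule (subst (λ s → sua′ Γ s (K (zeros (discTree (suc k)))))
               (sym (trans l (trans (𝒞-⟦⟧ (leafHeight P) V (toSub K)) (cong (λ j → coh ⌊ V ⌋ (𝒰 j V) (toSub K)) lh))))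
               (std-dr (suc k) K))))
    in r-trans (r-step dt eq ok st) (r-near (⟶-typed dt st) eq (insert-typed S P V b h l dt) (ok-step dt ok st)
         (okTarget S P V b A (insert-typed S P V b h l dt) eq ok′)
         (trivial-near P k b lh (coh-redex dt h l) (≤-trans (leaf-bound P dt) (≤-reflexive eq))))
  ...   | no _ | yes refl | _ = r-step dt eq ok (insertion-step S P V b h l ¬u ¬i (inj₁ (subst IsIdentity
            (sym (trans l (trans (𝒞-⟦⟧ (leafHeight P) V (toSub K)) (cong (λ j → coh ⌊ V ⌋ (𝒰 j V) (toSub K)) lh))))
            (std-IsIdentity k K))))
  ...   | no ne | no _ | yes hV = r-step dt eq ok (insertion-step S P V b h l ¬u ¬i (inj₂ (trans lh (sym hV) ,
            λ u → ne (trans (UnTree-𝒰 (UnShape⇒UnTree (un⇒shape (subst IsUnary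
              (trans l (𝒞-⟦⟧ (leafHeight P) V (toSub K))) u))) refl) (cong discTree lh)))))
  ggi zero S P V b le dt eq h l ok ok′ | no ¬u | no ¬i | k , lh | no _ | no ne | no ¬h =
    ⊥-elim (case ≤-trans (≤-reflexive (sym lh)) le of λ ())
  -- The leaf becomes an identity, the disc `D` is inserted, and `V` is then inserted at the
  -- shortened branch, whose leaf is one lower. The result is near the direct insertion by
  -- `short-near`.
  ggi (suc j) S P V b {A} {L} {K} le dt eq h l ok ok′ | no ¬u | no ¬i | k , lh | no _ | no ne | no ¬h =
    r-trans (r-step dt eq ok st₁) (r-trans (r-step dt₁ eq ok₁ st₂)
      (r-trans (ggi j (insert S P D bD) P₁ V c′ (≤-trans (≤-reflexive (shorten-lh P k bD lt)) (s≤s⁻¹ (≤-trans (≤-reflexive (sym lh)) le)))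
                 dt₂ eq (≤-trans hk (≤-reflexive (sym (shorten-lh P k bD lt))))
                 (rl (short-redex P k lh lt V hk ne bD b c′ (coh-redex {P = P} dt h l)))
                 (ok-step dt₁ ok₁ st₂) okO)
        (r-near dt₃ eq (insert-typed S P V b h l dt)
          (okTarget (insert S P D bD) P₁ V c′ (A ⟦ toSub (κ S P D bD) ⟧ᵀ) dt₃ eq okO)
          (okTarget S P V b A (insert-typed S P V b h l dt) eq ok′)
          (Near-sym (short-near P k lh lt V hk ne bD b c′)))))
    where
    D = discTree k
    hk : height V ≤ k
    hk with m≤n⇒m<n∨m≡n (≤-trans h (≤-reflexive lh))
    ... | inj₁ lt = s≤s⁻¹ lt
    ... | inj₂ e  = ⊥-elim (¬h e)
    -- Equality would force the trunk of `V` to have length `k`, its full height. Then `V` would be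
    -- the disc of dimension `k`, a case already excluded.
    lt : branchHeight P < k
    lt with m≤n⇒m<n∨m≡n (≤-trans b (≤-trans (trunk≤height V) hk))
    ... | inj₁ lt = lt
    ... | inj₂ e  = ⊥-elim (ne (trans (linear-disc V (≤-antisym (trunk≤height V) (≤-trans hk (≤-trans (≤-reflexive (sym e)) b))))
                      (cong discTree (≤-antisym hk (≤-trans (≤-reflexive (sym e)) (≤-trans b (trunk≤height V)))))))
    bD : branchHeight P ≤ trunkHeight D
    bD = ≤-trans (<⇒≤ lt) (≤-reflexive (sym (trans (disc-linear k) (height-disc k))))
    P₁ = shorten P k bD lt
    c′ : branchHeight P₁ ≤ trunkHeight V
    c′ = ≤-trans (≤-reflexive (shorten-bh P k bD lt)) b
    L₁ = id-label P k lh lt V hk ne bD b c′ L K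
    lab₁ : L₁ (overline P) ≡ 𝒞 (leafHeight P) D ⟦ toSub (toId k K) ⟧
    lab₁ = trans (upd-same L (overline P) _) (cong (λ j → 𝒞 j D ⟦ toSub (toId k K) ⟧) (sym lh))
    hD : height D ≤ leafHeight P
    hD = ≤-trans (≤-reflexive (height-disc k)) (≤-trans (n≤1+n k) (≤-reflexive (sym lh)))
    st₁ : Γ ⊢ coh ⌊ S ⌋ A (toSub L) ⟶ coh ⌊ S ⌋ A (toSub L₁)
    st₁ = coh-sub (upd-step {L = L} (overline P) (rule (id-ecr P k lh lt V hk ne bD b c′ {L = L} {K} l)))
    dt₁ = ⟶-typed dt st₁
    ok₁ = ok-step dt ok st₁
    st₂ : Γ ⊢ coh ⌊ S ⌋ A (toSub L₁) ⟶ target S P D bD A L₁ (toId k K)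
    st₂ = insertion-step S P D bD hD lab₁ ¬u ¬i (inj₁ (subst IsIdentity
      (sym (trans (upd-same L (overline P) _) (𝒞-⟦⟧ (suc k) D (toSub (toId k K))))) (std-IsIdentity k (toId k K))))
    dt₂ = ⟶-typed dt₁ st₂
    dt₃ = insert-typed (insert S P D bD) P₁ V c′ (≤-trans hk (≤-reflexive (sym (shorten-lh P k bD lt))))
      (rl (short-redex P k lh lt V hk ne bD b c′ (coh-redex {P = P} dt h l))) dt₂
    okO : OkOver (insert (insert S P D bD) P₁ V c′) (ins (insert S P D bD) P₁ V c′ (ins S P D bD L₁ (toId k K)) K)
    okO {R′} t e s = ok′ t e (Sim-trans {R = _≡_} {_≡_} trans (insert S P V b) _ R′ (short-Sim P k lh lt V hk ne bD b c′ L K) s)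

-- Compatibility of insertion with boundaries and standard types

Linear-∂ : ∀ i T → Linear T → Linear (∂ i T)
Linear-∂ zero    T             l = refl
Linear-∂ (suc i) []            l = refl
Linear-∂ (suc i) (T ∷ [])      l = cong suc (Linear-∂ i T (suc-injective l))
Linear-∂ (suc i) (T ∷ U ∷ Us)  l = linear-single T U Us l

∂-branch : ∀ j {T} (Q : Branch T) → branchHeight Q < j → Branch (∂ j T)
∂-branch (suc i) ([0] {T} l) lt       = [0] (Linear-∂ i T l)
∂-branch (suc i) (0∷ Q)      (s≤s lt) = 0∷ ∂-branch i Q lt
∂-branch (suc i) (next Q)    lt       = next (∂-branch (suc i) Q lt)

∂-branch-bh : ∀ j {T} (Q : Branch T) lt → branchHeight (∂-branch j Q lt) ≡ branchHeight Q
∂-branch-bh (suc i) ([0] l)  lt       = refl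
∂-branch-bh (suc i) (0∷ Q)   (s≤s lt) = cong suc (∂-branch-bh i Q lt)
∂-branch-bh (suc i) (next Q) lt       = ∂-branch-bh (suc i) Q lt

depth-zeros-∂ : ∀ i T → Linear T → depth (zeros (∂ i T)) ≡ i ⊓ depth (zeros T)
depth-zeros-∂ zero    T            l = refl
depth-zeros-∂ (suc i) []           l = refl
depth-zeros-∂ (suc i) (T ∷ [])     l = cong suc (depth-zeros-∂ i T (suc-injective l))
depth-zeros-∂ (suc i) (T ∷ U ∷ Us) l = linear-single T U Us l

∂-branch-lh : ∀ j {T} (Q : Branch T) lt → leafHeight (∂-branch j Q lt) ≡ j ⊓ leafHeight Q
∂-branch-lh (suc i) ([0] {T} l) lt       = cong suc (depth-zeros-∂ i T l)
∂-branch-lh (suc i) (0∷ Q)      (s≤s lt) = cong suc (∂-branch-lh i Q lt)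
∂-branch-lh (suc i) (next Q)    lt       = ∂-branch-lh (suc i) Q lt

trunk-∂ : ∀ j U {i} → i ≤ j → i ≤ trunkHeight U → i ≤ trunkHeight (∂ j U)
trunk-∂ j       U            {zero}  le h = z≤n
trunk-∂ (suc j) (U ∷ [])     {suc i} le h = s≤s (trunk-∂ j U (s≤s⁻¹ le) (s≤s⁻¹ h))

height-∂≤ : ∀ j U → height (∂ j U) ≤ height U
height-∂≤ zero    U        = z≤n
height-∂≤ (suc j) []       = z≤n
height-∂≤ (suc j) (U ∷ Us) = ⊔-mono-≤ (s≤s (height-∂≤ j U)) (height-∂≤ (suc j) Us)

≡-IsEq : IsEq {n} _≡_
≡-IsEq = record { rf = refl ; sy = sym ; tr = trans }

∂-append : ∀ i ε U Ts (ρ : Labelling (U ++ Ts) n) →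
  Sim _≡_ (∂ (suc i) (U ++ Ts)) (λ p → ρ (δ (suc i) ε (U ++ Ts) p))
    (∂ (suc i) U ++ ∂ (suc i) Ts)
    (append (λ p → ρ (++⁺ˡ Ts (δ (suc i) ε U p))) (λ p → ρ (++⁺ʳ U (δ (suc i) ε Ts p))))
∂-append i ε [] Ts ρ = Sim-intro (∂ (suc i) Ts) (append-nil ≡-IsEq (cong ρ (δ-[0] i ε Ts)))
∂-append i ε (U ∷ Us) Ts ρ = refl , Sim-refl (λ _ → refl) (∂ i U) , ∂-append i ε Us Ts (λ p → ρ (next p))

-- The case in which truncation at `j` shortens the branch but still meets it below the point of
-- insertion: the boundary is again an insertion, of the truncated `U`.
∂-insert : ∀ j ε T Q U c (lt : branchHeight Q < j) c′ (ρ : Labelling (insert T Q U c) n) e t →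
  Sim _≡_ (∂ j (insert T Q U c)) (λ p → ρ (δ j ε (insert T Q U c) p))
    (insert (∂ j T) (∂-branch j Q lt) (∂ j U) c′)
    (ins (∂ j T) (∂-branch j Q lt) (∂ j U) c′ (λ p → exterior T Q U c ρ e t (δ j ε T p))
      (λ p → ρ (ι T Q U c (δ j ε U p))))
∂-insert (suc i) ε (T ∷ Ts) ([0] l) U c lt c′ ρ e t = ∂-append i ε U Ts ρ
∂-insert (suc i) ε (T ∷ Ts) (0∷ Q) (U ∷ []) (s≤s c) (s≤s lt) (s≤s c′) ρ e t =
  refl , ∂-insert i ε T Q U c lt c′ (λ p → ρ (0∷ p)) (up e) t
  , Sim-intro (∂ (suc i) Ts) (ins-next-rel ≡-IsEq (∂ i T) (∂ (suc i) Ts) (∂-branch i Q lt) (∂ i U) c′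
      {λ p → exterior (T ∷ Ts) (0∷ Q) (U ∷ []) (s≤s c) ρ e t (δ (suc i) ε (T ∷ Ts) p)}
      {λ p → ρ (ι (T ∷ Ts) (0∷ Q) (U ∷ []) (s≤s c) (δ (suc i) ε (U ∷ []) p))}
      (cong (λ q → ρ (next q)) (δ-[0] i ε Ts)))
∂-insert (suc i) ε (T ∷ Ts) (next Q) U c lt c′ ρ e t =
  refl , Sim-refl (λ _ → refl) (∂ i T) , ∂-insert (suc i) ε Ts Q U c lt c′ (λ p → ρ (next p)) e t

exterior-[len] : ∀ S P T b (ρ : Labelling (insert S P T b) n) e t → exterior S P T b ρ e t [len] ≡ ρ [len]
exterior-[len] (S ∷ Ss) ([0] _)  T        b       ρ e t = cong ρ ([len]-++⁺ʳ T)
exterior-[len] (S ∷ Ss) (0∷ P)   (T ∷ []) (s≤s b) ρ e t = refl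
exterior-[len] (S ∷ Ss) (next P) T        b       ρ e t = exterior-[len] Ss P T b (λ p → ρ (next p)) e t

-- The complementary case: the truncation stops before the level at which `U` is inserted, so the
-- boundary does not notice it.
∂-low : ∀ j ε T Q U c → j ≤ branchHeight Q → ∀ (ρ : Labelling (insert T Q U c) n) e t →
  Sim _≡_ (∂ j T) (λ p → exterior T Q U c ρ e t (δ j ε T p)) (∂ j (insert T Q U c)) (λ p → ρ (δ j ε (insert T Q U c) p))
∂-low zero    Sign.- T        Q        U        c       le ρ e t = exterior-[0] T Q U c ρ e t
∂-low zero    Sign.+ T        Q        U        c       le ρ e t = exterior-[len] T Q U c ρ e t
∂-low (suc i) ε      (T ∷ Ts) (0∷ Q)   (U ∷ []) (s≤s c) le ρ e t =
  refl , ∂-low i ε T Q U c (s≤s⁻¹ le) (λ p → ρ (0∷ p)) (up e) t , Sim-refl (λ _ → refl) (∂ (suc i) Ts)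
∂-low (suc i) ε      (T ∷ Ts) (next Q) U        c       le ρ e t =
  refl , Sim-refl (λ _ → refl) (∂ i T) , ∂-low (suc i) ε Ts Q U c le (λ p → ρ (next p)) e t

discLab-∂ : ∀ i ε T → Linear T → ∀ (e : Ends n) t →
  (depth (zeros T) ≤ i → discLab {T = T} e t (δ i ε T (zeros (∂ i T))) ≡ t)
  × (i < depth (zeros T) → discLab {T = T} e t (δ i ε T (zeros (∂ i T))) ≡ e ε i)
discLab-∂ zero    Sign.- []           l e t = (λ _ → refl) , λ ()
discLab-∂ zero    Sign.+ []           l e t = (λ _ → refl) , λ ()
discLab-∂ (suc i) ε      []           l e t = (λ _ → refl) , λ ()
discLab-∂ zero    Sign.- (T ∷ [])     l e t = (λ ()) , (λ _ → refl)
discLab-∂ zero    Sign.+ (T ∷ [])     l e t = (λ ()) , (λ _ → refl)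
discLab-∂ (suc i) ε      (T ∷ [])     l e t =
  let f , g = discLab-∂ i ε T (suc-injective l) (up e) t in (λ le → f (s≤s⁻¹ le)) , (λ lt → g (s≤s⁻¹ lt))
discLab-∂ i       ε      (T ∷ U ∷ Us) l e t = linear-single T U Us l

exterior-∂-leaf : ∀ j ε T Q U c lt (ρ : Labelling (insert T Q U c) n) e t →
  (leafHeight Q ≤ j → exterior T Q U c ρ e t (δ j ε T (overline (∂-branch j Q lt))) ≡ t)
  × (j < leafHeight Q → exterior T Q U c ρ e t (δ j ε T (overline (∂-branch j Q lt))) ≡ e ε j)
exterior-∂-leaf (suc i) ε (T ∷ Ts) ([0] l) U c lt ρ e t =
  let f , g = discLab-∂ i ε T l (up e) t in (λ le → f (s≤s⁻¹ le)) , (λ lt → g (s≤s⁻¹ lt))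
exterior-∂-leaf (suc i) ε (T ∷ Ts) (0∷ Q) (U ∷ []) (s≤s c) (s≤s lt) ρ e t =
  let f , g = exterior-∂-leaf i ε T Q U c lt (λ p → ρ (0∷ p)) (up e) t in (λ le → f (s≤s⁻¹ le)) , (λ lt → g (s≤s⁻¹ lt))
exterior-∂-leaf (suc i) ε (T ∷ Ts) (next Q) U c lt ρ e t = exterior-∂-leaf (suc i) ε Ts Q U c lt (λ p → ρ (next p)) e t

ggi-≈ : ∀ {Γ : Ctx n} S P V b {A L K B} → Γ ⊢ coh ⌊ S ⌋ A (toSub L) ∶ B → height V ≤ leafHeight P →
  L (overline P) ≡ 𝒞 (leafHeight P) V ⟦ toSub K ⟧ →
  Γ ⊢ coh ⌊ S ⌋ A (toSub L) ≈ coh ⌊ insert S P V b ⌋ (A ⟦ toSub (κ S P V b) ⟧ᵀ) (toSub (ins S P V b L K))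
ggi-≈ {Γ = Γ} S P V b {B = B} d h l = GGI.ggi (dim B) (Γ ⊢_≈_) (λ _ → ⊤) (λ d _ _ s → ⟶⇒≈ d s) (λ _ _ _ → tt)
  (λ { _ _ _ _ _ (near e f) → coh e (≈ˢ-toSub (λ p → LowEq⇒≈ (f p))) }) ≈-sym ≈-trans
  (leafHeight P) S P V b ≤-refl d refl h l tt (λ _ _ _ → tt)

𝒯≈𝒞 : ∀ {Γ : Ctx n} k T {L : Labelling T n} → height T ≤ suc k → WL Γ ⋆ L →
      Γ ⊢ 𝒯 (suc k) T ⟦ toSub L ⟧ ≈ 𝒞 (suc k) T ⟦ toSub L ⟧
𝒯≈𝒞 {Γ = Γ} k T {L} h w with standard (suc k) T h
... | non-disc _ e = ≈-reflexive (cong (_⟦ toSub L ⟧) e)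
... | disc e = ≈-sym (rule (subst₂ (sua′ Γ) (sym (𝒞-⟦⟧ (suc k) T (toSub L)))
    (sym (trans (cong (_⟦ toSub L ⟧) e) (lookup-toSub L (zeros T)))) (std-dr (suc k) L))
  (⊢-⟦⟧ (WL⇒⊢ˢ w) (𝒞-typed k T h)))

𝒰-Insert : ℕ → Set
𝒰-Insert k = ∀ T Q U c → height U ≤ leafHeight Q →
  ⌊ insert T Q U c ⌋ ⊢ᵀ 𝒰 k T ⟦ toSub (κ T Q U c) ⟧ᵀ ≈ 𝒰 k (insert T Q U c)

-- If truncation keeps the branch, the truncated leaf is equal to a standard coherence over the
-- truncated `U`: either the old leaf or one of its ends. Inserting at that leaf yields the boundary
-- of `V`, with a type that `IH` makes standard.
stdEnd-insert : ∀ k → 𝒰-Insert k → ∀ ε T Q U c → height U ≤ leafHeight Q →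
  ⌊ insert T Q U c ⌋ ⊢ stdEnd ε k T ⟦ toSub (κ T Q U c) ⟧ ≈ stdEnd ε k (insert T Q U c)
stdEnd-insert k IH ε T Q U c h with k ≤? branchHeight Q
... | yes le = ≈-reflexive (trans (⟦⟧-• (𝒯 k (∂ k T)) _ _) (trans (cong (𝒯 k (∂ k T) ⟦_⟧)
    (trans (path-⟦⟧ (δ k ε T) (κ T Q U c)) (toSub-cong (λ p → κ-exterior T Q U c (δ k ε T p)))))
  (Sim-≡ (λ W σ → 𝒯 k W ⟦ σ ⟧) (∂-low k ε T Q U c le (path (insert T Q U c)) _ _))))
stdEnd-insert zero    IH ε T Q U c h | no ¬le = ⊥-elim (¬le z≤n)
stdEnd-insert (suc k) IH ε T Q U c h | no ¬le =
  ≈-trans (≈-reflexive (trans (⟦⟧-• (𝒯 j T′) _ _) (cong (𝒯 j T′ ⟦_⟧) (path-⟦⟧ (δ j ε T) (κ T Q U c)))))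
  (≈-trans (𝒯≈𝒞 k T′ hT′ wL)
  (≈-trans (≈-reflexive (𝒞-⟦⟧ j T′ (toSub L)))
  (≈-trans (coh (≈ᵀ-refl _) (≈ˢ-toSub (upd-rel {R = Γ ⊢_≈_} (≈-refl _) L (overline Q′) leaf)))
  (≈-trans (ggi-≈ T′ Q′ U′ c′ dt hU′ (rl r))
  (≈-trans (coh (IH T′ Q′ U′ c′ hU′) (≈ˢ-refl _))
  (≈-trans (≈-reflexive (sym final))
  (≈-sym (𝒯≈𝒞 k (∂ j V) (height-∂ j V) (WL-δ j ε V)))))))))
  where
  j = suc k
  V = insert T Q U c
  Γ = ⌊ V ⌋
  T′ = ∂ j T
  U′ = ∂ j U
  lt : branchHeight Q < j
  lt = ≰⇒> ¬le
  Q′ = ∂-branch j Q lt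
  c′ : branchHeight Q′ ≤ trunkHeight U′
  c′ = ≤-trans (≤-reflexive (∂-branch-bh j Q lt)) (trunk-∂ j U (<⇒≤ lt) c)
  hT′ : height T′ ≤ j
  hT′ = height-∂ j T
  hU′ : height U′ ≤ leafHeight Q′
  hU′ = ≤-trans (⊓-glb (height-∂ j U) (≤-trans (height-∂≤ j U) h)) (≤-reflexive (sym (∂-branch-lh j Q lt)))
  L : Labelling T′ (suc (size V))
  L p = κ T Q U c (δ j ε T p)
  M : Labelling U′ (suc (size V))
  M p = ιSub T Q U c (δ j ε U p)
  wL : WL Γ ⋆ L
  wL p = subst (Γ ⊢ L p ∶_) (tyP-δ j ε T ⋆ (κ T Q U c) p) (κ-WL T Q U c h (δ j ε T p))
  wM : WL Γ ⋆ M
  wM p = subst (Γ ⊢ M p ∶_) (tyP-δ j ε U ⋆ (ιSub T Q U c) p) (WL-ι T Q U c (WL-path V) (δ j ε U p))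
  exterior-leaf′ = exterior-∂-leaf j ε T Q U c lt (path V) (ends (ιSub T Q U c)) (𝒞 (leafHeight Q) U ⟦ toSub (ιSub T Q U c) ⟧)
  leaf : Γ ⊢ L (overline Q′) ≈ 𝒞 (leafHeight Q′) U′ ⟦ toSub M ⟧
  leaf with leafHeight Q ≤? j
  ... | yes le = ≈-reflexive (trans (κ-exterior T Q U c _) (trans (proj₁ exterior-leaf′ le)
          (trans (cong (λ i → 𝒞 i U ⟦ toSub (ιSub T Q U c) ⟧)
                    (sym (trans (∂-branch-lh j Q lt) (m≥n⇒m⊓n≡n le))))
            (sym (Sim-≡ (λ W σ → 𝒞 (leafHeight Q′) W ⟦ σ ⟧)
              (∂-full j ε U (≤-trans h le) (ιSub T Q U c)))))))
  ... | no ¬lh = ≈-trans (≈-reflexive (trans (κ-exterior T Q U c _) (trans (proj₂ exterior-leaf′ (≰⇒> ¬lh))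
          (trans (⟦⟧-• (𝒯 j U′) _ _) (cong (𝒯 j U′ ⟦_⟧) (path-⟦⟧ (δ j ε U) (ιSub T Q U c)))))))
          (subst (λ i → Γ ⊢ 𝒯 j U′ ⟦ toSub M ⟧ ≈ 𝒞 i U′ ⟦ toSub M ⟧)
            (sym (trans (∂-branch-lh j Q lt) (m≤n⇒m⊓n≡m (<⇒≤ (≰⇒> ¬lh)))))
            (𝒯≈𝒞 k U′ (height-∂ j U) wM))
  L″ = upd L (overline Q′) (𝒞 (leafHeight Q′) U′ ⟦ toSub M ⟧)
  r : Redex Γ T′ Q′ U′ L″ M
  r = upd-redex wL hU′ leaf
  dt : Γ ⊢ coh ⌊ T′ ⌋ (𝒰 j T′) (toSub L″) ∶ 𝒰 j T′ ⟦ toSub L″ ⟧ᵀ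
  dt = subst (Γ ⊢_∶ 𝒰 j T′ ⟦ toSub L″ ⟧ᵀ) (𝒞-⟦⟧ j T′ (toSub L″)) (⊢-⟦⟧ (WL⇒⊢ˢ (rw r)) (𝒞-typed k T′ hT′))
  final : 𝒞 j (∂ j V) ⟦ toSub (λ p → path V (δ j ε V p)) ⟧
    ≡ coh ⌊ insert T′ Q′ U′ c′ ⌋ (𝒰 j (insert T′ Q′ U′ c′)) (toSub (ins T′ Q′ U′ c′ L″ M))
  final = trans (Sim-≡ (λ W σ → 𝒞 j W ⟦ σ ⟧) (∂-insert j ε T Q U c lt c′ (path V) _ _))
    (trans (𝒞-⟦⟧ j (insert T′ Q′ U′ c′) _) (cong (coh ⌊ insert T′ Q′ U′ c′ ⌋ (𝒰 j (insert T′ Q′ U′ c′)))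
      (toSub-cong (λ p → trans (insert-rel T′ Q′ U′ c′ _≡_ (λ q → sym (κ-exterior T Q U c (δ j ε T q))) (λ _ → refl) p)
        (sym (ins-upd T′ Q′ U′ c′ {L} p))))))

𝒰-insert : ∀ k → 𝒰-Insert k
𝒰-insert zero    T Q U c h = ⋆
𝒰-insert (suc k) T Q U c h = arr (stdEnd-insert k (𝒰-insert k) Sign.- T Q U c h) (𝒰-insert k T Q U c h)
  (stdEnd-insert k (𝒰-insert k) Sign.+ T Q U c h)

std-insert : ∀ k T Q U c → height T ≤ suc k → height U ≤ leafHeight Q →
  ⌊ insert T Q U c ⌋ ⊢ 𝒞 (suc k) T ⟦ toSub (κ T Q U c) ⟧ ≈ 𝒞 (suc k) (insert T Q U c)
std-insert k T Q U c hT hU = ≈-trans (≈-reflexive eq)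
  (≈-trans (ggi-≈ T Q U c (subst (⌊ V ⌋ ⊢_∶ 𝒰 (suc k) T ⟦ toSub (κ T Q U c ⨾ toSub (path V)) ⟧ᵀ) (𝒞-⟦⟧ (suc k) T _)
      (⊢-⟦⟧ (WL⇒⊢ˢ (rw r)) (𝒞-typed k T hT))) hU (rl r))
    (coh (𝒰-insert (suc k) T Q U c hU)
      (subst (⌊ V ⌋ ⊢ˢ toSub (ins T Q U c (κ T Q U c ⨾ toSub (path V)) (ιSub T Q U c)) ≈_) (toSub-path V) (≈ˢ-toSub (λ p → ≈-reflexive (ins-κ-ι T Q U c (path V) p))))))
  where
  V = insert T Q U c
  r : Redex ⌊ V ⌋ T Q U (κ T Q U c ⨾ toSub (path V)) (ιSub T Q U c)
  r = κ-redex T Q U c hU (WL-path V)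
  eq : 𝒞 (suc k) T ⟦ toSub (κ T Q U c) ⟧ ≡ coh ⌊ T ⌋ (𝒰 (suc k) T) (toSub (κ T Q U c ⨾ toSub (path V)))
  eq = trans (𝒞-⟦⟧ (suc k) T _) (cong (coh ⌊ T ⌋ (𝒰 (suc k) T)) (toSub-cong (λ p → sym (κ⨾path T Q U c p))))

-- Termination

-- The Kronecker delta.
unit : ℕ → ℕ → ℕ
unit zero    zero    = 1
unit zero    (suc k) = 0
unit (suc d) zero    = 0
unit (suc d) (suc k) = unit d k

unit-same : ∀ d → unit d d ≡ 1
unit-same zero    = refl
unit-same (suc d) = unit-same d

unit-above : ∀ {d k} → d < k → unit d k ≡ 0
unit-above {zero}  {suc k} lt = refl
unit-above {suc d} {suc k} lt = unit-above (s≤s⁻¹ lt)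

level : ∀ {Δ : Ctx m} {A} → Dec (IdShape Δ A) → ℕ
level         (yes _) = 0
level {A = A} (no _)  = dim A

-- The coherences in a term, counted by dimension; identities are counted in
-- dimension zero, which no other coherence has, and the types of coherences
-- are disregarded.
cost  : Tm n → ℕ → ℕ
costs : Sub m n → ℕ → ℕ
cost (var x)     k = 0
cost (coh Δ A σ) k = unit (level (idShape? Δ A)) k + costs σ k
costs []      k = 0
costs (t ∷ σ) k = cost t k + costs σ k

infix 4 _<ₗ_

_<ₗ_ : (ℕ → ℕ) → (ℕ → ℕ) → Set
f <ₗ g = ∃[ k ] f k < g k × (∀ {j} → k < j → f j ≤ g j)

clear : ℕ → (ℕ → ℕ) → ℕ → ℕ
clear N f k with k <? N
... | yes _ = f k
... | no _  = 0

clear-below : ∀ {N k} f → k < N → clear N f k ≡ f k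
clear-below {N} {k} f lt with k <? N
... | yes _ = refl
... | no ¬l = ⊥-elim (¬l lt)

clear-≤ : ∀ {N k f g} → f k ≤ g k → clear N f k ≤ clear N g k
clear-≤ {N} {k} le with k <? N
... | yes _ = le
... | no _  = z≤n

clear-above : ∀ {N k} f → N ≤ k → clear N f k ≡ 0
clear-above {N} {k} f le with k <? N
... | yes l = ⊥-elim (<⇒≱ l le)
... | no _  = refl

-- An outer induction on the top entry and an inner one on the rest, isolated by `clear`. A descent
-- below the top may also lower the top entry, so `inner` keeps a bound on it rather than its value.
<ₗ-acc : ∀ N g → (∀ {k} → N ≤ k → g k ≡ 0) → Acc _<ₗ_ g
<ₗ-acc zero    g z = acc λ { (k , lt , _) → ⊥-elim (case subst (_ <_) (z {k} z≤n) lt of λ ()) }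
<ₗ-acc (suc N) g z = outer (suc (g N)) g z ≤-refl
  where
  outer : ∀ v g → (∀ {k} → suc N ≤ k → g k ≡ 0) → g N < v → Acc _<ₗ_ g
  inner : ∀ v g → (∀ {k} → suc N ≤ k → g k ≡ 0) → g N < suc v → Acc _<ₗ_ (clear N g) → Acc _<ₗ_ g
  outer (suc v) g z lt = inner v g z lt (<ₗ-acc N (clear N g) (clear-above g))
  inner v g z lt (acc rs) = acc λ { {f} (k , l , h) → go f k l h (<-cmp k N) }
    where
    go : ∀ f k → f k < g k → (∀ {j} → k < j → f j ≤ g j) → _ → Acc _<ₗ_ f
    go f k l h (tri> _ _ N<k) = ⊥-elim (case subst (f k <_) (z N<k) l of λ ())
    go f k l h (tri≈ _ refl _) =
      outer v f (λ le → n≤0⇒n≡0 (≤-trans (h le) (≤-reflexive (z le)))) (<-≤-trans l (s≤s⁻¹ lt))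
    go f k l h (tri< k<N _ _) = inner v f zf (≤-<-trans (h k<N) lt)
      (rs (k , subst₂ _<_ (sym (clear-below f k<N)) (sym (clear-below g k<N)) l
             , λ {j} k<j → clear-≤ {N} {j} {f} {g} (h k<j)))
      where
      zf : ∀ {j} → suc N ≤ j → f j ≡ 0
      zf le = n≤0⇒n≡0 (≤-trans (h (<-trans k<N le)) (≤-reflexive (z le)))

level-≤ : ∀ {Δ : Ctx m} {A} (i : Dec (IdShape Δ A)) → level i ≤ dim A
level-≤ (yes _) = z≤n
level-≤ (no _)  = ≤-refl

cost-dim  : ∀ {Γ : Ctx n} {t A} → Γ ⊢ t ∶ A → ∀ {k} → dim A < k → cost t k ≡ 0
costs-dim : ∀ {Γ : Ctx n} {Δ : Ctx m} {σ} → Γ ⊢ˢ σ ∶ Δ → ∀ {k} → dimCtx Δ < k → costs σ k ≡ 0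
cost-dim (var x) lt = refl
cost-dim (conv d e) lt = cost-dim d (≤-<-trans (≤-reflexive (dim-≈ e)) lt)
cost-dim (coh {Δ = Δ} {s} {A} {t} {σ} p (arr a ds dt) ts r) {k} lt = cong₂ _+_
  (unit-above (≤-<-trans (level-≤ (idShape? Δ (s ⇒[ A ] t))) lt′))
  (costs-dim ts (≤-<-trans (coh-dim {t = t} ds r) lt′))
  where
  lt′ : suc (dim A) < k
  lt′ = ≤-<-trans (≤-reflexive (cong suc (sym (dim-⟦⟧ A σ)))) lt
costs-dim [] lt = refl
costs-dim (_∷_ {Δ = Δ} {A = A} {σ = σ} d ds) lt = cong₂ _+_
  (cost-dim d (≤-<-trans (≤-trans (≤-reflexive (dim-⟦⟧ A σ)) (m≤n⊔m (dimCtx Δ) (dim A))) lt))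
  (costs-dim ds (≤-<-trans (m≤m⊔n (dimCtx Δ) (dim A)) lt))

cost-lookup : ∀ (σ : Sub m n) x k → cost (lookup σ x) k ≤ costs σ k
cost-lookup (t ∷ σ) zero    k = m≤m+n (cost t k) (costs σ k)
cost-lookup (t ∷ σ) (suc x) k = ≤-trans (cost-lookup σ x k) (m≤n+m (costs σ k) (cost t k))

cost-entry : ∀ (Δ : Ctx m) A (σ : Sub m n) x → cost (lookup σ x) <ₗ cost (coh Δ A σ)
cost-entry Δ A σ x = e
  , ≤-trans (s≤s (cost-lookup σ x e)) (≤-reflexive (cong (_+ costs σ e) (sym (unit-same e))))
  , λ {j} _ → ≤-trans (cost-lookup σ x j) (m≤n+m (costs σ j) (unit e j))
  where e = level (idShape? Δ A)

costs-susp : ∀ (a b : Tm n) (xs : Sub m n) k → costs (susp a b xs) k ≡ cost a k + (cost b k + costs xs k)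
costs-susp a b []       k = solve 2 (λ x y → y :+ (x :+ con 0) := x :+ (y :+ con 0)) refl (cost a k) (cost b k)
  where open +-*-Solver
costs-susp a b (x ∷ xs) k = trans (cong (cost x k +_) (costs-susp a b xs k))
  (solve 4 (λ x a b s → x :+ (a :+ (b :+ s)) := a :+ (b :+ (x :+ s))) refl (cost x k) (cost a k) (cost b k) (costs xs k))
  where open +-*-Solver

costs-wedge : ∀ (xs : Sub (suc l) n) (ys : Sub (suc m) n) k →
  costs (wedge xs ys) k + cost (lookup ys (fromℕ m)) k ≡ costs xs k + costs ys k
costs-wedge xs (y ∷ [])     k = cong (costs xs k +_) (sym (+-identityʳ (cost y k)))
costs-wedge xs (y ∷ z ∷ ys) k = trans (+-assoc (cost y k) _ _) (trans (cong (cost y k +_) (costs-wedge xs (z ∷ ys) k))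
  (solve 3 (λ y a b → y :+ (a :+ b) := a :+ (y :+ b)) refl (cost y k) (costs xs k) (costs (z ∷ ys) k)))
  where open +-*-Solver

-- The cost of a labelling summed along the tree, with every shared point counted once, instead of
-- in the order of the wedge.
total : ∀ T → Labelling T n → ℕ → ℕ
total []       L k = cost (L [0]) k
total (T ∷ Ts) L k = cost (L [0]) k + (total T (λ p → L (0∷ p)) k + total Ts (λ p → L (next p)) k)

costs-toSub : ∀ T (L : Labelling T n) k → costs (toSub L) k ≡ total T L k
costs-toSub []       L k = +-identityʳ (cost (L [0]) k)
costs-toSub (T ∷ Ts) L k = +-cancelʳ-≡ (cost (L (next [0])) k) _ _ (begin
  costs (toSub L) k + cost (L (next [0])) k
    ≡⟨ cong₂ (λ σ t → costs σ k + cost t k) (trans (map-wedge L (suspPaths T Ts) (nextPaths T Ts))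
         (cong₂ wedge (trans (map-susp L [0] (next [0]) (map 0∷ᵖ_ (paths T)))
           (cong (susp (L [0]) (L (next [0]))) (sym (map-∘ L 0∷ᵖ_ (paths T))))) (sym (map-∘ L nextᵖ (paths Ts)))))
         (sym (trans (lookup-toSub-var (λ p → L (next p)) (fromℕ (size Ts))) (cong (λ p → L (next p)) (paths-first Ts)))) ⟩
  costs (wedge σ₁ σ₂) k + cost (lookup σ₂ (fromℕ (size Ts))) k
    ≡⟨ costs-wedge σ₁ σ₂ k ⟩
  costs σ₁ k + costs σ₂ k
    ≡⟨ cong₂ _+_ (trans (costs-susp (L [0]) (L (next [0])) (toSub (λ p → L (0∷ p))) k)
         (cong (λ x → cost (L [0]) k + (cost (L (next [0])) k + x)) (costs-toSub T (λ p → L (0∷ p)) k)))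
         (costs-toSub Ts (λ p → L (next p)) k) ⟩
  cost (L [0]) k + (cost (L (next [0])) k + total T (λ p → L (0∷ p)) k) + total Ts (λ p → L (next p)) k
    ≡⟨ solve 4 (λ a b c d → a :+ (b :+ c) :+ d := a :+ (c :+ d) :+ b) refl
         (cost (L [0]) k) (cost (L (next [0])) k) (total T (λ p → L (0∷ p)) k) (total Ts (λ p → L (next p)) k) ⟩
  total (T ∷ Ts) L k + cost (L (next [0])) k ∎)
  where
  open ≡-Reasoning
  open +-*-Solver
  σ₁ = susp (L [0]) (L (next [0])) (toSub (λ p → L (0∷ p)))
  σ₂ = toSub (λ p → L (next p))

cost≤total : ∀ T (L : Labelling T n) p k → cost (L p) k ≤ total T L k
cost≤total T L p k = ≤-trans (≤-reflexive (cong (λ t → cost t k) (sym (lookup-toSub L p))))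
  (≤-trans (cost-lookup (toSub L) (pathVar T p) k) (≤-reflexive (costs-toSub T L k)))

total-[0] : ∀ T (L L′ : Labelling T n) k → (∀ {p} → Positive p → L p ≡ L′ p) → total T L k ≤ cost (L [0]) k + total T L′ k
total-[0] []       L L′ k e = m≤m+n _ _
total-[0] (T ∷ Ts) L L′ k e = +-monoʳ-≤ (cost (L [0]) k) (≤-trans (≤-reflexive (cong₂ _+_
  (total-cong T (λ p → e (0∷ p))) (total-cong Ts (λ p → e (next p))))) (m≤n+m _ (cost (L′ [0]) k)))
  where
  total-cong : ∀ T {L L′ : Labelling T _} → (∀ p → L p ≡ L′ p) → total T L k ≡ total T L′ k
  total-cong []       e = cong (λ t → cost t k) (e [0])
  total-cong (T ∷ Ts) e = cong₂ _+_ (cong (λ t → cost t k) (e [0]))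
    (cong₂ _+_ (total-cong T (λ p → e (0∷ p))) (total-cong Ts (λ p → e (next p))))

total-append : ∀ T {U} (M : Labelling T n) (L : Labelling U n) k →
               total (T ++ U) (append M L) k ≤ total T M k + total U L k
total-append [] {U} M L k = subst (λ t → total U (append M L) k ≤ cost t k + total U L k) (append-[0] M L)
  (total-[0] U (append M L) L k λ { (0∷ p) → refl ; (next p) → refl })
total-append (T ∷ Ts) {U} M L k = ≤-trans
  (+-monoʳ-≤ (cost (M [0]) k) (+-monoʳ-≤ (total T (λ p → M (0∷ p)) k) (total-append Ts (λ p → M (next p)) L k)))
  (≤-reflexive (solve 4 (λ a b c d → a :+ (b :+ (c :+ d)) := a :+ (b :+ c) :+ d) refl
    (cost (M [0]) k) (total T (λ p → M (0∷ p)) k) (total Ts (λ p → M (next p)) k) (total U L k)))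
  where open +-*-Solver

-- The labels of `M` come in, the leaf label goes out, and whatever else is lost on the branch or at
-- shared points only helps the inequality.
total-ins : ∀ S P T b (L : Labelling S n) M k →
  total (insert S P T b) (ins S P T b L M) k + cost (L (overline P)) k ≤ total S L k + total T M k
total-ins (S ∷ Ss) ([0] _) T b L M k = begin
  total (T ++ Ss) (append M (λ p → L (next p))) k + cost (L (0∷ zeros S)) k
    ≤⟨ +-mono-≤ (total-append T M (λ p → L (next p)) k) (cost≤total S (λ p → L (0∷ p)) (zeros S) k) ⟩
  total T M k + n₀ + s
    ≤⟨ m≤m+n _ (cost (L [0]) k) ⟩
  total T M k + n₀ + s + cost (L [0]) k
    ≡⟨ solve 4 (λ t n s a → t :+ n :+ s :+ a := a :+ (s :+ n) :+ t) refl (total T M k) n₀ s (cost (L [0]) k) ⟩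
  total (S ∷ Ss) L k + total T M k ∎
  where
  open ≤-Reasoning
  open +-*-Solver
  n₀ = total Ss (λ p → L (next p)) k
  s = total S (λ p → L (0∷ p)) k
total-ins (S ∷ Ss) (0∷ P) (T ∷ []) (s≤s b) L M k = begin
  m₀ + (r + x) + a
    ≡⟨ solve 4 (λ m r x a → m :+ (r :+ x) :+ a := m :+ ((r :+ a) :+ x)) refl m₀ r x a ⟩
  m₀ + ((r + a) + x)
    ≤⟨ +-monoʳ-≤ m₀ (+-mono-≤ (total-ins S P T b (λ p → L (0∷ p)) (λ p → M (0∷ p)) k)
         (total-[0] Ss X (λ p → L (next p)) k λ { (0∷ p) → refl ; (next p) → refl })) ⟩
  m₀ + ((s + t) + (m₁ + n₀))
    ≤⟨ m≤m+n _ (cost (L [0]) k) ⟩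
  m₀ + ((s + t) + (m₁ + n₀)) + cost (L [0]) k
    ≡⟨ solve 6 (λ m s t m₁ n l → m :+ ((s :+ t) :+ (m₁ :+ n)) :+ l := l :+ (s :+ n) :+ (m :+ (t :+ m₁))) refl
         m₀ s t m₁ n₀ (cost (L [0]) k) ⟩
  total (S ∷ Ss) L k + total (T ∷ []) M k ∎
  where
  open ≤-Reasoning
  open +-*-Solver
  X : Labelling Ss _
  X p = ins (S ∷ Ss) (0∷ P) (T ∷ []) (s≤s b) L M (next p)
  m₀ = cost (M [0]) k
  m₁ = cost (M (next [0])) k
  r = total (insert S P T b) (ins S P T b (λ p → L (0∷ p)) (λ p → M (0∷ p))) k
  a = cost (L (0∷ overline P)) k
  x = total Ss X k
  s = total S (λ p → L (0∷ p)) k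
  t = total T (λ p → M (0∷ p)) k
  n₀ = total Ss (λ p → L (next p)) k
total-ins (S ∷ Ss) (next P) T b L M k = begin
  l₀ + (s + r) + a
    ≡⟨ solve 4 (λ l s r a → l :+ (s :+ r) :+ a := l :+ (s :+ (r :+ a))) refl l₀ s r a ⟩
  l₀ + (s + (r + a))
    ≤⟨ +-monoʳ-≤ l₀ (+-monoʳ-≤ s (total-ins Ss P T b (λ p → L (next p)) M k)) ⟩
  l₀ + (s + (n₀ + t))
    ≡⟨ solve 4 (λ l s n t → l :+ (s :+ (n :+ t)) := l :+ (s :+ n) :+ t) refl l₀ s n₀ t ⟩
  total (S ∷ Ss) L k + total T M k ∎
  where
  open ≤-Reasoning
  open +-*-Solver
  l₀ = cost (L [0]) k
  s = total S (λ p → L (0∷ p)) k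
  r = total (insert Ss P T b) (ins Ss P T b (λ p → L (next p)) M) k
  a = cost (L (next (overline P))) k
  n₀ = total Ss (λ p → L (next p)) k
  t = total T M k

<ₗ-+ˡ : ∀ {f g} (h : ℕ → ℕ) → f <ₗ g → (λ k → h k + f k) <ₗ (λ k → h k + g k)
<ₗ-+ˡ h (k , lt , le) = k , +-monoʳ-< (h k) lt , λ {j} l → +-monoʳ-≤ (h j) (le l)

<ₗ-+ʳ : ∀ {f g} (h : ℕ → ℕ) → f <ₗ g → (λ k → f k + h k) <ₗ (λ k → g k + h k)
<ₗ-+ʳ h (k , lt , le) = k , +-monoˡ-< (h k) lt , λ {j} l → +-monoˡ-≤ (h j) (le l)

level-id : ∀ {Δ : Ctx m} {A} → IdShape Δ A → level (idShape? Δ A) ≡ 0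
level-id {Δ = Δ} {A} i with idShape? Δ A
... | yes _ = refl
... | no ¬i = ⊥-elim (¬i i)

level-non-id : ∀ {Δ : Ctx m} {A} → ¬ IdShape Δ A → level (idShape? Δ A) ≡ dim A
level-non-id {Δ = Δ} {A} ¬i with idShape? Δ A
... | yes i = ⊥-elim (¬i i)
... | no _  = refl

dimCtx-Disc : ∀ d → dimCtx (Disc d) ≤ d
dimCtx-Disc d = ⊔-lub (dimCtx-Sphere d) (≤-reflexive (dim-SphereType d))

-- The cost of the leaf is one unit plus the labels of `M`. Those labels cancel against the ones
-- brought in by the insertion, which leaves one unit of gain.
costs-ins : ∀ S P T b {L : Labelling S n} {M} → L (overline P) ≡ 𝒞 (leafHeight P) T ⟦ toSub M ⟧ → ∀ k →
  costs (toSub (ins S P T b L M)) k + unit (level (idShape? ⌊ T ⌋ (𝒰 (leafHeight P) T))) k ≤ costs (toSub L) k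
costs-ins S P T b {L} {M} l k = +-cancelʳ-≤ (costs (toSub M) k) _ _ (begin
  costs (toSub (ins S P T b L M)) k + u + costs (toSub M) k
    ≡⟨ +-assoc (costs (toSub (ins S P T b L M)) k) u _ ⟩
  costs (toSub (ins S P T b L M)) k + (u + costs (toSub M) k)
    ≡⟨ cong₂ _+_ (costs-toSub (insert S P T b) (ins S P T b L M) k)
         (cong (λ t → cost t k) (sym (trans l (𝒞-⟦⟧ (leafHeight P) T (toSub M))))) ⟩
  total (insert S P T b) (ins S P T b L M) k + cost (L (overline P)) k
    ≤⟨ total-ins S P T b L M k ⟩
  total S L k + total T M k
    ≡⟨ cong₂ _+_ (costs-toSub S L k) (costs-toSub T M k) ⟨
  costs (toSub L) k + costs (toSub M) k ∎)
  where
  open ≤-Reasoning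
  u = unit (level (idShape? ⌊ T ⌋ (𝒰 (leafHeight P) T))) k

identity-cost : ∀ {Γ : Ctx n} {A t B} → Γ ⊢ identity A t ∶ B → ∀ {k} → dim A < k → cost (identity A t) k ≡ 0
identity-cost {A = A} d {suc k} lt = cong₂ _+_
  (cong (λ l → unit l (suc k)) (level-id (idShape (dim A))))
  (costs-dim (inv-sub (coh-inv d)) (≤-<-trans (dimCtx-Disc (dim A)) lt))

arrow-dim : ∀ {Γ : Ctx n} {Δ : Ctx m} {A σ B} → Γ ⊢ coh Δ A σ ∶ B → 0 < dim A
arrow-dim d with coh-inv d
... | cohInv _ _ _ _ _ = s≤s z≤n

unit-zero : ∀ {j} → 0 < j → unit 0 j ≡ 0
unit-zero {suc j} _ = refl

-- If the new coherence is not an identity, both heads count alike and the arguments decide at `e`.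
-- If it is one, the head drops out of the positive entry `dim A`, which decides instead.
cost-below : ∀ (Δ : Ctx m) A (σ : Sub m n) (Θ : Ctx l) C (τ : Sub l n) → ¬ IdShape Δ A → 0 < dim A → dim C ≡ dim A →
  ∀ e → (∀ k → costs τ k + unit e k ≤ costs σ k) → cost (coh Θ C τ) <ₗ cost (coh Δ A σ)
cost-below Δ A σ Θ C τ ¬i pos eq e h with idShape? Θ C
... | yes _ = dim A
  , ≤-trans (s≤s (subst (λ u → u + costs τ (dim A) ≤ costs σ (dim A)) (sym (unit-zero pos))
      (≤-trans (m≤m+n _ _) (h (dim A)))))
      (≤-reflexive (cong (_+ costs σ (dim A)) (sym (trans
        (cong (λ l → unit l (dim A)) (level-non-id ¬i)) (unit-same (dim A))))))
  , λ {j} lt → ≤-trans (subst (λ u → u + costs τ j ≤ costs σ j) (sym (unit-zero (<-trans pos lt)))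
      (≤-trans (m≤m+n _ _) (h j))) (m≤n+m _ _)
... | no _ = e
  , ≤-trans (≤-reflexive (sym (+-suc (unit (dim C) e) _))) (+-mono-≤ (w e) (≤-trans
      (≤-reflexive (trans (+-comm 1 _) (cong (costs τ e +_) (sym (unit-same e))))) (h e)))
  , λ {j} _ → +-mono-≤ (w j) (≤-trans (m≤m+n _ _) (h j))
  where
  w : ∀ j → unit (dim C) j ≤ unit (level (idShape? Δ A)) j
  w j = ≤-reflexive (cong (λ l → unit l j) (trans eq (sym (level-non-id ¬i))))

rule-cost : ∀ {Γ : Ctx n} {s t A} → Γ ⊢ s ∶ A → sua′ Γ s t → cost t <ₗ cost s
rule-cost d (inj₁ (disc-removal A t)) = cost-entry (Disc (dim A)) (DiscType (dim A)) (fromDisc A t) zero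
rule-cost {Γ = Γ} d r@(inj₂ (inj₁ (endo-coherence-removal Δ s A σ ¬i))) = e
  , ≤-trans (≤-reflexive (cong suc (z ≤-refl))) (≤-trans (≤-reflexive (sym (trans
      (cong (λ l → unit l e) (level-non-id (λ i → ¬i (shape⇒id i)))) (unit-same e)))) (m≤m+n _ (costs σ e)))
  , λ lt → ≤-trans (≤-reflexive (z (<⇒≤ lt))) z≤n
  where
  e = suc (dim A)
  -- The arguments of the identity have dimension at most `dim A`, and its head is counted in
  -- dimension zero; so nothing remains from `e` upwards, where the removed coherence counted one.
  z : ∀ {j} → e ≤ j → cost (identity (A ⟦ σ ⟧ᵀ) (s ⟦ σ ⟧)) j ≡ 0
  z le = identity-cost (rule-typed r d) (≤-trans (≤-reflexive (cong suc (dim-⟦⟧ A σ))) le)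
rule-cost {Γ = Γ} d (inj₂ (inj₂ (insertion {S} {P} {T} {L} {M} r A ¬i _ _))) =
  cost-below ⌊ S ⌋ A (toSub L) ⌊ insert S P T b ⌋ (A ⟦ toSub (κ S P T b) ⟧ᵀ) (toSub (ins S P T b L M))
    (λ i → ¬i (shape⇒id i)) (arrow-dim d) (dim-⟦⟧ A _)
    (level (idShape? ⌊ T ⌋ (𝒰 (leafHeight P) T))) (costs-ins S P T b {L} {M} (InsertionRedex.label r))
  where b = InsertionRedex.bh≤th r

-- Strong normalisation

infix 4 _⊢_⟶ᵗ_ _⊢ˢ_⟶ᵗ_

-- Steps inside the type of some coherence in the term: the only ones that can leave the cost
-- unchanged.
data _⊢_⟶ᵗ_ (Γ : Ctx n) : Tm n → Tm n → Set
data _⊢ˢ_⟶ᵗ_ (Γ : Ctx n) : Sub m n → Sub m n → Set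
data _⊢_⟶ᵗ_ Γ where
  coh-ty  : ∀ {Δ : Ctx m} {A B σ} → Δ ⊢ᵀ A ⟶ B → Γ ⊢ coh Δ A σ ⟶ᵗ coh Δ B σ
  coh-sub : ∀ {Δ : Ctx m} {A σ τ} → Γ ⊢ˢ σ ⟶ᵗ τ → Γ ⊢ coh Δ A σ ⟶ᵗ coh Δ A τ
data _⊢ˢ_⟶ᵗ_ Γ where
  head : ∀ {t t′} {σ : Sub m _} → Γ ⊢ t ⟶ᵗ t′ → Γ ⊢ˢ t ∷ σ ⟶ᵗ t′ ∷ σ
  tail : ∀ {t} {σ σ′ : Sub m _} → Γ ⊢ˢ σ ⟶ᵗ σ′ → Γ ⊢ˢ t ∷ σ ⟶ᵗ t ∷ σ′

var-normal : ∀ {Γ : Ctx n} {x t} → ¬ Γ ⊢ var x ⟶ t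
var-normal (rule (inj₁ ()))
var-normal (rule (inj₂ (inj₁ ())))
var-normal (rule (inj₂ (inj₂ ())))

VarTy-normal : ∀ {Γ : Ctx n} {A B} → VarTy Γ A → ¬ Γ ⊢ᵀ A ⟶ B
VarTy-normal (arr x y e f a) (src r)  = var-normal r
VarTy-normal (arr x y e f a) (base r) = VarTy-normal a r
VarTy-normal (arr x y e f a) (tgt r)  = var-normal r

DiscType-normal : ∀ d {B} → ¬ Disc d ⊢ᵀ DiscType d ⟶ B
DiscType-normal d = VarTy-normal (ps-VarTy (Disc-ps′ d) zero)

IdShape-normal : ∀ {Δ : Ctx m} {A B} → IdShape Δ A → ¬ Δ ⊢ᵀ A ⟶ B
IdShape-normal (idShape d) (src r)  = var-normal r
IdShape-normal (idShape d) (base r) = DiscType-normal d r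
IdShape-normal (idShape d) (tgt r)  = var-normal r

⟶ᵀ-dim : ∀ {Γ : Ctx n} {A B} → Γ ⊢ᵀ A ⟶ B → dim A ≡ dim B
⟶ᵀ-dim (src r)  = refl
⟶ᵀ-dim (base r) = cong suc (⟶ᵀ-dim r)
⟶ᵀ-dim (tgt r)  = refl

step-cost : ∀ {Γ : Ctx n} {s t A} → Γ ⊢ s ∶ A → Γ ⊢ s ⟶ t →
  cost t <ₗ cost s ⊎ ((∀ k → cost t k ≡ cost s k) × Γ ⊢ s ⟶ᵗ t)
step-costs : ∀ {Γ : Ctx n} {Δ : Ctx m} {σ τ} → Γ ⊢ˢ σ ∶ Δ → Γ ⊢ˢ σ ⟶ τ →
  costs τ <ₗ costs σ ⊎ ((∀ k → costs τ k ≡ costs σ k) × Γ ⊢ˢ σ ⟶ᵗ τ)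
step-cost (conv d e) r = step-cost d r
step-cost d (rule r) = inj₁ (rule-cost d r)
step-cost d@(coh _ _ _ _) (coh-ty {Δ = Δ} {A} {B} {σ} r) with idShape? Δ A
... | yes i = ⊥-elim (IdShape-normal i r)
... | no ¬i with idShape? Δ B
-- The type may reduce to that of an identity, which moves the coherence from entry `dim A` down to
-- entry zero.
...   | yes _ = inj₁ (dim A , ≤-trans (≤-reflexive (cong (λ u → suc (u + costs σ (dim A))) (unit-zero (arrow-dim d))))
          (≤-reflexive (cong (_+ costs σ (dim A)) (sym (unit-same (dim A)))))
        , λ {j} lt → ≤-trans (≤-reflexive (cong (_+ costs σ j) (unit-zero (<-trans (arrow-dim d) lt)))) (m≤n+m _ _))
...   | no _ = inj₂ ((λ k → cong (λ l → unit l k + costs σ k) (sym (⟶ᵀ-dim r))) , coh-ty r)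
step-cost (coh {Δ = Δ} {s} {A} {t} p a ts r) (coh-sub st) with step-costs ts st
... | inj₁ lt       = inj₁ (<ₗ-+ˡ (unit (level (idShape? Δ (s ⇒[ A ] t)))) lt)
... | inj₂ (e , st′) = inj₂ ((λ k → cong (unit (level (idShape? Δ (s ⇒[ A ] t))) k +_) (e k)) , coh-sub st′)
step-costs (_∷_ {σ = σ} d ds) (head r) with step-cost d r
... | inj₁ lt       = inj₁ (<ₗ-+ʳ (costs σ) lt)
... | inj₂ (e , r′) = inj₂ ((λ k → cong (_+ costs σ k) (e k)) , head r′)
step-costs (_∷_ {t = t} d ds) (tail r) with step-costs ds r
... | inj₁ lt       = inj₁ (<ₗ-+ˡ (cost t) lt)
... | inj₂ (e , r′) = inj₂ ((λ k → cong (cost t k +_) (e k)) , tail r′)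

SN : ℕ → Set
SN N = ∀ {n} {Γ : Ctx n} {t A} → Γ ⊢ t ∶ A → dim A < N → Acc (λ y x → Γ ⊢ x ⟶ y) t

SN-Ty : ∀ {N} → SN N → ∀ {n} {Γ : Ctx n} {A} → Γ ⊢ᵀ A → dim A ≤ N → Acc (λ B A → Γ ⊢ᵀ A ⟶ B) A
SN-Ty sn ⋆ le = acc λ ()
SN-Ty sn {Γ = Γ} (arr a s t) le = lem (sn s le) (SN-Ty sn a (<⇒≤ le)) (sn t le)
  where
  lem : ∀ {s A t} → Acc (λ y x → Γ ⊢ x ⟶ y) s → Acc (λ B A → Γ ⊢ᵀ A ⟶ B) A → Acc (λ y x → Γ ⊢ x ⟶ y) t →
        Acc (λ B A → Γ ⊢ᵀ A ⟶ B) (s ⇒[ A ] t)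
  lem a₁@(acc r₁) a₂@(acc r₂) a₃@(acc r₃) = acc λ where
    (src r)  → lem (r₁ r) a₂ a₃
    (base r) → lem a₁ (r₂ r) a₃
    (tgt r)  → lem a₁ a₂ (r₃ r)

-- The ends of a type of dimension at most `N` are terms of dimension below `N`, which is where `sn`
-- applies. The arguments are handled by recursion, as `coh-dim` keeps them within the bound.
SNᵗ  : ∀ {N} → SN N → ∀ {n} {Γ : Ctx n} {t A} → Γ ⊢ t ∶ A → dim A ≤ N → Acc (λ y x → Γ ⊢ x ⟶ᵗ y) t
SNˢᵗ : ∀ {N} → SN N → ∀ {n m} {Γ : Ctx n} {Δ : Ctx m} {σ} → Γ ⊢ˢ σ ∶ Δ → dimCtx Δ ≤ N →
       Acc (λ τ σ → Γ ⊢ˢ σ ⟶ᵗ τ) σ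
SNᵗ sn (var x) le = acc λ ()
SNᵗ sn (conv d e) le = SNᵗ sn d (≤-trans (≤-reflexive (dim-≈ e)) le)
SNᵗ sn {Γ = Γ} (coh {Δ = Δ} {s} {A} {t} {σ} p a@(arr a₀ ds dt) ts r) le =
  lem (SN-Ty sn a le′) (SNˢᵗ sn ts (≤-trans (coh-dim {t = t} ds r) le′))
  where
  le′ = ≤-trans (≤-reflexive (cong suc (sym (dim-⟦⟧ A σ)))) le
  lem : ∀ {A σ} → Acc (λ B A → Δ ⊢ᵀ A ⟶ B) A → Acc (λ τ σ → Γ ⊢ˢ σ ⟶ᵗ τ) σ →
        Acc (λ y x → Γ ⊢ x ⟶ᵗ y) (coh Δ A σ)
  lem a₁@(acc r₁) a₂@(acc r₂) = acc λ where
    (coh-ty r)  → lem (r₁ r) a₂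
    (coh-sub r) → lem a₁ (r₂ r)
SNˢᵗ sn [] le = acc λ ()
SNˢᵗ sn {Γ = Γ} (_∷_ {Δ = Δ} {A = A} {σ = σ} d ds) le = lem
  (SNᵗ sn d (≤-trans (≤-reflexive (dim-⟦⟧ A σ)) (≤-trans (m≤n⊔m (dimCtx Δ) (dim A)) le)))
  (SNˢᵗ sn ds (≤-trans (m≤m⊔n (dimCtx Δ) (dim A)) le))
  where
  lem : ∀ {t} {σ : Sub m _} → Acc (λ y x → Γ ⊢ x ⟶ᵗ y) t → Acc (λ τ σ → Γ ⊢ˢ σ ⟶ᵗ τ) σ →
        Acc (λ τ σ → Γ ⊢ˢ σ ⟶ᵗ τ) (t ∷ σ)
  lem a₁@(acc r₁) a₂@(acc r₂) = acc λ where
    (head r) → lem (r₁ r) a₂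
    (tail r) → lem a₁ (r₂ r)

Typed : Ctx n → ℕ → Tm n → Set
Typed Γ N t = ∃[ A ] Γ ⊢ t ∶ A × dim A ≤ N

-- Wider than reduction: `drop` admits any typed term of smaller cost. Confluence is needed at such
-- terms when zigzags are composed.
data Below (Γ : Ctx n) (N : ℕ) (y x : Tm n) : Set where
  drop : Typed Γ N y → cost y <ₗ cost x → Below Γ N y x
  type : Typed Γ N y → (∀ k → cost y k ≡ cost x k) → Γ ⊢ x ⟶ᵗ y → Below Γ N y x

Below-acc : ∀ {N} → SN N → ∀ {Γ : Ctx n} {x} → Typed Γ N x → Acc (Below Γ N) x
Below-acc {N = N} sn {Γ} {x} tx@(A , d , le) =
  outer (<ₗ-acc (suc N) (cost x) (λ lt → cost-dim d (≤-trans (s≤s le) lt))) tx (λ _ → refl)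
  where
  -- A type step preserves the cost only pointwise, so the induction runs over a function `f` that
  -- agrees pointwise with the cost of the current term.
  outer : ∀ {f x} → Acc _<ₗ_ f → Typed Γ N x → (∀ k → cost x k ≡ f k) → Acc (Below Γ N) x
  inner : ∀ {f x} → Acc _<ₗ_ f → (∀ k → cost x k ≡ f k) → Acc (λ y x → Γ ⊢ x ⟶ᵗ y) x → Acc (Below Γ N) x
  outer a (_ , d , le) e = inner a e (SNᵗ sn d le)
  below : ∀ {f x y} → Acc _<ₗ_ f → (∀ k → cost x k ≡ f k) → Acc (λ y x → Γ ⊢ x ⟶ᵗ y) x → Below Γ N y x →
         Acc (Below Γ N) y
  inner a e b = acc (below a e b)
  below (acc rs) e b (drop ty (k , lt , le)) =
    outer (rs (k , <-≤-trans lt (≤-reflexive (e k)) , λ {j} l → ≤-trans (le l) (≤-reflexive (e j)))) ty (λ _ → refl)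
  below a e (acc ts) (type ty e′ r) = inner a (λ k → trans (e′ k) (e k)) (ts r)

step-Below : ∀ {Γ : Ctx n} {N x y} → Typed Γ N x → Γ ⊢ x ⟶ y → Below Γ N y x
step-Below (A , d , le) r with step-cost d r
... | inj₁ lt       = drop (A , ⟶-typed d r , le) lt
... | inj₂ (e , r′) = type (A , ⟶-typed d r , le) e r′

SN-suc : ∀ {N} → SN N → SN (suc N)
SN-suc {N} sn {Γ = Γ} d le = go (Below-acc sn (_ , d , s≤s⁻¹ le)) (_ , d , s≤s⁻¹ le)
  where
  go : ∀ {x} → Acc (Below Γ N) x → Typed Γ N x → Acc (λ y x → Γ ⊢ x ⟶ y) x
  go (acc rs) tx@(A , d , le) = acc λ r → go (rs (step-Below tx r)) (A , ⟶-typed d r , le)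

strongly-normalising : ∀ N → SN N
strongly-normalising zero    d ()
strongly-normalising (suc N) = SN-suc (strongly-normalising N)

-- Confluence

infix 4 _⊢_⟶*_ _⊢ᵀ_⟶*_ _⊢ˢ_⟶*_

_⊢_⟶*_ : Ctx n → Tm n → Tm n → Set
Γ ⊢ s ⟶* t = Star (Γ ⊢_⟶_) s t

_⊢ᵀ_⟶*_ : Ctx n → Ty n → Ty n → Set
Γ ⊢ᵀ A ⟶* B = Star (Γ ⊢ᵀ_⟶_) A B

_⊢ˢ_⟶*_ : Ctx n → Sub m n → Sub m n → Set
Γ ⊢ˢ σ ⟶* τ = Star (Γ ⊢ˢ_⟶_) σ τ

Join : Ctx n → Tm n → Tm n → Set
Join Γ s t = ∃[ u ] Γ ⊢ s ⟶* u × Γ ⊢ t ⟶* u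

JoinTy : Ctx n → Ty n → Ty n → Set
JoinTy Γ A B = ∃[ C ] Γ ⊢ᵀ A ⟶* C × Γ ⊢ᵀ B ⟶* C

JoinSub : Ctx n → Sub m n → Sub m n → Set
JoinSub Γ σ τ = ∃[ ρ ] Γ ⊢ˢ σ ⟶* ρ × Γ ⊢ˢ τ ⟶* ρ

Join-refl : ∀ {Γ : Ctx n} {s} → Join Γ s s
Join-refl = _ , done , done

Join-sym : ∀ {Γ : Ctx n} {s t} → Join Γ s t → Join Γ t s
Join-sym (u , p , q) = u , q , p

coh-⟶* : ∀ {Γ : Ctx n} {Δ : Ctx m} {A B σ τ} → Δ ⊢ᵀ A ⟶* B → Γ ⊢ˢ σ ⟶* τ → Γ ⊢ coh Δ A σ ⟶* coh Δ B τ
coh-⟶* {Δ = Δ} {A} {B} {σ} p q = gmap (λ A → coh Δ A σ) coh-ty p ◅◅ gmap (coh Δ B) coh-sub q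

∷-⟶* : ∀ {Γ : Ctx n} {s t} {σ τ : Sub m n} → Γ ⊢ s ⟶* t → Γ ⊢ˢ σ ⟶* τ → Γ ⊢ˢ s ∷ σ ⟶* t ∷ τ
∷-⟶* {t = t} {σ = σ} p q = gmap (_∷ σ) head p ◅◅ gmap (t ∷_) tail q

arr-⟶* : ∀ {Γ : Ctx n} {s s′ A A′ t t′} → Γ ⊢ s ⟶* s′ → Γ ⊢ᵀ A ⟶* A′ → Γ ⊢ t ⟶* t′ →
         Γ ⊢ᵀ s ⇒[ A ] t ⟶* s′ ⇒[ A′ ] t′
arr-⟶* {s′ = s′} {A} {A′} {t} p q r =
  gmap (_⇒[ A ] t) src p ◅◅ gmap (s′ ⇒[_] t) base q ◅◅ gmap (s′ ⇒[ A′ ]_) tgt r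

sub-⟶* : ∀ {Γ : Ctx n} {σ τ : Sub m n} → (∀ x → Γ ⊢ lookup σ x ⟶* lookup τ x) → Γ ⊢ˢ σ ⟶* τ
sub-⟶* {σ = []}    {[]}    e = done
sub-⟶* {σ = s ∷ σ} {t ∷ τ} e = ∷-⟶* (e zero) (sub-⟶* (λ x → e (suc x)))

toSub-⟶* : ∀ {Γ : Ctx n} {T} {L M : Labelling T n} → (∀ p → Γ ⊢ L p ⟶* M p) → Γ ⊢ˢ toSub L ⟶* toSub M
toSub-⟶* {Γ = Γ} {T} {L} {M} e = sub-⟶* λ x →
  subst₂ (Γ ⊢_⟶*_) (sym (lookup-toSub-var L x)) (sym (lookup-toSub-var M x)) (e (varPath T x))

JoinSub-ext : ∀ {Γ : Ctx n} {σ τ : Sub m n} → (∀ x → Join Γ (lookup σ x) (lookup τ x)) → JoinSub Γ σ τ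
JoinSub-ext {σ = []}    {[]}    e = [] , done , done
JoinSub-ext {σ = s ∷ σ} {t ∷ τ} e with e zero | JoinSub-ext {σ = σ} {τ} (λ x → e (suc x))
... | u , p , q | ρ , p′ , q′ = u ∷ ρ , ∷-⟶* p p′ , ∷-⟶* q q′

JoinSub-toSub : ∀ {Γ : Ctx n} {T} {L M : Labelling T n} → (∀ p → Join Γ (L p) (M p)) → JoinSub Γ (toSub L) (toSub M)
JoinSub-toSub {Γ = Γ} {T} {L} {M} e = JoinSub-ext λ x →
  subst₂ (Join Γ) (sym (lookup-toSub-var L x)) (sym (lookup-toSub-var M x)) (e (varPath T x))

Join-coh : ∀ {Γ : Ctx n} {Δ : Ctx m} {A B σ τ} → JoinTy Δ A B → JoinSub Γ σ τ → Join Γ (coh Δ A σ) (coh Δ B τ)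
Join-coh (C , p , q) (ρ , p′ , q′) = coh _ C ρ , coh-⟶* p p′ , coh-⟶* q q′

⟶-⟦⟧ : ∀ {Γ : Ctx n} {Δ : Ctx m} {s t} (σ : Sub m n) → Δ ⊢ s ⟶ t → Γ ⊢ s ⟦ σ ⟧ ⟶ t ⟦ σ ⟧
⟶-• : ∀ {Γ : Ctx n} {Δ : Ctx m} {τ ρ : Sub l m} (σ : Sub m n) → Δ ⊢ˢ τ ⟶ ρ → Γ ⊢ˢ τ • σ ⟶ ρ • σ
⟶-⟦⟧ σ (rule r)    = rule (sua-⟦⟧ σ r)
⟶-⟦⟧ σ (coh-ty r)  = coh-ty r
⟶-⟦⟧ σ (coh-sub r) = coh-sub (⟶-• σ r)
⟶-• σ (head r) = head (⟶-⟦⟧ σ r)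
⟶-• σ (tail r) = tail (⟶-• σ r)

⟶ᵀ-⟦⟧ : ∀ {Γ : Ctx n} {Δ : Ctx m} {A B} (σ : Sub m n) → Δ ⊢ᵀ A ⟶ B → Γ ⊢ᵀ A ⟦ σ ⟧ᵀ ⟶ B ⟦ σ ⟧ᵀ
⟶ᵀ-⟦⟧ σ (src r)  = src (⟶-⟦⟧ σ r)
⟶ᵀ-⟦⟧ σ (base r) = base (⟶ᵀ-⟦⟧ σ r)
⟶ᵀ-⟦⟧ σ (tgt r)  = tgt (⟶-⟦⟧ σ r)

lookup-⟶* : ∀ {Γ : Ctx n} {σ τ : Sub m n} → Γ ⊢ˢ σ ⟶ τ → ∀ x → Γ ⊢ lookup σ x ⟶* lookup τ x
lookup-⟶* (head r) zero    = r ◅ done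
lookup-⟶* (head r) (suc x) = done
lookup-⟶* (tail r) zero    = done
lookup-⟶* (tail r) (suc x) = lookup-⟶* r x

⟦⟧-⟶ : ∀ {Γ : Ctx n} (t : Tm m) {σ τ : Sub m n} → Γ ⊢ˢ σ ⟶ τ → Γ ⊢ t ⟦ σ ⟧ ⟶* t ⟦ τ ⟧
•-⟶ : ∀ {Γ : Ctx n} (ρ : Sub l m) {σ τ : Sub m n} → Γ ⊢ˢ σ ⟶ τ → Γ ⊢ˢ ρ • σ ⟶* ρ • τ
⟦⟧-⟶ (var x)     r = lookup-⟶* r x
⟦⟧-⟶ (coh Δ A ρ) r = coh-⟶* done (•-⟶ ρ r)
•-⟶ []      r = done
•-⟶ (t ∷ ρ) r = ∷-⟶* (⟦⟧-⟶ t r) (•-⟶ ρ r)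

⟦⟧ᵀ-⟶ : ∀ {Γ : Ctx n} (A : Ty m) {σ τ : Sub m n} → Γ ⊢ˢ σ ⟶ τ → Γ ⊢ᵀ A ⟦ σ ⟧ᵀ ⟶* A ⟦ τ ⟧ᵀ
⟦⟧ᵀ-⟶ ⋆            r = done
⟦⟧ᵀ-⟶ (s ⇒[ A ] t) r = arr-⟶* (⟦⟧-⟶ s r) (⟦⟧ᵀ-⟶ A r) (⟦⟧-⟶ t r)

star-bind : ∀ {a} {X Y : Set a} {R : X → X → Set} {Q : Y → Y → Set} (f : X → Y) →
            (∀ {x y} → R x y → Star Q (f x) (f y)) → ∀ {x y} → Star R x y → Star Q (f x) (f y)
star-bind f g done     = done
star-bind f g (r ◅ rs) = g r ◅◅ star-bind f g rs

⟦⟧-⟶* : ∀ {Γ : Ctx n} (t : Tm m) {σ τ : Sub m n} → Γ ⊢ˢ σ ⟶* τ → Γ ⊢ t ⟦ σ ⟧ ⟶* t ⟦ τ ⟧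
⟦⟧-⟶* t = star-bind (t ⟦_⟧) (⟦⟧-⟶ t)

⟦⟧ᵀ-⟶* : ∀ {Γ : Ctx n} (A : Ty m) {σ τ : Sub m n} → Γ ⊢ˢ σ ⟶* τ → Γ ⊢ᵀ A ⟦ σ ⟧ᵀ ⟶* A ⟦ τ ⟧ᵀ
⟦⟧ᵀ-⟶* A = star-bind (A ⟦_⟧ᵀ) (⟦⟧ᵀ-⟶ A)

fromSphere-⟶ : ∀ {Γ : Ctx n} {A B} (F : ∀ d → Sub (d * 2) n → Tm n) →
  (∀ d {σ τ} → Γ ⊢ˢ σ ⟶ τ → Γ ⊢ F d σ ⟶ F d τ) → Γ ⊢ᵀ A ⟶ B →
  Γ ⊢ F (dim A) (fromSphere A) ⟶ F (dim B) (fromSphere B)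
fromSphere-⟶ F f (src {A = A} r)                 = f (suc (dim A)) (tail (head r))
fromSphere-⟶ F f (tgt {A = A} r)                 = f (suc (dim A)) (head r)
fromSphere-⟶ F f (base {s = s} {A} {A′} {t} r) =
  fromSphere-⟶ (λ d τ → F (suc d) (t ∷ s ∷ τ)) (λ d r → f (suc d) (tail (tail r))) r

identity-⟶* : ∀ {Γ : Ctx n} {A B s t} → Γ ⊢ᵀ A ⟶* B → Γ ⊢ s ⟶* t → Γ ⊢ identity A s ⟶* identity B t
identity-⟶* {B = B} {s} p q =
  gmap (λ A → identity A s) (fromSphere-⟶ (λ d τ → coh (Disc d) (idType d) (s ∷ τ)) (λ d r → coh-sub (tail r))) p
  ◅◅ gmap (identity B) (λ r → coh-sub (head r)) q

identity-join : ∀ {Γ : Ctx n} (A : Ty m) s {σ τ : Sub m n} → JoinSub Γ σ τ →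
  Join Γ (identity (A ⟦ σ ⟧ᵀ) (s ⟦ σ ⟧)) (identity (A ⟦ τ ⟧ᵀ) (s ⟦ τ ⟧))
identity-join A s (ρ , p , q) = identity (A ⟦ ρ ⟧ᵀ) (s ⟦ ρ ⟧)
  , identity-⟶* (⟦⟧ᵀ-⟶* A p) (⟦⟧-⟶* s p) , identity-⟶* (⟦⟧ᵀ-⟶* A q) (⟦⟧-⟶* s q)

ecr-⟶* : ∀ {Γ : Ctx n} (Δ : Ctx m) s B (σ : Sub m n) → Γ ⊢ coh Δ (s ⇒[ B ] s) σ ⟶* identity (B ⟦ σ ⟧ᵀ) (s ⟦ σ ⟧)
ecr-⟶* {Γ = Γ} Δ s B σ with ecr-any {Γ = Γ} Δ s B σ
... | inj₁ e = subst (Γ ⊢ coh Δ (s ⇒[ B ] s) σ ⟶*_) e done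
... | inj₂ r = rule r ◅ done

⟶*-typed : ∀ {Γ : Ctx n} {s t A} → Γ ⊢ s ∶ A → Γ ⊢ s ⟶* t → Γ ⊢ t ∶ A
⟶*-typed d done     = d
⟶*-typed d (r ◅ rs) = ⟶*-typed (⟶-typed d r) rs

-- Equal ends make `𝒞` an endo-coherence, and `endo-dim` then bounds the tree. So a standard
-- composite of full height is never subject to endo-coherence removal.
endo-height : ∀ k V {s B} → 𝒰 (suc k) V ≡ s ⇒[ B ] s → height V ≤ suc k → height V ≤ k
endo-height k V {s} {B} e h with coh-inv (𝒞-typed k V h)
... | i = lem i e refl
  where
  lem : ∀ {A C} → CohInv ⌊ V ⌋ ⌊ V ⌋ A idSub C → A ≡ s ⇒[ B ] s → 𝒰 (suc k) V ≡ A → height V ≤ k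
  lem (cohInv _ (arr _ ds _) _ r _) refl e′ = ≤-trans (≤-reflexive (sym (dimCtx-⌊⌋ V)))
    (≤-trans (endo-dim ds r) (≤-reflexive (suc-injective (trans (cong dim (sym e′)) (dim-𝒰 (suc k) V)))))

height-∂-≥ : ∀ i V → i ≤ height V → height (∂ i V) ≡ i
height-∂-≥ i V le = ≤-antisym (height-∂ i V) (lem i V le)
  where
  lem : ∀ i V → i ≤ height V → i ≤ height (∂ i V)
  lem zero    V        le = z≤n
  lem (suc i) (V ∷ Vs) le with ≤-total (suc (height V)) (height Vs)
  ... | inj₁ h = ≤-trans (lem (suc i) Vs (≤-trans le (≤-reflexive (m≤n⇒m⊔n≡n h)))) (m≤n⊔m (suc (height (∂ i V))) _)
  ... | inj₂ h = ≤-trans (s≤s (lem i V (s≤s⁻¹ (≤-trans le (≤-reflexive (m≥n⇒m⊔n≡m h)))))) (m≤m⊔n _ (height (∂ (suc i) Vs)))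

vars-normal : ∀ {Γ : Ctx n} {σ τ : Sub m n} → (∀ x → ∃[ y ] lookup σ x ≡ var y) → ¬ Γ ⊢ˢ σ ⟶ τ
vars-normal {σ = s ∷ σ} e (head r) with e zero
... | y , refl = var-normal r
vars-normal {σ = s ∷ σ} e (tail r) = vars-normal (λ x → e (suc x)) r

-- Such a term is not unary, is not an endo-coherence by `endo-height`, and offers no leaf for an
-- insertion because all its labels are variables.
std-rule-normal : ∀ {Γ : Ctx n} k V {σ x z} → height V ≡ suc k → V ≢ discTree (suc k) → (∀ x → ∃[ y ] lookup σ x ≡ var y) →
  sua′ Γ x z → x ≢ coh ⌊ V ⌋ (𝒰 (suc k) V) σ
std-rule-normal k V h ne v (inj₁ (disc-removal A t)) e =
  ne (UnTree-𝒰 (UnShape⇒UnTree (un⇒shape (subst IsUnary e (A , t , refl)))) refl)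
std-rule-normal k V h ne v (inj₂ (inj₁ (endo-coherence-removal Δ s A τ _))) e =
  <-irrefl refl (≤-trans (≤-reflexive (sym h)) (endo-height k V (proj₂ (proj₂ (endo e))) (≤-reflexive h)))
  where
  endo : ∀ {m} {Δ : Ctx m} {Θ : Ctx l} {s A τ B} {σ : Sub l n} → Tm.coh Δ (s ⇒[ A ] s) τ ≡ coh Θ B σ →
         ∃[ s ] ∃[ A ] B ≡ s ⇒[ A ] s
  endo refl = _ , _ , refl
std-rule-normal k V {σ} h ne v (inj₂ (inj₂ (insertion {S} {P} {T} {L} {M} r A _ _ _))) e with coh-tree S V e
... | refl with coh-inj e
...   | _ , refl with v (pathVar S (overline P))
...     | y , eq = case trans (sym (trans (sym (lookup-toSub L (overline P))) eq)) (InsertionRedex.label r) of λ ()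

height-0 : ∀ W → height W ≡ 0 → W ≡ []
height-0 []       h = refl
height-0 (Y ∷ Ys) h with ≤-trans (m≤m⊔n (suc (height Y)) (height Ys)) (≤-reflexive h)
... | ()

-- A reduction inside the type of a composite leaf would destroy its standard form and with it the
-- redex; this shows that none exists. Both ends are variables or standard coherences of full height
-- with variable labels.
𝒰-normal : ∀ j V → j ≤ height V → ∀ {B} → ¬ ⌊ V ⌋ ⊢ᵀ 𝒰 j V ⟶ B
stdEnd-normal : ∀ i ε V → i < height V → (∀ W → i ≤ height W → ∀ {B} → ¬ ⌊ W ⌋ ⊢ᵀ 𝒰 i W ⟶ B) →
                ∀ {t} → ¬ ⌊ V ⌋ ⊢ stdEnd ε i V ⟶ t
𝒰-normal (suc i) V le (src r)  = stdEnd-normal i Sign.- V le (𝒰-normal i) r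
𝒰-normal (suc i) V le (base r) = 𝒰-normal i V (<⇒≤ le) r
𝒰-normal (suc i) V le (tgt r)  = stdEnd-normal i Sign.+ V le (𝒰-normal i) r
stdEnd-normal i ε V lt ih {t} = go (standard i (∂ i V) (height-∂ i V)) (height-∂-≥ i V (<⇒≤ lt)) (δ i ε V)
  where
  go : ∀ {W} → Standard i W → height W ≡ i → (f : Path W → Path V) →
       ¬ ⌊ V ⌋ ⊢ 𝒯 i W ⟦ toSub (λ p → path V (f p)) ⟧ ⟶ t
  go {W} (disc e) h f r rewrite e | lookup-toSub (λ p → path V (f p)) (zeros W) = var-normal r
  go {W} (non-disc ne e) h f r rewrite e = step-normal (subst (λ s → ⌊ V ⌋ ⊢ s ⟶ t) (𝒞-⟦⟧ i W _) r) refl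
    where
    σ = toSub (λ p → path V (f p))
    vars : ∀ x → ∃[ y ] lookup σ x ≡ var y
    vars x = _ , lookup-toSub-var (λ p → path V (f p)) x
    step-normal : ∀ {s} → ⌊ V ⌋ ⊢ s ⟶ t → s ≢ coh ⌊ W ⌋ (𝒰 i W) σ
    step-normal (coh-ty r)  refl = ih W (≤-reflexive (sym h)) r
    step-normal (coh-sub r) refl = vars-normal vars r
    step-normal (rule r)    eq = contra i h ne r eq
      where
      contra : ∀ i → height W ≡ i → W ≢ discTree i → ∀ {x} → sua′ ⌊ V ⌋ x t → x ≢ coh ⌊ W ⌋ (𝒰 i W) σ
      contra zero    h ne r _ = ne (height-0 W h)
      contra (suc k) h ne r   = std-rule-normal k W h ne vars r

-- Joining along equality, relative to lower dimensions

ChurchRosser : ℕ → Set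
ChurchRosser N = ∀ {n} {Γ : Ctx n} {s t A} → Γ ⊢ s ∶ A → dim A < N → Γ ⊢ s ≈ t → Join Γ s t

join-type : ∀ {N} → ChurchRosser N → ∀ {n} {Γ : Ctx n} {A B} → Γ ⊢ᵀ A → dim A ≤ N → Γ ⊢ᵀ A ≈ B → JoinTy Γ A B
join-type cr ⋆ le ⋆ = ⋆ , done , done
join-type cr (arr a s t) le (arr e f g) with cr s le e | join-type cr a (<⇒≤ le) f | cr t le g
... | _ , p , q | _ , p′ , q′ | _ , p″ , q″ = _ , arr-⟶* p p′ p″ , arr-⟶* q q′ q″

ConflAt : Ctx n → Tm n → Set
ConflAt Γ s = ∀ {t u} → Γ ⊢ s ⟶* t → Γ ⊢ s ⟶* u → Join Γ t u

join-trans : ∀ {Γ : Ctx n} {s t u} → ConflAt Γ t → Join Γ s t → Join Γ t u → Join Γ s u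
join-trans c (v , p , q) (w , p′ , q′) with c q p′
... | x , r , r′ = x , p ◅◅ r , q′ ◅◅ r′

near-join : ∀ {N} → ChurchRosser N → ∀ {n} {Γ : Ctx n} {d s t A} → Γ ⊢ s ∶ A → dim A ≡ d → d ≤ N → Near d Γ s t → Join Γ s t
near-join cr {Γ = Γ} dt refl le (near e f) = Join-coh
  (join-type cr (inv-type (coh-inv dt)) (≤-trans (≤-reflexive (dim-coh dt)) le) e)
  (JoinSub-toSub λ p → lem (f p))
  where
  lem : ∀ {s t} → LowEq _ Γ s t → Join Γ s t
  lem (inj₁ refl)             = Join-refl
  lem (inj₂ (e , A , d , lt)) = cr d (<-≤-trans lt le) e

-- Joins compose only at a confluent middle term. The relation given to `GGI` therefore carries
-- confluence of both its ends along with the join.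
ggi-join : ∀ {N} → ChurchRosser N → ∀ {n} {Γ : Ctx n} S (P : Branch S) V b {A L K B} →
  Γ ⊢ coh ⌊ S ⌋ A (toSub L) ∶ B → dim B ≤ N → height V ≤ leafHeight P →
  L (overline P) ≡ 𝒞 (leafHeight P) V ⟦ toSub K ⟧ → ConflAt Γ (coh ⌊ S ⌋ A (toSub L)) →
  (∀ {R′ C B′} {K′ : Labelling R′ n} → Γ ⊢ coh ⌊ R′ ⌋ C (toSub K′) ∶ B′ → dim B′ ≡ dim B →
    Sim _≡_ (insert S P V b) (ins S P V b L K) R′ K′ → ConflAt Γ (coh ⌊ R′ ⌋ C (toSub K′))) →
  Join Γ (coh ⌊ S ⌋ A (toSub L)) (target S P V b A L K)
ggi-join cr {Γ = Γ} S P V b {B = B} dt le h l ok ok′ = proj₂ (proj₂ (GGI.ggi (dim B)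
  (λ s t → ConflAt Γ s × ConflAt Γ t × Join Γ s t) (ConflAt Γ)
  (λ _ _ c r → c , (λ p q → c (r ◅ p) (r ◅ q)) , (_ , r ◅ done , done))
  (λ _ c r p q → c (r ◅ p) (r ◅ q))
  (λ dx e _ c c′ nr → c , c′ , near-join cr dx e le nr)
  (λ (c , c′ , j) → c′ , c , Join-sym j)
  (λ (c , c′ , j) (_ , c″ , j′) → c , c″ , join-trans c′ j j′)
  (leafHeight P) S P V b ≤-refl dt refl h l ok (λ {_} {_} {_} {K′} → ok′ {K′ = K′})))

step-at : ∀ {Γ : Ctx n} {σ τ : Sub m n} → Γ ⊢ˢ σ ⟶ τ →
  ∃[ x ] Γ ⊢ lookup σ x ⟶ lookup τ x × (∀ {y} → y ≢ x → lookup σ y ≡ lookup τ y)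
step-at (head r) = zero , r , λ { {zero} ne → ⊥-elim (ne refl) ; {suc y} ne → refl }
step-at (tail r) with step-at r
... | x , r′ , e = suc x , r′ , λ { {zero} ne → refl ; {suc y} ne → e (λ eq → ne (cong suc eq)) }

costs-change : ∀ {σ τ : Sub m n} x → cost (lookup τ x) <ₗ cost (lookup σ x) →
  (∀ {y} → y ≢ x → lookup σ y ≡ lookup τ y) → costs τ <ₗ costs σ
costs-change {σ = s ∷ σ} {t ∷ τ} zero lt e with lookup-ext {xs = σ} {τ} (λ x → e {suc x} λ ())
... | refl = <ₗ-+ʳ (costs σ) lt
costs-change {σ = s ∷ σ} {t ∷ τ} (suc x) lt e with e {zero} (λ ())
... | refl = <ₗ-+ˡ (cost s) (costs-change {σ = σ} {τ} x lt (λ {y} ne → e {suc y} (λ { refl → ne refl })))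

costs-upd : ∀ {S} (L : Labelling S n) q {t} → cost t <ₗ cost (L q) → costs (toSub (upd L q t)) <ₗ costs (toSub L)
costs-upd {S = S} L q {t} lt = costs-change {σ = toSub L} {toSub (upd L q t)} (pathVar S q)
  (subst₂ (λ s u → cost s <ₗ cost u) (sym (trans (lookup-toSub (upd L q t) q) (upd-same L q t))) (sym (lookup-toSub L q)) lt)
  λ {y} ne → trans (lookup-toSub-var L y) (trans
    (sym (upd-other L q t (λ e → ne (trans (sym (pathVar-varPath S y)) (cong (pathVar S) e)))))
    (sym (lookup-toSub-var (upd L q t) y)))

-- By the dimensions of their types, a unary composite that is an identity would live over discs of
-- two consecutive dimensions at once, but these have different sizes.
shapes-disjoint : ∀ {Δ : Ctx m} {A} → UnShape Δ A → IdShape Δ A → Empty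
shapes-disjoint {m} {Δ} {A} u i with UnShape-ctx u | IdShape-ctx i
... | d , e | d′ , e′ = <-irrefl (suc-injective (trans (cong proj₁ (sym e′)) (cong proj₁ e)))
  (≤-trans (s≤s (n≤1+n (d′ * 2))) (≤-reflexive (cong (_* 2) (sym d≡))))
  where
  d≡ : d ≡ suc d′
  d≡ = trans (sym (dim-DiscType d)) (trans (cong (λ x → dim (proj₂ (proj₂ x))) (trans (sym e) e′))
    (cong suc (dim-DiscType d′)))

Sim-costs : ∀ {R R′} {K : Labelling R n} {K′ : Labelling R′ n} → Sim _≡_ R K R′ K′ → ∀ k →
            costs (toSub K′) k ≡ costs (toSub K) k
Sim-costs {R = R} {R′} {K} {K′} s k = sym (Sim-≡ (λ _ σ → costs σ k) {R} {K} {R′} {K′} s)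

toSub-injective : ∀ {T} {L M : Labelling T n} → toSub L ≡ toSub M → ∀ p → L p ≡ M p
toSub-injective {T = T} {L} {M} e p =
  trans (sym (lookup-toSub L p)) (trans (cong (λ σ → lookup σ (pathVar T p)) e) (lookup-toSub M p))

path-≟ : ∀ {T} (p q : Path T) → Dec (p ≡ q)
path-≟ {T} p q with pathVar T p Fin.≟ pathVar T q
... | yes e = yes (pathVar-injective {p = p} {q} e)
... | no ¬e = no λ { refl → ¬e refl }

endo-≡ : ∀ {Δ : Ctx m} {Θ : Ctx l} {s A τ B} {σ : Sub l n} → Tm.coh Δ (s ⇒[ A ] s) τ ≡ coh Θ B σ →
         ∃[ s ] ∃[ A ] B ≡ s ⇒[ A ] s
endo-≡ refl = _ , _ , refl

¬endo-𝒰 : ∀ {S} (P : Branch S) T → leafHeight P ≡ height T → ∀ {s B} → 𝒰 (leafHeight P) T ≢ s ⇒[ B ] s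
¬endo-𝒰 P T hT e with leafHeight P | leafHeight-suc P
... | .(suc k) | k , refl = <-irrefl refl (≤-trans (≤-reflexive hT) (endo-height k T e (≤-reflexive (sym hT))))

leaf-level : ∀ {S} → Branch S → Tree → ℕ
leaf-level P T = level (idShape? ⌊ T ⌋ (𝒰 (leafHeight P) T))

std-insert′ : ∀ {S} (P : Branch S) T Q U c → height T ≤ leafHeight P → height U ≤ leafHeight Q →
  ⌊ insert T Q U c ⌋ ⊢ 𝒞 (leafHeight P) T ⟦ toSub (κ T Q U c) ⟧ ≈ 𝒞 (leafHeight P) (insert T Q U c)
std-insert′ P T Q U c h g with leafHeight P | leafHeight-suc P
... | .(suc k) | k , refl = std-insert k T Q U c h g

¬IdShape-𝒰 : ∀ {S} (P : Branch S) T → height T ≡ leafHeight P → ¬ IdShape ⌊ T ⌋ (𝒰 (leafHeight P) T)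
¬IdShape-𝒰 P T hT i with leafHeight P | leafHeight-suc P
... | .(suc k) | k , refl with IdTree-𝒰 {k} (IdShape⇒IdTree i) refl
...   | refl = <-irrefl (sym (trans (sym hT) (height-disc k))) ≤-refl

-- Peaks at an insertion

module Peak {N} (cr : ChurchRosser N) {n} {Γ : Ctx n} {S A A₀} {L : Labelling S n}
  (dx : Γ ⊢ coh ⌊ S ⌋ A (toSub L) ∶ A₀) (le : dim A₀ ≤ N) (¬i : ¬ IdShape ⌊ S ⌋ A) (¬u : ¬ UnShape ⌊ S ⌋ A)
  (ih : ∀ {y} → Below Γ N y (coh ⌊ S ⌋ A (toSub L)) → ConflAt Γ y) where

  ok-cost : ∀ {R C B} {K : Labelling R n} e → Γ ⊢ coh ⌊ R ⌋ C (toSub K) ∶ B → dim B ≡ dim A₀ →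
    (∀ k → costs (toSub K) k + unit e k ≤ costs (toSub L) k) → ConflAt Γ (coh ⌊ R ⌋ C (toSub K))
  ok-cost {R} {C} {B} {K} e dt eq f = ih (drop (B , dt , ≤-trans (≤-reflexive eq) le)
    (cost-below ⌊ S ⌋ A (toSub L) ⌊ R ⌋ C (toSub K) ¬i (arrow-dim dx) (trans (dim-coh dt) (trans eq (sym (dim-coh dx)))) e f))

  module _ (P : Branch S) (T : Tree) {M : Labelling T n} (b : branchHeight P ≤ trunkHeight T) (h : height T ≤ leafHeight P)
           (l : L (overline P) ≡ 𝒞 (leafHeight P) T ⟦ toSub M ⟧) where
    ok-target : ∀ {R C B} {K : Labelling R n} → Γ ⊢ coh ⌊ R ⌋ C (toSub K) ∶ B → dim B ≡ dim A₀ →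
      Sim _≡_ (insert S P T b) (ins S P T b L M) R K → ConflAt Γ (coh ⌊ R ⌋ C (toSub K))
    ok-target {K = K} dt eq s = ok-cost {K = K} (leaf-level P T) dt eq λ k →
      ≤-trans (≤-reflexive (cong (_+ unit (leaf-level P T) k) (Sim-costs {K = ins S P T b L M} {K} s k))) (costs-ins S P T b {L} {M} l k)

    target-typed : Γ ⊢ target S P T b A L M ∶ A₀
    target-typed = insert-typed S P T b h l dx

    ok-target₀ : ConflAt Γ (target S P T b A L M)
    ok-target₀ = ok-target {K = ins S P T b L M} target-typed refl (Sim-refl (λ _ → refl) (insert S P T b))

    -- After the type step the rule may be blocked, since `B` may have become the type of an
    -- identity or of a unary composite; insertion without side conditions covers this.
    insert-type : ∀ {B} → ⌊ S ⌋ ⊢ᵀ A ⟶ B → Join Γ (target S P T b A L M) (coh ⌊ S ⌋ B (toSub L))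
    insert-type {B} r with ggi-join cr S P T b {B} {L} {M} (⟶-typed dx (coh-ty r)) le h l
      (ih (step-Below (A₀ , dx , le) (coh-ty r))) (λ {_} {_} {_} {K′} → ok-target {K = K′})
    ... | u , p , q = u , coh-ty (⟶ᵀ-⟦⟧ (toSub (κ S P T b)) r) ◅ q , p

    -- The first insertion already gains a unit of cost and a second one never loses it, so every
    -- term met on the way stays below the peak.
    further : ∀ (Q : Branch (insert S P T b)) U c {K} → height U ≤ leafHeight Q →
      ins S P T b L M (overline Q) ≡ 𝒞 (leafHeight Q) U ⟦ toSub K ⟧ →
      let R = insert S P T b ; I = ins S P T b L M ; B = A ⟦ toSub (κ S P T b) ⟧ᵀ in
      Join Γ (target S P T b A L M) (target R Q U c B I K)
        × Γ ⊢ target R Q U c B I K ∶ A₀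
        × (∀ {R′ C B} {K′ : Labelling R′ n} → Γ ⊢ coh ⌊ R′ ⌋ C (toSub K′) ∶ B → dim B ≡ dim A₀ →
             Sim _≡_ (insert R Q U c) (ins R Q U c I K) R′ K′ → ConflAt Γ (coh ⌊ R′ ⌋ C (toSub K′)))
    further Q U c {K} g e = ggi-join cr R Q U c target-typed le g e ok-target₀ (λ {_} {_} {_} {K′} → ok {K′ = K′}) ,
      insert-typed R Q U c g e target-typed , λ {_} {_} {_} {K′} → ok {K′ = K′}
      where
      R = insert S P T b
      I = ins S P T b L M
      ok : ∀ {R′ C B} {K′ : Labelling R′ n} → Γ ⊢ coh ⌊ R′ ⌋ C (toSub K′) ∶ B → dim B ≡ dim A₀ →
           Sim _≡_ (insert R Q U c) (ins R Q U c I K) R′ K′ → ConflAt Γ (coh ⌊ R′ ⌋ C (toSub K′))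
      ok {K′ = K′} dt eq s = ok-cost {K = K′} (leaf-level P T) dt eq λ k →
        ≤-trans (+-monoˡ-≤ (unit (leaf-level P T) k) (≤-trans (≤-reflexive (Sim-costs {K = ins R Q U c I K} {K′} s k))
          (≤-trans (m≤m+n (costs (toSub (ins R Q U c I K)) k) _) (costs-ins R Q U c {I} {K} e k)))) (costs-ins S P T b {L} {M} l k)

    -- Reducing arguments changes neither the context nor the type of the leaf, so the side
    -- condition persists and the rule can be applied after the reductions.
    insert-pointwise : ∀ {L′ : Labelling S n} {M′ : Labelling T n} → (∀ p → Γ ⊢ L p ⟶* L′ p) → (∀ p → Γ ⊢ M p ⟶* M′ p) →
      L′ (overline P) ≡ 𝒞 (leafHeight P) T ⟦ toSub M′ ⟧ →
      IsIdentity (L (overline P)) ⊎ (leafHeight P ≡ height T × ¬ IsUnary (L (overline P))) →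
      Join Γ (target S P T b A L M) (coh ⌊ S ⌋ A (toSub L′))
    insert-pointwise {L′} {M′} p q l′ c = target S P T b A L′ M′
      , coh-⟶* done (toSub-⟶* (insert-rel S P T b (Γ ⊢_⟶*_) p q))
      , insertion-step S P T b h l′ ¬u ¬i (cond c) ◅ done
      where
      lab : ∀ {L : Labelling S n} {M} → L (overline P) ≡ 𝒞 (leafHeight P) T ⟦ toSub M ⟧ →
            L (overline P) ≡ coh ⌊ T ⌋ (𝒰 (leafHeight P) T) (toSub M)
      lab l = trans l (𝒞-⟦⟧ (leafHeight P) T _)
      cond : IsIdentity (L (overline P)) ⊎ (leafHeight P ≡ height T × ¬ IsUnary (L (overline P))) →
             IsIdentity (L′ (overline P)) ⊎ (leafHeight P ≡ height T × ¬ IsUnary (L′ (overline P)))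
      cond (inj₁ i)       = inj₁ (subst IsIdentity (sym (lab {L′} {M′} l′)) (id-⟦⟧⁻ (subst IsIdentity (lab {L} {M} l) i)))
      cond (inj₂ (e , v)) = inj₂ (e , λ u → v (subst IsUnary (sym (lab {L} {M} l)) (un-⟦⟧⁻ (subst IsUnary (lab {L′} {M′} l′) u))))

  -- Both leaves are one term, and a coherence determines its tree and labels; only the branches
  -- leading to the leaf can differ.
  insert-same : ∀ (P Q : Branch S) T U b c {M : Labelling T n} {N : Labelling U n} → Same P Q →
    height T ≤ leafHeight P → height U ≤ leafHeight Q →
    L (overline P) ≡ 𝒞 (leafHeight P) T ⟦ toSub M ⟧ → L (overline Q) ≡ 𝒞 (leafHeight Q) U ⟦ toSub N ⟧ →
    Join Γ (target S P T b A L M) (target S Q U c A L N)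
  insert-same P Q T U b c {M} {N} s h g l l′ with coh-tree T U
    (trans (sym (trans l (𝒞-⟦⟧ (leafHeight P) T (toSub M)))) (trans (cong L (same-leaf s)) (trans l′ (𝒞-⟦⟧ (leafHeight Q) U (toSub N)))))
  ... | refl = near-join cr (target-typed P T b h l) refl le (near-univ R₁ R₂ {A = A} sim₀ eq₀ sim)
    where
    R₁ = insert S P T b
    R₂ = insert S Q T c
    lh : leafHeight P ≡ leafHeight Q
    lh = cong depth (same-leaf s)
    M≡N : ∀ p → M p ≡ N p
    M≡N = toSub-injective (proj₂ (coh-inj (trans (sym (trans l (𝒞-⟦⟧ (leafHeight P) T (toSub M))))
      (trans (cong L (same-leaf s)) (trans l′ (𝒞-⟦⟧ (leafHeight Q) T (toSub N)))))))
    sim : Sim (LowEq (dim A₀) Γ) R₁ (ins S P T b L M) R₂ (ins S Q T c L N)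
    sim = Sim-trans {R = _≡_} {_≡_} (λ { refl refl → inj₁ refl }) R₁ R₂ R₂ (same-insert s T b c L M)
      (Sim-intro R₂ (insert-rel S Q T c _≡_ (λ _ → refl) M≡N))
    r₀ = κ-redex S P T b h (WL-path R₁)
    L₀ = κ S P T b ⨾ toSub (path R₁)
    M₀ = ιSub S P T b
    r₁ : Redex ⌊ R₁ ⌋ S Q T L₀ M₀
    r₁ = redex (rw r₀) g (trans (cong L₀ (sym (same-leaf s))) (trans (rl r₀) (cong (λ j → 𝒞 j T ⟦ toSub M₀ ⟧) lh)))
    sim₀ : Sim (⌊ R₁ ⌋ ⊢_≈_) R₁ (path R₁) R₂ (ins S Q T c L₀ M₀)
    sim₀ = Sim-trans {R = _≡_} {_≡_} (λ { refl refl → ≈-refl _ }) R₁ R₁ R₂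
      (Sim-intro R₁ (λ p → sym (ins-κ-ι S P T b (path R₁) p))) (same-insert s T b c L₀ M₀)
    eq₀ : ∀ p → ⌊ R₁ ⌋ ⊢ κ S P T b p ≈ (κ S Q T c ⨾ toSub (ins S Q T c L₀ M₀)) p
    eq₀ p = ≈-trans (≈-reflexive (sym (κ⨾path S P T b p))) (r-κ c r₁ p)

  insert-before : ∀ (P Q : Branch S) T U b c {M : Labelling T n} {N : Labelling U n} → Before P Q →
    height T ≤ leafHeight P → height U ≤ leafHeight Q →
    L (overline P) ≡ 𝒞 (leafHeight P) T ⟦ toSub M ⟧ → L (overline Q) ≡ 𝒞 (leafHeight Q) U ⟦ toSub N ⟧ →
    Join Γ (target S P T b A L M) (target S Q U c A L N)
  insert-before P Q T U b c {M} {N} s h g l l′ =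
    let j  , dt  , ok  = further P T b h l (moveʳ s T b) U c′ (rh rʳ) (rl rʳ)
        j′ , dt′ , ok′ = further Q U c g l′ (moveˡ s U c) T b′ (rh rˡ) (rl rˡ)
    in join-trans (ok {K′ = ins _ (moveʳ s T b) U c′ (ins S P T b L M) N} dt refl (Sim-refl (λ _ → refl) (insert (insert S P T b) (moveʳ s T b) U c′))) j
        (join-trans (ok′ {K′ = ins _ (moveˡ s U c) T b′ (ins S Q U c L N) M} dt′ refl (Sim-refl (λ _ → refl) (insert (insert S Q U c) (moveˡ s U c) T b′)))
          (near-join cr dt refl le (parallel-near s T U r r′ b c b′ c′ (leaf-bound P dx) (leaf-bound Q dx)))
          (Join-sym j′))
    where
    r : Redex Γ S P T L M
    r = coh-redex dx h l
    r′ : Redex Γ S Q U L N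
    r′ = coh-redex dx g l′
    c′ : branchHeight (moveʳ s T b) ≤ trunkHeight U
    c′ = ≤-trans (≤-reflexive (moveʳ-bh s T b)) c
    b′ : branchHeight (moveˡ s U c) ≤ trunkHeight T
    b′ = ≤-trans (≤-reflexive (moveˡ-bh s U c)) b
    rʳ = redexʳ s T U r r′ b c b′ c′
    rˡ = redexˡ s T U r r′ b c b′ c′

  insert-insert : ∀ (P Q : Branch S) T U b c {M : Labelling T n} {N : Labelling U n} →
    height T ≤ leafHeight P → height U ≤ leafHeight Q →
    L (overline P) ≡ 𝒞 (leafHeight P) T ⟦ toSub M ⟧ → L (overline Q) ≡ 𝒞 (leafHeight Q) U ⟦ toSub N ⟧ →
    Join Γ (target S P T b A L M) (target S Q U c A L N)
  insert-insert P Q T U b c h g l l′ with compare P Q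
  ... | inj₁ s        = insert-same P Q T U b c s h g l l′
  ... | inj₂ (inj₁ s) = insert-before P Q T U b c s h g l l′
  ... | inj₂ (inj₂ s) = Join-sym (insert-before Q P U T c b s g h l′ l)

  -- Reducing inside the leaf gives a coherence over `V` whose type is only equal to the standard
  -- one, so it need not be a redex for `S`. The labelling `L″` has the standard coherence there
  -- instead. It need not be a reduct of `L`, but it costs less, so `ih` applies to it.
  insert-nested : ∀ (P : Branch S) T b {M : Labelling T n} → height T ≡ leafHeight P → T ≢ discTree (leafHeight P) →
    L (overline P) ≡ 𝒞 (leafHeight P) T ⟦ toSub M ⟧ →
    ∀ (Q : Branch T) U c {N : Labelling U n} → height U ≤ leafHeight Q → M (overline Q) ≡ 𝒞 (leafHeight Q) U ⟦ toSub N ⟧ →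
    ∀ {L′ : Labelling S n} → (∀ {p} → p ≢ overline P → L p ≡ L′ p) →
    L′ (overline P) ≡ target T Q U c (𝒰 (leafHeight P) T) M N →
    Join Γ (target S P T b A L M) (coh ⌊ S ⌋ A (toSub L′))
  insert-nested P T b {M} hT ne l Q U c {N} g l₂ {L′} e l′ =
    let j , dt , ok = further P T b h l (nest P T b ¬lin Q) U c′ (rh rn) (rl rn)
        j′ = ggi-join cr S P V b′ {A} {L″} {K} dz le hV (upd-same L (overline P) _) okz okV
        dV = insert-typed S P V b′ hV (upd-same L (overline P) _) dz
    in join-trans (ok {K′ = ins _ (nest P T b ¬lin Q) U c′ (ins S P T b L M) N} dt refl
           (Sim-refl (λ _ → refl) (insert (insert S P T b) (nest P T b ¬lin Q) U c′))) j
        (join-trans (okV {K′ = ins S P V b′ L″ K} dV refl (Sim-refl (λ _ → refl) (insert S P V b′)))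
          (Join-sym (near-join cr dV refl le (subst (λ σ → Near (dim A₀) Γ (coh ⌊ insert S P V b′ ⌋ (A ⟦ toSub (κ S P V b′) ⟧ᵀ) σ)
             (target _ (nest P T b ¬lin Q) U c′ (A ⟦ toSub (κ S P T b) ⟧ᵀ) (ins S P T b L M) N))
             (sym (toSub-cong (ins-upd S P V b′ {L} {K}))) nn)))
          (join-trans okz (Join-sym j′) (Join-coh (_ , done , done) (JoinSub-toSub leaf-join))))
    where
    h = ≤-reflexive hT
    r : Redex Γ S P T L M
    r = coh-redex dx h l
    ¬lin : ¬ Linear T
    ¬lin lin = ne (trans (linear-disc T lin) (cong discTree hT))
    V = insert T Q U c
    K = ins T Q U c M N
    b′ : branchHeight P ≤ trunkHeight V
    b′ = ≤-trans b (insert-trunk T Q U c ¬lin)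
    c′ : branchHeight (nest P T b ¬lin Q) ≤ trunkHeight U
    c′ = ≤-trans (≤-reflexive (nest-bh P T b ¬lin Q)) c
    hV : height V ≤ leafHeight P
    hV = ≤-trans (height-insert T Q U c g) h
    r₂ : Redex Γ T Q U M N
    r₂ = redex (redex-M S P T (rw r) l) g l₂
    N′ = insert (insert S P T b) (nest P T b ¬lin Q) U c′
    rn = nested-redex P T ¬lin Q U h g b c b′ c′ r r₂
    lhV = leafHeight P
    s₁ = coh ⌊ V ⌋ (𝒰 lhV T ⟦ toSub (κ T Q U c) ⟧ᵀ) (toSub K)
    s₂ = 𝒞 lhV V ⟦ toSub K ⟧
    lab : L (overline P) ≡ coh ⌊ T ⌋ (𝒰 lhV T) (toSub M)
    lab = trans l (𝒞-⟦⟧ lhV T (toSub M))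
    d-leaf : Γ ⊢ coh ⌊ T ⌋ (𝒰 lhV T) (toSub M) ∶ tyP ⋆ L (overline P)
    d-leaf = subst (Γ ⊢_∶ tyP ⋆ L (overline P)) lab (rw r (overline P))
    d₁ : Γ ⊢ s₁ ∶ tyP ⋆ L (overline P)
    d₁ = insert-typed T Q U c g l₂ d-leaf
    std : ⌊ V ⌋ ⊢ 𝒞 lhV T ⟦ toSub (κ T Q U c) ⟧ ≈ 𝒞 lhV V
    std = std-insert′ P T Q U c h g
    L″ = upd L (overline P) s₂
    s₂≡ : coh ⌊ V ⌋ (𝒰 lhV V) (toSub K) ≡ s₂
    s₂≡ = sym (𝒞-⟦⟧ lhV V (toSub K))
    leaf≈ : Γ ⊢ L (overline P) ≈ s₂
    leaf≈ = ≈-trans (≈-reflexive lab) (≈-trans (ggi-≈ T Q U c d-leaf g l₂)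
      (subst (Γ ⊢ s₁ ≈_) s₂≡ (coh (𝒰-insert lhV T Q U c g) (≈ˢ-refl _))))
    L≈ : ∀ p → Γ ⊢ L p ≈ L″ p
    L≈ = upd-rel {R = Γ ⊢_≈_} (≈-refl _) L (overline P) leaf≈
    dz : Γ ⊢ coh ⌊ S ⌋ A (toSub L″) ∶ A₀
    dz = proj₁ (≈-typed (coh (≈ᵀ-refl A) (≈ˢ-toSub L≈))) dx
    cost-leaf : cost s₂ <ₗ cost (L (overline P))
    cost-leaf = subst₂ (λ s t → cost s <ₗ cost t) s₂≡ (sym lab)
      (cost-below ⌊ T ⌋ (𝒰 lhV T) (toSub M) ⌊ V ⌋ (𝒰 lhV V) (toSub K) (¬IdShape-𝒰 P T hT) (arrow-dim d-leaf)
        (trans (dim-𝒰 lhV V) (sym (dim-𝒰 lhV T))) (leaf-level Q U) (costs-ins T Q U c {M} {N} l₂))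
    okz : ConflAt Γ (coh ⌊ S ⌋ A (toSub L″))
    okz = ih (drop (A₀ , dz , le) (<ₗ-+ˡ (unit (level (idShape? ⌊ S ⌋ A))) (costs-upd L (overline P) cost-leaf)))
    nn = nested-near P T ¬lin Q U h g b c b′ c′ {L = L} {M} {N} {dim A₀} {A} std
    nestSim : Sim _≡_ (insert (insert S P T b) (nest P T b ¬lin Q) U c′)
      (ins _ (nest P T b ¬lin Q) U c′ (ins S P T b L M) N) (insert S P V b′) (ins S P V b′ L″ K)
    nestSim = Sim-trans {R = _≡_} {_≡_} trans N′ (insert S P V b′) (insert S P V b′)
      (Sim-map {R = λ s t → t ≡ s} {_≡_} sym N′ (insert S P V b′)
        (Sim-sym {R = _≡_} (insert S P V b′) N′ (nested P T b ¬lin Q U c b′ c′ {L} {M} {N})))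
      (Sim-intro (insert S P V b′) (λ p → sym (ins-upd S P V b′ {L} {K} {s₂} p)))
    okV : ∀ {R′ C B} {K′ : Labelling R′ n} → Γ ⊢ coh ⌊ R′ ⌋ C (toSub K′) ∶ B → dim B ≡ dim A₀ →
          Sim _≡_ (insert S P V b′) (ins S P V b′ L″ K) R′ K′ → ConflAt Γ (coh ⌊ R′ ⌋ C (toSub K′))
    okV {R′} {K′ = K′} dt eq s = proj₂ (proj₂ (further P T b h l (nest P T b ¬lin Q) U c′ (rh rn) (rl rn)))
      {K′ = K′} dt eq (Sim-trans {R = _≡_} {_≡_} trans N′ (insert S P V b′) R′ nestSim s)
    leaf-join : ∀ p → Join Γ (L″ p) (L′ p)
    leaf-join p with path-≟ p (overline P)
    ... | no ¬e    = subst (Join Γ (L″ p)) (trans (upd-other L (overline P) s₂ ¬e) (e ¬e)) Join-refl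
    ... | yes refl = subst₂ (Join Γ) (trans s₂≡ (sym (upd-same L (overline P) s₂))) (sym l′) (Join-sym (Join-coh (join-type cr (inv-type (coh-inv d₁))
            (≤-trans (≤-reflexive (dim-coh d₁)) (≤-trans (≤-reflexive (dim-tyP ⋆ L (overline P)))
              (≤-trans (leaf-bound P dx) le))) (𝒰-insert lhV T Q U c g)) (_ , done , done)))

  module _ (P : Branch S) (T : Tree) (b : branchHeight P ≤ trunkHeight T) {M : Labelling T n} (h : height T ≤ leafHeight P)
           (l : L (overline P) ≡ 𝒞 (leafHeight P) T ⟦ toSub M ⟧)
           (c : IsIdentity (L (overline P)) ⊎ (leafHeight P ≡ height T × ¬ IsUnary (L (overline P))))
           {L′ : Labelling S n} (e : ∀ {p} → p ≢ overline P → L p ≡ L′ p) where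
    private
      lab : L (overline P) ≡ coh ⌊ T ⌋ (𝒰 (leafHeight P) T) (toSub M)
      lab = trans l (𝒞-⟦⟧ (leafHeight P) T (toSub M))

    -- An identity leaf admits no rule at all. A composite leaf is neither unary nor, having full
    -- height, an endo-coherence. Only an insertion into a composite leaf remains.
    leaf-rule : ∀ {s t} → sua′ Γ s t → s ≡ coh ⌊ T ⌋ (𝒰 (leafHeight P) T) (toSub M) → L′ (overline P) ≡ t →
      IsIdentity s ⊎ (leafHeight P ≡ height T × ¬ IsUnary s) →
      Join Γ (target S P T b A L M) (coh ⌊ S ⌋ A (toSub L′))
    leaf-rule (inj₁ (disc-removal B t)) f l′ (inj₁ i) =
      ⊥-elim (shapes-disjoint (unShape (dim B)) (id⇒shape i))
    leaf-rule (inj₁ (disc-removal B t)) f l′ (inj₂ (hT , ¬v)) = ⊥-elim (¬v (B , t , refl))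
    leaf-rule (inj₂ (inj₁ (endo-coherence-removal Δ s B σ ¬j))) f l′ (inj₁ i) = ⊥-elim (¬j i)
    leaf-rule (inj₂ (inj₁ (endo-coherence-removal Δ s B σ ¬j))) f l′ (inj₂ (hT , ¬v)) =
      ⊥-elim (¬endo-𝒰 P T hT (proj₂ (proj₂ (endo-≡ f))))
    leaf-rule (inj₂ (inj₂ (insertion r B ¬j ¬w _))) f l′ (inj₁ i) = ⊥-elim (¬j i)
    leaf-rule (inj₂ (inj₂ (insertion {T′} {Q} {U} {M′} {K} r B ¬j ¬w _))) f l′ (inj₂ (hT , ¬v)) with coh-tree T′ T f
    ... | refl with coh-inj f
    ...   | refl , eq = subst (λ σ → Join Γ (coh ⌊ insert S P T b ⌋ (A ⟦ toSub (κ S P T b) ⟧ᵀ) σ) (coh ⌊ S ⌋ A (toSub L′)))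
      (toSub-cong (insert-rel S P T b _≡_ (λ _ → refl) (toSub-injective eq)))
      (insert-nested P T b {M′} (sym hT) ne (trans l (cong (𝒞 (leafHeight P) T ⟦_⟧) (sym eq)))
        Q U (InsertionRedex.bh≤th r) (InsertionRedex.h≤lh r) (InsertionRedex.label r) e l′)
      where
      ne : T ≢ discTree (leafHeight P)
      ne t≡ = ¬v (shape⇒un (subst (λ V → UnShape ⌊ V ⌋ (𝒰 (leafHeight P) V)) (sym t≡) (ctx-UnShape (disc-unary (leafHeight P)))))

    leaf-step : ∀ {t} → L′ (overline P) ≡ t →
      Γ ⊢ coh ⌊ T ⌋ (𝒰 (leafHeight P) T) (toSub M) ⟶ t →
      Join Γ (target S P T b A L M) (coh ⌊ S ⌋ A (toSub L′))
    leaf-step l′ (rule r) = leaf-rule r refl l′ (subst (λ s → IsIdentity s ⊎ (leafHeight P ≡ height T × ¬ IsUnary s)) lab c)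
    leaf-step l′ (coh-ty r) = ⊥-elim (leaf-type-normal c)
      where
      leaf-type-normal : ¬ (IsIdentity (L (overline P)) ⊎ (leafHeight P ≡ height T × ¬ IsUnary (L (overline P))))
      leaf-type-normal (inj₁ i)         = IdShape-normal (id⇒shape (subst IsIdentity lab i)) r
      leaf-type-normal (inj₂ (hT , ¬v)) = 𝒰-normal (leafHeight P) T (≤-reflexive hT) r
    leaf-step l′ (coh-sub {τ = τ} r) = insert-pointwise P T b h l {L′} {toLab τ} steps
      (λ p → subst (λ s → Γ ⊢ s ⟶* lookup τ (pathVar T p)) (lookup-toSub M p) (lookup-⟶* r (pathVar T p)))
      (trans l′ (trans (cong (coh ⌊ T ⌋ (𝒰 (leafHeight P) T)) (sym (toSub-toLab {T = T} τ))) (sym (𝒞-⟦⟧ (leafHeight P) T (toSub (toLab {T = T} τ)))))) c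
      where
      steps : ∀ p → Γ ⊢ L p ⟶* L′ p
      steps p with path-≟ p (overline P)
      ... | no ¬e    = subst (Γ ⊢ L p ⟶*_) (e ¬e) done
      ... | yes refl = subst₂ (Γ ⊢_⟶*_) (sym lab) (sym l′) (coh-sub r ◅ done)

  insert-sub : ∀ P T b {M : Labelling T n} → height T ≤ leafHeight P → L (overline P) ≡ 𝒞 (leafHeight P) T ⟦ toSub M ⟧ →
    IsIdentity (L (overline P)) ⊎ (leafHeight P ≡ height T × ¬ IsUnary (L (overline P))) →
    ∀ {τ} → Γ ⊢ˢ toSub L ⟶ τ → Join Γ (target S P T b A L M) (coh ⌊ S ⌋ A τ)
  insert-sub P T b {M} h l c {τ} r = subst (λ σ → Join Γ (target S P T b A L M) (coh ⌊ S ⌋ A σ)) (toSub-toLab {T = S} τ)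
    (lem (step-at r))
    where
    L′ : Labelling S n
    L′ = toLab τ
    lem : ∃[ x ] Γ ⊢ lookup (toSub L) x ⟶ lookup τ x × (∀ {y} → y ≢ x → lookup (toSub L) y ≡ lookup τ y) →
          Join Γ (target S P T b A L M) (coh ⌊ S ⌋ A (toSub L′))
    lem (x , st , eq) with x Fin.≟ pathVar S (overline P)
    ... | yes refl = leaf-step P T b h l c {L′} others refl
      (subst (Γ ⊢_⟶ L′ (overline P)) (trans (lookup-toSub L (overline P)) (trans l (𝒞-⟦⟧ (leafHeight P) T (toSub M)))) st)
      where
      others : ∀ {p} → p ≢ overline P → L p ≡ L′ p
      others {p} ne = trans (sym (lookup-toSub L p)) (eq λ f → ne (pathVar-injective {p = p} {overline P} f))
    ... | no ¬x = insert-pointwise P T b h l {L′} {M}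
      (λ p → subst (λ s → Γ ⊢ s ⟶* L′ p) (lookup-toSub L p) (lookup-⟶* r (pathVar S p))) (λ _ → done)
      (trans (trans (sym (eq (λ f → ¬x (sym f)))) (lookup-toSub L (overline P))) l) c

-- Local confluence and Newman's argument

DiscType-endo : ∀ d {m} {Δ : Ctx m} {s A} → _≡_ {A = TyCtx} (m , Δ , s ⇒[ A ] s) (_ , Disc d , DiscType d) → Empty
DiscType-endo zero    ()
DiscType-endo (suc d) ()

unary-endo : ∀ {Δ : Ctx m} {s A} → ¬ UnShape Δ (s ⇒[ A ] s)
unary-endo u with UnShape-ctx u
... | d , e = DiscType-endo d e

unary-step : ∀ {Γ : Ctx n} d t (τ : Sub (d * 2) n) → Γ ⊢ coh (Disc d) (DiscType d) (t ∷ τ) ⟶ t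
unary-step {Γ = Γ} d t τ = subst (λ s → Γ ⊢ s ⟶ t)
  (sym (fromSphere-sphereTy (λ d τ → coh (Disc d) (DiscType d) (t ∷ τ)) d τ)) (rule (inj₁ (disc-removal (sphereTy d τ) t)))

-- Reads off the filler of a disc, so that equal unary composites yield equal fillers without
-- matching on their types.
latest : Tm n → Tm n
latest (coh Δ A (t ∷ σ)) = t
latest t                 = t

coh-entries : ∀ {Γ : Ctx n} {Δ : Ctx m} {A σ B} → Γ ⊢ coh Δ A σ ∶ B → dimCtx Δ ≤ dim B
coh-entries d with coh-inv d
... | cohInv {s} {A} {t} {σ} _ (arr _ ds _) _ r e =
  ≤-trans (coh-dim {t = t} ds r) (≤-reflexive (trans (cong suc (sym (dim-⟦⟧ A σ))) (dim-≈ e)))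

endo-entries : ∀ {Γ : Ctx n} {Δ : Ctx m} {s A σ B} → Γ ⊢ coh Δ (s ⇒[ A ] s) σ ∶ B → dimCtx Δ < dim B
endo-entries {A = A} {σ} d with coh-inv d
... | cohInv _ (arr _ ds _) _ r e = ≤-trans (s≤s (endo-dim ds r)) (≤-reflexive (trans (cong suc (sym (dim-⟦⟧ A σ))) (dim-≈ e)))

-- All labels of an endo-coherence have strictly lower dimension, so `cr` joins `L` with `κ`
-- followed by the inserted labelling. The two identities are then joined by reducing their
-- arguments.
endo-insert : ∀ {N} → ChurchRosser N → ∀ {Γ : Ctx n} {S} (P : Branch S) T b {s B L M A₀} →
  Γ ⊢ coh ⌊ S ⌋ (s ⇒[ B ] s) (toSub L) ∶ A₀ → dim A₀ ≤ N → height T ≤ leafHeight P →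
  L (overline P) ≡ 𝒞 (leafHeight P) T ⟦ toSub M ⟧ →
  Join Γ (identity (B ⟦ toSub L ⟧ᵀ) (s ⟦ toSub L ⟧)) (target S P T b (s ⇒[ B ] s) L M)
endo-insert cr {Γ} {S} P T b {s} {B} {L} {M} dx le h l
  with identity-join {Γ = Γ} B s (JoinSub-toSub {L = L} {κ S P T b ⨾ toSub (ins S P T b L M)} join)
  where
  r : Redex Γ S P T L M
  r = coh-redex dx h l
  join : ∀ p → Join Γ (L p) ((κ S P T b ⨾ toSub (ins S P T b L M)) p)
  join p = cr (rw r p) (≤-<-trans (≤-trans (≤-reflexive (trans (dim-tyP ⋆ L p) (sym (dim-path p)))) (dim-‼ ⌊ S ⌋ (pathVar S p)))
    (<-≤-trans (endo-entries dx) le)) (r-κ b r p)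
... | u , p , q = u , p , (ecr-⟶* _ _ _ _ ◅◅ subst (λ s → Γ ⊢ s ⟶* u) (cong₂ identity
    (trans (cong (B ⟦_⟧ᵀ) (sym (toSub-• (κ S P T b) _))) (sym (⟦⟧ᵀ-• B (toSub (κ S P T b)) _)))
    (trans (cong (s ⟦_⟧) (sym (toSub-• (κ S P T b) _))) (sym (⟦⟧-• s (toSub (κ S P T b)) _)))) q)

module Local {N} (cr : ChurchRosser N) {n} {Γ : Ctx n} where

  LocalAt : Tm n → Set
  LocalAt s = ∀ {t u} → Γ ⊢ s ⟶ t → Γ ⊢ s ⟶ u → Join Γ t u

  disc-peak : ∀ A t {x u} → x ≡ unary A t → Γ ⊢ x ⟶ u → Join Γ t u
  disc-peak A t e (rule (inj₁ (disc-removal B s))) = subst (Join Γ t) (cong latest (sym e)) Join-refl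
  disc-peak A t e (rule (inj₂ (inj₁ (endo-coherence-removal Δ s B σ _)))) =
    ⊥-elim (unary-endo (un⇒shape {A = s ⇒[ B ] s} {σ} (A , t , e)))
  disc-peak A t e (rule (inj₂ (inj₂ (insertion r B _ ¬u _)))) = ⊥-elim (¬u (A , t , e))
  disc-peak A t refl (coh-ty r)         = ⊥-elim (DiscType-normal (dim A) r)
  disc-peak A t refl (coh-sub (head r)) = _ , r ◅ done , unary-step (dim A) _ _ ◅ done
  disc-peak A t refl (coh-sub (tail r)) = t , done , unary-step (dim A) _ _ ◅ done

  endo-peak : ∀ {A₀} (Δ : Ctx m) s B σ → Γ ⊢ coh Δ (s ⇒[ B ] s) σ ∶ A₀ → dim A₀ ≤ N → ∀ {x u} → x ≡ coh Δ (s ⇒[ B ] s) σ →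
    Γ ⊢ x ⟶ u → Join Γ (identity (B ⟦ σ ⟧ᵀ) (s ⟦ σ ⟧)) u
  endo-peak Δ s B σ dx le e (rule (inj₁ (disc-removal A t))) = ⊥-elim (unary-endo (un⇒shape {A = s ⇒[ B ] s} {σ} (A , t , sym e)))
  endo-peak Δ s B σ dx le refl (rule (inj₂ (inj₁ (endo-coherence-removal _ _ _ _ _)))) = Join-refl
  endo-peak Δ s B σ dx le refl (rule (inj₂ (inj₂ (insertion {S} {P} {T} {L} {M} r _ _ _ _)))) =
    endo-insert cr P T (InsertionRedex.bh≤th r) dx le (InsertionRedex.h≤lh r) (InsertionRedex.label r)
  endo-peak Δ s B σ dx le refl (coh-ty (src r))  = _ , identity-⟶* done (⟶-⟦⟧ σ r ◅ done) , coh-ty (tgt r) ◅ ecr-⟶* Δ _ B σ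
  endo-peak Δ s B σ dx le refl (coh-ty (tgt r))  = _ , identity-⟶* done (⟶-⟦⟧ σ r ◅ done) , coh-ty (src r) ◅ ecr-⟶* Δ _ B σ
  endo-peak Δ s B σ dx le refl (coh-ty (base r)) = _ , identity-⟶* (⟶ᵀ-⟦⟧ σ r ◅ done) done , ecr-⟶* Δ s _ σ
  endo-peak Δ s B σ dx le refl (coh-sub {τ = τ} r) = _ , identity-⟶* (⟦⟧ᵀ-⟶ B r) (⟦⟧-⟶ s r) , ecr-⟶* Δ s B τ

  insert-peak : ∀ {S} (P : Branch S) T b {A L M A₀} (dx : Γ ⊢ coh ⌊ S ⌋ A (toSub L) ∶ A₀) → dim A₀ ≤ N →
    (∀ {y} → Below Γ N y (coh ⌊ S ⌋ A (toSub L)) → ConflAt Γ y) →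
    height T ≤ leafHeight P → L (overline P) ≡ 𝒞 (leafHeight P) T ⟦ toSub M ⟧ →
    ¬ IsIdentity (coh ⌊ S ⌋ A (toSub L)) → ¬ IsUnary (coh ⌊ S ⌋ A (toSub L)) →
    IsIdentity (L (overline P)) ⊎ (leafHeight P ≡ height T × ¬ IsUnary (L (overline P))) →
    ∀ {x u} → Γ ⊢ x ⟶ u → x ≡ coh ⌊ S ⌋ A (toSub L) → Join Γ (target S P T b A L M) u
  insert-peak P T b dx le ih h l ¬i ¬u c (rule (inj₁ (disc-removal B t))) e = ⊥-elim (¬u (B , t , sym e))
  insert-peak P T b dx le ih h l ¬i ¬u c (rule (inj₂ (inj₁ (endo-coherence-removal Δ s B σ _)))) refl =
    Join-sym (endo-insert cr P T b dx le h l)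
  insert-peak {S} P T b {A} {L} {M} dx le ih h l ¬i ¬u c (rule (inj₂ (inj₂ (insertion {S′} {Q} {U} {L′} {K} r B _ _ _)))) e with coh-tree S′ S e
  ... | refl with coh-inj e
  ...   | refl , eq = subst (λ σ → Join Γ (target S P T b A L M) (coh ⌊ insert S Q U (InsertionRedex.bh≤th r) ⌋ (A ⟦ toSub (κ S Q U (InsertionRedex.bh≤th r)) ⟧ᵀ) σ))
    (toSub-cong (insert-rel S Q U (InsertionRedex.bh≤th r) _≡_ (λ p → sym (L≡ p)) (λ _ → refl)))
    (Peak.insert-insert cr dx le (λ i → ¬i (shape⇒id i)) (λ u → ¬u (shape⇒un u)) ih P Q T U b (InsertionRedex.bh≤th r)
      h (InsertionRedex.h≤lh r) l (trans (sym (L≡ (overline Q))) (InsertionRedex.label r)))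
    where
    L≡ : ∀ p → L′ p ≡ L p
    L≡ = toSub-injective eq
  insert-peak P T b dx le ih h l ¬i ¬u c (coh-ty r) refl =
    Peak.insert-type cr dx le (λ i → ¬i (shape⇒id i)) (λ u → ¬u (shape⇒un u)) ih P T b h l r
  insert-peak P T b dx le ih h l ¬i ¬u c (coh-sub r) refl =
    Peak.insert-sub cr dx le (λ i → ¬i (shape⇒id i)) (λ u → ¬u (shape⇒un u)) ih P T b h l c r

  rule-peak : ∀ {s A} → Γ ⊢ s ∶ A → dim A ≤ N → (∀ {y} → Below Γ N y s → ConflAt Γ y) →
    ∀ {t u} → sua′ Γ s t → Γ ⊢ s ⟶ u → Join Γ t u
  rule-peak dx le ih (inj₁ (disc-removal A t)) = disc-peak A t refl
  rule-peak dx le ih (inj₂ (inj₁ (endo-coherence-removal Δ s A σ _))) = endo-peak Δ s A σ dx le refl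
  rule-peak dx le ih (inj₂ (inj₂ (insertion {S} {P} {T} r A ¬i ¬u c))) =
    λ r′ →
    insert-peak P T (InsertionRedex.bh≤th r) dx le ih (InsertionRedex.h≤lh r) (InsertionRedex.label r) ¬i ¬u c r′ refl

  sub-peak : ∀ {σ τ ρ : Sub m n} → (∀ x → ConflAt Γ (lookup σ x)) → Γ ⊢ˢ σ ⟶ τ → Γ ⊢ˢ σ ⟶ ρ → JoinSub Γ τ ρ
  sub-peak c (head r) (head r′) with c zero (r ◅ done) (r′ ◅ done)
  ... | _ , p , q = _ , ∷-⟶* p done , ∷-⟶* q done
  sub-peak c (head r) (tail r′) = _ , tail r′ ◅ done , head r ◅ done
  sub-peak c (tail r) (head r′) = _ , head r′ ◅ done , tail r ◅ done
  sub-peak c (tail r) (tail r′) with sub-peak (λ x → c (suc x)) r r′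
  ... | _ , p , q = _ , ∷-⟶* done p , ∷-⟶* done q

  local : ∀ {s A} → Γ ⊢ s ∶ A → dim A ≤ N → (∀ {y} → Below Γ N y s → ConflAt Γ y) → LocalAt s
  local dx le ih (rule r) r′ = rule-peak dx le ih r r′
  local dx le ih r (rule r′) = Join-sym (rule-peak dx le ih r′ r)
  local dx le ih (coh-ty r) (coh-ty r′) = Join-coh
    (join-type cr (proj₁ (≈ᵀ-typed (⟶ᵀ⇒≈ a r)) a)
      (≤-trans (≤-reflexive (trans (sym (⟶ᵀ-dim r)) (dim-coh dx))) le)
      (≈ᵀ-trans (≈ᵀ-sym (⟶ᵀ⇒≈ a r)) (⟶ᵀ⇒≈ a r′)))
    (_ , done , done)
    where a = inv-type (coh-inv dx)
  local dx le ih (coh-ty r) (coh-sub r′) = _ , coh-sub r′ ◅ done , coh-ty r ◅ done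
  local dx le ih (coh-sub r) (coh-ty r′) = _ , coh-ty r′ ◅ done , coh-sub r ◅ done
  local dx le ih (coh-sub {Δ = Δ} {A} {σ} r) (coh-sub r′) = Join-coh (_ , done , done) (sub-peak entries r r′)
    where
    -- Two steps in the same argument are joined by confluence of that argument, which costs less
    -- than the whole coherence.
    entries : ∀ x → ConflAt Γ (lookup σ x)
    entries x = ih (drop (_ , ⊢lookup (inv-sub (coh-inv dx)) x
      , ≤-trans (≤-reflexive (dim-⟦⟧ (Δ ‼ x) σ)) (≤-trans (dim-‼ Δ x) (≤-trans (coh-entries dx) le))) (cost-entry Δ A σ x))

  -- The induction of Newman's lemma, run along `Below`. The same hypothesis is handed to `local`,
  -- which also uses it at terms that are not reducts of `s`.
  confluent-at : ∀ {s} → Acc (Below Γ N) s → Typed Γ N s → ConflAt Γ s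
  confluent-at a        ts done     q          = _ , q , done
  confluent-at a        ts p        done       = _ , done , p
  confluent-at (acc rs) ts@(A , d , le) (r ◅ p) (r′ ◅ q)
    with local d le (λ b → confluent-at (rs b) (below-typed b)) r r′
    where
    below-typed : ∀ {y x} → Below Γ N y x → Typed Γ N y
    below-typed (drop t _)   = t
    below-typed (type t _ _) = t
  ... | v , f , g with confluent-at (rs (step-Below ts r)) (A , ⟶-typed d r , le) p f
  ...   | w , f′ , g′ with confluent-at (rs (step-Below ts r′)) (A , ⟶-typed d r′ , le) (g ◅◅ g′) q
  ...     | x , f″ , g″ = x , f′ ◅◅ f″ , g″

-- From confluence to joinability of equal terms

module _ {N} (cr : ChurchRosser N) where

  confluent : ∀ {Γ : Ctx n} {s A} → Γ ⊢ s ∶ A → dim A ≤ N → ConflAt Γ s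
  confluent d le = Local.confluent-at cr (Below-acc (strongly-normalising N) (_ , d , le)) (_ , d , le)

  -- Confluence is used at the middle term of `≈-trans`; congruence for coherences sends their types
  -- to the lower dimension and their arguments back to this induction.
  join-term : ∀ {Γ : Ctx n} {s t A} → Γ ⊢ s ∶ A → dim A ≤ N → Γ ⊢ s ≈ t → Join Γ s t
  join-sub : ∀ {Γ : Ctx n} {Δ : Ctx m} {σ τ} → Γ ⊢ˢ σ ∶ Δ → dimCtx Δ ≤ N → Γ ⊢ˢ σ ≈ τ → JoinSub Γ σ τ
  join-term d le (var-refl x)  = Join-refl
  join-term d le (≈-sym e)     = Join-sym (join-term (proj₂ (≈-typed e) d) le e)
  join-term d le (≈-trans e f) =
    join-trans (confluent (proj₁ (≈-typed e) d) le) (join-term d le e) (join-term (proj₁ (≈-typed e) d) le f)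
  join-term d le (coh e f)     = Join-coh
    (join-type cr (inv-type (coh-inv d)) (≤-trans (≤-reflexive (dim-coh d)) le) e)
    (join-sub (inv-sub (coh-inv d)) (≤-trans (coh-entries d) le) f)
  join-term d le (rule r _)    = _ , rule r ◅ done , done
  join-sub [] le []            = [] , done , done
  join-sub (_∷_ {Δ = Δ} {A} {σ} d ds) le (e ∷ f)
    with join-term d (≤-trans (≤-reflexive (dim-⟦⟧ A σ)) (≤-trans (m≤n⊔m (dimCtx Δ) (dim A)) le)) e
       | join-sub ds (≤-trans (m≤m⊔n (dimCtx Δ) (dim A)) le) f
  ... | _ , p , q | _ , p′ , q′ = _ , ∷-⟶* p p′ , ∷-⟶* q q′

church-rosser : ∀ N → ChurchRosser N
church-rosser zero    d ()
church-rosser (suc N) d lt = join-term (church-rosser N) d (s≤s⁻¹ lt)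

well-formed-steps : ∀ {Γ : Ctx n} {s t A} → Γ ⊢ s ∶ A → Γ ⊢ s ⟶* t → Star (Γ ⊢_⇝_) s t
well-formed-steps d done     = done
well-formed-steps d (r ◅ rs) = ((_ , d) , (_ , ⟶-typed d r) , r) ◅ well-formed-steps (⟶-typed d r) rs

raw-steps : ∀ {Γ : Ctx n} {s t} → Star (Γ ⊢_⇝_) s t → Γ ⊢ s ⟶* t
raw-steps = gmap id λ (_ , _ , r) → r

theorem4p3p13 : ∀ {n : ℕ} (Γ : Ctx n) → Confluent (Catt._⊢_⇝_ sua′ Γ)
-- The typing of the source is carried by the first step of a reduction, so the empty reduction,
-- which carries none, is settled separately.
theorem4p3p13 Γ done q = _ , q , done
theorem4p3p13 Γ p@(((A , d) , _) ◅ _) q with confluent (church-rosser (dim A)) d ≤-refl (raw-steps p) (raw-steps q)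
... | _ , f , g = _ , well-formed-steps (⟶*-typed d (raw-steps p)) f , well-formed-steps (⟶*-typed d (raw-steps q)) g
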